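{- In $\mathbb{Z}[t][[u]]$, \[ \sum_{n=2}^\infty P_{W_n}(t) u^{n}=\frac{2 (u-1)}{\sqrt{(u-1)^2-4 t u^2}-u+1}-\frac{2 \left(u^2+u-1\right)}{(u+1) \left(\sqrt{(u-1)^2-4 t u^2}+u+1\right)}+\frac{2 u}{(u+1) \sqrt{(u-1)^2-4 t u^2}}, \] where the square root is the power series in $u$ with constant term $1$.
   Context: For a matroid $M$ let $L(M)$ be its lattice of flats, $\mathrm{rk}\, M$ its rank, $\chi_M(t)$ its characteristic polynomial; for a flat $F$, $M_F$ is the localization (restriction to $F$) and $M^F$ the contraction at $F$. The Kazhdan–Lusztig polynomial is the unique assignment of $P_M(t)\in\mathbb{Z}[t]$ to each loopless matroid $M$ with: $P_M=1$ if $\mathrm{rk}\, M=0$; $\deg P_M<\frac12\mathrm{rk}\, M$ if $\mathrm{rk}\, M>0$; $t^{\mathrm{rk}\, M}P_M(t^{ -1})=\sum_{F\in L(M)}\chi_{M_F}(t)P_{M^F}(t)$. For a graph $G$, $P_G=P_{M(G)}$. For $n\ge3$ the wheel $W_n$ has vertices $0,\dots,n$, the edges of the cycle $1,2,\dots,n,1$ and edges $\{0,i\}$ ($1\le i\le n$); $W_2$ denotes the simple cycle (triangle) on three vertices $0,1,2$. -}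

module Defs where

open import Data.Bool using (Bool; true; false; if_then_else_; _∧_; _∨_; not)
open import Data.Nat as ℕ using (ℕ; zero; suc; _∸_; _≤_; _<_; _≤ᵇ_; _≡ᵇ_)
open import Data.Integer as ℤ using (ℤ; +_; 0ℤ; 1ℤ)
open import Data.Rational as ℚ using (ℚ; 0ℚ; 1ℚ; ½)
open import Data.Fin as Fin using (Fin; toℕ)
open import Data.Fin.Subset using (Subset; ⊤; ⁅_⁆; _∪_; _∩_; _⊆_; ∣_∣; ⋃; ∁)
open import Data.Vec as Vec using (Vec; []; _∷_)
open import Data.List as List using (List; []; _∷_; _++_; [_]; length; upTo; map; foldr; filter; allFin)
open import Data.Bool.ListAction using (all; any)
open import Data.Product using (_×_; _,_)
open import Relation.Nullary using (does)
open import Relation.Binary.PropositionalEquality using (_≡_; _≢_)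

sumWith : {A B : Set} → (B → B → B) → B → (A → B) → List A → B
sumWith _+_ z f = foldr (λ a acc → f a + acc) z

-- Polynomials in t over ℤ, as coefficient functions (coefficient of t^k)

PolyZ : Set
PolyZ = ℕ → ℤ

_+ᶻ_ : PolyZ → PolyZ → PolyZ
(p +ᶻ q) k = p k ℤ.+ q k

zeroᶻ : PolyZ
zeroᶻ _ = 0ℤ

oneᶻ : PolyZ
oneᶻ zero = 1ℤ
oneᶻ (suc _) = 0ℤ

monoᶻ : ℤ → ℕ → PolyZ
monoᶻ c d k = if k ≡ᵇ d then c else 0ℤ

_*ᶻ_ : PolyZ → PolyZ → PolyZ
(p *ᶻ q) k = sumWith ℤ._+_ 0ℤ (λ i → p i ℤ.* q (k ∸ i)) (upTo (suc k))

sumᶻ : {A : Set} → (A → PolyZ) → List A → PolyZ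
sumᶻ = sumWith _+ᶻ_ zeroᶻ

-- t^r · p(t⁻¹)  (reversal; exact whenever deg p ≤ r)
revᶻ : ℕ → PolyZ → PolyZ
revᶻ r p k = if k ≤ᵇ r then p (r ∸ k) else 0ℤ

allSubsets : (m : ℕ) → List (Subset m)
allSubsets zero = Vec.[] ∷ []
allSubsets (suc m) = map (true Vec.∷_) (allSubsets m) ++ map (false Vec.∷_) (allSubsets m)

members : {m : ℕ} → Subset m → List (Fin m)
members {m} X = filter (λ i → Vec.lookup X i Data.Bool.≟ true) (allFin m)
  where import Data.Bool

image : {m : ℕ} (xs : List (Fin m)) → Subset (length xs) → Subset m
image xs X = ⋃ (map (λ i → ⁅ List.lookup xs i ⁆) (members X))

-- Matroids on the ground set Fin m, given by their rank function

RankFn : ℕ → Set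
RankFn m = Subset m → ℕ

record IsMatroid {m : ℕ} (r : RankFn m) : Set where
  field
    bounded     : ∀ X → r X ≤ ∣ X ∣
    monotone    : ∀ X Y → X ⊆ Y → r X ≤ r Y
    submodular  : ∀ X Y → r (X ∪ Y) ℕ.+ r (X ∩ Y) ≤ r X ℕ.+ r Y

Loopless : {m : ℕ} → RankFn m → Set
Loopless {m} r = (e : Fin m) → r ⁅ e ⁆ ≡ 1

rk : {m : ℕ} → RankFn m → ℕ
rk r = r ⊤

isFlat : {m : ℕ} → RankFn m → Subset m → Bool
isFlat {m} r F =
  all (λ e → Vec.lookup F e ∨ not (r (F ∪ ⁅ e ⁆) ≡ᵇ r F)) (allFin m)

flats : {m : ℕ} → RankFn m → List (Subset m)
flats {m} r = filter (λ F → isFlat r F Data.Bool.≟ true) (allSubsets m)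
  where import Data.Bool

localization : {m : ℕ} (r : RankFn m) (F : Subset m) → RankFn (length (members F))
localization r F X = r (image (members F) X)

contraction : {m : ℕ} (r : RankFn m) (F : Subset m) → RankFn (length (members (∁ F)))
contraction r F X = r (image (members (∁ F)) X ∪ F) ∸ r F

sign : ℕ → ℤ
sign n = if ℕ._%_ n 2 ≡ᵇ 0 then 1ℤ else ℤ.- 1ℤ

charPoly : {m : ℕ} → RankFn m → PolyZ
charPoly {m} r = sumᶻ (λ X → monoᶻ (sign ∣ X ∣) (rk r ∸ r X)) (allSubsets m)

-- Kazhdan–Lusztig polynomials: the defining properties of an assignment
-- M ↦ P_M on loopless matroids

KLAssignment : Set
KLAssignment = {m : ℕ} → RankFn m → PolyZ

record IsKL (P : KLAssignment) : Set where
  field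
    rank0  : ∀ {m} (r : RankFn m) → IsMatroid r → Loopless r →
             rk r ≡ 0 → ∀ k → P r k ≡ oneᶻ k
    degree : ∀ {m} (r : RankFn m) → IsMatroid r → Loopless r →
             0 < rk r → ∀ k → rk r ≤ 2 ℕ.* k → P r k ≡ 0ℤ
    recurrence : ∀ {m} (r : RankFn m) → IsMatroid r → Loopless r → ∀ k →
             revᶻ (rk r) (P r) k
               ≡ sumᶻ (λ F → charPoly (localization r F) *ᶻ P (contraction r F)) (flats r) k

Graph : ℕ → Set
Graph v = List (Fin v × Fin v)

_==_ : {v : ℕ} → Fin v → Fin v → Bool
a == b = does (a Fin.≟ b)

reach : {v : ℕ} → Graph v → ℕ → Fin v → Fin v → Bool
reach es zero a b = a == b
reach es (suc k) a b = reach es k a b ∨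
  any (λ { (x , y) → (reach es k a x ∧ (y == b)) ∨ (reach es k a y ∧ (x == b)) }) es

components : {v : ℕ} → Graph v → ℕ
components {v} es = length (filter
  (λ i → all (λ j → not (toℕ j <ᵇ' toℕ i) ∨ not (reach es v j i)) (allFin v) Data.Bool.≟ true)
  (allFin v))
  where
    import Data.Bool
    _<ᵇ'_ : ℕ → ℕ → Bool
    m <ᵇ' n = suc m ≤ᵇ n

graphicRank : {v : ℕ} (G : Graph v) → RankFn (length G)
graphicRank {v} G X = v ∸ components (map (List.lookup G) (members X))

-- Wheels W_n (vertices 0..n); W_2 is the triangle

vtx : (n k : ℕ) → Fin (suc n)   -- the vertex k (used only for k ≤ n)
vtx n zero = Fin.zero
vtx zero (suc k) = Fin.zero
vtx (suc n) (suc k) = Fin.suc (vtx n k)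

wheel : (n : ℕ) → Graph (suc n)
wheel (suc (suc zero)) = (vtx 2 1 , vtx 2 2) ∷ (vtx 2 0 , vtx 2 1) ∷ (vtx 2 0 , vtx 2 2) ∷ []
wheel n =
  map (λ i → (vtx n (suc i) , vtx n (suc (suc i)))) (upTo (n ∸ 1))
  ++ [ (vtx n n , vtx n 1) ]
  ++ map (λ i → (vtx n 0 , vtx n (suc i))) (upTo n)

P-wheel : KLAssignment → ℕ → PolyZ
P-wheel P n = P (graphicRank (wheel n))

-- Power series in u over ℚ[t]:  S n k = coefficient of u^n t^k

PolyQ : Set
PolyQ = ℕ → ℚ

Series : Set
Series = ℕ → PolyQ

_+ᵠ_ : PolyQ → PolyQ → PolyQ
(p +ᵠ q) k = p k ℚ.+ q k

zeroᵠ : PolyQ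
zeroᵠ _ = 0ℚ

constᵠ : ℚ → PolyQ
constᵠ c zero = c
constᵠ c (suc _) = 0ℚ

scaleᵠ : ℚ → PolyQ → PolyQ
scaleᵠ c p k = c ℚ.* p k

_*ᵠ_ : PolyQ → PolyQ → PolyQ
(p *ᵠ q) k = sumWith ℚ._+_ 0ℚ (λ i → p i ℚ.* q (k ∸ i)) (upTo (suc k))

sumᵠ : {A : Set} → (A → PolyQ) → List A → PolyQ
sumᵠ = sumWith _+ᵠ_ zeroᵠ

infixl 6 _⊕_ _⊖_
infixl 7 _⊗_

_⊕_ : Series → Series → Series
(a ⊕ b) n = a n +ᵠ b n

_⊖_ : Series → Series → Series
(a ⊖ b) n = a n +ᵠ scaleᵠ (ℚ.- 1ℚ) (b n)

_⊗_ : Series → Series → Series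
(a ⊗ b) n = sumᵠ (λ i → a i *ᵠ b (n ∸ i)) (upTo (suc n))

cstS : PolyQ → Series
cstS p zero = p
cstS p (suc _) = zeroᵠ

numS : ℤ → Series
numS z = cstS (constᵠ (z ℚ./ 1))

uS : Series
uS (suc zero) = constᵠ 1ℚ
uS _ = zeroᵠ

tS : Series
tS zero (suc zero) = 1ℚ
tS _ _ = 0ℚ

-- course-of-values recursion on coefficients
lookupD : {A : Set} → A → List A → ℕ → A
lookupD d [] _ = d
lookupD d (x ∷ xs) zero = x
lookupD d (x ∷ xs) (suc n) = lookupD d xs n

covPrefix : {A : Set} → A → ((n : ℕ) → (ℕ → A) → A) → ℕ → List A
covPrefix d step zero = []
covPrefix d step (suc n) = let p = covPrefix d step n in p ++ [ step n (lookupD d p) ]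

cov : {A : Set} → A → ((n : ℕ) → (ℕ → A) → A) → ℕ → A
cov d step n = step n (lookupD d (covPrefix d step n))

-- square root of a series f with constant term 1: the series s with s₀ = 1, s² = f
sqrtS : Series → Series
sqrtS f = cov zeroᵠ step
  where
    step : (n : ℕ) → (ℕ → PolyQ) → PolyQ
    step zero s = constᵠ 1ℚ
    step (suc n) s = scaleᵠ ½
      (f (suc n) +ᵠ scaleᵠ (ℚ.- 1ℚ)
         (sumᵠ (λ k → s (suc k) *ᵠ s (suc n ∸ suc k)) (upTo n)))

recipℚ : ℚ → ℚ
recipℚ c with c ℚ.≟ 0ℚ
... | Relation.Nullary.yes _ = 0ℚ
... | Relation.Nullary.no c≢0 = ℚ.1/_ c {{ℚ.≢-nonZero c≢0}}

-- inverse of a series whose u⁰-coefficient is a nonzero constant c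
invS : Series → Series
invS a = cov zeroᵠ step
  where
    c⁻¹ : ℚ
    c⁻¹ = recipℚ (a zero zero)
    step : (n : ℕ) → (ℕ → PolyQ) → PolyQ
    step zero b = constᵠ c⁻¹
    step (suc n) b = scaleᵠ (ℚ.- c⁻¹)
      (sumᵠ (λ k → a (suc k) *ᵠ b (suc n ∸ suc k)) (upTo (suc n)))

root : Series
root = sqrtS (((uS ⊖ numS 1ℤ) ⊗ (uS ⊖ numS 1ℤ)) ⊖ (numS (+ 4) ⊗ tS ⊗ uS ⊗ uS))

rhs : Series
rhs =
  ((numS (+ 2) ⊗ (uS ⊖ numS 1ℤ)) ⊗ invS ((root ⊖ uS) ⊕ numS 1ℤ))
  ⊖ ((numS (+ 2) ⊗ (((uS ⊗ uS) ⊕ uS) ⊖ numS 1ℤ))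
       ⊗ invS ((uS ⊕ numS 1ℤ) ⊗ ((root ⊕ uS) ⊕ numS 1ℤ)))
  ⊕ ((numS (+ 2) ⊗ uS) ⊗ invS ((uS ⊕ numS 1ℤ) ⊗ root))

lhs : KLAssignment → Series
lhs P zero = zeroᵠ
lhs P (suc zero) = zeroᵠ
lhs P n@(suc (suc _)) k = P-wheel P n k ℚ./ 1

{-# OPTIONS --safe #-}
module Submission where

-- The Z-polynomial Σ_F t^(rk F) P_{M^F} of a matroid is palindromic, and together with the degree
-- bound this determines the Kazhdan–Lusztig polynomials: expanding χ over subsets turns the
-- palindromic identities for all contractions into the defining recurrence.
--
-- A flat of the wheel is a cyclic word: each rim vertex is joined to the hub or not, and the runs of
-- vertices off the hub are cut into blocks. Contracting the flat leaves fans at the hub, one for each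
-- run (or a smaller wheel if no vertex is joined to the hub), and a fan with b blocks has the Motzkin
-- polynomial of index b - 1. Passing from blocks to vertices is the substitution u ↦ u/(1 - tu); it
-- turns the Motzkin series into the Narayana series A = u(1+A)(1+tA), and reversing the coefficients
-- first turns it into tA. So all generating functions involved are rational on that curve, where both
-- the fan identity (1+A)(1+tA) = (1+tA)(1+A) and the wheel identity can be checked.

-- An assignment `P` is given on rank functions over numbered ground sets, and no invariance under
-- isomorphism or direct sums is assumed. So contractions of the wheel are never identified with
-- fans or smaller wheels. A polynomial is proposed for every edge set at once, and an induction on
-- the rank compares `P` with the proposal on all contractions simultaneously. Flats are replaced by
-- all words in four letters, the value being 0 on words that are not flats. The sums over flats can
-- then be taken letter by letter, and the power of t splits into letter weights. Two words resist.
-- The full rim has one rank less than its missing edges predict, hence a separate summand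
-- throughout. A rim with exactly one missing edge is not a flat; there it helps that the right-hand
-- side has no term in u^1. Reversing coefficients is multiplicative only under degree bounds. The
-- closed form therefore needs a bound on each of its ingredients: 2k at most n in u^n t^k. The
-- strict inequality asked of Kazhdan-Lusztig polynomials holds only for the sum of the three
-- summands.

open import Defs using (sumWith)
open import Algebra.Bundles using (CommutativeRing)
open import Data.Bool.Base using (Bool; true; false; if_then_else_; not; _∧_; _∨_)
import Data.Bool.Properties as 𝔹
open import Data.Empty using (⊥-elim)
open import Data.Fin.Base as Fin using (Fin; zero; suc; toℕ)
import Data.Fin.Properties as Fin
open import Data.List.Base as List using (List; []; _∷_; _++_; length; map; upTo; applyUpTo)
open import Data.Nat.Base as ℕ using (ℕ; zero; suc; _∸_; _≤ᵇ_; z≤n; s≤s)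
import Data.Nat.Properties as ℕ
open import Data.Product.Base using (_,_; proj₁; proj₂; ∃; ∃₂)
open import Data.Rational as ℚ using (ℚ; 0ℚ; 1ℚ)
import Data.Rational.Properties as ℚ
open import Data.Sum.Base using (_⊎_; inj₁; inj₂)
open import Function.Base using (_∘_; id)
open import Level using (0ℓ)
open import Relation.Binary.PropositionalEquality as ≡ using (_≡_; _≢_)
open import Relation.Nullary using (yes; no; Dec; does; ¬_)

-- Normalisation of ring expressions with integer coefficients.

module IntegerCoefficientSolver (R : CommutativeRing 0ℓ 0ℓ) where

  open CommutativeRing R
  open import Algebra.Bundles using (RawRing)
  open import Algebra.Properties.Ring ring using (-‿distribˡ-*; -‿distribʳ-*; -0#≈0#; -‿involutive; -‿+-comm)
  open import Algebra.Properties.Semiring.Mult.TCOptimised semiring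
  open import Algebra.Solver.Ring.AlmostCommutativeRing using (_-Raw-AlmostCommutative⟶_; fromCommutativeRing)
  open import Data.Integer as ℤ using (ℤ; +_; -[1+_]; _⊖_)
  import Data.Integer.Properties as ℤ
  open import Data.Maybe.Base using (Maybe; just; nothing)
  open import Data.Sign.Base as Sign using (Sign)
  open import Relation.Binary.Reasoning.Setoid setoid

  private
    -- `_×_` is the optimised multiple, for which `1 × 1#` is `1#` by computation; the constants 0
    -- and 1 of the solver thus evaluate to `0#` and `1#` themselves.
    embed : ℤ → Carrier
    embed (+ n) = n × 1#
    embed -[1+ n ] = - (suc n × 1#)

    cancel-1 : ∀ x y → (1# + x) - (1# + y) ≈ x - y
    cancel-1 x y = begin
      (1# + x) - (1# + y)           ≈⟨ +-congˡ (-‿+-comm 1# y) ⟨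
      (1# + x) + (- 1# - y)         ≈⟨ +-congʳ (+-comm 1# x) ⟩
      (x + 1#) + (- 1# - y)         ≈⟨ +-assoc x 1# _ ⟩
      x + (1# + (- 1# - y))         ≈⟨ +-congˡ (+-assoc 1# (- 1#) (- y)) ⟨
      x + ((1# - 1#) - y)           ≈⟨ +-congˡ (+-congʳ (-‿inverseʳ 1#)) ⟩
      x + (0# - y)                  ≈⟨ +-congˡ (+-identityˡ (- y)) ⟩
      x - y                         ∎

    embed-⊖ : ∀ m n → embed (m ⊖ n) ≈ m × 1# - n × 1#
    embed-⊖ m zero = sym (trans (+-congˡ -0#≈0#) (+-identityʳ _))
    embed-⊖ zero (suc n) = sym (+-identityˡ _)
    embed-⊖ (suc m) (suc n) = begin
      embed (suc m ⊖ suc n)         ≡⟨ ≡.cong embed (ℤ.[1+m]⊖[1+n]≡m⊖n m n) ⟩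
      embed (m ⊖ n)                 ≈⟨ embed-⊖ m n ⟩
      m × 1# - n × 1#               ≈⟨ cancel-1 _ _ ⟨
      (1# + m × 1#) - (1# + n × 1#) ≈⟨ +-cong (1+× m 1#) (-‿cong (1+× n 1#)) ⟨
      suc m × 1# - suc n × 1#       ∎

    embed-+ : ∀ i j → embed (i ℤ.+ j) ≈ embed i + embed j
    embed-+ (+ m) (+ n) = ×-homo-+ 1# m n
    embed-+ (+ m) -[1+ n ] = embed-⊖ m (suc n)
    embed-+ -[1+ m ] (+ n) = trans (embed-⊖ n (suc m)) (+-comm _ _)
    embed-+ -[1+ m ] -[1+ n ] = begin
      - (suc (suc (m ℕ.+ n)) × 1#)      ≡⟨ ≡.cong (λ k → - (k × 1#)) (≡.sym (ℕ+-suc (suc m) n)) ⟩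
      - ((suc m ℕ.+ suc n) × 1#)        ≈⟨ -‿cong (×-homo-+ 1# (suc m) (suc n)) ⟩
      - (suc m × 1# + suc n × 1#)       ≈⟨ -‿+-comm _ _ ⟨
      - (suc m × 1#) - (suc n × 1#)     ∎
      where open import Data.Nat.Properties using () renaming (+-suc to ℕ+-suc)

    embed-+◃ : ∀ n → embed (Sign.+ ℤ.◃ n) ≈ n × 1#
    embed-+◃ n = reflexive (≡.cong embed (ℤ.+◃n≡+n n))

    embed--◃ : ∀ n → embed (Sign.- ℤ.◃ n) ≈ - (n × 1#)
    embed--◃ zero = sym -0#≈0#
    embed--◃ (suc n) = refl

    embed-* : ∀ i j → embed (i ℤ.* j) ≈ embed i * embed j
    embed-* (+ m) (+ n) = trans (embed-+◃ (m ℕ.* n)) (×1-homo-* m n)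
    embed-* (+ m) -[1+ n ] = begin
      embed (Sign.- ℤ.◃ (m ℕ.* suc n)) ≈⟨ embed--◃ (m ℕ.* suc n) ⟩
      - ((m ℕ.* suc n) × 1#)           ≈⟨ -‿cong (×1-homo-* m (suc n)) ⟩
      - (m × 1# * (suc n × 1#))        ≈⟨ -‿distribʳ-* _ _ ⟩
      m × 1# * - (suc n × 1#)          ∎
    embed-* -[1+ m ] (+ n) = begin
      embed (Sign.- ℤ.◃ (suc m ℕ.* n)) ≈⟨ embed--◃ (suc m ℕ.* n) ⟩
      - ((suc m ℕ.* n) × 1#)           ≈⟨ -‿cong (×1-homo-* (suc m) n) ⟩
      - (suc m × 1# * (n × 1#))        ≈⟨ -‿distribˡ-* _ _ ⟩
      - (suc m × 1#) * (n × 1#)        ∎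
    embed-* -[1+ m ] -[1+ n ] = begin
      (suc m ℕ.* suc n) × 1#               ≈⟨ ×1-homo-* (suc m) (suc n) ⟩
      (suc m × 1#) * (suc n × 1#)          ≈⟨ -‿involutive _ ⟨
      - - ((suc m × 1#) * (suc n × 1#))    ≈⟨ -‿cong (-‿distribˡ-* _ _) ⟩
      - (- (suc m × 1#) * (suc n × 1#))    ≈⟨ -‿distribʳ-* _ _ ⟩
      - (suc m × 1#) * - (suc n × 1#)      ∎

    embed-neg : ∀ i → embed (ℤ.- i) ≈ - embed i
    embed-neg (+ zero) = sym -0#≈0#
    embed-neg (+ suc n) = refl
    embed-neg -[1+ n ] = sym (-‿involutive _)

    ℤ-rawRing : RawRing 0ℓ 0ℓ
    ℤ-rawRing = record
      { Carrier = ℤ ; _≈_ = _≡_ ; _+_ = ℤ._+_ ; _*_ = ℤ._*_ ; -_ = ℤ.-_ ; 0# = + 0 ; 1# = + 1 }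

    morphism : ℤ-rawRing -Raw-AlmostCommutative⟶ fromCommutativeRing R
    morphism = record
      { ⟦_⟧ = embed ; +-homo = embed-+ ; *-homo = embed-* ; -‿homo = embed-neg
      ; 0-homo = refl ; 1-homo = refl }

    -- Normal forms are compared through their integer coefficients, because equality in the ring is
    -- not assumed decidable.
    dec : ∀ i j → Maybe (embed i ≈ embed j)
    dec i j with i ℤ.≟ j
    ... | yes ≡.refl = just refl
    ... | no _ = nothing

  open import Algebra.Solver.Ring ℤ-rawRing (fromCommutativeRing R) morphism dec public
    using (solve; _:=_; _:+_; _:*_; _:-_; :-_; con; Polynomial)

  :1 : ∀ {n} → Polynomial n
  :1 = con (+ 1)

  :0 : ∀ {n} → Polynomial n
  :0 = con (+ 0)

-- Formal power series over a commutative ring.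

module PowerSeries (R : CommutativeRing 0ℓ 0ℓ) where

  open CommutativeRing R
  open import Relation.Binary.Reasoning.Setoid setoid
  open IntegerCoefficientSolver R

  Ser : Set
  Ser = ℕ → Carrier

  infix 4 _≋_
  infixl 6 _⊞_
  infixl 7 _⊠_

  _≋_ : Ser → Ser → Set
  f ≋ g = ∀ n → f n ≈ g n

  _⊞_ : Ser → Ser → Ser
  (f ⊞ g) n = f n + g n

  -- The same fold over `upTo` as in the products of the statement, so that over the rationals, and
  -- again over polynomials, it is that product by computation.
  _⊠_ : Ser → Ser → Ser
  (f ⊠ g) n = sumWith _+_ 0# (λ i → f i * g (n ∸ i)) (upTo (suc n))

  neg : Ser → Ser
  neg f n = - f n

  constant : Carrier → Ser
  constant c zero = c
  constant c (suc _) = 0#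

  shift : Ser → Ser
  shift f n = f (suc n)

  -- Inductions need a sum whose tail is a sum of the same kind; the tail of `upTo` is not an
  -- `upTo`.
  Σ< : ℕ → Ser → Carrier
  Σ< zero f = 0#
  Σ< (suc n) f = f 0 + Σ< n (shift f)

  sumWith-applyUpTo : ∀ n (f : ℕ → Carrier) (g : ℕ → ℕ) → sumWith _+_ 0# f (applyUpTo g n) ≡ Σ< n (f ∘ g)
  sumWith-applyUpTo zero f g = ≡.refl
  sumWith-applyUpTo (suc n) f g = ≡.cong (f (g 0) +_) (sumWith-applyUpTo n f (g ∘ suc))

  Σ<-cong : ∀ n {f g} → (∀ i → i ℕ.< n → f i ≈ g i) → Σ< n f ≈ Σ< n g
  Σ<-cong zero _ = refl
  Σ<-cong (suc n) e = +-cong (e 0 (ℕ.s≤s ℕ.z≤n)) (Σ<-cong n (λ i i<n → e (suc i) (ℕ.s≤s i<n)))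

  ⊠-Σ< : ∀ f g n → (f ⊠ g) n ≡ Σ< (suc n) (λ i → f i * g (n ∸ i))
  ⊠-Σ< f g n = sumWith-applyUpTo (suc n) _ id

  ⊠-zero : ∀ f g → (f ⊠ g) 0 ≈ f 0 * g 0
  ⊠-zero f g = +-identityʳ _

  -- The recursion on which the ring axioms are proved by induction on the degree; `⊠-sucʳ` is its
  -- mirror image, and commutativity needs both.
  ⊠-suc : ∀ f g n → (f ⊠ g) (suc n) ≈ f 0 * g (suc n) + (shift f ⊠ g) n
  ⊠-suc f g n = reflexive (≡.cong (f 0 * g (suc n) +_) (≡.trans (sumWith-applyUpTo (suc n) (λ i → f i * g (suc n ∸ i)) suc) (≡.sym (⊠-Σ< (shift f) g n))))

  ⊠-cong-≤ : ∀ n {f f′ g g′} → (∀ i → i ℕ.≤ n → f i ≈ f′ i) → (∀ i → i ℕ.≤ n → g i ≈ g′ i) → (f ⊠ g) n ≈ (f′ ⊠ g′) n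
  ⊠-cong-≤ zero {f} {f′} {g} {g′} e e′ = trans (⊠-zero f g) (trans (*-cong (e 0 ℕ.z≤n) (e′ 0 ℕ.z≤n)) (sym (⊠-zero f′ g′)))
  ⊠-cong-≤ (suc n) {f} {f′} {g} {g′} e e′ = begin
    (f ⊠ g) (suc n)                      ≈⟨ ⊠-suc f g n ⟩
    f 0 * g (suc n) + (shift f ⊠ g) n    ≈⟨ +-cong (*-cong (e 0 ℕ.z≤n) (e′ (suc n) ≤-refl))
                                              (⊠-cong-≤ n (λ i i≤n → e (suc i) (ℕ.s≤s i≤n)) (λ i i≤n → e′ i (m≤n⇒m≤1+n i≤n))) ⟩
    f′ 0 * g′ (suc n) + (shift f′ ⊠ g′) n ≈⟨ ⊠-suc f′ g′ n ⟨
    (f′ ⊠ g′) (suc n)                    ∎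
    where open import Data.Nat.Properties using (≤-refl; m≤n⇒m≤1+n)

  ⊠-cong : ∀ {f f′ g g′} → f ≋ f′ → g ≋ g′ → (f ⊠ g) ≋ (f′ ⊠ g′)
  ⊠-cong e e′ n = ⊠-cong-≤ n (λ i _ → e i) (λ i _ → e′ i)

  ⊠-sucʳ : ∀ f g n → (f ⊠ g) (suc n) ≈ f (suc n) * g 0 + (f ⊠ shift g) n
  ⊠-sucʳ f g zero = begin
    (f ⊠ g) 1                             ≈⟨ ⊠-suc f g 0 ⟩
    f 0 * g 1 + (shift f ⊠ g) 0           ≈⟨ +-congˡ (⊠-zero (shift f) g) ⟩
    f 0 * g 1 + f 1 * g 0                 ≈⟨ +-comm _ _ ⟩
    f 1 * g 0 + f 0 * g 1                 ≈⟨ +-congˡ (⊠-zero f (shift g)) ⟨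
    f 1 * g 0 + (f ⊠ shift g) 0           ∎
  ⊠-sucʳ f g (suc n) = begin
    (f ⊠ g) (suc (suc n))                                                ≈⟨ ⊠-suc f g (suc n) ⟩
    f 0 * g (suc (suc n)) + (shift f ⊠ g) (suc n)                        ≈⟨ +-congˡ (⊠-sucʳ (shift f) g n) ⟩
    f 0 * g (suc (suc n)) + (f (suc (suc n)) * g 0 + (shift f ⊠ shift g) n)
      ≈⟨ solve 3 (λ a b c → a :+ (b :+ c) := b :+ (a :+ c)) refl _ _ _ ⟩
    f (suc (suc n)) * g 0 + (f 0 * g (suc (suc n)) + (shift f ⊠ shift g) n) ≈⟨ +-congˡ (⊠-suc f (shift g) n) ⟨
    f (suc (suc n)) * g 0 + (f ⊠ shift g) (suc n)                        ∎

  ⊠-comm : ∀ f g → f ⊠ g ≋ g ⊠ f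
  ⊠-comm f g zero = trans (⊠-zero f g) (trans (*-comm _ _) (sym (⊠-zero g f)))
  ⊠-comm f g (suc n) = begin
    (f ⊠ g) (suc n)                    ≈⟨ ⊠-suc f g n ⟩
    f 0 * g (suc n) + (shift f ⊠ g) n  ≈⟨ +-cong (*-comm _ _) (⊠-comm (shift f) g n) ⟩
    g (suc n) * f 0 + (g ⊠ shift f) n  ≈⟨ ⊠-sucʳ g f n ⟨
    (g ⊠ f) (suc n)                    ∎

  ⊠-distribʳ : ∀ h f g → (f ⊞ g) ⊠ h ≋ (f ⊠ h) ⊞ (g ⊠ h)
  ⊠-distribʳ h f g zero = begin
    ((f ⊞ g) ⊠ h) 0         ≈⟨ ⊠-zero (f ⊞ g) h ⟩
    (f 0 + g 0) * h 0       ≈⟨ distribʳ _ _ _ ⟩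
    f 0 * h 0 + g 0 * h 0   ≈⟨ +-cong (⊠-zero f h) (⊠-zero g h) ⟨
    (f ⊠ h) 0 + (g ⊠ h) 0   ∎
  ⊠-distribʳ h f g (suc n) = begin
    ((f ⊞ g) ⊠ h) (suc n)   ≈⟨ ⊠-suc (f ⊞ g) h n ⟩
    (f 0 + g 0) * h (suc n) + ((shift f ⊞ shift g) ⊠ h) n      ≈⟨ +-congˡ (⊠-distribʳ h (shift f) (shift g) n) ⟩
    (f 0 + g 0) * h (suc n) + ((shift f ⊠ h) n + (shift g ⊠ h) n)
      ≈⟨ solve 5 (λ a b c d e → (a :+ b) :* c :+ (d :+ e) := (a :* c :+ d) :+ (b :* c :+ e)) refl _ _ _ _ _ ⟩
    (f 0 * h (suc n) + (shift f ⊠ h) n) + (g 0 * h (suc n) + (shift g ⊠ h) n) ≈⟨ +-cong (⊠-suc f h n) (⊠-suc g h n) ⟨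
    (f ⊠ h) (suc n) + (g ⊠ h) (suc n)   ∎

  ⊠-scaleˡ : ∀ c f g n → ((λ i → c * f i) ⊠ g) n ≈ c * (f ⊠ g) n
  ⊠-scaleˡ c f g zero = trans (⊠-zero (λ i → c * f i) g) (trans (*-assoc _ _ _) (*-congˡ (sym (⊠-zero f g))))
  ⊠-scaleˡ c f g (suc n) = begin
    ((λ i → c * f i) ⊠ g) (suc n)                        ≈⟨ ⊠-suc (λ i → c * f i) g n ⟩
    c * f 0 * g (suc n) + ((λ i → c * f (suc i)) ⊠ g) n  ≈⟨ +-cong (*-assoc _ _ _) (⊠-scaleˡ c (shift f) g n) ⟩
    c * (f 0 * g (suc n)) + c * (shift f ⊠ g) n          ≈⟨ distribˡ _ _ _ ⟨
    c * (f 0 * g (suc n) + (shift f ⊠ g) n)              ≈⟨ *-congˡ (⊠-suc f g n) ⟨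
    c * (f ⊠ g) (suc n)                                  ∎

  ⊠-assoc : ∀ f g h → (f ⊠ g) ⊠ h ≋ f ⊠ (g ⊠ h)
  ⊠-assoc f g h zero = begin
    ((f ⊠ g) ⊠ h) 0      ≈⟨ trans (⊠-zero (f ⊠ g) h) (*-congʳ (⊠-zero f g)) ⟩
    f 0 * g 0 * h 0      ≈⟨ *-assoc _ _ _ ⟩
    f 0 * (g 0 * h 0)    ≈⟨ trans (⊠-zero f (g ⊠ h)) (*-congˡ (⊠-zero g h)) ⟨
    (f ⊠ (g ⊠ h)) 0      ∎
  ⊠-assoc f g h (suc n) = begin
    ((f ⊠ g) ⊠ h) (suc n)                                           ≈⟨ ⊠-suc (f ⊠ g) h n ⟩
    (f ⊠ g) 0 * h (suc n) + (shift (f ⊠ g) ⊠ h) n                   ≈⟨ +-cong (*-congʳ (⊠-zero f g))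
         (trans (⊠-cong {g = h} (⊠-suc f g) (λ _ → refl) n) (⊠-distribʳ h (λ i → f 0 * shift g i) (shift f ⊠ g) n)) ⟩
    f 0 * g 0 * h (suc n) + (((λ i → f 0 * shift g i) ⊠ h) n + ((shift f ⊠ g) ⊠ h) n)
         ≈⟨ +-congˡ (+-cong (⊠-scaleˡ (f 0) (shift g) h n) (⊠-assoc (shift f) g h n)) ⟩
    f 0 * g 0 * h (suc n) + (f 0 * (shift g ⊠ h) n + (shift f ⊠ (g ⊠ h)) n)
         ≈⟨ solve 5 (λ a b c d e → a :* b :* c :+ (a :* d :+ e) := a :* (b :* c :+ d) :+ e) refl _ _ _ _ _ ⟩
    f 0 * (g 0 * h (suc n) + (shift g ⊠ h) n) + (shift f ⊠ (g ⊠ h)) n ≈⟨ +-congʳ (*-congˡ (⊠-suc g h n)) ⟨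
    f 0 * (g ⊠ h) (suc n) + (shift f ⊠ (g ⊠ h)) n                   ≈⟨ ⊠-suc f (g ⊠ h) n ⟨
    (f ⊠ (g ⊠ h)) (suc n)                                           ∎

  ⊠-zeroˡ : ∀ f → (λ _ → 0#) ⊠ f ≋ (λ _ → 0#)
  ⊠-zeroˡ f zero = trans (⊠-zero (λ _ → 0#) f) (zeroˡ _)
  ⊠-zeroˡ f (suc n) = trans (⊠-suc (λ _ → 0#) f n) (trans (+-cong (zeroˡ _) (⊠-zeroˡ f n)) (+-identityˡ _))

  ⊠-constantˡ : ∀ c f n → (constant c ⊠ f) n ≈ c * f n
  ⊠-constantˡ c f zero = ⊠-zero (constant c) f
  ⊠-constantˡ c f (suc n) = trans (⊠-suc (constant c) f n) (trans (+-congˡ (⊠-zeroˡ f n)) (+-identityʳ _))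

  ⊠-identityˡ : ∀ f → constant 1# ⊠ f ≋ f
  ⊠-identityˡ f n = trans (⊠-constantˡ 1# f n) (*-identityˡ _)

  ring′ : CommutativeRing 0ℓ 0ℓ
  ring′ = record
    { Carrier = Ser ; _≈_ = _≋_ ; _+_ = _⊞_ ; _*_ = _⊠_ ; -_ = neg ; 0# = λ _ → 0# ; 1# = constant 1#
    ; isCommutativeRing = record
      { isRing = record
        { +-isAbelianGroup = record
          { isGroup = record
            { isMonoid = record
              { isSemigroup = record
                { isMagma = record
                  { isEquivalence = record
                    { refl = λ _ → refl ; sym = λ e n → sym (e n) ; trans = λ e e′ n → trans (e n) (e′ n) }
                  ; ∙-cong = λ e e′ n → +-cong (e n) (e′ n) }
                ; assoc = λ f g h n → +-assoc _ _ _ }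
              ; identity = (λ f n → +-identityˡ _) , (λ f n → +-identityʳ _) }
            ; inverse = (λ f n → -‿inverseˡ _) , (λ f n → -‿inverseʳ _)
            ; ⁻¹-cong = λ e n → -‿cong (e n) }
          ; comm = λ f g n → +-comm _ _ }
        ; *-cong = ⊠-cong
        ; *-assoc = ⊠-assoc
        ; *-identity = ⊠-identityˡ , (λ f n → trans (⊠-comm f _ n) (⊠-identityˡ f n))
        ; distrib = (λ h f g n → trans (⊠-comm h _ n) (trans (⊠-distribʳ h f g n) (+-cong (⊠-comm f h n) (⊠-comm g h n))))
                  , ⊠-distribʳ }
      ; *-comm = ⊠-comm } }
    where open import Data.Product.Base using (_,_)

  infixl 6 _⊟_
  _⊟_ : Ser → Ser → Ser
  f ⊟ g = f ⊞ neg g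

  X : Ser
  X zero = 0#
  X (suc n) = constant 1# n

  X⊠-zero : ∀ f → (X ⊠ f) 0 ≈ 0#
  X⊠-zero f = trans (⊠-zero X f) (zeroˡ _)

  X⊠-suc : ∀ f n → (X ⊠ f) (suc n) ≈ f n
  X⊠-suc f n = trans (⊠-suc X f n) (trans (+-cong (zeroˡ _) (⊠-identityˡ f n)) (+-identityˡ _))

  X⊠shift : ∀ f → f ≋ constant (f 0) ⊞ X ⊠ shift f
  X⊠shift f zero = sym (trans (+-congˡ (X⊠-zero (shift f))) (+-identityʳ _))
  X⊠shift f (suc n) = sym (trans (+-congˡ (X⊠-suc (shift f) n)) (+-identityˡ _))

  -- The factor `X` makes each coefficient of the right-hand side depend on lower coefficients of
  -- `f` only. Applied to the difference of two solutions, this gives uniqueness of fixed points.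
  X-guarded⇒0 : ∀ f g → f ≋ X ⊠ (g ⊠ f) → ∀ n → f n ≈ 0#
  X-guarded⇒0 f g e n = below (suc n) n ≤-refl
    where
    open import Data.Nat.Properties using (≤-refl; ≤-trans)
    below : ∀ n i → i ℕ.< n → f i ≈ 0#
    below (suc n) zero _ = trans (e 0) (X⊠-zero (g ⊠ f))
    below (suc n) (suc i) (ℕ.s≤s i<n) = begin
      f (suc i)                  ≈⟨ e (suc i) ⟩
      (X ⊠ (g ⊠ f)) (suc i)      ≈⟨ X⊠-suc (g ⊠ f) i ⟩
      (g ⊠ f) i                  ≈⟨ ⊠-cong-≤ i {g} (λ _ _ → refl) (λ j j≤i → below n j (≤-trans (ℕ.s≤s j≤i) i<n)) ⟩
      (g ⊠ (λ _ → 0#)) i         ≈⟨ ⊠-comm g _ i ⟩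
      ((λ _ → 0#) ⊠ g) i         ≈⟨ ⊠-zeroˡ g i ⟩
      0#                         ∎

  -- The binomial transform and the substitution X / (1 - cX).

  module BinomialTransform (c : Carrier) where

    -- binomial f n = Σ_b (n choose b) c^(n-b) f b
    binomial : Ser → Ser
    binomial f zero = f 0
    binomial f (suc n) = c * binomial f n + binomial (shift f) n

    -- substitute f = f(X / (1 - cX))
    substitute : Ser → Ser
    substitute f zero = f 0
    substitute f (suc n) = binomial (shift f) n

    binomial-cong : ∀ {f g} → f ≋ g → binomial f ≋ binomial g
    binomial-cong e zero = e 0
    binomial-cong e (suc n) = +-cong (*-congˡ (binomial-cong e n)) (binomial-cong (e ∘ suc) n)

    binomial-⊞ : ∀ f g → binomial (f ⊞ g) ≋ binomial f ⊞ binomial g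
    binomial-⊞ f g zero = refl
    binomial-⊞ f g (suc n) = trans (+-cong (*-congˡ (binomial-⊞ f g n)) (binomial-⊞ (shift f) (shift g) n))
      (solve 5 (λ c a b a′ b′ → c :* (a :+ b) :+ (a′ :+ b′) := (c :* a :+ a′) :+ (c :* b :+ b′)) refl _ _ _ _ _)

    binomial-scale : ∀ k f n → binomial (λ i → k * f i) n ≈ k * binomial f n
    binomial-scale k f zero = refl
    binomial-scale k f (suc n) = trans (+-cong (*-congˡ (binomial-scale k f n)) (binomial-scale k (shift f) n))
      (solve 4 (λ c k a b → c :* (k :* a) :+ k :* b := k :* (c :* a :+ b)) refl _ _ _ _)

    binomial-shift-⊠ : ∀ f g n → binomial (shift (f ⊠ g)) n ≈ f 0 * binomial (shift g) n + binomial (shift f ⊠ g) n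
    binomial-shift-⊠ f g n = begin
      binomial (shift (f ⊠ g)) n                                   ≈⟨ binomial-cong (⊠-suc f g) n ⟩
      binomial ((λ i → f 0 * shift g i) ⊞ (shift f ⊠ g)) n         ≈⟨ binomial-⊞ _ (shift f ⊠ g) n ⟩
      binomial (λ i → f 0 * shift g i) n + binomial (shift f ⊠ g) n ≈⟨ +-congʳ (binomial-scale (f 0) (shift g) n) ⟩
      f 0 * binomial (shift g) n + binomial (shift f ⊠ g) n        ∎

    -- `binomial f` is `substitute f` divided by `1 - cX`. A product has this denominator once, so
    -- one factor carries it and the other is merely substituted.
    binomial-⊠ : ∀ f g → binomial (f ⊠ g) ≋ binomial f ⊠ substitute g
    binomial-⊠ f g zero = trans (⊠-zero f g) (sym (⊠-zero (binomial f) (substitute g)))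
    binomial-⊠ f g (suc n) = begin
      c * binomial (f ⊠ g) n + binomial (shift (f ⊠ g)) n
        ≈⟨ +-cong (*-congˡ (binomial-⊠ f g n)) (trans (binomial-shift-⊠ f g n) (+-congˡ (binomial-⊠ (shift f) g n))) ⟩
      c * (binomial f ⊠ substitute g) n + (f 0 * binomial (shift g) n + (binomial (shift f) ⊠ substitute g) n)
        ≈⟨ solve 3 (λ a b d → a :+ (b :+ d) := b :+ (a :+ d)) refl _ _ _ ⟩
      f 0 * binomial (shift g) n + (c * (binomial f ⊠ substitute g) n + (binomial (shift f) ⊠ substitute g) n)
        ≈⟨ +-congˡ (+-congʳ (⊠-scaleˡ c (binomial f) (substitute g) n)) ⟨
      f 0 * binomial (shift g) n + (((λ i → c * binomial f i) ⊠ substitute g) n + (binomial (shift f) ⊠ substitute g) n)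
        ≈⟨ +-congˡ (⊠-distribʳ (substitute g) (λ i → c * binomial f i) (binomial (shift f)) n) ⟨
      f 0 * binomial (shift g) n + (shift (binomial f) ⊠ substitute g) n
        ≈⟨ ⊠-suc (binomial f) (substitute g) n ⟨
      (binomial f ⊠ substitute g) (suc n) ∎

    substitute-⊠ : ∀ f g → substitute (f ⊠ g) ≋ substitute f ⊠ substitute g
    substitute-⊠ f g zero = trans (⊠-zero f g) (sym (⊠-zero (substitute f) (substitute g)))
    substitute-⊠ f g (suc n) = begin
      binomial (shift (f ⊠ g)) n                                        ≈⟨ binomial-shift-⊠ f g n ⟩
      f 0 * binomial (shift g) n + binomial (shift f ⊠ g) n             ≈⟨ +-congˡ (binomial-⊠ (shift f) g n) ⟩
      f 0 * binomial (shift g) n + (binomial (shift f) ⊠ substitute g) n ≈⟨ ⊠-suc (substitute f) (substitute g) n ⟨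
      (substitute f ⊠ substitute g) (suc n)                             ∎

    substitute-cong : ∀ {f g} → f ≋ g → substitute f ≋ substitute g
    substitute-cong e zero = e 0
    substitute-cong e (suc n) = binomial-cong (e ∘ suc) n

    substitute-⊞ : ∀ f g → substitute (f ⊞ g) ≋ substitute f ⊞ substitute g
    substitute-⊞ f g zero = refl
    substitute-⊞ f g (suc n) = binomial-⊞ (shift f) (shift g) n

    binomial-neg : ∀ f → binomial (neg f) ≋ neg (binomial f)
    binomial-neg f zero = refl
    binomial-neg f (suc n) = trans (+-cong (*-congˡ (binomial-neg f n)) (binomial-neg (shift f) n))
      (solve 3 (λ c a b → c :* (:- a) :+ (:- b) := :- (c :* a :+ b)) refl c _ _)

    substitute-neg : ∀ f → substitute (neg f) ≋ neg (substitute f)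
    substitute-neg f zero = refl
    substitute-neg f (suc n) = binomial-neg (shift f) n

    binomial-0 : ∀ n → binomial (λ _ → 0#) n ≈ 0#
    binomial-0 zero = refl
    binomial-0 (suc n) = trans (+-cong (*-congˡ (binomial-0 n)) (binomial-0 n)) (trans (+-identityʳ _) (zeroʳ c))

    substitute-constant : ∀ k → substitute (constant k) ≋ constant k
    substitute-constant k zero = refl
    substitute-constant k (suc n) = binomial-0 n

    -- Multiplication by `1 - cX` cancels the first term of Pascal's recurrence, and the second term
    -- is the coefficient of `substitute f`.
    substitute-binomial : ∀ f → (constant 1# ⊟ constant c ⊠ X) ⊠ binomial f ≋ substitute f
    substitute-binomial f n = trans (expand n) (go n)
      where
      open CommutativeRing ring′ using () renaming (trans to ≋-trans; refl to ≋-refl)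
      open IntegerCoefficientSolver ring′ using () renaming (solve to solve′; _:*_ to _:*′_; _:-_ to _:-′_; _:=_ to _:=′_; :1 to :1′)
      expand : (constant 1# ⊟ constant c ⊠ X) ⊠ binomial f ≋ binomial f ⊟ constant c ⊠ (X ⊠ binomial f)
      expand = solve′ 3 (λ c x b → (:1′ :-′ c :*′ x) :*′ b :=′ b :-′ c :*′ (x :*′ b)) ≋-refl (constant c) X (binomial f)
      go : binomial f ⊟ constant c ⊠ (X ⊠ binomial f) ≋ substitute f
      go zero = trans (+-congˡ (-‿cong (trans (⊠-constantˡ c (X ⊠ binomial f) 0) (*-congˡ (X⊠-zero (binomial f))))))
        (solve 2 (λ a c → a :- c :* :0 := a) refl _ _)
      go (suc n) = trans (+-congˡ (-‿cong (trans (⊠-constantˡ c (X ⊠ binomial f) (suc n)) (*-congˡ (X⊠-suc (binomial f) n)))))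
        (solve 3 (λ c a b → c :* a :+ b :- c :* a := b) refl _ _ _)

    substitute-X : (constant 1# ⊟ constant c ⊠ X) ⊠ substitute X ≋ X
    substitute-X = ≋-trans (⊠-cong {f = V} ≋-refl sX)
      (≋-trans (solve′ 3 (λ a x b → a :*′ (x :*′ b) :=′ x :*′ (a :*′ b)) ≋-refl V X (binomial (constant 1#)))
      (≋-trans (⊠-cong {f = X} ≋-refl (≋-trans (substitute-binomial (constant 1#)) (substitute-constant 1#)))
      (≋*-identityʳ X)))
      where
      open CommutativeRing ring′ using () renaming (trans to ≋-trans; refl to ≋-refl; *-identityʳ to ≋*-identityʳ)
      open IntegerCoefficientSolver ring′ using () renaming (solve to solve′; _:*_ to _:*′_; _:=_ to _:=′_)
      V : Ser
      V = constant 1# ⊟ constant c ⊠ X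
      sX : substitute X ≋ X ⊠ binomial (constant 1#)
      sX zero = sym (X⊠-zero (binomial (constant 1#)))
      sX (suc n) = sym (X⊠-suc (binomial (constant 1#)) n)

  open import Algebra.Properties.Semiring.Mult semiring using (_×_; ×-homo-+; ×-assoc-*; ×-comm-*; ×-congʳ)
  open import Algebra.Properties.CommutativeMonoid.Mult +-commutativeMonoid using (×-distrib-+)

  -- The derivation `X d/dX`. It enters because a cyclic word can be cut inside a run of j vertices
  -- in j + 1 places.
  θ : Ser → Ser
  θ f n = n × f n

  Σ<-⊞ : ∀ n f g → Σ< n (λ i → f i + g i) ≈ Σ< n f + Σ< n g
  Σ<-⊞ zero f g = sym (+-identityʳ 0#)
  Σ<-⊞ (suc n) f g = trans (+-congˡ (Σ<-⊞ n (shift f) (shift g)))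
    (solve 4 (λ a b c d → (a :+ b) :+ (c :+ d) := (a :+ c) :+ (b :+ d)) refl _ _ _ _)

  ×-zeroʳ : ∀ m → m × 0# ≈ 0#
  ×-zeroʳ zero = refl
  ×-zeroʳ (suc m) = trans (+-identityˡ _) (×-zeroʳ m)

  Σ<-× : ∀ m n f → Σ< n (λ i → m × f i) ≈ m × Σ< n f
  Σ<-× m zero f = sym (×-zeroʳ m)
  Σ<-× m (suc n) f = trans (+-congˡ (Σ<-× m n (shift f))) (sym (×-distrib-+ _ _ m))

  θ-⊠ : ∀ f g → θ (f ⊠ g) ≋ θ f ⊠ g ⊞ f ⊠ θ g
  θ-⊠ f g n = begin
    n × (f ⊠ g) n                                            ≡⟨ ≡.cong (n ×_) (⊠-Σ< f g n) ⟩
    n × Σ< (suc n) (λ i → f i * g (n ∸ i))                   ≈⟨ Σ<-× n (suc n) (λ i → f i * g (n ∸ i)) ⟨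
    Σ< (suc n) (λ i → n × (f i * g (n ∸ i)))                 ≈⟨ Σ<-cong (suc n) split ⟩
    Σ< (suc n) (λ i → θ f i * g (n ∸ i) + f i * θ g (n ∸ i)) ≈⟨ Σ<-⊞ (suc n) (λ i → θ f i * g (n ∸ i)) (λ i → f i * θ g (n ∸ i)) ⟩
    Σ< (suc n) (λ i → θ f i * g (n ∸ i)) + Σ< (suc n) (λ i → f i * θ g (n ∸ i)) ≡⟨ ≡.cong₂ _+_ (⊠-Σ< (θ f) g n) (⊠-Σ< f (θ g) n) ⟨
    (θ f ⊠ g) n + (f ⊠ θ g) n                                ∎
    where
    open import Data.Nat.Properties using (m+[n∸m]≡n)
    split : ∀ i → i ℕ.< suc n → n × (f i * g (n ∸ i)) ≈ θ f i * g (n ∸ i) + f i * θ g (n ∸ i)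
    split i (ℕ.s≤s i≤n) = begin
      n × (f i * g (n ∸ i))                                    ≡⟨ ≡.cong (_× (f i * g (n ∸ i))) (m+[n∸m]≡n i≤n) ⟨
      (i ℕ.+ (n ∸ i)) × (f i * g (n ∸ i))                      ≈⟨ ×-homo-+ (f i * g (n ∸ i)) i (n ∸ i) ⟩
      i × (f i * g (n ∸ i)) + (n ∸ i) × (f i * g (n ∸ i))      ≈⟨ +-cong (×-assoc-* i (f i) (g (n ∸ i))) (×-comm-* (n ∸ i) (f i) (g (n ∸ i))) ⟨
      θ f i * g (n ∸ i) + f i * θ g (n ∸ i)                    ∎

  θ-cong : ∀ {f g} → f ≋ g → θ f ≋ θ g
  θ-cong e n = ×-congʳ n (e n)

  θ-⊞ : ∀ f g → θ (f ⊞ g) ≋ θ f ⊞ θ g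
  θ-⊞ f g n = ×-distrib-+ _ _ n

  θ-constant : ∀ k → θ (constant k) ≋ (λ _ → 0#)
  θ-constant k zero = refl
  θ-constant k (suc n) = ×-zeroʳ (suc n)

  θ-X : θ X ≋ X
  θ-X zero = refl
  θ-X (suc zero) = +-identityʳ _
  θ-X (suc (suc n)) = ×-zeroʳ (suc (suc n))

  -- As `1 - d` is a multiple of `X`, the equation d f = 0 has the guarded form f = X g f.
  -- Denominators with constant term 1 can so be cancelled without inverting them.
  unit-cancel : ∀ d f → d 0 ≈ 1# → (∀ n → (d ⊠ f) n ≈ 0#) → ∀ n → f n ≈ 0#
  unit-cancel d f d₀ e = X-guarded⇒0 f (shift (constant 1# ⊟ d)) (λ n → begin
    f n                                          ≈⟨ solve 2 (λ a b → a := (:1 :* a :- b) :+ b) refl (f n) ((d ⊠ f) n) ⟩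
    (1# * f n - (d ⊠ f) n) + (d ⊠ f) n           ≈⟨ trans (+-cong (+-congʳ (trans (*-identityˡ (f n)) (sym (⊠-identityˡ f n)))) (e n)) (+-identityʳ _) ⟩
    (constant 1# ⊠ f) n - (d ⊠ f) n              ≈⟨ solve′ 3 (λ a b c → a :*′ c :-′ b :*′ c :=′ (a :-′ b) :*′ c) (λ _ → refl) (constant 1#) d f n ⟩
    ((constant 1# ⊟ d) ⊠ f) n                    ≈⟨ ⊠-cong {g = f} (λ m → trans (X⊠shift (constant 1# ⊟ d) m) (+-congʳ (const-0 m))) (λ _ → refl) n ⟩
    (((λ _ → 0#) ⊞ X ⊠ shift (constant 1# ⊟ d)) ⊠ f) n ≈⟨ ⊠-cong {g = f} (λ m → +-identityˡ _) (λ _ → refl) n ⟩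
    ((X ⊠ shift (constant 1# ⊟ d)) ⊠ f) n        ≈⟨ ⊠-assoc X _ f n ⟩
    (X ⊠ (shift (constant 1# ⊟ d) ⊠ f)) n        ∎)
    where
    open IntegerCoefficientSolver ring′ using () renaming (solve to solve′; _:*_ to _:*′_; _:-_ to _:-′_; _:=_ to _:=′_)
    const-0 : ∀ m → constant ((constant 1# ⊟ d) 0) m ≈ 0#
    const-0 zero = trans (+-congˡ (-‿cong d₀)) (-‿inverseʳ 1#)
    const-0 (suc m) = refl

  -- t^r f(1/t), where the coefficients of f beyond r are dropped
  reverse : ℕ → Ser → Ser
  reverse r f k = if k ≤ᵇ r then f (r ∸ k) else 0#

  DegreeAtMost : ℕ → Ser → Set
  DegreeAtMost d f = ∀ k → d ℕ.< k → f k ≈ 0#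

  -- Multiplication by the m-th power of `X`, in a form that computes on coefficients.
  raise : ℕ → Ser → Ser
  raise zero f = f
  raise (suc m) f zero = 0#
  raise (suc m) f (suc k) = raise m f k

  raise-cong : ∀ m {f g} → f ≋ g → raise m f ≋ raise m g
  raise-cong zero e = e
  raise-cong (suc m) e zero = refl
  raise-cong (suc m) e (suc k) = raise-cong m e k

  raise-⊠ : ∀ m f g → raise m f ⊠ g ≋ raise m (f ⊠ g)
  raise-⊠ zero f g k = refl
  raise-⊠ (suc m) f g zero = trans (⊠-zero (raise (suc m) f) g) (zeroˡ _)
  raise-⊠ (suc m) f g (suc k) = begin
    (raise (suc m) f ⊠ g) (suc k)      ≈⟨ ⊠-suc (raise (suc m) f) g k ⟩
    0# * g (suc k) + (raise m f ⊠ g) k ≈⟨ +-cong (zeroˡ _) (raise-⊠ m f g k) ⟩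
    0# + raise m (f ⊠ g) k             ≈⟨ +-identityˡ _ ⟩
    raise m (f ⊠ g) k                  ∎

  raise-scale : ∀ m c f k → raise m (λ i → c * f i) k ≈ c * raise m f k
  raise-scale zero c f k = refl
  raise-scale (suc m) c f zero = sym (zeroʳ c)
  raise-scale (suc m) c f (suc k) = raise-scale m c f k

  reverse-suc : ∀ r f k → reverse (suc r) f (suc k) ≡ reverse r f k
  reverse-suc r f zero = ≡.refl
  reverse-suc r f (suc k) = ≡.refl

  reverse-cong : ∀ r {f g} → f ≋ g → reverse r f ≋ reverse r g
  reverse-cong r e k with k ≤ᵇ r
  ... | true = e (r ∸ k)
  ... | false = refl

  reverse-⊞ : ∀ r f g → reverse r (f ⊞ g) ≋ reverse r f ⊞ reverse r g
  reverse-⊞ r f g k with k ≤ᵇ r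
  ... | true = refl
  ... | false = sym (+-identityˡ 0#)

  reverse-scale : ∀ r c f k → reverse r (λ i → c * f i) k ≈ c * reverse r f k
  reverse-scale r c f k with k ≤ᵇ r
  ... | true = refl
  ... | false = sym (zeroʳ c)

  reverse-raise : ∀ m r f → DegreeAtMost r f → reverse (m ℕ.+ r) f ≋ raise m (reverse r f)
  reverse-raise zero r f d k = refl
  reverse-raise (suc m) r f d zero = d (suc (m ℕ.+ r)) (ℕ.s≤s (m≤n+m r m))
    where open import Data.Nat.Properties using (m≤n+m)
  reverse-raise (suc m) r f d (suc k) = trans (reflexive (reverse-suc (m ℕ.+ r) f k)) (reverse-raise m r f d k)

  reverse-shift : ∀ r f → reverse (suc r) f ≋ reverse r (shift f) ⊞ raise (suc r) (constant (f 0))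
  reverse-shift zero f zero = sym (+-identityʳ _)
  reverse-shift zero f (suc zero) = sym (+-identityˡ _)
  reverse-shift zero f (suc (suc k)) = sym (+-identityˡ _)
  reverse-shift (suc r) f zero = sym (+-identityʳ _)
  reverse-shift (suc r) f (suc k) = begin
    reverse (suc (suc r)) f (suc k)                                       ≡⟨ reverse-suc (suc r) f k ⟩
    reverse (suc r) f k                                                   ≈⟨ reverse-shift r f k ⟩
    reverse r (shift f) k + raise (suc r) (constant (f 0)) k              ≡⟨ ≡.cong (_+ raise (suc r) (constant (f 0)) k) (reverse-suc r (shift f) k) ⟨
    reverse (suc r) (shift f) (suc k) + raise (suc r) (constant (f 0)) k  ∎

  -- `reverse` drops coefficients beyond its bound, whence the two degree hypotheses. The induction
  -- splits off the constant term of `f`, which moves to the top; the remainder has a factor `X`,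
  -- which disappears as the bound drops by one.
  reverse-⊠ : ∀ a b f g → DegreeAtMost a f → DegreeAtMost b g → reverse (a ℕ.+ b) (f ⊠ g) ≋ reverse a f ⊠ reverse b g
  reverse-⊠ zero b f g df dg k = begin
    reverse b (f ⊠ g) k                ≈⟨ reverse-cong b (λ i → trans (⊠-cong {g = g} f-const (λ _ → refl) i) (⊠-constantˡ (f 0) g i)) k ⟩
    reverse b (λ i → f 0 * g i) k      ≈⟨ reverse-scale b (f 0) g k ⟩
    f 0 * reverse b g k                ≈⟨ ⊠-constantˡ (f 0) (reverse b g) k ⟨
    (constant (f 0) ⊠ reverse b g) k   ≈⟨ ⊠-cong {g = reverse b g} rev-const (λ _ → refl) k ⟨
    (reverse 0 f ⊠ reverse b g) k      ∎
    where
    f-const : f ≋ constant (f 0)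
    f-const zero = refl
    f-const (suc i) = df (suc i) (ℕ.s≤s ℕ.z≤n)
    rev-const : reverse 0 f ≋ constant (f 0)
    rev-const zero = refl
    rev-const (suc i) = refl
  reverse-⊠ (suc a) b f g df dg k = begin
    reverse (suc (a ℕ.+ b)) (f ⊠ g) k
      ≈⟨ reverse-cong (suc (a ℕ.+ b)) split k ⟩
    reverse (suc (a ℕ.+ b)) ((λ i → f 0 * g i) ⊞ X ⊠ (shift f ⊠ g)) k
      ≈⟨ reverse-⊞ (suc (a ℕ.+ b)) (λ i → f 0 * g i) (X ⊠ (shift f ⊠ g)) k ⟩
    reverse (suc (a ℕ.+ b)) (λ i → f 0 * g i) k + reverse (suc (a ℕ.+ b)) (X ⊠ (shift f ⊠ g)) k
      ≈⟨ +-cong (trans (reverse-scale (suc (a ℕ.+ b)) (f 0) g k) (*-congˡ (reverse-raise (suc a) b g dg k)))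
                (trans (rev-X (a ℕ.+ b) (shift f ⊠ g) k) (reverse-⊠ a b (shift f) g (λ i a<i → df (suc i) (ℕ.s≤s a<i)) dg k)) ⟩
    f 0 * raise (suc a) (reverse b g) k + (reverse a (shift f) ⊠ reverse b g) k
      ≈⟨ +-comm _ _ ⟩
    (reverse a (shift f) ⊠ reverse b g) k + f 0 * raise (suc a) (reverse b g) k
      ≈⟨ +-congˡ (trans (raise-⊠ (suc a) (constant (f 0)) (reverse b g) k)
           (trans (raise-cong (suc a) (⊠-constantˡ (f 0) (reverse b g)) k) (raise-scale (suc a) (f 0) (reverse b g) k))) ⟨
    (reverse a (shift f) ⊠ reverse b g) k + (raise (suc a) (constant (f 0)) ⊠ reverse b g) k
      ≈⟨ ⊠-distribʳ (reverse b g) (reverse a (shift f)) (raise (suc a) (constant (f 0))) k ⟨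
    ((reverse a (shift f) ⊞ raise (suc a) (constant (f 0))) ⊠ reverse b g) k
      ≈⟨ ⊠-cong {g = reverse b g} (reverse-shift a f) (λ _ → refl) k ⟨
    (reverse (suc a) f ⊠ reverse b g) k ∎
    where
    split : f ⊠ g ≋ (λ i → f 0 * g i) ⊞ X ⊠ (shift f ⊠ g)
    split zero = trans (⊠-zero f g) (sym (trans (+-congˡ (X⊠-zero (shift f ⊠ g))) (+-identityʳ _)))
    split (suc i) = trans (⊠-suc f g i) (+-congˡ (sym (X⊠-suc (shift f ⊠ g) i)))
    rev-X : ∀ r h → reverse (suc r) (X ⊠ h) ≋ reverse r h
    rev-X r h i = trans (reverse-shift r (X ⊠ h) i) (trans (+-cong (reverse-cong r (X⊠-suc h) i)
      (trans (raise-cong (suc r) {g = λ _ → 0#} const-0 i) (raise-0 (suc r) i))) (+-identityʳ _))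
      where
      const-0 : constant ((X ⊠ h) 0) ≋ (λ _ → 0#)
      const-0 zero = X⊠-zero h
      const-0 (suc _) = refl
      raise-0 : ∀ m → raise m (λ _ → 0#) ≋ (λ _ → 0#)
      raise-0 zero _ = refl
      raise-0 (suc m) zero = refl
      raise-0 (suc m) (suc k) = raise-0 m k

-- Identities with cleared denominators on the curve A = u(1+A)(1+tA).

module WheelAlgebra (R : CommutativeRing 0ℓ 0ℓ) where

  open CommutativeRing R
  open import Relation.Binary.Reasoning.Setoid setoid
  open IntegerCoefficientSolver R
  open import Data.Integer.Base using (+_)

  2# : Carrier
  2# = 1# + 1#

  :2 : ∀ {n} → Polynomial n
  :2 = :1 :+ :1

  inverse-unique : ∀ {a b c} → a * b ≈ 1# → a * c ≈ 1# → b ≈ c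
  inverse-unique {a} {b} {c} ab ac = begin
    b              ≈⟨ *-identityʳ b ⟨
    b * 1#         ≈⟨ *-congˡ ac ⟨
    b * (a * c)    ≈⟨ solve 3 (λ a b c → b :* (a :* c) := (a :* b) :* c) refl a b c ⟩
    (a * b) * c    ≈⟨ *-congʳ ab ⟩
    1# * c         ≈⟨ *-identityˡ c ⟩
    c              ∎

  -- At `V = 1 - tu`, `x = u`, `z = tuA` this is 1 - u - tu - 2tuA: the derivative of A -
  -- u(1+A)(1+tA) with respect to A, and a square root of the discriminant of this quadratic.
  discriminant : Carrier → Carrier → Carrier → Carrier
  discriminant V x z = V - x - 2# * z

  -- What the three summands of the closed form become when u is replaced by x / V and all is
  -- multiplied by the common denominator.
  cleared : (V x z α β : Carrier) → Carrier
  cleared V x z α β = (x - V) * (α * β) * (V + x) * discriminant V x z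
    - (x * x + x * V - V * V) * β * discriminant V x z + 2# * x * V

  -- Quotients are given by equations, since the ring has no division. `m`, `j`, `i` are the three
  -- reciprocals in the closed form: uniqueness of inverses expresses the first two through α and β,
  -- and the third goes away with its denominator.
  clear-denominators : ∀ {V w v m j i α β b} →
    (1# - w - v) * m ≈ 1# → (1# + w) * (1# - v) * j ≈ 1# → (1# + w) * (1# - w - 2# * v) * i ≈ 1# →
    V * (1# - v) * β ≈ 1# → V * (1# - w - v) * (α * β) ≈ 1# →
    V * b ≈ (w - 1#) * m - (w * w + w - 1#) * j + 2# * w * i →
    (V + V * w) * discriminant V (V * w) (V * v) * V * b ≈ cleared V (V * w) (V * v) α β
  clear-denominators {V} {w} {v} {m} {j} {i} {α} {β} {b} hm hj hi hβ hαβ hb = begin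
    (V + V * w) * discriminant V (V * w) (V * v) * V * b
      ≈⟨ solve 4 (λ V w v b → (V :+ V :* w) :* (V :- V :* w :- :2 :* (V :* v)) :* V :* b
                 := V :* V :* ((:1 :+ w) :* (:1 :- w :- :2 :* v)) :* (V :* b)) refl V w v b ⟩
    V * V * ((1# + w) * (1# - w - 2# * v)) * (V * b)
      ≈⟨ *-congˡ hb ⟩
    V * V * ((1# + w) * (1# - w - 2# * v)) * ((w - 1#) * m - (w * w + w - 1#) * j + 2# * w * i)
      ≈⟨ solve 6 (λ V w v m j i → V :* V :* ((:1 :+ w) :* (:1 :- w :- :2 :* v)) :* ((w :- :1) :* m :- (w :* w :+ w :- :1) :* j :+ :2 :* w :* i)
                 := V :* V :* ((w :- :1) :* m :* ((:1 :+ w) :* (:1 :- w :- :2 :* v)) :- (w :* w :+ w :- :1) :* ((:1 :+ w) :* j) :* (:1 :- w :- :2 :* v)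
                      :+ :2 :* w :* ((:1 :+ w) :* (:1 :- w :- :2 :* v) :* i))) refl V w v m j i ⟩
    V * V * ((w - 1#) * m * ((1# + w) * (1# - w - 2# * v)) - (w * w + w - 1#) * ((1# + w) * j) * (1# - w - 2# * v)
                      + 2# * w * ((1# + w) * (1# - w - 2# * v) * i))
      ≈⟨ *-congˡ (+-cong (+-cong (*-congʳ (*-congˡ m≈)) (-‿cong (*-congʳ (*-congˡ j≈)))) (*-congˡ hi)) ⟩
    V * V * ((w - 1#) * (V * (α * β)) * ((1# + w) * (1# - w - 2# * v)) - (w * w + w - 1#) * (V * β) * (1# - w - 2# * v)
                      + 2# * w * 1#)
      ≈⟨ solve 5 (λ V w v α β → V :* V :* ((w :- :1) :* (V :* (α :* β)) :* ((:1 :+ w) :* (:1 :- w :- :2 :* v)) :- (w :* w :+ w :- :1) :* (V :* β) :* (:1 :- w :- :2 :* v)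
                      :+ :2 :* w :* :1)
            := let x = V :* w; D = V :- V :* w :- :2 :* (V :* v) in
               (x :- V) :* (α :* β) :* (V :+ x) :* D :- (x :* x :+ x :* V :- V :* V) :* β :* D :+ :2 :* x :* V) refl V w v α β ⟩
    cleared V (V * w) (V * v) α β ∎
    where
    m≈ : m ≈ V * (α * β)
    m≈ = inverse-unique hm (trans (solve 4 (λ w v V p → (:1 :- w :- v) :* (V :* p) := V :* (:1 :- w :- v) :* p) refl w v V (α * β)) hαβ)
    j≈ : (1# + w) * j ≈ V * β
    j≈ = inverse-unique (trans (solve 3 (λ w v j → (:1 :- v) :* ((:1 :+ w) :* j) := (:1 :+ w) :* (:1 :- v) :* j) refl w v j) hj)
           (trans (solve 3 (λ v V b → (:1 :- v) :* (V :* b) := V :* (:1 :- v) :* b) refl v V β) hβ)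

  discriminant-cong : ∀ {V x x′ z z′} → x ≈ x′ → z ≈ z′ → discriminant V x z ≈ discriminant V x′ z′
  discriminant-cong ex ez = +-cong (+-congˡ (-‿cong ex)) (-‿cong (*-congˡ ez))

  cleared-cong : ∀ {V x x′ z z′ α β} → x ≈ x′ → z ≈ z′ → cleared V x z α β ≈ cleared V x′ z′ α β
  cleared-cong ex ez = +-cong (+-cong (*-cong (*-cong (*-congʳ (+-congʳ ex)) (+-congˡ ex)) Δ≈)
      (-‿cong (*-cong (*-congʳ (+-congʳ (+-cong (*-cong ex ex) (*-congʳ ex)))) Δ≈))) (*-congʳ (*-congˡ ex))
    where Δ≈ = discriminant-cong ex ez

  clear-denominators′ : ∀ {V x z w v m j i α β b} → V * w ≈ x → V * v ≈ z →
    (1# - w - v) * m ≈ 1# → (1# + w) * (1# - v) * j ≈ 1# → (1# + w) * (1# - w - 2# * v) * i ≈ 1# →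
    (V - z) * β ≈ 1# → (V - x - z) * (α * β) ≈ 1# →
    V * b ≈ (w - 1#) * m - (w * w + w - 1#) * j + 2# * w * i →
    (V + x) * discriminant V x z * V * b ≈ cleared V x z α β
  clear-denominators′ {V} {w = w} {v} {α = α} {β} ex ez hm hj hi hβ hαβ hb =
    trans (sym (*-congʳ (*-congʳ (*-cong (+-congˡ ex) (discriminant-cong ex ez)))))
    (trans (clear-denominators hm hj hi
      (trans (*-congʳ (trans (solve 2 (λ V v → V :* (:1 :- v) := V :- V :* v) refl V v) (+-congˡ (-‿cong ez)))) hβ)
      (trans (*-congʳ (trans (solve 3 (λ V w v → V :* (:1 :- w :- v) := V :- V :* w :- V :* v) refl V w v) (+-cong (+-congˡ (-‿cong ex)) (-‿cong ez)))) hαβ) hb)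
    (cleared-cong ex ez))

  module Curve {u t A : Carrier} (curve : A ≈ u * ((1# + A) * (1# + t * A))) where

    -- Expanding produces tu(1+A)(1+tA), which the curve turns into tA. The next two inverses arise
    -- in the same way.
    β-inverse : (1# - t * u - t * u * A) * (1# + t * A) ≈ 1#
    β-inverse = trans (solve 3 (λ u t A → (:1 :- t :* u :- t :* u :* A) :* (:1 :+ t :* A) := :1 :+ t :* A :- t :* (u :* ((:1 :+ A) :* (:1 :+ t :* A)))) refl u t A)
      (trans (+-congˡ (-‿cong (*-congˡ (sym curve)))) (solve 2 (λ t A → :1 :+ t :* A :- t :* A := :1) refl t A))

    α-inverse : (1# - u - t * u * A) * (1# + A) ≈ 1#
    α-inverse = trans (solve 3 (λ u t A → (:1 :- u :- t :* u :* A) :* (:1 :+ A) := :1 :+ A :- u :* ((:1 :+ A) :* (:1 :+ t :* A))) refl u t A)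
      (trans (+-congˡ (-‿cong (sym curve))) (solve 1 (λ A → :1 :+ A :- A := :1) refl A))

    αβ-inverse : (1# - t * u - u - t * u * A) * ((1# + A) * (1# + t * A)) ≈ 1#
    αβ-inverse = trans (solve 3 (λ u t A → (:1 :- t :* u :- u :- t :* u :* A) :* ((:1 :+ A) :* (:1 :+ t :* A))
         := (:1 :+ A) :* (:1 :+ t :* A) :- (t :+ :1 :+ t :* A) :* (u :* ((:1 :+ A) :* (:1 :+ t :* A)))) refl u t A)
      (trans (+-congˡ (-‿cong (*-congˡ (sym curve)))) (solve 2 (λ t A → (:1 :+ A) :* (:1 :+ t :* A) :- (t :+ :1 :+ t :* A) :* A := :1) refl t A))

  -- The cofactor of A - u(1+A)(1+tA) comes from dividing the cleared identity by that relation.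
  wheel-identity : ∀ {u t A θ b b′ i i′} → let x = u; y = t * u; z = t * u * A; V = 1# - y; U = 1# - x; α = 1# + A; β = 1# + t * A; Δ = discriminant V x z in
    A ≈ u * (α * β) → Δ * θ ≈ A →
    (V + x) * Δ * V * b ≈ cleared V x z α β → (U + y) * Δ * U * b′ ≈ cleared U y z β α →
    V * i ≈ 1# → U * i′ ≈ 1# →
    Δ * V * U * (V + x) * (U + y) * (y * (α + θ) * β + b + x * i - (x * (β + t * θ) * α + b′ + y * i′)) ≈ 0#
  wheel-identity {u} {t} {A} {θ} {b} {b′} {i} {i′} hA hθ hb hb′ hi hi′ = begin
    Δ * V * U * (V + x) * (U + y) * (y * (α + θ) * β + b + x * i - (x * (β + t * θ) * α + b′ + y * i′))
      ≈⟨ solve 15 (λ Δ V U Vx Uy x y α β t θ b b′ i i′ →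
           Δ :* V :* U :* Vx :* Uy :* (y :* (α :+ θ) :* β :+ b :+ x :* i :- (x :* (β :+ t :* θ) :* α :+ b′ :+ y :* i′))
           := (y :- x) :* (α :* β) :* Δ :* V :* U :* Vx :* Uy :+ (y :* β :- x :* α :* t) :* (Δ :* θ) :* V :* U :* Vx :* Uy
              :+ (Vx :* Δ :* V :* b) :* U :* Uy :- (Uy :* Δ :* U :* b′) :* V :* Vx
              :+ (x :* (V :* i) :* U :- y :* (U :* i′) :* V) :* Δ :* Vx :* Uy) refl Δ V U (V + x) (U + y) x y α β t θ b b′ i i′ ⟩
    (y - x) * (α * β) * Δ * V * U * (V + x) * (U + y) + (y * β - x * α * t) * (Δ * θ) * V * U * (V + x) * (U + y)
      + ((V + x) * Δ * V * b) * U * (U + y) - ((U + y) * Δ * U * b′) * V * (V + x)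
      + (x * (V * i) * U - y * (U * i′) * V) * Δ * (V + x) * (U + y)
      ≈⟨ +-cong (+-cong (+-cong (+-congˡ (*-congʳ (*-congʳ (*-congʳ (*-congʳ (*-congˡ hθ)))))) (*-congʳ (*-congʳ hb))) (-‿cong (*-congʳ (*-congʳ hb′))))
           (*-congʳ (*-congʳ (*-congʳ (+-cong (*-congʳ (*-congˡ hi)) (-‿cong (*-congʳ (*-congˡ hi′))))))) ⟩
    (y - x) * (α * β) * Δ * V * U * (V + x) * (U + y) + (y * β - x * α * t) * A * V * U * (V + x) * (U + y)
      + cleared V x z α β * U * (U + y) - cleared U y z β α * V * (V + x)
      + (x * 1# * U - y * 1# * V) * Δ * (V + x) * (U + y)
      ≈⟨ solve 3 (λ u t A → let x = u; y = t :* u; z = t :* u :* A; V = :1 :- y; U = :1 :- x; α = :1 :+ A; β = :1 :+ t :* A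
                                D = V :- x :- :2 :* z; D′ = U :- y :- :2 :* z in
           (y :- x) :* (α :* β) :* D :* V :* U :* (V :+ x) :* (U :+ y) :+ (y :* β :- x :* α :* t) :* A :* V :* U :* (V :+ x) :* (U :+ y)
           :+ ((x :- V) :* (α :* β) :* (V :+ x) :* D :- (x :* x :+ x :* V :- V :* V) :* β :* D :+ :2 :* x :* V) :* U :* (U :+ y)
           :- ((y :- U) :* (β :* α) :* (U :+ y) :* D′ :- (y :* y :+ y :* U :- U :* U) :* α :* D′ :+ :2 :* y :* U) :* V :* (V :+ x)
           :+ (x :* :1 :* U :- y :* :1 :* V) :* D :* (V :+ x) :* (U :+ y)
           := (:- (:1) :+ (t) :+ (u) :- (u :* t :* t) :+ (u :* u) :+ (u :* u :* t) :- (u :* u :* t :* t) :- (u :* u :* t :* t :* t) :- (u :* u :* u) :- (con (+ 3) :* u :* u :* u :* t) :- (con (+ 2) :* u :* u :* u :* t :* t :* A) :+ (con (+ 3) :* u :* u :* u :* t :* t :* t) :+ (con (+ 2) :* u :* u :* u :* t :* t :* t :* A) :+ (u :* u :* u :* t :* t :* t :* t) :+ (con (+ 4) :* u :* u :* u :* u :* t :* t) :- (con (+ 4) :* u :* u :* u :* u :* t :* t :* t) :+ (u :* u :* u :* u :* u :* t) :- (con (+ 2) :* u :* u :* u :* u :* u :* t :* t) :+ (con (+ 2) :* u :* u :* u :* u :* u :* t :* t :* A) :- (con (+ 6) :* u :* u :* u :* u :* u :* t :* t :* t :* A) :+ (con (+ 2) :* u :* u :* u :* u :* u :* t :* t :*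 t :* t) :+ (con (+ 6) :* u :* u :* u :* u :* u :* t :* t :* t :* t :* A) :- (u :* u :* u :* u :* u :* t :* t :* t :* t :* t) :- (con (+ 2) :* u :* u :* u :* u :* u :* t :* t :* t :* t :* t :* A))
              :* (A :- u :* (α :* β))) refl u t A ⟩
    _ * (A - u * (α * β))   ≈⟨ *-congˡ (trans (+-congʳ hA) (-‿inverseʳ _)) ⟩
    _ * 0#                  ≈⟨ zeroʳ _ ⟩
    0#                      ∎
    where
    x y z V U α β Δ : Carrier
    x = u
    y = t * u
    z = t * u * A
    V = 1# - y
    U = 1# - x
    α = 1# + A
    β = 1# + t * A
    Δ = discriminant V x z

-- Recursions for the sums over flats of fans and wheels.

module Fan (R : CommutativeRing 0ℓ 0ℓ) (c : CommutativeRing.Carrier R) (μ : ℕ → CommutativeRing.Carrier R) where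

  open CommutativeRing R
  open PowerSeries R
  open BinomialTransform c
  open import Relation.Binary.Reasoning.Setoid setoid
  open IntegerCoefficientSolver R
  open IntegerCoefficientSolver ring′ using () renaming (solve to solve′; _:+_ to _:+′_; _:*_ to _:*′_; _:=_ to _:=′_)
  module S = CommutativeRing ring′

  -- b vertices of the rim are free and the following i vertices are not joined to the hub;
  -- in runF the current run of vertices off the hub already has a blocks.
  hubF : ℕ → ℕ → Carrier
  runF : ℕ → ℕ → ℕ → Carrier
  hubF i zero = substitute μ i
  hubF i (suc b) = c * hubF i b + runF i b 1
  runF i zero a = binomial (λ j → μ (a ℕ.+ j)) i
  runF i (suc b) a = runF i b (suc a) + c * runF i b a + c * (μ a * hubF i b)

  -- For `c = t`, and with `μ` the Kazhdan-Lusztig polynomials of fans, this is the Z-polynomial of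
  -- the fan with that many rim vertices. For `c = 1` and the reversed `μ` it is the reversed
  -- Z-polynomial.
  hub : ℕ → Carrier
  hub = hubF 0

  run : ℕ → ℕ → Carrier
  run a b = runF 0 b a

  -- The i in wheelF counts vertices off the hub preceding the first one joined to it.
  wheelF : ℕ → ℕ → Carrier
  wheelF i zero = 0#
  wheelF i (suc b) = c * hubF i b + wheelF (suc i) b

  -- Weighs the part of a word up to its last vertex joined to the hub: nothing at all, or an
  -- arbitrary hub word followed by one joined vertex of weight `c`.
  K : Ser
  K zero = 1#
  K (suc b) = c * hub b

  module _ (μ₀ : μ 0 ≈ 1#) where

    -- The weight of a final run that is prolonged by the `i` vertices forced off the hub.
    φ : ℕ → Ser
    φ i j = substitute μ (i ℕ.+ j)

    hub≋ : hub ≋ K ⊞ X ⊠ run 1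
    hub≋ zero = trans μ₀ (sym (trans (+-congˡ (X⊠-zero (run 1))) (+-identityʳ 1#)))
    hub≋ (suc b) = +-congˡ (sym (X⊠-suc (run 1) b))

    run≋ : ∀ a → run a ≋ constant (μ a) ⊠ K ⊞ X ⊠ (run (suc a) ⊞ constant c ⊠ run a)
    run≋ a zero = trans (reflexive (≡.cong μ (ℕ.+-identityʳ a))) (sym (trans (+-cong (⊠-constantˡ (μ a) K 0) (X⊠-zero (run (suc a) ⊞ constant c ⊠ run a))) (trans (+-identityʳ _) (*-identityʳ _))))
    run≋ a (suc b) = sym (begin
      (constant (μ a) ⊠ K) (suc b) + (X ⊠ (run (suc a) ⊞ constant c ⊠ run a)) (suc b)
        ≈⟨ +-cong (⊠-constantˡ (μ a) K (suc b)) (trans (X⊠-suc (run (suc a) ⊞ constant c ⊠ run a) b) (+-congˡ (⊠-constantˡ c (run a) b))) ⟩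
      μ a * (c * hub b) + (run (suc a) b + c * run a b)
        ≈⟨ solve 5 (λ m c h r r′ → m :* (c :* h) :+ (r :+ c :* r′) := r :+ c :* r′ :+ c :* (m :* h)) refl (μ a) c (hub b) (run (suc a) b) (run a b) ⟩
      run a (suc b) ∎)

    -- Split at the last vertex joined to the hub.
    hubF≈ : ∀ i b → hubF i b ≈ (φ i ⊠ K) b
    runF≈ : ∀ i b a → runF i b a ≈ binomial (λ j → μ (a ℕ.+ j)) (i ℕ.+ b) + (φ i ⊠ (constant c ⊠ (X ⊠ run a))) b
    hubF≈ i zero = sym (trans (⊠-zero (φ i) K) (trans (*-identityʳ _) (reflexive (≡.cong (substitute μ) (ℕ.+-identityʳ i)))))
    hubF≈ i (suc b) = begin
      c * hubF i b + runF i b 1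
        ≈⟨ +-cong (*-congˡ (hubF≈ i b)) (runF≈ i b 1) ⟩
      c * (φ i ⊠ K) b + (substitute μ (suc (i ℕ.+ b)) + (φ i ⊠ (constant c ⊠ (X ⊠ run 1))) b)
        ≈⟨ +-congʳ (⊠-constantˡ c (φ i ⊠ K) b) ⟨
      (constant c ⊠ (φ i ⊠ K)) b + (substitute μ (suc (i ℕ.+ b)) + (φ i ⊠ (constant c ⊠ (X ⊠ run 1))) b)
        ≈⟨ solve 3 (λ x y z → x :+ (y :+ z) := y :* :1 :+ (x :+ z)) refl _ _ _ ⟩
      substitute μ (suc (i ℕ.+ b)) * 1# + ((constant c ⊠ (φ i ⊠ K)) b + (φ i ⊠ (constant c ⊠ (X ⊠ run 1))) b)
        ≈⟨ +-cong (*-congʳ (reflexive (≡.cong (substitute μ) (≡.sym (ℕ.+-suc i b)))))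
             (solve′ 5 (λ c f k x r → c :*′ (f :*′ k) :+′ f :*′ (c :*′ (x :*′ r)) :=′ f :*′ (c :*′ (k :+′ x :*′ r))) S.refl (constant c) (φ i) K X (run 1) b) ⟩
      φ i (suc b) * 1# + (φ i ⊠ (constant c ⊠ (K ⊞ X ⊠ run 1))) b
        ≈⟨ +-congˡ (⊠-cong {φ i} (λ _ → refl) (λ j → trans (⊠-cong {constant c} (λ _ → refl) (S.sym hub≋) j) (⊠-constantˡ c hub j)) b) ⟩
      φ i (suc b) * K 0 + (φ i ⊠ shift K) b
        ≈⟨ ⊠-sucʳ (φ i) K b ⟨
      (φ i ⊠ K) (suc b) ∎
    runF≈ i zero a = sym (trans (+-cong (reflexive (≡.cong (binomial (λ j → μ (a ℕ.+ j))) (ℕ.+-identityʳ i)))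
        (trans (⊠-zero (φ i) (constant c ⊠ (X ⊠ run a))) (trans (*-congˡ (trans (⊠-constantˡ c (X ⊠ run a) 0) (trans (*-congˡ (X⊠-zero (run a))) (zeroʳ c)))) (zeroʳ _)))) (+-identityʳ _))
    runF≈ i (suc b) a = begin
      runF i b (suc a) + c * runF i b a + c * (μ a * hubF i b)
        ≈⟨ +-cong (+-cong (runF≈ i b (suc a)) (*-congˡ (runF≈ i b a))) (*-congˡ (*-congˡ (hubF≈ i b))) ⟩
      (B′ + F′) + c * (B + F) + c * (μ a * H)
        ≈⟨ solve 7 (λ b′ f′ c b f m h → (b′ :+ f′) :+ c :* (b :+ f) :+ c :* (m :* h) := (c :* b :+ b′) :+ (c :* (m :* h) :+ (f′ :+ c :* f))) refl B′ F′ c B F (μ a) H ⟩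
      (c * B + B′) + (c * (μ a * H) + (F′ + c * F))
        ≈⟨ +-cong binomial-step tail-step ⟩
      binomial (λ j → μ (a ℕ.+ j)) (i ℕ.+ suc b) + (φ i ⊠ (constant c ⊠ (X ⊠ run a))) (suc b) ∎
      where
      B B′ F F′ H : Carrier
      B = binomial (λ j → μ (a ℕ.+ j)) (i ℕ.+ b)
      B′ = binomial (λ j → μ (suc a ℕ.+ j)) (i ℕ.+ b)
      F = (φ i ⊠ (constant c ⊠ (X ⊠ run a))) b
      F′ = (φ i ⊠ (constant c ⊠ (X ⊠ run (suc a)))) b
      H = (φ i ⊠ K) b
      binomial-step : c * B + B′ ≈ binomial (λ j → μ (a ℕ.+ j)) (i ℕ.+ suc b)
      binomial-step = trans (+-congˡ (binomial-cong (λ j → reflexive (≡.cong μ (≡.sym (ℕ.+-suc a j)))) (i ℕ.+ b)))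
        (reflexive (≡.cong (binomial (λ j → μ (a ℕ.+ j))) (≡.sym (ℕ.+-suc i b))))
      X-shift : φ i ⊠ (constant c ⊠ (X ⊠ run a)) ≋ X ⊠ (φ i ⊠ (constant c ⊠ run a))
      X-shift = solve′ 4 (λ f c x r → f :*′ (c :*′ (x :*′ r)) :=′ x :*′ (f :*′ (c :*′ r))) S.refl (φ i) (constant c) X (run a)
      tail-step : c * (μ a * H) + (F′ + c * F) ≈ (φ i ⊠ (constant c ⊠ (X ⊠ run a))) (suc b)
      tail-step = begin
        c * (μ a * H) + (F′ + c * F)
          ≈⟨ +-cong (trans (⊠-constantˡ c (constant (μ a) ⊠ (φ i ⊠ K)) b) (*-congˡ (⊠-constantˡ (μ a) (φ i ⊠ K) b))) (+-congˡ (⊠-constantˡ c (φ i ⊠ (constant c ⊠ (X ⊠ run a))) b)) ⟨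
        (constant c ⊠ (constant (μ a) ⊠ (φ i ⊠ K))) b + (F′ + (constant c ⊠ (φ i ⊠ (constant c ⊠ (X ⊠ run a)))) b)
          ≈⟨ solve′ 7 (λ c m f k x r r′ → c :*′ (m :*′ (f :*′ k)) :+′ (f :*′ (c :*′ (x :*′ r′)) :+′ c :*′ (f :*′ (c :*′ (x :*′ r))))
                :=′ f :*′ (c :*′ (m :*′ k :+′ x :*′ (r′ :+′ c :*′ r)))) S.refl (constant c) (constant (μ a)) (φ i) K X (run a) (run (suc a)) b ⟩
        (φ i ⊠ (constant c ⊠ (constant (μ a) ⊠ K ⊞ X ⊠ (run (suc a) ⊞ constant c ⊠ run a)))) b
          ≈⟨ ⊠-cong {φ i} (λ _ → refl) (⊠-cong {constant c} (λ _ → refl) (S.sym (run≋ a))) b ⟩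
        (φ i ⊠ (constant c ⊠ run a)) b
          ≈⟨ X⊠-suc (φ i ⊠ (constant c ⊠ run a)) b ⟨
        (X ⊠ (φ i ⊠ (constant c ⊠ run a))) (suc b)
          ≈⟨ X-shift (suc b) ⟨
        (φ i ⊠ (constant c ⊠ (X ⊠ run a))) (suc b) ∎

    hub-factor : hub ≋ substitute μ ⊠ K
    hub-factor = hubF≈ 0

    -- Together with `hub-factor` this is a linear equation for `K`, which the curve solves.
    K-series : K ≋ S.1# ⊞ constant c ⊠ X ⊠ hub
    K-series zero = sym (trans (+-congˡ (trans (⊠-assoc (constant c) X hub 0) (trans (⊠-constantˡ c (X ⊠ hub) 0) (trans (*-congˡ (X⊠-zero hub)) (zeroʳ c))))) (+-identityʳ 1#))
    K-series (suc b) = sym (trans (+-identityˡ _) (trans (⊠-assoc (constant c) X hub (suc b)) (trans (⊠-constantˡ c (X ⊠ hub) (suc b)) (*-congˡ (X⊠-suc hub b)))))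

    -- If the run at the cut has j vertices besides the given `i`, the first joined vertex can be
    -- met in j + 1 positions, all of equal weight. The factor `φ i ⊞ θ (φ i)` records this
    -- multiplicity.
    wheelF≈ : ∀ b i → wheelF i (suc b) ≈ c * ((φ i ⊞ θ (φ i)) ⊠ K) b
    wheelF≈ zero i = begin
      c * hubF i 0 + 0#               ≈⟨ trans (+-identityʳ _) (*-congˡ (hubF≈ i 0)) ⟩
      c * (φ i ⊠ K) 0                 ≈⟨ *-congˡ (trans (⊠-zero (φ i) K) (*-congʳ (sym (+-identityʳ _)))) ⟩
      c * ((φ i 0 + θ (φ i) 0) * K 0) ≈⟨ *-congˡ (⊠-zero (φ i ⊞ θ (φ i)) K) ⟨
      c * ((φ i ⊞ θ (φ i)) ⊠ K) 0     ∎
    wheelF≈ (suc b) i = begin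
      c * hubF i (suc b) + wheelF (suc i) (suc b)
        ≈⟨ +-cong (*-congˡ (hubF≈ i (suc b))) (wheelF≈ b (suc i)) ⟩
      c * (φ i ⊠ K) (suc b) + c * ((φ (suc i) ⊞ θ (φ (suc i))) ⊠ K) b
        ≈⟨ +-cong (*-congˡ (trans (⊠-suc (φ i) K b) (+-cong (*-congʳ (sym (+-identityʳ _))) (⊠-cong {g = K} shift-φ (λ _ → refl) b))))
             (*-congˡ (⊠-distribʳ K (φ (suc i)) (θ (φ (suc i))) b)) ⟩
      c * ((φ i 0 + θ (φ i) 0) * K (suc b) + (φ (suc i) ⊠ K) b) + c * ((φ (suc i) ⊠ K) b + (θ (φ (suc i)) ⊠ K) b)
        ≈⟨ solve 4 (λ c x y z → c :* (x :+ y) :+ c :* (y :+ z) := c :* (x :+ (y :+ (y :+ z)))) refl c _ _ _ ⟩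
      c * ((φ i 0 + θ (φ i) 0) * K (suc b) + ((φ (suc i) ⊠ K) b + ((φ (suc i) ⊠ K) b + (θ (φ (suc i)) ⊠ K) b)))
        ≈⟨ *-congˡ (+-congˡ (trans (⊠-distribʳ K (φ (suc i)) (φ (suc i) ⊞ θ (φ (suc i))) b) (+-congˡ (⊠-distribʳ K (φ (suc i)) (θ (φ (suc i))) b)))) ⟨
      c * ((φ i 0 + θ (φ i) 0) * K (suc b) + ((φ (suc i) ⊞ (φ (suc i) ⊞ θ (φ (suc i)))) ⊠ K) b)
        ≈⟨ *-congˡ (+-congˡ (⊠-cong {g = K} (λ j → +-cong (sym (shift-φ j)) (+-cong (sym (shift-φ j)) (×-congʳ j (sym (shift-φ j))))) (λ _ → refl) b)) ⟩
      c * ((φ i 0 + θ (φ i) 0) * K (suc b) + (shift (φ i ⊞ θ (φ i)) ⊠ K) b)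
        ≈⟨ *-congˡ (⊠-suc (φ i ⊞ θ (φ i)) K b) ⟨
      c * ((φ i ⊞ θ (φ i)) ⊠ K) (suc b) ∎
      where
      open import Algebra.Properties.Semiring.Mult semiring using (×-congʳ)
      shift-φ : shift (φ i) ≋ φ (suc i)
      shift-φ j = reflexive (≡.cong (substitute μ) (ℕ.+-suc i j))

open import Defs

-- The right-hand side without square root: Motzkin series and inverses.

module ClosedForm where

  open import Data.Integer.Base using (+_; 1ℤ)
  open import Data.Rational using (½)
  open import Data.List.Base using ([_])
  open import Data.List.Properties using (length-++)

  ℚ-ring : CommutativeRing 0ℓ 0ℓ
  ℚ-ring = ℚ.+-*-commutativeRing

  module Poly = PowerSeries ℚ-ring

  polyRing : CommutativeRing 0ℓ 0ℓ
  polyRing = Poly.ring′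

  open PowerSeries polyRing public hiding (reverse; raise; DegreeAtMost)

  seriesRing : CommutativeRing 0ℓ 0ℓ
  seriesRing = ring′

  module 𝕊 = CommutativeRing seriesRing
  module ℙ = CommutativeRing polyRing

  lookupD-++ˡ : {A : Set} (d : A) (xs ys : List A) (k : ℕ) → k ℕ.< length xs → lookupD d (xs ++ ys) k ≡ lookupD d xs k
  lookupD-++ˡ d (x ∷ xs) ys zero _ = ≡.refl
  lookupD-++ˡ d (x ∷ xs) ys (suc k) (s≤s k<) = lookupD-++ˡ d xs ys k k<

  lookupD-last : {A : Set} (d : A) (xs : List A) (y : A) → lookupD d (xs ++ [ y ]) (length xs) ≡ y
  lookupD-last d [] y = ≡.refl
  lookupD-last d (x ∷ xs) y = lookupD-last d xs y

  length-covPrefix : {A : Set} (d : A) (step : (n : ℕ) → (ℕ → A) → A) (n : ℕ) → length (covPrefix d step n) ≡ n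
  length-covPrefix d step zero = ≡.refl
  length-covPrefix d step (suc n) = ≡.trans (length-++ (covPrefix d step n)) (≡.trans (ℕ.+-comm _ 1) (≡.cong suc (length-covPrefix d step n)))

  -- Entries of the prefix list are never revised. So the recursions behind `invS`, `sqrtS` and
  -- `motzkin` may be read with the series itself in place of the list.
  lookupD-covPrefix : {A : Set} (d : A) (step : (n : ℕ) → (ℕ → A) → A) (n k : ℕ) → k ℕ.< n →
    lookupD d (covPrefix d step n) k ≡ cov d step k
  lookupD-covPrefix d step (suc n) k (s≤s k≤n) with ℕ.m≤n⇒m<n∨m≡n k≤n
  ... | inj₁ k<n = ≡.trans (lookupD-++ˡ d (covPrefix d step n) _ k (≡.subst (k ℕ.<_) (≡.sym (length-covPrefix d step n)) k<n))
                     (lookupD-covPrefix d step n k k<n)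
  ... | inj₂ ≡.refl = ≡.trans (≡.cong (lookupD d (covPrefix d step (suc n))) (≡.sym (length-covPrefix d step n)))
                     (lookupD-last d (covPrefix d step n) _)

  prefix-≈ : (step : (n : ℕ) → (ℕ → PolyQ) → PolyQ) (n i : ℕ) → i ℕ.≤ n →
    lookupD zeroᵠ (covPrefix zeroᵠ step (suc n)) i ℙ.≈ cov zeroᵠ step i
  prefix-≈ step n i i≤n k = ≡.cong (λ p → p k) (lookupD-covPrefix zeroᵠ step (suc n) i (s≤s i≤n))

  constᵠ-≈ : ∀ c → constᵠ c ℙ.≈ Poly.constant c
  constᵠ-≈ c zero = ≡.refl
  constᵠ-≈ c (suc k) = ≡.refl

  recipℚ-inverse : ∀ c → c ≢ 0ℚ → c ℚ.* recipℚ c ≡ 1ℚ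
  recipℚ-inverse c c≢0 with c ℚ.≟ 0ℚ
  ... | yes c≡0 = ⊥-elim (c≢0 c≡0)
  ... | no c≢0′ = ℚ.*-inverseʳ c {{ℚ.≢-nonZero c≢0′}}

  invS-suc : ∀ a n → invS a (suc n) ℙ.≈ scaleᵠ (ℚ.- recipℚ (a 0 0)) ((shift a ⊠ invS a) n)
  invS-suc a n k = ≡.cong (λ x → (ℚ.- recipℚ (a 0 0)) ℚ.* x) (⊠-cong-≤ n {shift a} (λ _ _ → ℙ.refl) (prefix-≈ _ n) k)

  -- In positive degree the recursion chooses the new coefficient as -1/c times the convolution of
  -- the earlier ones, which is what cancels that convolution.
  invS-inverse : ∀ a c → c ≢ 0ℚ → a 0 ℙ.≈ Poly.constant c → a ⊠ invS a ≋ 𝕊.1#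
  invS-inverse a c c≢0 a₀ zero k = ≡.trans (⊠-zero a (invS a) k)
    (≡.trans (Poly.⊠-cong a₀ (constᵠ-≈ (recipℚ (a 0 0))) k)
    (≡.trans (Poly.⊠-constantˡ c (Poly.constant (recipℚ (a 0 0))) k) (go k)))
    where
    go : ∀ k → c ℚ.* Poly.constant (recipℚ (a 0 0)) k ≡ Poly.constant 1ℚ k
    go zero = ≡.trans (≡.cong (λ x → c ℚ.* recipℚ x) (a₀ 0)) (recipℚ-inverse c c≢0)
    go (suc k) = ℚ.*-zeroʳ c
  invS-inverse a c c≢0 a₀ (suc n) k = begin
    (a ⊠ invS a) (suc n) k                                     ≡⟨ ⊠-suc a (invS a) n k ⟩
    (a 0 ℙ.* invS a (suc n)) k ℚ.+ S                           ≡⟨ ≡.cong (ℚ._+ S) (Poly.⊠-cong {g = invS a (suc n)} a₀ (λ _ → ≡.refl) k) ⟩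
    (Poly.constant c ℙ.* invS a (suc n)) k ℚ.+ S               ≡⟨ ≡.cong (ℚ._+ S) (Poly.⊠-constantˡ c (invS a (suc n)) k) ⟩
    c ℚ.* invS a (suc n) k ℚ.+ S                               ≡⟨ ≡.cong (λ x → c ℚ.* x ℚ.+ S) (invS-suc a n k) ⟩
    c ℚ.* ((ℚ.- recipℚ (a 0 0)) ℚ.* S) ℚ.+ S                   ≡⟨ solve 3 (λ c r s → c :* ((:- r) :* s) :+ s := (:1 :- c :* r) :* s) ≡.refl c (recipℚ (a 0 0)) S ⟩
    (1ℚ ℚ.- c ℚ.* recipℚ (a 0 0)) ℚ.* S                        ≡⟨ ≡.cong (λ x → (1ℚ ℚ.- x) ℚ.* S) (≡.trans (≡.cong (λ x → c ℚ.* recipℚ x) (a₀ 0)) (recipℚ-inverse c c≢0)) ⟩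
    (1ℚ ℚ.- 1ℚ) ℚ.* S                                          ≡⟨ ℚ.*-zeroˡ S ⟩
    0ℚ                                                         ∎
    where
    open ≡.≡-Reasoning
    open IntegerCoefficientSolver ℚ-ring
    S : ℚ
    S = (shift a ⊠ invS a) n k

  half+half : ∀ x → ½ ℚ.* x ℚ.+ ½ ℚ.* x ≡ x
  half+half x = ≡.trans (≡.sym (ℚ.*-distribʳ-+ x ½ ½)) (ℚ.*-identityˡ x)

  sqrtS-middle : Series → ℕ → PolyQ
  sqrtS-middle s n = sumᵠ (λ k → s (suc k) *ᵠ s (suc n ∸ suc k)) (upTo n)

  sqrtS-middle-cong : ∀ n {s s′} → (∀ i → i ℕ.≤ n → s i ℙ.≈ s′ i) → sqrtS-middle s n ℙ.≈ sqrtS-middle s′ n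
  sqrtS-middle-cong n {s} {s′} e = ℙ.trans (ℙ.reflexive (sumWith-applyUpTo n (λ k → s (suc k) *ᵠ s (suc n ∸ suc k)) id))
    (ℙ.trans (Σ<-cong n (λ i i<n → ℙ.*-cong (e (suc i) i<n) (e (n ∸ i) (ℕ.m∸n≤m n i))))
    (ℙ.sym (ℙ.reflexive (sumWith-applyUpTo n (λ k → s′ (suc k) *ᵠ s′ (suc n ∸ suc k)) id))))

  -- The newest coefficient occurs at both ends of the convolution; what lies between is what
  -- `sqrtS` subtracts before halving.
  sqrtS-middle-⊠ : ∀ s n → (s ⊠ s) (suc n) ℙ.≈ (s 0 ℙ.* s (suc n)) ℙ.+ (s (suc n) ℙ.* s 0) ℙ.+ sqrtS-middle s n
  sqrtS-middle-⊠ s zero = ℙ.trans (⊠-suc s s 0) (ℙ.trans (ℙ.+-congˡ {s 0 ℙ.* s 1} (⊠-zero (shift s) s)) (ℙ.sym (ℙ.+-identityʳ _)))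
  sqrtS-middle-⊠ s (suc m) = ℙ.trans (⊠-suc s s (suc m))
    (ℙ.trans (ℙ.+-congˡ {s 0 ℙ.* s (suc (suc m))} (⊠-sucʳ (shift s) s m))
    (ℙ.trans (ℙ.sym (ℙ.+-assoc (s 0 ℙ.* s (suc (suc m))) (s (suc (suc m)) ℙ.* s 0) _))
    (ℙ.+-congˡ {(s 0 ℙ.* s (suc (suc m))) ℙ.+ (s (suc (suc m)) ℙ.* s 0)} middle)))
    where
    middle : (shift s ⊠ shift s) m ℙ.≈ sqrtS-middle s (suc m)
    middle = ℙ.trans (ℙ.reflexive (⊠-Σ< (shift s) (shift s) m))
      (ℙ.trans (Σ<-cong (suc m) (λ i i≤m → ℙ.reflexive (≡.cong (λ j → s (suc i) ℙ.* s j) (≡.sym (ℕ.+-∸-assoc 1 (ℕ.≤-pred i≤m))))))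
      (ℙ.sym (ℙ.reflexive (sumWith-applyUpTo (suc m) (λ k → s (suc k) *ᵠ s (suc (suc m) ∸ suc k)) id))))

  sqrtS-square : ∀ f → f 0 ℙ.≈ ℙ.1# → sqrtS f ⊠ sqrtS f ≋ f
  sqrtS-square f f₀ zero = ℙ.trans (⊠-zero (sqrtS f) (sqrtS f)) (ℙ.trans (ℙ.*-cong (constᵠ-≈ 1ℚ) (constᵠ-≈ 1ℚ)) (ℙ.trans (ℙ.*-identityˡ ℙ.1#) (ℙ.sym f₀)))
  sqrtS-square f f₀ (suc n) k = begin
    (r ⊠ r) (suc n) k                                              ≡⟨ sqrtS-middle-⊠ r n k ⟩
    (r 0 ℙ.* r (suc n)) k ℚ.+ (r (suc n) ℙ.* r 0) k ℚ.+ m          ≡⟨ ≡.cong₂ (λ a b → a ℚ.+ b ℚ.+ m) (one-l k) (≡.trans (ℙ.*-comm (r (suc n)) (r 0) k) (one-l k)) ⟩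
    r (suc n) k ℚ.+ r (suc n) k ℚ.+ m                              ≡⟨ ≡.cong (λ x → x ℚ.+ x ℚ.+ m) unfold ⟩
    ½ ℚ.* y ℚ.+ ½ ℚ.* y ℚ.+ m                                      ≡⟨ ≡.cong (ℚ._+ m) (half+half y) ⟩
    f (suc n) k ℚ.+ (ℚ.- 1ℚ) ℚ.* m ℚ.+ m                           ≡⟨ solve 2 (λ a m → a :+ (:- :1) :* m :+ m := a) ≡.refl (f (suc n) k) m ⟩
    f (suc n) k                                                    ∎
    where
    open ≡.≡-Reasoning
    open IntegerCoefficientSolver ℚ-ring
    r : Series
    r = sqrtS f
    m y : ℚ
    m = sqrtS-middle r n k
    y = f (suc n) k ℚ.+ (ℚ.- 1ℚ) ℚ.* m
    one-l : r 0 ℙ.* r (suc n) ℙ.≈ r (suc n)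
    one-l = ℙ.trans (ℙ.*-congʳ {r (suc n)} (constᵠ-≈ 1ℚ)) (ℙ.*-identityˡ (r (suc n)))
    unfold : r (suc n) k ≡ ½ ℚ.* y
    unfold = ≡.cong (λ x → ½ ℚ.* (f (suc n) k ℚ.+ (ℚ.- 1ℚ) ℚ.* x)) (sqrtS-middle-cong n (prefix-≈ _ n) k)

  open IntegerCoefficientSolver seriesRing
  open WheelAlgebra seriesRing using (2#; :2; inverse-unique)

  T : Series
  T = constant Poly.X

  -- The recursion of M = 1 + uM + tu²M², whose coefficients count Motzkin paths by length and
  -- number of up steps.
  motzkin-step : (n : ℕ) → Series → PolyQ
  motzkin-step zero s = ℙ.1#
  motzkin-step (suc n) s = (s ⊞ T ⊠ (X ⊠ (s ⊠ s))) n

  motzkin : Series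
  motzkin = cov zeroᵠ motzkin-step

  motzkin-equation : motzkin ≋ 𝕊.1# ⊞ X ⊠ (motzkin ⊞ T ⊠ (X ⊠ (motzkin ⊠ motzkin)))
  motzkin-equation zero = ℙ.sym (ℙ.trans (ℙ.+-congˡ {ℙ.1#} (X⊠-zero (motzkin ⊞ T ⊠ (X ⊠ (motzkin ⊠ motzkin))))) (ℙ.+-identityʳ ℙ.1#))
  motzkin-equation (suc n) = ℙ.trans
    (ℙ.+-cong (prefix-≈ motzkin-step n n ℕ.≤-refl) (⊠-cong-≤ n {T} (λ _ _ → ℙ.refl) (λ i i≤n → ⊠-cong-≤ i {X} (λ _ _ → ℙ.refl)
       (λ j j≤i → ⊠-cong-≤ j (λ l l≤j → prefix-≈ motzkin-step n l (ℕ.≤-trans l≤j (ℕ.≤-trans j≤i i≤n))) (λ l l≤j → prefix-≈ motzkin-step n l (ℕ.≤-trans l≤j (ℕ.≤-trans j≤i i≤n)))))))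
    (ℙ.sym (ℙ.trans (ℙ.+-identityˡ _) (X⊠-suc (motzkin ⊞ T ⊠ (X ⊠ (motzkin ⊠ motzkin))) n)))

  N : Series
  N = X ⊠ motzkin

  motzkin-N : motzkin ≋ 𝕊.1# ⊞ N ⊞ T ⊠ N ⊠ N
  motzkin-N = 𝕊.trans motzkin-equation (solve 3 (λ x t m → :1 :+ x :* (m :+ t :* (x :* (m :* m))) := :1 :+ x :* m :+ t :* (x :* m) :* (x :* m)) 𝕊.refl X T motzkin)

  N-equation : N ≋ X ⊠ (𝕊.1# ⊞ N ⊞ T ⊠ N ⊠ N)
  N-equation = 𝕊.*-congˡ {X} motzkin-N

  tXN : Series
  tXN = T ⊠ (X ⊠ N)

  motzkin-inverse : (𝕊.1# ⊟ X ⊟ tXN) ⊠ motzkin ≋ 𝕊.1#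
  motzkin-inverse = 𝕊.trans (solve 3 (λ x t m → (:1 :- x :- t :* (x :* (x :* m))) :* m := m :- x :* (m :+ t :* (x :* (m :* m)))) 𝕊.refl X T motzkin)
    (𝕊.trans (𝕊.+-congʳ motzkin-equation) (solve 1 (λ a → :1 :+ a :- a := :1) 𝕊.refl (X ⊠ (motzkin ⊞ T ⊠ (X ⊠ (motzkin ⊠ motzkin))))))

  uS≋X : uS ≋ X
  uS≋X zero k = ≡.refl
  uS≋X (suc zero) k = constᵠ-≈ 1ℚ k
  uS≋X (suc (suc n)) k = ≡.refl

  tS≋T : tS ≋ T
  tS≋T zero zero = ≡.refl
  tS≋T zero (suc zero) = ≡.refl
  tS≋T zero (suc (suc k)) = ≡.refl
  tS≋T (suc n) k = ≡.refl

  numS-1 : numS 1ℤ ≋ 𝕊.1#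
  numS-1 zero k = constᵠ-≈ 1ℚ k
  numS-1 (suc n) k = ≡.refl

  numS-2 : numS (+ 2) ≋ 2#
  numS-2 zero zero = ≡.refl
  numS-2 zero (suc k) = ≡.refl
  numS-2 (suc n) k = ≡.refl

  numS-4 : numS (+ 4) ≋ 2# ⊞ 2#
  numS-4 zero zero = ≡.refl
  numS-4 zero (suc k) = ≡.refl
  numS-4 (suc n) k = ≡.refl

  ⊖≋⊟ : ∀ {a a′ b b′} → a ≋ a′ → b ≋ b′ → a ⊖ b ≋ a′ ⊟ b′
  ⊖≋⊟ {b = b} e e′ n k = ≡.cong₂ ℚ._+_ (e n k) (≡.trans (≡.sym (ℚ.neg-distribˡ-* 1ℚ (b n k))) (≡.cong ℚ.-_ (≡.trans (ℚ.*-identityˡ (b n k)) (e′ n k))))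

  -- Solving M = 1 + uM + tu²M² for M shows that 1 - u - 2tu²M is a square root of (1-u)² - 4tu².
  root-closed : Series
  root-closed = 𝕊.1# ⊟ X ⊟ 2# ⊠ tXN

  radicand≋ : ((uS ⊖ numS 1ℤ) ⊗ (uS ⊖ numS 1ℤ)) ⊖ (numS (+ 4) ⊗ tS ⊗ uS ⊗ uS) ≋ (X ⊟ 𝕊.1#) ⊠ (X ⊟ 𝕊.1#) ⊟ (2# ⊞ 2#) ⊠ T ⊠ X ⊠ X
  radicand≋ = ⊖≋⊟ (⊠-cong (⊖≋⊟ uS≋X numS-1) (⊖≋⊟ uS≋X numS-1)) (⊠-cong (⊠-cong (⊠-cong numS-4 tS≋T) uS≋X) uS≋X)

  root-square : root ⊠ root ≋ root-closed ⊠ root-closed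
  root-square = 𝕊.trans (sqrtS-square _ f₀) (𝕊.trans radicand≋ (𝕊.sym closed-square))
    where
    f₀ : (((uS ⊖ numS 1ℤ) ⊗ (uS ⊖ numS 1ℤ)) ⊖ (numS (+ 4) ⊗ tS ⊗ uS ⊗ uS)) 0 ℙ.≈ ℙ.1#
    f₀ = ℙ.trans (radicand≋ 0) (ℙ.trans (solve 3 (λ x t u → (x :- :1) :* (x :- :1) :- (:2 :+ :2) :* t :* x :* x := :1 :+ x :* (x :- :2 :- (:2 :+ :2) :* t :* x)) 𝕊.refl X T X 0)
       (ℙ.trans (ℙ.+-congˡ {ℙ.1#} (X⊠-zero (X ⊟ 2# ⊟ (2# ⊞ 2#) ⊠ T ⊠ X))) (ℙ.+-identityʳ _)))
    closed-square : root-closed ⊠ root-closed ≋ (X ⊟ 𝕊.1#) ⊠ (X ⊟ 𝕊.1#) ⊟ (2# ⊞ 2#) ⊠ T ⊠ X ⊠ X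
    closed-square = 𝕊.trans (solve 3 (λ x t n → (:1 :- x :- :2 :* (t :* (x :* n))) :* (:1 :- x :- :2 :* (t :* (x :* n)))
       := (x :- :1) :* (x :- :1) :+ (:2 :+ :2) :* t :* x :* (x :* (:1 :+ n :+ t :* n :* n) :- n :- x)) 𝕊.refl X T N)
      (𝕊.trans (𝕊.+-congˡ {(X ⊟ 𝕊.1#) ⊠ (X ⊟ 𝕊.1#)} (𝕊.*-congˡ {(2# ⊞ 2#) ⊠ T ⊠ X} (𝕊.+-congʳ (𝕊.+-congʳ (𝕊.sym N-equation)))))
      (solve 3 (λ x t n → (x :- :1) :* (x :- :1) :+ (:2 :+ :2) :* t :* x :* (n :- n :- x) := (x :- :1) :* (x :- :1) :- (:2 :+ :2) :* t :* x :* x) 𝕊.refl X T N))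

  -- Two square roots of one series, both with constant term 1: their difference times their sum is
  -- zero, and the sum is a unit.
  root≋ : root ≋ root-closed
  root≋ n k = ≡.trans (solve 2 (λ a b → a := (a :- b) :+ b) 𝕊.refl root root-closed n k)
    (≡.trans (≡.cong (ℚ._+ root-closed n k) (unit-cancel d (root ⊟ root-closed) d₀ vanish n k)) (ℚ.+-identityˡ _))
    where
    ½S d : Series
    ½S = constant (Poly.constant ½)
    -- Halving gives the sum the constant term 1 that `unit-cancel` asks for.
    d = ½S ⊠ (root ⊞ root-closed)
    closed₀ : root-closed 0 ℙ.≈ ℙ.1#
    closed₀ = ℙ.trans (solve 3 (λ x t n → :1 :- x :- :2 :* (t :* (x :* n)) := :1 :+ x :* (:- :1 :- :2 :* (t :* n))) 𝕊.refl X T N 0)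
      (ℙ.trans (ℙ.+-congˡ {ℙ.1#} (X⊠-zero (neg 𝕊.1# ⊟ 2# ⊠ (T ⊠ N)))) (ℙ.+-identityʳ _))
    d₀ : d 0 ℙ.≈ ℙ.1#
    d₀ = ℙ.trans (⊠-zero ½S (root ⊞ root-closed)) (ℙ.trans (ℙ.*-congˡ {Poly.constant ½} (ℙ.+-cong (constᵠ-≈ 1ℚ) closed₀))
      (ℙ.trans (Poly.⊠-constantˡ ½ (ℙ.1# ℙ.+ ℙ.1#)) (λ { zero → ≡.refl ; (suc k) → ≡.refl })))
    vanish : ∀ n → (d ⊠ (root ⊟ root-closed)) n ℙ.≈ ℙ.0#
    vanish = 𝕊.trans (solve 3 (λ h a b → h :* (a :+ b) :* (a :- b) := h :* (a :* a :- b :* b)) 𝕊.refl ½S root root-closed)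
      (𝕊.trans (𝕊.*-congˡ {½S} (𝕊.trans (𝕊.+-congʳ root-square) (𝕊.-‿inverseʳ (root-closed ⊠ root-closed)))) (𝕊.zeroʳ ½S))

  -- The first two denominators of the closed form contain a factor 2. It is absorbed, so that 2
  -- `i₁` is `motzkin` and `J` inverts (1+u)(1 - tu²M).
  i₁ i₂ i₃ J I : Series
  i₁ = invS ((root ⊖ uS) ⊕ numS 1ℤ)
  i₂ = invS ((uS ⊕ numS 1ℤ) ⊗ ((root ⊕ uS) ⊕ numS 1ℤ))
  i₃ = invS ((uS ⊕ numS 1ℤ) ⊗ root)
  J = 2# ⊠ i₂
  I = i₃

  den₁≋ : (root ⊖ uS) ⊕ numS 1ℤ ≋ 2# ⊠ (𝕊.1# ⊟ X ⊟ tXN)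
  den₁≋ = 𝕊.trans (𝕊.+-cong (⊖≋⊟ root≋ uS≋X) numS-1) (solve 2 (λ x z → :1 :- x :- :2 :* z :- x :+ :1 := :2 :* (:1 :- x :- z)) 𝕊.refl X tXN)

  den₂≋ : (uS ⊕ numS 1ℤ) ⊗ ((root ⊕ uS) ⊕ numS 1ℤ) ≋ 2# ⊠ ((𝕊.1# ⊞ X) ⊠ (𝕊.1# ⊟ tXN))
  den₂≋ = 𝕊.trans (𝕊.*-cong (𝕊.+-cong uS≋X numS-1) (𝕊.+-cong (𝕊.+-cong root≋ uS≋X) numS-1))
    (solve 2 (λ x z → (x :+ :1) :* (:1 :- x :- :2 :* z :+ x :+ :1) := :2 :* ((:1 :+ x) :* (:1 :- z))) 𝕊.refl X tXN)

  den₃≋ : (uS ⊕ numS 1ℤ) ⊗ root ≋ (𝕊.1# ⊞ X) ⊠ (𝕊.1# ⊟ X ⊟ 2# ⊠ tXN)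
  den₃≋ = 𝕊.*-cong (𝕊.trans (𝕊.+-cong uS≋X numS-1) (𝕊.+-comm X 𝕊.1#)) root≋

  constant-term : ∀ c g → (c ⊞ X ⊠ g) 0 ℙ.≈ c 0
  constant-term c g = ℙ.trans (ℙ.+-congˡ {c 0} (X⊠-zero g)) (ℙ.+-identityʳ _)

  2#-zero : 2# 0 ℙ.≈ Poly.constant (1ℚ ℚ.+ 1ℚ)
  2#-zero zero = ≡.refl
  2#-zero (suc k) = ≡.refl

  i₁-inverse : 2# ⊠ (𝕊.1# ⊟ X ⊟ tXN) ⊠ i₁ ≋ 𝕊.1#
  i₁-inverse = 𝕊.trans (𝕊.*-congʳ {i₁} (𝕊.sym den₁≋)) (invS-inverse ((root ⊖ uS) ⊕ numS 1ℤ) (1ℚ ℚ.+ 1ℚ) (λ ())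
    (ℙ.trans (den₁≋ 0) (ℙ.trans (solve 3 (λ x t n → :2 :* (:1 :- x :- t :* (x :* n)) := :2 :+ x :* (:2 :* (:- :1 :- t :* n))) 𝕊.refl X T N 0)
      (ℙ.trans (constant-term 2# (2# ⊠ (neg 𝕊.1# ⊟ T ⊠ N))) 2#-zero))))

  i₂-inverse : 2# ⊠ ((𝕊.1# ⊞ X) ⊠ (𝕊.1# ⊟ tXN)) ⊠ i₂ ≋ 𝕊.1#
  i₂-inverse = 𝕊.trans (𝕊.*-congʳ {i₂} (𝕊.sym den₂≋)) (invS-inverse ((uS ⊕ numS 1ℤ) ⊗ ((root ⊕ uS) ⊕ numS 1ℤ)) (1ℚ ℚ.+ 1ℚ) (λ ())
    (ℙ.trans (den₂≋ 0) (ℙ.trans (solve 3 (λ x t n → :2 :* ((:1 :+ x) :* (:1 :- t :* (x :* n))) := :2 :+ x :* (:2 :* (:1 :- t :* n :- x :* (t :* n)))) 𝕊.refl X T N 0)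
      (ℙ.trans (constant-term 2# (2# ⊠ (𝕊.1# ⊟ T ⊠ N ⊟ X ⊠ (T ⊠ N)))) 2#-zero))))

  I-inverse : (𝕊.1# ⊞ X) ⊠ (𝕊.1# ⊟ X ⊟ 2# ⊠ tXN) ⊠ I ≋ 𝕊.1#
  I-inverse = 𝕊.trans (𝕊.*-congʳ {I} (𝕊.sym den₃≋)) (invS-inverse ((uS ⊕ numS 1ℤ) ⊗ root) 1ℚ (λ ())
    (ℙ.trans (den₃≋ 0) (ℙ.trans (solve 3 (λ x t n → (:1 :+ x) :* (:1 :- x :- :2 :* (t :* (x :* n))) := :1 :+ x :* (:- x :- :2 :* (t :* n) :- :2 :* (x :* (t :* n)))) 𝕊.refl X T N 0)
      (constant-term 𝕊.1# (neg X ⊟ 2# ⊠ (T ⊠ N) ⊟ 2# ⊠ (X ⊠ (T ⊠ N)))))))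

  J-inverse : (𝕊.1# ⊞ X) ⊠ (𝕊.1# ⊟ tXN) ⊠ J ≋ 𝕊.1#
  J-inverse = 𝕊.trans (solve 3 (λ x z i → (:1 :+ x) :* (:1 :- z) :* (:2 :* i) := :2 :* ((:1 :+ x) :* (:1 :- z)) :* i) 𝕊.refl X tXN i₂) i₂-inverse

  -- From here on the square root is gone; what is left of it are `motzkin` and inverses of
  -- polynomials in u, t and `motzkin`.
  rhs≋ : rhs ≋ (X ⊟ 𝕊.1#) ⊠ motzkin ⊟ (X ⊠ X ⊞ X ⊟ 𝕊.1#) ⊠ J ⊞ 2# ⊠ X ⊠ I
  rhs≋ = 𝕊.+-cong (⊖≋⊟ (𝕊.trans (𝕊.*-congʳ {i₁} (𝕊.*-cong numS-2 (⊖≋⊟ uS≋X numS-1)))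
                          (𝕊.trans (solve 2 (λ x i → :2 :* (x :- :1) :* i := (x :- :1) :* (:2 :* i)) 𝕊.refl X i₁) (𝕊.*-congˡ {X ⊟ 𝕊.1#} 2i₁)))
                       (𝕊.trans (𝕊.*-congʳ {i₂} (𝕊.*-cong numS-2 (⊖≋⊟ (𝕊.+-cong (𝕊.*-cong uS≋X uS≋X) uS≋X) numS-1)))
                          (solve 2 (λ x i → :2 :* (x :* x :+ x :- :1) :* i := (x :* x :+ x :- :1) :* (:2 :* i)) 𝕊.refl X i₂)))
                   (𝕊.*-congʳ {i₃} (𝕊.*-cong numS-2 uS≋X))
    where
    2i₁ : 2# ⊠ i₁ ≋ motzkin
    2i₁ = inverse-unique {𝕊.1# ⊟ X ⊟ tXN} (𝕊.trans (solve 2 (λ a i → a :* (:2 :* i) := :2 :* a :* i) 𝕊.refl (𝕊.1# ⊟ X ⊟ tXN) i₁) i₁-inverse) motzkin-inverse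

-- Degree bounds for the coefficients of the closed form.

module Support where

  open ClosedForm

  open IntegerCoefficientSolver seriesRing
  open WheelAlgebra seriesRing using (2#; :2)

  -- SupportedUpTo s n f: up to degree n in u, f only has monomials u^i t^k with 2k ≤ i + s.
  SupportedUpTo : ℕ → ℕ → Series → Set
  SupportedUpTo s n f = ∀ i → i ℕ.≤ n → ∀ k → i ℕ.+ s ℕ.< 2 ℕ.* k → f i k ≡ 0ℚ

  -- Giving u weight 1 and t weight -2 makes the bound additive under multiplication, so that
  -- supported series form a ring; t alone does not belong to it.
  Supported : Series → Set
  Supported f = ∀ n k → n ℕ.< 2 ℕ.* k → f n k ≡ 0ℚ

  Supported⇒UpTo : ∀ {f} n → Supported f → SupportedUpTo 0 n f
  Supported⇒UpTo n S i _ k lt = S i k (≡.subst (ℕ._< 2 ℕ.* k) (ℕ.+-identityʳ i) lt)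

  Σ<-vanish : ∀ n (f : ℕ → ℚ) → (∀ i → i ℕ.< n → f i ≡ 0ℚ) → Poly.Σ< n f ≡ 0ℚ
  Σ<-vanish zero f e = ≡.refl
  Σ<-vanish (suc n) f e = ≡.trans (≡.cong₂ ℚ._+_ (e 0 (s≤s z≤n)) (Σ<-vanish n (f ∘ suc) (λ i i<n → e (suc i) (s≤s i<n)))) (ℚ.+-identityʳ 0ℚ)

  Σ<-at : ∀ n (f : Series) k → Σ< n f k ≡ Poly.Σ< n (λ i → f i k)
  Σ<-at zero f k = ≡.refl
  Σ<-at (suc n) f k = ≡.cong (f 0 k ℚ.+_) (Σ<-at n (shift f) k)

  private
    half-split : ∀ {i n j k s s′} → i ℕ.≤ n → j ℕ.≤ k → n ℕ.+ (s ℕ.+ s′) ℕ.< 2 ℕ.* k → 2 ℕ.* j ℕ.≤ i ℕ.+ s → (n ∸ i) ℕ.+ s′ ℕ.< 2 ℕ.* (k ∸ j)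
    half-split {i} {n} {j} {k} {s} {s′} i≤n j≤k lt le = ℕ.+-cancelˡ-< (2 ℕ.* j) _ _ (begin-strict
      2 ℕ.* j ℕ.+ ((n ∸ i) ℕ.+ s′)       ≤⟨ ℕ.+-monoˡ-≤ _ le ⟩
      i ℕ.+ s ℕ.+ ((n ∸ i) ℕ.+ s′)       ≡⟨ rearrange i s (n ∸ i) s′ ⟩
      (i ℕ.+ (n ∸ i)) ℕ.+ (s ℕ.+ s′)     ≡⟨ ≡.cong (ℕ._+ (s ℕ.+ s′)) (ℕ.m+[n∸m]≡n i≤n) ⟩
      n ℕ.+ (s ℕ.+ s′)                   <⟨ lt ⟩
      2 ℕ.* k                            ≡⟨ ≡.cong (2 ℕ.*_) (ℕ.m+[n∸m]≡n j≤k) ⟨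
      2 ℕ.* (j ℕ.+ (k ∸ j))              ≡⟨ ℕ.*-distribˡ-+ 2 j (k ∸ j) ⟩
      2 ℕ.* j ℕ.+ 2 ℕ.* (k ∸ j)          ∎)
      where
      open ℕ.≤-Reasoning
      rearrange : ∀ a b c d → a ℕ.+ b ℕ.+ (c ℕ.+ d) ≡ (a ℕ.+ c) ℕ.+ (b ℕ.+ d)
      rearrange a b c d = +solve 4 (λ a b c d → a ⊹ b ⊹ (c ⊹ d) ⩴ (a ⊹ c) ⊹ (b ⊹ d)) ≡.refl a b c d
        where open import Data.Nat.Solver using (module +-*-Solver)
              open +-*-Solver using () renaming (solve to +solve; _:+_ to infixl 6 _⊹_; _:=_ to infix 4 _⩴_)

  ⊠-supported : ∀ s s′ n f g → SupportedUpTo s n f → SupportedUpTo s′ n g → ∀ k → n ℕ.+ (s ℕ.+ s′) ℕ.< 2 ℕ.* k → (f ⊠ g) n k ≡ 0ℚ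
  ⊠-supported s s′ n f g Sf Sg k lt = ≡.trans (≡.cong (λ p → p k) (⊠-Σ< f g n)) (≡.trans (Σ<-at (suc n) (λ i → f i ℙ.* g (n ∸ i)) k)
    (Σ<-vanish (suc n) _ λ { i (s≤s i≤n) → ≡.trans (Poly.⊠-Σ< (f i) (g (n ∸ i)) k) (Σ<-vanish (suc k) _ λ { j (s≤s j≤k) → term i i≤n j j≤k }) }))
    where
    term : ∀ i → i ℕ.≤ n → ∀ j → j ℕ.≤ k → f i j ℚ.* g (n ∸ i) (k ∸ j) ≡ 0ℚ
    -- Since the two bounds add up to the total, one of the factors must exceed its own.
    term i i≤n j j≤k with i ℕ.+ s ℕ.<? 2 ℕ.* j
    ... | yes p = ≡.trans (≡.cong (ℚ._* g (n ∸ i) (k ∸ j)) (Sf i i≤n j p)) (ℚ.*-zeroˡ (g (n ∸ i) (k ∸ j)))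
    ... | no ¬p = ≡.trans (≡.cong (f i j ℚ.*_) (Sg (n ∸ i) (ℕ.m∸n≤m n i) (k ∸ j) (half-split i≤n j≤k lt (ℕ.≮⇒≥ ¬p)))) (ℚ.*-zeroʳ (f i j))

  supported-⊠ : ∀ {f g} → Supported f → Supported g → Supported (f ⊠ g)
  supported-⊠ {f} {g} Sf Sg n k lt = ⊠-supported 0 0 n f g (Supported⇒UpTo n Sf) (Supported⇒UpTo n Sg) k (≡.subst (ℕ._< 2 ℕ.* k) (≡.sym (ℕ.+-identityʳ n)) lt)

  supported-⊞ : ∀ {f g} → Supported f → Supported g → Supported (f ⊞ g)
  supported-⊞ Sf Sg n k lt = ≡.trans (≡.cong₂ ℚ._+_ (Sf n k lt) (Sg n k lt)) (ℚ.+-identityʳ 0ℚ)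

  supported-neg : ∀ {f} → Supported f → Supported (neg f)
  supported-neg Sf n k lt = ≡.cong ℚ.-_ (Sf n k lt)

  supported-1 : Supported 𝕊.1#
  supported-1 zero (suc k) lt = ≡.refl
  supported-1 (suc n) k lt = ≡.refl

  supported-≋ : ∀ {f g} → f ≋ g → Supported f → Supported g
  supported-≋ e Sf n k lt = ≡.trans (≡.sym (e n k)) (Sf n k lt)

  supported-2 : Supported 2#
  supported-2 = supported-⊞ supported-1 supported-1

  -- A further factor u gains one degree and so yields the strict inequality demanded of
  -- Kazhdan-Lusztig polynomials.
  X⊠-strict : ∀ {f} → Supported f → ∀ n k → n ℕ.≤ 2 ℕ.* k → (X ⊠ f) n k ≡ 0ℚ
  X⊠-strict {f} Sf zero k _ = X⊠-zero f k
  X⊠-strict {f} Sf (suc n) k lt = ≡.trans (X⊠-suc f n k) (Sf n k lt)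

  supported-X⊠ : ∀ {f} → Supported f → Supported (X ⊠ f)
  supported-X⊠ Sf n k lt = X⊠-strict Sf n k (ℕ.<⇒≤ lt)

  supported-X : Supported X
  supported-X = supported-≋ (𝕊.*-identityʳ X) (supported-X⊠ supported-1)

  T⊠X⊠-zero : ∀ f n → (T ⊠ (X ⊠ f)) n 0 ≡ 0ℚ
  T⊠X⊠-zero f n = ≡.trans (⊠-constantˡ Poly.X (X ⊠ f) n 0) (Poly.X⊠-zero ((X ⊠ f) n))

  T⊠X⊠-suc : ∀ f n k → (T ⊠ (X ⊠ f)) (suc n) (suc k) ≡ f n k
  T⊠X⊠-suc f n k = ≡.trans (⊠-constantˡ Poly.X (X ⊠ f) (suc n) (suc k)) (≡.trans (Poly.X⊠-suc ((X ⊠ f) (suc n)) k) (X⊠-suc f n k))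

  T⊠X⊠-0 : ∀ f k → (T ⊠ (X ⊠ f)) 0 k ≡ 0ℚ
  T⊠X⊠-0 f zero = T⊠X⊠-zero f 0
  T⊠X⊠-0 f (suc k) = ≡.trans (⊠-constantˡ Poly.X (X ⊠ f) 0 (suc k)) (≡.trans (Poly.X⊠-suc ((X ⊠ f) 0) k) (X⊠-zero f k))

  private
    drop2 : ∀ {n k} → suc (suc n) ℕ.< 2 ℕ.* suc k → n ℕ.< 2 ℕ.* k
    drop2 {n} {k} lt = ℕ.≤-pred (ℕ.≤-pred (≡.subst (suc (suc (suc n)) ℕ.≤_) (≡.trans (≡.cong suc (ℕ.+-suc k (k ℕ.+ 0))) ≡.refl) lt))

  supported-motzkin : Supported motzkin
  supported-motzkin n = below n n ℕ.≤-refl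
    where
    below : ∀ n i → i ℕ.≤ n → ∀ k → i ℕ.< 2 ℕ.* k → motzkin i k ≡ 0ℚ
    below n zero _ (suc k) lt = ≡.refl
    below (suc n) (suc i) (s≤s i≤n) k lt = ≡.trans (motzkin-equation (suc i) k)
      (≡.trans (ℚ.+-identityˡ _) (≡.trans (X⊠-suc (motzkin ⊞ T ⊠ (X ⊠ (motzkin ⊠ motzkin))) i k)
      (≡.trans (≡.cong₂ ℚ._+_ (below n i i≤n k (ℕ.<-trans (ℕ.n<1+n i) lt)) (second i i≤n k lt)) (ℚ.+-identityʳ 0ℚ))))
      where
      second : ∀ i → i ℕ.≤ n → ∀ k → suc i ℕ.< 2 ℕ.* k → (T ⊠ (X ⊠ (motzkin ⊠ motzkin))) i k ≡ 0ℚ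
      second zero _ k _ = T⊠X⊠-0 (motzkin ⊠ motzkin) k
      second (suc i) i<n zero _ = T⊠X⊠-zero (motzkin ⊠ motzkin) (suc i)
      second (suc i) i<n (suc k) lt = ≡.trans (T⊠X⊠-suc (motzkin ⊠ motzkin) i k)
        (⊠-supported 0 0 i motzkin motzkin up up k (≡.subst (ℕ._< 2 ℕ.* k) (≡.sym (ℕ.+-identityʳ i)) (drop2 lt)))
        where
        up : SupportedUpTo 0 i motzkin
        up j j≤i l lt′ = below n j (ℕ.≤-trans j≤i (ℕ.≤-trans (ℕ.n≤1+n i) i<n)) l (≡.subst (ℕ._< 2 ℕ.* l) (ℕ.+-identityʳ j) lt′)

  supported-N : Supported N
  supported-N = supported-X⊠ supported-motzkin

  -- The factor t costs two degrees in u. One is supplied by the visible `X`, the other by the `X`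
  -- inside `N`.
  supported-tXN : Supported tXN
  supported-tXN zero k lt = T⊠X⊠-0 N k
  supported-tXN (suc n) zero lt = T⊠X⊠-zero N (suc n)
  supported-tXN (suc n) (suc k) lt = ≡.trans (T⊠X⊠-suc N n k) (X⊠-strict supported-motzkin n k
    (ℕ.≤-pred (ℕ.≤-pred (≡.subst (suc (suc n) ℕ.≤_) (≡.cong suc (ℕ.+-suc k (k ℕ.+ 0))) lt))))

  -- Each coefficient of `b` is minus a convolution of `shift a` with earlier coefficients. The
  -- shift loses one degree, hence the slack 1 for that factor.
  supported-inverse : ∀ a b → a 0 ℙ.≈ ℙ.1# → a ⊠ b ≋ 𝕊.1# → Supported a → Supported b
  supported-inverse a b a₀ ab Sa n = below n n ℕ.≤-refl
    where
    a₀b : ∀ i k → (a 0 ℙ.* b i) k ≡ b i k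
    a₀b i k = ≡.trans (ℙ.*-congʳ {b i} a₀ k) (ℙ.*-identityˡ (b i) k)
    below : ∀ n i → i ℕ.≤ n → ∀ k → i ℕ.< 2 ℕ.* k → b i k ≡ 0ℚ
    below n zero _ (suc k) lt = ≡.trans (≡.sym (a₀b 0 (suc k))) (≡.trans (≡.sym (⊠-zero a b (suc k))) (ab 0 (suc k)))
    below (suc n) (suc i) (s≤s i≤n) k lt = begin
      b (suc i) k                                            ≡⟨ a₀b (suc i) k ⟨
      (a 0 ℙ.* b (suc i)) k                                  ≡⟨ ℚ.+-identityʳ _ ⟨
      (a 0 ℙ.* b (suc i)) k ℚ.+ 0ℚ                           ≡⟨ ≡.cong ((a 0 ℙ.* b (suc i)) k ℚ.+_) rest ⟨
      (a 0 ℙ.* b (suc i)) k ℚ.+ (shift a ⊠ b) i k            ≡⟨ ⊠-suc a b i k ⟨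
      (a ⊠ b) (suc i) k                                      ≡⟨ ab (suc i) k ⟩
      0ℚ                                                     ∎
      where
      open ≡.≡-Reasoning
      rest : (shift a ⊠ b) i k ≡ 0ℚ
      rest = ⊠-supported 1 0 i (shift a) b (λ j _ l lt′ → Sa (suc j) l (≡.subst (ℕ._< 2 ℕ.* l) (ℕ.+-comm j 1) lt′))
        (λ j j≤i l lt′ → below n j (ℕ.≤-trans j≤i i≤n) l (≡.subst (ℕ._< 2 ℕ.* l) (ℕ.+-identityʳ j) lt′)) k (≡.subst (ℕ._< 2 ℕ.* k) (ℕ.+-comm 1 i) lt)

  supported-J : Supported J
  supported-J = supported-inverse ((𝕊.1# ⊞ X) ⊠ (𝕊.1# ⊟ tXN)) J
    (ℙ.trans (solve 3 (λ x t n → (:1 :+ x) :* (:1 :- t :* (x :* n)) := :1 :+ x :* (:1 :- t :* n :- x :* (t :* n))) 𝕊.refl X T N 0) (constant-term 𝕊.1# (𝕊.1# ⊟ T ⊠ N ⊟ X ⊠ (T ⊠ N))))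
    J-inverse (supported-⊠ (supported-⊞ supported-1 supported-X) (supported-⊞ supported-1 (supported-neg supported-tXN)))

  supported-I : Supported I
  supported-I = supported-inverse ((𝕊.1# ⊞ X) ⊠ (𝕊.1# ⊟ X ⊟ 2# ⊠ tXN)) I
    (ℙ.trans (solve 3 (λ x t n → (:1 :+ x) :* (:1 :- x :- :2 :* (t :* (x :* n))) := :1 :+ x :* (:- x :- :2 :* (t :* n) :- :2 :* (x :* (t :* n)))) 𝕊.refl X T N 0)
      (constant-term 𝕊.1# (neg X ⊟ 2# ⊠ (T ⊠ N) ⊟ 2# ⊠ (X ⊠ (T ⊠ N)))))
    I-inverse (supported-⊠ (supported-⊞ supported-1 supported-X) (supported-⊞ (supported-⊞ supported-1 (supported-neg supported-X)) (supported-neg (supported-⊠ supported-2 supported-tXN))))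

  -- The leading parts (2k = n) of the first two summands cancel because J - motzkin is divisible by u.
  rhs-degree : ∀ n k → n ℕ.≤ 2 ℕ.* k → rhs n k ≡ 0ℚ
  rhs-degree n k le = ≡.trans (≡.trans (rhs≋ n k) (factor n k)) (X⊠-strict supported-cofactor n k le)
    where
    cofactor : Series
    cofactor = motzkin ⊟ (X ⊞ 𝕊.1#) ⊠ J ⊞ 2# ⊠ I ⊟ (J ⊠ motzkin) ⊠ (2# ⊟ tXN)
    supported-cofactor : Supported cofactor
    supported-cofactor = supported-⊞ (supported-⊞ (supported-⊞ supported-motzkin
      (supported-neg (supported-⊠ (supported-⊞ supported-X supported-1) supported-J))) (supported-⊠ supported-2 supported-I))
      (supported-neg (supported-⊠ (supported-⊠ supported-J supported-motzkin) (supported-⊞ supported-2 (supported-neg supported-tXN))))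
    P Q : Series
    P = (𝕊.1# ⊟ X ⊟ tXN) ⊠ motzkin
    Q = (𝕊.1# ⊞ X) ⊠ (𝕊.1# ⊟ tXN) ⊠ J
    factor : (X ⊟ 𝕊.1#) ⊠ motzkin ⊟ (X ⊠ X ⊞ X ⊟ 𝕊.1#) ⊠ J ⊞ 2# ⊠ X ⊠ I ≋ X ⊠ cofactor
    factor = 𝕊.trans (solve 4 (λ x m j i → (x :- :1) :* m :- (x :* x :+ x :- :1) :* j :+ :2 :* x :* i
          := x :* (m :- (x :+ :1) :* j :+ :2 :* i) :+ (j :* :1 :- m :* :1)) 𝕊.refl X motzkin J I)
      (𝕊.trans (𝕊.+-congˡ {X ⊠ (motzkin ⊟ (X ⊞ 𝕊.1#) ⊠ J ⊞ 2# ⊠ I)} (𝕊.+-cong (𝕊.*-congˡ {J} (𝕊.sym motzkin-inverse)) (𝕊.-‿cong {motzkin ⊠ 𝕊.1#} (𝕊.*-congˡ {motzkin} (𝕊.sym J-inverse)))))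
      (solve 5 (λ x m j i z → x :* (m :- (x :+ :1) :* j :+ :2 :* i) :+ (j :* ((:1 :- x :- z) :* m) :- m :* ((:1 :+ x) :* (:1 :- z) :* j))
          := x :* (m :- (x :+ :1) :* j :+ :2 :* i :- (j :* m) :* (:2 :- z))) 𝕊.refl X motzkin J I tXN))

-- Reversal of all coefficients of a series.

module Reversal where

  open ClosedForm
  open Support

  open IntegerCoefficientSolver seriesRing
  open WheelAlgebra seriesRing

  -- On series whose coefficient of u^n has degree at most n this is the substitution u ↦ tu, t ↦
  -- 1/t, and in particular multiplicative.
  Rev : Series → Series
  Rev f n = Poly.reverse n (f n)

  Bounded : Series → Set
  Bounded f = ∀ n → Poly.DegreeAtMost n (f n)

  supported⇒bounded : ∀ {f} → Supported f → Bounded f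
  supported⇒bounded Sf n k n<k = Sf n k (ℕ.≤-trans n<k (ℕ.m≤m+n k (k ℕ.+ 0)))

  Rev-cong : ∀ {f g} → f ≋ g → Rev f ≋ Rev g
  Rev-cong e n = Poly.reverse-cong n (e n)

  Rev-⊞ : ∀ f g → Rev (f ⊞ g) ≋ Rev f ⊞ Rev g
  Rev-⊞ f g n = Poly.reverse-⊞ n (f n) (g n)

  Rev-neg : ∀ f → Rev (neg f) ≋ neg (Rev f)
  Rev-neg f n k with k ≤ᵇ n
  ... | true = ≡.refl
  ... | false = ≡.refl

  Rev-1 : Rev 𝕊.1# ≋ 𝕊.1#
  Rev-1 zero zero = ≡.refl
  Rev-1 zero (suc k) = ≡.refl
  Rev-1 (suc n) k with k ≤ᵇ suc n
  ... | true = ≡.refl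
  ... | false = ≡.refl

  reverse-Σ< : ∀ r m (F : Series) → Poly.reverse r (Σ< m F) ℙ.≈ Σ< m (λ i → Poly.reverse r (F i))
  reverse-Σ< r zero F k with k ≤ᵇ r
  ... | true = ≡.refl
  ... | false = ≡.refl
  reverse-Σ< r (suc m) F = ℙ.trans (Poly.reverse-⊞ r (F 0) (Σ< m (shift F))) (ℙ.+-congˡ {Poly.reverse r (F 0)} (reverse-Σ< r m (shift F)))

  -- The summand with index `i` is reversed at degree n, which splits as i plus n - i, exactly the
  -- bounds of its two factors.
  Rev-⊠ : ∀ {f g} → Bounded f → Bounded g → Rev (f ⊠ g) ≋ Rev f ⊠ Rev g
  Rev-⊠ {f} {g} Bf Bg n = ℙ.trans (ℙ.reflexive (≡.cong (Poly.reverse n) (⊠-Σ< f g n)))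
    (ℙ.trans (reverse-Σ< n (suc n) (λ i → f i ℙ.* g (n ∸ i)))
    (ℙ.trans (Σ<-cong (suc n) (λ { i (s≤s i≤n) → ℙ.trans (ℙ.reflexive (≡.cong (λ r → Poly.reverse r (f i ℙ.* g (n ∸ i))) (≡.sym (ℕ.m+[n∸m]≡n i≤n))))
        (Poly.reverse-⊠ i (n ∸ i) (f i) (g (n ∸ i)) (Bf i) (Bg (n ∸ i))) }))
    (ℙ.sym (ℙ.reflexive (⊠-Σ< (Rev f) (Rev g) n)))))

  -- `T` has degree 1 in the coefficient of u^0 and is not `Bounded`; t can be reversed only when
  -- paired with a factor u.
  TX : Series
  TX = T ⊠ X

  bounded-TX : Bounded TX
  bounded-TX n k n<k = ≡.trans (𝕊.*-congˡ {T} (𝕊.sym (𝕊.*-identityʳ X)) n k) (go n k n<k)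
    where
    go : ∀ n k → n ℕ.< k → (T ⊠ (X ⊠ 𝕊.1#)) n k ≡ 0ℚ
    go zero k _ = T⊠X⊠-0 𝕊.1# k
    go (suc n) (suc k) (s≤s n<k) = ≡.trans (T⊠X⊠-suc 𝕊.1# n k) (supported⇒bounded supported-1 n k n<k)

  TX-0 : ∀ k → TX 0 k ≡ 0ℚ
  TX-0 k = ≡.trans (𝕊.*-congˡ {T} (𝕊.sym (𝕊.*-identityʳ X)) 0 k) (T⊠X⊠-0 𝕊.1# k)

  TX-zero : ∀ n → TX n 0 ≡ 0ℚ
  TX-zero n = ≡.trans (𝕊.*-congˡ {T} (𝕊.sym (𝕊.*-identityʳ X)) n 0) (T⊠X⊠-zero 𝕊.1# n)

  TX-suc : ∀ n k → TX (suc n) (suc k) ≡ 𝕊.1# n k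
  TX-suc n k = ≡.trans (𝕊.*-congˡ {T} (𝕊.sym (𝕊.*-identityʳ X)) (suc n) (suc k)) (T⊠X⊠-suc 𝕊.1# n k)

  Rev-X : Rev X ≋ TX
  Rev-X zero zero = ≡.sym (TX-0 0)
  Rev-X zero (suc k) = ≡.sym (TX-0 (suc k))
  Rev-X (suc zero) zero = ≡.sym (TX-zero 1)
  Rev-X (suc zero) (suc zero) = ≡.sym (TX-suc 0 0)
  Rev-X (suc zero) (suc (suc k)) = ≡.sym (TX-suc 0 (suc k))
  Rev-X (suc (suc n)) zero = ≡.sym (TX-zero (suc (suc n)))
  Rev-X (suc (suc n)) (suc k) with suc k ≤ᵇ suc (suc n)
  ... | true = ≡.sym (TX-suc (suc n) k)
  ... | false = ≡.sym (TX-suc (suc n) k)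

  Rev-TX : Rev TX ≋ X
  Rev-TX zero zero = TX-0 0
  Rev-TX zero (suc k) = ≡.refl
  Rev-TX (suc zero) zero = TX-suc 0 0
  Rev-TX (suc zero) (suc zero) = TX-zero 1
  Rev-TX (suc zero) (suc (suc k)) = ≡.refl
  Rev-TX (suc (suc n)) k with k ≤ᵇ suc (suc n)
  ... | false = ≡.refl
  ... | true with suc (suc n) ∸ k
  ...   | zero = TX-zero (suc (suc n))
  ...   | suc j = TX-suc (suc n) j

  N̄ M̄ J̄ Ī P̄ : Series
  N̄ = Rev N
  M̄ = Rev motzkin
  J̄ = Rev J
  Ī = Rev I
  P̄ = Rev rhs

  bounded-⊠ : ∀ {f g} → Supported f → Supported g → Bounded (f ⊠ g)
  bounded-⊠ Sf Sg = supported⇒bounded (supported-⊠ Sf Sg)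

  Rev-tXN : Rev tXN ≋ X ⊠ N̄
  Rev-tXN = 𝕊.trans (Rev-cong (𝕊.sym (𝕊.*-assoc T X N))) (𝕊.trans (Rev-⊠ bounded-TX (supported⇒bounded supported-N)) (𝕊.*-congʳ {N̄} Rev-TX))

  Rev-1+ : ∀ f → Rev (𝕊.1# ⊞ f) ≋ 𝕊.1# ⊞ Rev f
  Rev-1+ f = 𝕊.trans (Rev-⊞ 𝕊.1# f) (𝕊.+-congʳ {Rev f} Rev-1)

  Rev-⊟ : ∀ f g → Rev (f ⊟ g) ≋ Rev f ⊟ Rev g
  Rev-⊟ f g = 𝕊.trans (Rev-⊞ f (neg g)) (𝕊.+-congˡ {Rev f} (Rev-neg g))

  N̄-equation : N̄ ≋ TX ⊠ (𝕊.1# ⊞ N̄) ⊞ X ⊠ (N̄ ⊠ N̄)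
  -- Every t is moved next to a u, so that reversal applies factor by factor.
  N̄-equation = 𝕊.trans (Rev-cong (𝕊.trans N-equation (solve 3 (λ x t n → x :* (:1 :+ n :+ t :* n :* n) := x :* (:1 :+ n) :+ t :* x :* (n :* n)) 𝕊.refl X T N)))
    (𝕊.trans (Rev-⊞ (X ⊠ (𝕊.1# ⊞ N)) (TX ⊠ (N ⊠ N)))
    (𝕊.+-cong (𝕊.trans (Rev-⊠ (supported⇒bounded supported-X) (supported⇒bounded (supported-⊞ supported-1 supported-N))) (𝕊.*-cong Rev-X (Rev-1+ N)))
              (𝕊.trans (Rev-⊠ bounded-TX (bounded-⊠ supported-N supported-N)) (𝕊.*-cong Rev-TX (Rev-⊠ (supported⇒bounded supported-N) (supported⇒bounded supported-N))))))

  supported-1-X-tXN : Supported (𝕊.1# ⊟ X ⊟ tXN)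
  supported-1-X-tXN = supported-⊞ (supported-⊞ supported-1 (supported-neg supported-X)) (supported-neg supported-tXN)

  supported-1+X : Supported (𝕊.1# ⊞ X)
  supported-1+X = supported-⊞ supported-1 supported-X

  supported-1-tXN : Supported (𝕊.1# ⊟ tXN)
  supported-1-tXN = supported-⊞ supported-1 (supported-neg supported-tXN)

  supported-2tXN : Supported (2# ⊠ tXN)
  supported-2tXN = supported-⊠ supported-2 supported-tXN

  supported-root : Supported (𝕊.1# ⊟ X ⊟ 2# ⊠ tXN)
  supported-root = supported-⊞ (supported-⊞ supported-1 (supported-neg supported-X)) (supported-neg supported-2tXN)

  Rev-⊠s : ∀ {f g} → Supported f → Supported g → Rev (f ⊠ g) ≋ Rev f ⊠ Rev g
  Rev-⊠s Sf Sg = Rev-⊠ (supported⇒bounded Sf) (supported⇒bounded Sg)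

  Rev-1-X- : ∀ f → Rev (𝕊.1# ⊟ X ⊟ f) ≋ 𝕊.1# ⊟ TX ⊟ Rev f
  Rev-1-X- f = 𝕊.trans (Rev-⊟ (𝕊.1# ⊟ X) f) (𝕊.+-congʳ {neg (Rev f)} (𝕊.trans (Rev-⊟ 𝕊.1# X) (𝕊.+-cong Rev-1 (𝕊.-‿cong Rev-X))))

  Rev-2 : ∀ {f} → Supported f → Rev (2# ⊠ f) ≋ 2# ⊠ Rev f
  Rev-2 {f} Sf = 𝕊.trans (Rev-⊠s supported-2 Sf) (𝕊.*-congʳ {Rev f} (𝕊.trans (Rev-⊞ 𝕊.1# 𝕊.1#) (𝕊.+-cong Rev-1 Rev-1)))

  M̄-inverse : (𝕊.1# ⊟ TX ⊟ X ⊠ N̄) ⊠ M̄ ≋ 𝕊.1#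
  M̄-inverse = 𝕊.trans (𝕊.*-congʳ {M̄} (𝕊.sym (𝕊.trans (Rev-1-X- tXN) (𝕊.+-congˡ {𝕊.1# ⊟ TX} (𝕊.-‿cong Rev-tXN)))))
    (𝕊.trans (𝕊.sym (Rev-⊠s supported-1-X-tXN supported-motzkin)) (𝕊.trans (Rev-cong motzkin-inverse) Rev-1))

  J̄-inverse : (𝕊.1# ⊞ TX) ⊠ (𝕊.1# ⊟ X ⊠ N̄) ⊠ J̄ ≋ 𝕊.1#
  J̄-inverse = 𝕊.trans (𝕊.*-congʳ {J̄} (𝕊.sym (𝕊.trans (Rev-⊠s supported-1+X supported-1-tXN)
      (𝕊.*-cong (𝕊.trans (Rev-1+ X) (𝕊.+-congˡ {𝕊.1#} Rev-X)) (𝕊.trans (Rev-⊟ 𝕊.1# tXN) (𝕊.+-cong Rev-1 (𝕊.-‿cong Rev-tXN)))))))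
    (𝕊.trans (𝕊.sym (Rev-⊠s (supported-⊠ supported-1+X supported-1-tXN) supported-J)) (𝕊.trans (Rev-cong J-inverse) Rev-1))

  Ī-inverse : (𝕊.1# ⊞ TX) ⊠ (𝕊.1# ⊟ TX ⊟ 2# ⊠ (X ⊠ N̄)) ⊠ Ī ≋ 𝕊.1#
  Ī-inverse = 𝕊.trans (𝕊.*-congʳ {Ī} (𝕊.sym (𝕊.trans (Rev-⊠s supported-1+X supported-root)
      (𝕊.*-cong (𝕊.trans (Rev-1+ X) (𝕊.+-congˡ {𝕊.1#} Rev-X))
        (𝕊.trans (Rev-1-X- (2# ⊠ tXN)) (𝕊.+-congˡ {𝕊.1# ⊟ TX} (𝕊.-‿cong (𝕊.trans (Rev-2 supported-tXN) (𝕊.*-congˡ {2#} Rev-tXN)))))))))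
    (𝕊.trans (𝕊.sym (Rev-⊠s (supported-⊠ supported-1+X supported-root) supported-I)) (𝕊.trans (Rev-cong I-inverse) Rev-1))

  P̄≋ : P̄ ≋ (TX ⊟ 𝕊.1#) ⊠ M̄ ⊟ (TX ⊠ TX ⊞ TX ⊟ 𝕊.1#) ⊠ J̄ ⊞ 2# ⊠ TX ⊠ Ī
  P̄≋ = 𝕊.trans (Rev-cong rhs≋) (𝕊.trans (Rev-⊞ ((X ⊟ 𝕊.1#) ⊠ motzkin ⊟ (X ⊠ X ⊞ X ⊟ 𝕊.1#) ⊠ J) (2# ⊠ X ⊠ I))
    (𝕊.+-cong (𝕊.trans (Rev-⊟ ((X ⊟ 𝕊.1#) ⊠ motzkin) ((X ⊠ X ⊞ X ⊟ 𝕊.1#) ⊠ J))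
       (𝕊.+-cong (𝕊.trans (Rev-⊠s sX-1 supported-motzkin) (𝕊.*-congʳ {M̄} (𝕊.trans (Rev-⊟ X 𝕊.1#) (𝕊.+-cong Rev-X (𝕊.-‿cong Rev-1)))))
         (𝕊.-‿cong (𝕊.trans (Rev-⊠s sQ supported-J) (𝕊.*-congʳ {J̄} (𝕊.trans (Rev-⊟ (X ⊠ X ⊞ X) 𝕊.1#)
             (𝕊.+-cong (𝕊.trans (Rev-⊞ (X ⊠ X) X) (𝕊.+-cong (𝕊.trans (Rev-⊠s supported-X supported-X) (𝕊.*-cong Rev-X Rev-X)) Rev-X)) (𝕊.-‿cong Rev-1))))))))
       (𝕊.trans (Rev-⊠s (supported-⊠ supported-2 supported-X) supported-I) (𝕊.*-congʳ {Ī} (𝕊.trans (Rev-2 supported-X) (𝕊.*-congˡ {2#} Rev-X))))))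
    where
    sX-1 : Supported (X ⊟ 𝕊.1#)
    sX-1 = supported-⊞ supported-X (supported-neg supported-1)
    sQ : Supported (X ⊠ X ⊞ X ⊟ 𝕊.1#)
    sQ = supported-⊞ (supported-⊞ (supported-⊠ supported-X supported-X) supported-X) (supported-neg supported-1)

-- From Motzkin series to the curve, for both substitutions.

module Substitutions where

  open ClosedForm
  open Support
  open Reversal

  open IntegerCoefficientSolver seriesRing
  open WheelAlgebra seriesRing

  -- The denominators of the two substitutions. On the side of the Z-polynomial an added rim edge
  -- raises the rank and contributes t; on the reversed side it contributes 1.
  V U : Series
  V = 𝕊.1# ⊟ TX
  U = 𝕊.1# ⊟ X

  module Substitution (c : PolyQ) where
    open BinomialTransform c public

    substitute-⊟ : ∀ f g → substitute (f ⊟ g) ≋ substitute f ⊟ substitute g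
    substitute-⊟ f g = 𝕊.trans (substitute-⊞ f (neg g)) (𝕊.+-congˡ {substitute f} (substitute-neg g))

    substitute-1 : substitute 𝕊.1# ≋ 𝕊.1#
    substitute-1 = substitute-constant ℙ.1#

    substitute-2 : substitute 2# ≋ 2#
    substitute-2 = 𝕊.trans (substitute-⊞ 𝕊.1# 𝕊.1#) (𝕊.+-cong substitute-1 substitute-1)

    substitute-1+ : ∀ f → substitute (𝕊.1# ⊞ f) ≋ 𝕊.1# ⊞ substitute f
    substitute-1+ f = 𝕊.trans (substitute-⊞ 𝕊.1# f) (𝕊.+-congʳ {substitute f} substitute-1)

    substitute-1- : ∀ f → substitute (𝕊.1# ⊟ f) ≋ 𝕊.1# ⊟ substitute f
    substitute-1- f = 𝕊.trans (substitute-⊟ 𝕊.1# f) (𝕊.+-congʳ {neg (substitute f)} substitute-1)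

    substitute-inverse₁ : ∀ {x z m} → (𝕊.1# ⊟ x ⊟ z) ⊠ m ≋ 𝕊.1# → (𝕊.1# ⊟ substitute x ⊟ substitute z) ⊠ substitute m ≋ 𝕊.1#
    substitute-inverse₁ {x} {z} {m} e = 𝕊.trans (𝕊.*-congʳ {substitute m} (𝕊.sym (𝕊.trans (substitute-⊟ (𝕊.1# ⊟ x) z) (𝕊.+-congʳ {neg (substitute z)} (substitute-1- x)))))
      (𝕊.trans (𝕊.sym (substitute-⊠ (𝕊.1# ⊟ x ⊟ z) m)) (𝕊.trans (substitute-cong e) substitute-1))

    substitute-inverse₂ : ∀ {x z j} → (𝕊.1# ⊞ x) ⊠ (𝕊.1# ⊟ z) ⊠ j ≋ 𝕊.1# → (𝕊.1# ⊞ substitute x) ⊠ (𝕊.1# ⊟ substitute z) ⊠ substitute j ≋ 𝕊.1#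
    substitute-inverse₂ {x} {z} {j} e = 𝕊.trans (𝕊.*-congʳ {substitute j} (𝕊.sym (𝕊.trans (substitute-⊠ (𝕊.1# ⊞ x) (𝕊.1# ⊟ z)) (𝕊.*-cong (substitute-1+ x) (substitute-1- z)))))
      (𝕊.trans (𝕊.sym (substitute-⊠ ((𝕊.1# ⊞ x) ⊠ (𝕊.1# ⊟ z)) j)) (𝕊.trans (substitute-cong e) substitute-1))

    substitute-inverse₃ : ∀ {x z i} → (𝕊.1# ⊞ x) ⊠ (𝕊.1# ⊟ x ⊟ 2# ⊠ z) ⊠ i ≋ 𝕊.1# → (𝕊.1# ⊞ substitute x) ⊠ (𝕊.1# ⊟ substitute x ⊟ 2# ⊠ substitute z) ⊠ substitute i ≋ 𝕊.1#
    substitute-inverse₃ {x} {z} {i} e = 𝕊.trans (𝕊.*-congʳ {substitute i} (𝕊.sym (𝕊.trans (substitute-⊠ (𝕊.1# ⊞ x) (𝕊.1# ⊟ x ⊟ 2# ⊠ z))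
        (𝕊.*-cong (substitute-1+ x) (𝕊.trans (substitute-⊟ (𝕊.1# ⊟ x) (2# ⊠ z)) (𝕊.+-cong (substitute-1- x) (𝕊.-‿cong (𝕊.trans (substitute-⊠ 2# z) (𝕊.*-congʳ {substitute z} substitute-2)))))))))
      (𝕊.trans (𝕊.sym (substitute-⊠ ((𝕊.1# ⊞ x) ⊠ (𝕊.1# ⊟ x ⊟ 2# ⊠ z)) i)) (𝕊.trans (substitute-cong e) substitute-1))

    substitute-sum : ∀ {p x m j i} → p ≋ (x ⊟ 𝕊.1#) ⊠ m ⊟ (x ⊠ x ⊞ x ⊟ 𝕊.1#) ⊠ j ⊞ 2# ⊠ x ⊠ i →
      substitute p ≋ (substitute x ⊟ 𝕊.1#) ⊠ substitute m ⊟ (substitute x ⊠ substitute x ⊞ substitute x ⊟ 𝕊.1#) ⊠ substitute j ⊞ 2# ⊠ substitute x ⊠ substitute i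
    substitute-sum {p} {x} {m} {j} {i} e = 𝕊.trans (substitute-cong e) (𝕊.trans (substitute-⊞ ((x ⊟ 𝕊.1#) ⊠ m ⊟ (x ⊠ x ⊞ x ⊟ 𝕊.1#) ⊠ j) (2# ⊠ x ⊠ i))
      (𝕊.+-cong (𝕊.trans (substitute-⊟ ((x ⊟ 𝕊.1#) ⊠ m) ((x ⊠ x ⊞ x ⊟ 𝕊.1#) ⊠ j))
         (𝕊.+-cong (𝕊.trans (substitute-⊠ (x ⊟ 𝕊.1#) m) (𝕊.*-congʳ {substitute m} (-1′ x)))
           (𝕊.-‿cong (𝕊.trans (substitute-⊠ (x ⊠ x ⊞ x ⊟ 𝕊.1#) j) (𝕊.*-congʳ {substitute j} (𝕊.trans (-1′ (x ⊠ x ⊞ x))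
              (𝕊.+-congʳ {neg 𝕊.1#} (𝕊.trans (substitute-⊞ (x ⊠ x) x) (𝕊.+-congʳ {substitute x} (substitute-⊠ x x))))))))))
         (𝕊.trans (substitute-⊠ (2# ⊠ x) i) (𝕊.*-congʳ {substitute i} (𝕊.trans (substitute-⊠ 2# x) (𝕊.*-congʳ {substitute x} substitute-2))))))
      where
      -1′ : ∀ f → substitute (f ⊟ 𝕊.1#) ≋ substitute f ⊟ 𝕊.1#
      -1′ f = 𝕊.trans (substitute-⊟ f 𝕊.1#) (𝕊.+-congˡ {substitute f} (𝕊.-‿cong substitute-1))

  module Sₜ = Substitution Poly.X
  module S₁ = Substitution ℙ.1#

  A Ā : Series
  A = Sₜ.substitute N
  Ā = S₁.substitute N̄

  V-X : V ⊠ Sₜ.substitute X ≋ X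
  V-X = Sₜ.substitute-X

  U-w : U ⊠ S₁.substitute X ≋ X
  U-w = 𝕊.trans (𝕊.*-congʳ {S₁.substitute X} (𝕊.+-congˡ {𝕊.1#} (𝕊.-‿cong (𝕊.sym (𝕊.*-identityˡ X))))) S₁.substitute-X

  U-TX : U ⊠ S₁.substitute TX ≋ TX
  U-TX = 𝕊.trans (𝕊.*-congˡ {U} (𝕊.trans (S₁.substitute-⊠ T X) (𝕊.*-congʳ {S₁.substitute X} (S₁.substitute-constant Poly.X))))
    (𝕊.trans (solve 3 (λ u t w → u :* (t :* w) := t :* (u :* w)) 𝕊.refl U T (S₁.substitute X)) (𝕊.*-congˡ {T} U-w))

  -- Clearing the denominator 1 - tu leaves tuA, which completes u(1 + A + tA²) to a product.
  curve : A ≋ X ⊠ ((𝕊.1# ⊞ A) ⊠ (𝕊.1# ⊞ T ⊠ A))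
  curve = 𝕊.trans (solve 2 (λ a y → a := (:1 :- y) :* a :+ y :* a) 𝕊.refl A TX)
    (𝕊.trans (𝕊.+-congʳ {TX ⊠ A} (𝕊.trans (𝕊.*-congˡ {V} A-eq) (𝕊.trans (𝕊.sym (𝕊.*-assoc V (Sₜ.substitute X) (𝕊.1# ⊞ A ⊞ T ⊠ A ⊠ A))) (𝕊.*-congʳ {𝕊.1# ⊞ A ⊞ T ⊠ A ⊠ A} V-X))))
    (solve 3 (λ x t a → x :* (:1 :+ a :+ t :* a :* a) :+ t :* x :* a := x :* ((:1 :+ a) :* (:1 :+ t :* a))) 𝕊.refl X T A))
    where
    A-eq : A ≋ Sₜ.substitute X ⊠ (𝕊.1# ⊞ A ⊞ T ⊠ A ⊠ A)
    A-eq = 𝕊.trans (Sₜ.substitute-cong N-equation) (𝕊.trans (Sₜ.substitute-⊠ X (𝕊.1# ⊞ N ⊞ T ⊠ N ⊠ N)) (𝕊.*-congˡ {Sₜ.substitute X}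
      (𝕊.trans (Sₜ.substitute-⊞ (𝕊.1# ⊞ N) (T ⊠ N ⊠ N)) (𝕊.+-cong (Sₜ.substitute-1+ N)
        (𝕊.trans (Sₜ.substitute-⊠ (T ⊠ N) N) (𝕊.*-congʳ {A} (𝕊.trans (Sₜ.substitute-⊠ T N) (𝕊.*-congʳ {A} (Sₜ.substitute-constant Poly.X)))))))))

  -- Here the denominator is 1 - u, and the remaining uĀ completes u(t + tĀ + Ā²) to a product.
  curve̅ : Ā ≋ X ⊠ ((T ⊞ Ā) ⊠ (𝕊.1# ⊞ Ā))
  curve̅ = 𝕊.trans (solve 2 (λ a x → a := (:1 :- x) :* a :+ x :* a) 𝕊.refl Ā X)
    (𝕊.trans (𝕊.+-congʳ {X ⊠ Ā} (𝕊.trans (𝕊.*-congˡ {U} Ā-eq)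
       (𝕊.trans (solve 5 (λ u w y a b → u :* (y :* a :+ w :* b) := (u :* y) :* a :+ (u :* w) :* b) 𝕊.refl U (S₁.substitute X) (S₁.substitute TX) (𝕊.1# ⊞ Ā) (Ā ⊠ Ā))
          (𝕊.+-cong (𝕊.*-congʳ {𝕊.1# ⊞ Ā} U-TX) (𝕊.*-congʳ {Ā ⊠ Ā} U-w)))))
    (solve 3 (λ x t a → t :* x :* (:1 :+ a) :+ x :* (a :* a) :+ x :* a := x :* ((t :+ a) :* (:1 :+ a))) 𝕊.refl X T Ā))
    where
    Ā-eq : Ā ≋ S₁.substitute TX ⊠ (𝕊.1# ⊞ Ā) ⊞ S₁.substitute X ⊠ (Ā ⊠ Ā)
    Ā-eq = 𝕊.trans (S₁.substitute-cong N̄-equation) (𝕊.trans (S₁.substitute-⊞ (TX ⊠ (𝕊.1# ⊞ N̄)) (X ⊠ (N̄ ⊠ N̄)))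
      (𝕊.+-cong (𝕊.trans (S₁.substitute-⊠ TX (𝕊.1# ⊞ N̄)) (𝕊.*-congˡ {S₁.substitute TX} (S₁.substitute-1+ N̄)))
        (𝕊.trans (S₁.substitute-⊠ X (N̄ ⊠ N̄)) (𝕊.*-congˡ {S₁.substitute X} (S₁.substitute-⊠ N̄ N̄)))))

  -- Both sides solve Y = u(t+Y)(1+Y), which has a unique solution.
  Ā≋TA : Ā ≋ T ⊠ A
  Ā≋TA n k = ≡.trans (solve 2 (λ a b → a := (a :- b) :+ b) 𝕊.refl Ā (T ⊠ A) n k)
    (≡.trans (≡.cong (ℚ._+ (T ⊠ A) n k) (X-guarded⇒0 (Ā ⊟ T ⊠ A) (𝕊.1# ⊞ T ⊞ Ā ⊞ T ⊠ A) guarded n k)) (ℚ.+-identityˡ _))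
    where
    guarded : Ā ⊟ T ⊠ A ≋ X ⊠ ((𝕊.1# ⊞ T ⊞ Ā ⊞ T ⊠ A) ⊠ (Ā ⊟ T ⊠ A))
    guarded = 𝕊.trans (𝕊.+-cong curve̅ (𝕊.-‿cong (𝕊.*-congˡ {T} curve)))
      (solve 4 (λ x t a b → x :* ((t :+ b) :* (:1 :+ b)) :- t :* (x :* ((:1 :+ a) :* (:1 :+ t :* a)))
        := x :* ((:1 :+ t :+ b :+ t :* a) :* (b :- t :* a))) 𝕊.refl X T A Ā)

  open Curve {X} {T} {A} curve

  z Δ : Series
  z = T ⊠ X ⊠ A
  Δ = discriminant V X z

  -- `binomial` and not `substitute`, since a flat without spokes is obtained by choosing among the
  -- missing rim edges; this is the reason for the separate factor `V`.
  cleared-rhs : (V ⊞ X) ⊠ Δ ⊠ V ⊠ Sₜ.binomial rhs ≋ cleared V X z (𝕊.1# ⊞ A) (𝕊.1# ⊞ T ⊠ A)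
  cleared-rhs = clear-denominators′ {V} {X} {z} {Sₜ.substitute X} {Sₜ.substitute tXN} {Sₜ.substitute motzkin} {Sₜ.substitute J} {Sₜ.substitute I} {𝕊.1# ⊞ A} {𝕊.1# ⊞ T ⊠ A} {Sₜ.binomial rhs}
    V-X V-v (Sₜ.substitute-inverse₁ {X} {tXN} {motzkin} motzkin-inverse) (Sₜ.substitute-inverse₂ {X} {tXN} {J} J-inverse) (Sₜ.substitute-inverse₃ {X} {tXN} {I} I-inverse) β-inverse αβ-inverse
    (𝕊.trans (Sₜ.substitute-binomial rhs) (Sₜ.substitute-sum {rhs} {X} {motzkin} {J} {I} rhs≋))
    where
    V-v : V ⊠ Sₜ.substitute tXN ≋ z
    V-v = 𝕊.trans (𝕊.*-congˡ {V} (𝕊.trans (Sₜ.substitute-⊠ T (X ⊠ N)) (𝕊.*-cong (Sₜ.substitute-constant Poly.X) (Sₜ.substitute-⊠ X N))))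
      (𝕊.trans (solve 4 (λ v t w a → v :* (t :* (w :* a)) := t :* (v :* w) :* a) 𝕊.refl V T (Sₜ.substitute X) A) (𝕊.*-congʳ {A} (𝕊.*-congˡ {T} V-X)))

  -- The previous identity with u and tu, and likewise α and β, exchanged. Since `Δ` is symmetric in
  -- u and tu, the same `Δ` serves both.
  cleared-P̄ : (U ⊞ TX) ⊠ Δ ⊠ U ⊠ S₁.binomial P̄ ≋ cleared U TX z (𝕊.1# ⊞ T ⊠ A) (𝕊.1# ⊞ A)
  cleared-P̄ = 𝕊.trans (𝕊.*-congʳ {S₁.binomial P̄} (𝕊.*-congʳ {U} (𝕊.*-congˡ {U ⊞ TX} (solve 3 (λ x y z → :1 :- y :- x :- z := :1 :- x :- y :- z) 𝕊.refl X TX (2# ⊠ z)))))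
    (clear-denominators′ {U} {TX} {z} {S₁.substitute TX} {S₁.substitute (X ⊠ N̄)} {S₁.substitute M̄} {S₁.substitute J̄} {S₁.substitute Ī} {𝕊.1# ⊞ T ⊠ A} {𝕊.1# ⊞ A} {S₁.binomial P̄}
    U-TX U-v (S₁.substitute-inverse₁ {TX} {X ⊠ N̄} {M̄} M̄-inverse) (S₁.substitute-inverse₂ {TX} {X ⊠ N̄} {J̄} J̄-inverse) (S₁.substitute-inverse₃ {TX} {X ⊠ N̄} {Ī} Ī-inverse) α-inverse
    (𝕊.trans (solve 5 (λ x y z a b → (:1 :- x :- y :- z) :* (b :* a) := (:1 :- y :- x :- z) :* (a :* b)) 𝕊.refl X TX z (𝕊.1# ⊞ A) (𝕊.1# ⊞ T ⊠ A)) αβ-inverse)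
    (𝕊.trans (𝕊.trans (𝕊.*-congʳ {S₁.binomial P̄} (𝕊.+-congˡ {𝕊.1#} (𝕊.-‿cong (𝕊.sym (𝕊.*-identityˡ X))))) (S₁.substitute-binomial P̄)) (S₁.substitute-sum {P̄} {TX} {M̄} {J̄} {Ī} P̄≋)))
    where
    U-v : U ⊠ S₁.substitute (X ⊠ N̄) ≋ z
    U-v = 𝕊.trans (𝕊.*-congˡ {U} (S₁.substitute-⊠ X N̄)) (𝕊.trans (𝕊.sym (𝕊.*-assoc U (S₁.substitute X) Ā))
      (𝕊.trans (𝕊.*-cong U-w Ā≋TA) (solve 3 (λ x t a → x :* (t :* a) := t :* x :* a) 𝕊.refl X T A)))

  θA : Series
  θA = θ A

  -- Differentiating the curve: the terms with θA collect to the derivative of the relation in A,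
  -- which is `Δ`, and the explicit u leaves u(1+A)(1+tA) = A.
  θ-curve : Δ ⊠ θA ≋ A
  θ-curve = 𝕊.trans (solve 4 (λ x t a d → (:1 :- t :* x :- x :- :2 :* (t :* x :* a)) :* d := d :- x :* (d :* (:1 :+ t :* a) :+ (:1 :+ a) :* (t :* d))) 𝕊.refl X T A θA)
    (𝕊.trans (𝕊.+-congʳ {neg (X ⊠ (θA ⊠ β ⊞ α ⊠ (T ⊠ θA)))} expand)
    (𝕊.trans (solve 3 (λ a b c → (a :+ b) :- b := a) 𝕊.refl (X ⊠ (α ⊠ β)) (X ⊠ (θA ⊠ β ⊞ α ⊠ (T ⊠ θA))) X) (𝕊.sym curve)))
    where
    α β : Series
    α = 𝕊.1# ⊞ A
    β = 𝕊.1# ⊞ T ⊠ A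
    θ-1+ : ∀ f → θ (𝕊.1# ⊞ f) ≋ θ f
    θ-1+ f = 𝕊.trans (θ-⊞ 𝕊.1# f) (𝕊.trans (𝕊.+-congʳ {θ f} (θ-constant ℙ.1#)) (𝕊.+-identityˡ (θ f)))
    θ-TA : θ (T ⊠ A) ≋ T ⊠ θA
    θ-TA = 𝕊.trans (θ-⊠ T A) (𝕊.trans (𝕊.+-congʳ {T ⊠ θA} (𝕊.trans (𝕊.*-congʳ {A} (θ-constant Poly.X)) (𝕊.zeroˡ A))) (𝕊.+-identityˡ (T ⊠ θA)))
    expand : θA ≋ X ⊠ (α ⊠ β) ⊞ X ⊠ (θA ⊠ β ⊞ α ⊠ (T ⊠ θA))
    expand = 𝕊.trans (θ-cong curve) (𝕊.trans (θ-⊠ X (α ⊠ β)) (𝕊.+-cong (𝕊.*-congʳ {α ⊠ β} θ-X)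
      (𝕊.*-congˡ {X} (𝕊.trans (θ-⊠ α β) (𝕊.+-cong (𝕊.*-congʳ {β} (θ-1+ A)) (𝕊.*-congˡ {α} (𝕊.trans (θ-1+ (T ⊠ A)) θ-TA)))))))

-- The palindromic identities of fans and wheels.

module Symmetry where

  open ClosedForm
  open Support
  open Reversal
  open Substitutions

  open IntegerCoefficientSolver seriesRing
  open WheelAlgebra seriesRing
  open Curve {X} {T} {A} curve

  -- The proposed polynomials of fans, indexed by the number a of blocks: 1 for a = 0 and otherwise
  -- the Motzkin polynomial of index a - 1. In `μ̄` each is reversed at the rank a.
  μ μ̄ : Series
  μ = 𝕊.1# ⊞ N
  μ̄ = Rev μ

  μ-0 : μ 0 ℙ.≈ ℙ.1#
  μ-0 = constant-term 𝕊.1# motzkin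

  μ̄≋ : μ̄ ≋ 𝕊.1# ⊞ N̄
  μ̄≋ = Rev-1+ N

  μ̄-0 : μ̄ 0 ℙ.≈ ℙ.1#
  μ̄-0 zero = μ-0 0
  μ̄-0 (suc k) = ≡.refl

  module Fₜ = Fan polyRing Poly.X μ
  module F₁ = Fan polyRing ℙ.1# μ̄

  α β : Series
  α = 𝕊.1# ⊞ A
  β = 𝕊.1# ⊞ T ⊠ A

  substitute-μ : Sₜ.substitute μ ≋ α
  substitute-μ = Sₜ.substitute-1+ N

  substitute-μ̄ : S₁.substitute μ̄ ≋ β
  substitute-μ̄ = 𝕊.trans (S₁.substitute-cong μ̄≋) (𝕊.trans (S₁.substitute-1+ N̄) (𝕊.+-congˡ {𝕊.1#} Ā≋TA))

  -- `K` solves K = 1 + tu(1+A)K, and on the curve so does 1 + tA.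
  Kₜ≋β : Fₜ.K ≋ β
  Kₜ≋β = inverse-unique {𝕊.1# ⊟ TX ⊟ T ⊠ X ⊠ A} {Fₜ.K} {β} (𝕊.trans (solve 4 (λ x t a k → (:1 :- t :* x :- t :* x :* a) :* k := k :- t :* x :* ((:1 :+ a) :* k)) 𝕊.refl X T A Fₜ.K)
      (𝕊.trans (𝕊.+-congʳ {neg (TX ⊠ (α ⊠ Fₜ.K))} (𝕊.trans (Fₜ.K-series μ-0) (𝕊.+-congˡ {𝕊.1#} (𝕊.*-congˡ {TX} (𝕊.trans (Fₜ.hub-factor μ-0) (𝕊.*-congʳ {Fₜ.K} substitute-μ))))))
        (solve 1 (λ a → :1 :+ a :- a := :1) 𝕊.refl (TX ⊠ (α ⊠ Fₜ.K))))) β-inverse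

  K₁≋α : F₁.K ≋ α
  K₁≋α = inverse-unique {𝕊.1# ⊟ X ⊟ T ⊠ X ⊠ A} {F₁.K} {α} (𝕊.trans (solve 4 (λ x t a k → (:1 :- x :- t :* x :* a) :* k := k :- :1 :* x :* ((:1 :+ t :* a) :* k)) 𝕊.refl X T A F₁.K)
      (𝕊.trans (𝕊.+-congʳ {neg (𝕊.1# ⊠ X ⊠ (β ⊠ F₁.K))} (𝕊.trans (F₁.K-series μ̄-0) (𝕊.+-congˡ {𝕊.1#} (𝕊.*-congˡ {𝕊.1# ⊠ X} (𝕊.trans (F₁.hub-factor μ̄-0) (𝕊.*-congʳ {F₁.K} substitute-μ̄))))))
        (solve 1 (λ a → :1 :+ a :- a := :1) 𝕊.refl (𝕊.1# ⊠ X ⊠ (β ⊠ F₁.K))))) α-inverse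

  -- The last run contributes α and the rest of the word β when `c = t`; on the reversed side they
  -- change places. This is palindromicity for fans.
  hub-symmetric : Fₜ.hub ≋ F₁.hub
  hub-symmetric = 𝕊.trans (𝕊.trans (Fₜ.hub-factor μ-0) (𝕊.*-cong substitute-μ Kₜ≋β))
    (𝕊.trans (𝕊.*-comm α β) (𝕊.sym (𝕊.trans (F₁.hub-factor μ̄-0) (𝕊.*-cong substitute-μ̄ K₁≋α))))

  θ-1+ : ∀ f → θ (𝕊.1# ⊞ f) ≋ θ f
  θ-1+ f = 𝕊.trans (θ-⊞ 𝕊.1# f) (𝕊.trans (𝕊.+-congʳ {θ f} (θ-constant ℙ.1#)) (𝕊.+-identityˡ (θ f)))

  θ-TA : θ (T ⊠ A) ≋ T ⊠ θA
  θ-TA = 𝕊.trans (θ-⊠ T A) (𝕊.trans (𝕊.+-congʳ {T ⊠ θA} (𝕊.trans (𝕊.*-congʳ {A} (θ-constant Poly.X)) (𝕊.zeroˡ A))) (𝕊.+-identityˡ (T ⊠ θA)))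

  wheelₜ≋ : Fₜ.wheelF 0 ≋ TX ⊠ (α ⊞ θA) ⊠ β
  wheelₜ≋ zero = ℙ.sym (ℙ.trans (solve 4 (λ t x f b → t :* x :* f :* b := x :* (t :* f :* b)) 𝕊.refl T X (α ⊞ θA) β 0) (X⊠-zero (T ⊠ (α ⊞ θA) ⊠ β)))
  wheelₜ≋ (suc b) = ℙ.trans (Fₜ.wheelF≈ μ-0 b 0)
    (ℙ.trans (ℙ.*-congˡ {Poly.X} (𝕊.*-cong (𝕊.+-cong substitute-μ (𝕊.trans (θ-cong substitute-μ) (θ-1+ A))) Kₜ≋β b))
    (ℙ.trans (ℙ.sym (⊠-constantˡ Poly.X ((α ⊞ θA) ⊠ β) b))
    (ℙ.trans (ℙ.sym (X⊠-suc (T ⊠ ((α ⊞ θA) ⊠ β)) b))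
    (solve 4 (λ t x f b → x :* (t :* (f :* b)) := t :* x :* f :* b) 𝕊.refl T X (α ⊞ θA) β (suc b)))))

  wheel₁≋ : F₁.wheelF 0 ≋ X ⊠ (β ⊞ T ⊠ θA) ⊠ α
  wheel₁≋ zero = ℙ.sym (ℙ.trans (𝕊.*-assoc X (β ⊞ T ⊠ θA) α 0) (X⊠-zero ((β ⊞ T ⊠ θA) ⊠ α)))
  wheel₁≋ (suc b) = ℙ.trans (F₁.wheelF≈ μ̄-0 b 0)
    (ℙ.trans (ℙ.*-congˡ {ℙ.1#} (𝕊.*-cong (𝕊.+-cong substitute-μ̄ (𝕊.trans (θ-cong substitute-μ̄) (𝕊.trans (θ-1+ (T ⊠ A)) θ-TA))) K₁≋α b))
    (ℙ.trans (ℙ.*-identityˡ (((β ⊞ T ⊠ θA) ⊠ α) b))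
    (ℙ.trans (ℙ.sym (X⊠-suc ((β ⊞ T ⊠ θA) ⊠ α) b))
    (𝕊.sym (𝕊.*-assoc X (β ⊞ T ⊠ θA) α) (suc b)))))

  V-inverse : V ⊠ Sₜ.binomial 𝕊.1# ≋ 𝕊.1#
  V-inverse = 𝕊.trans (Sₜ.substitute-binomial 𝕊.1#) Sₜ.substitute-1

  U-inverse : U ⊠ S₁.binomial 𝕊.1# ≋ 𝕊.1#
  U-inverse = 𝕊.trans (𝕊.*-congʳ {S₁.binomial 𝕊.1#} (𝕊.+-congˡ {𝕊.1#} (𝕊.-‿cong (𝕊.sym (𝕊.*-identityˡ X))))) (𝕊.trans (S₁.substitute-binomial 𝕊.1#) S₁.substitute-1)

  -- The summands belong to flats with a spoke, to flats without spokes that miss rim edges, and to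
  -- the full rim. The latter has rank n - 1 and value 1, so it gives t^(n-1) on one side and t on
  -- the other. `D` is the common denominator.
  lhsₜ lhs₁ D : Series
  lhsₜ = TX ⊠ (α ⊞ θA) ⊠ β ⊞ Sₜ.binomial rhs ⊞ X ⊠ Sₜ.binomial 𝕊.1#
  lhs₁ = X ⊠ (β ⊞ T ⊠ θA) ⊠ α ⊞ S₁.binomial P̄ ⊞ TX ⊠ S₁.binomial 𝕊.1#
  D = Δ ⊠ V ⊠ U ⊠ (V ⊞ X) ⊠ (U ⊞ TX)

  D-0 : D 0 ℙ.≈ ℙ.1#
  D-0 = ⊠₁ (Δ ⊠ V ⊠ U ⊠ (V ⊞ X)) (U ⊞ TX) (⊠₁ (Δ ⊠ V ⊠ U) (V ⊞ X) (⊠₁ (Δ ⊠ V) U (⊠₁ Δ V Δ-0 V-0) U-0) V+X-0) U+TX-0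
    where
    ⊠₁ : ∀ f g → f 0 ℙ.≈ ℙ.1# → g 0 ℙ.≈ ℙ.1# → (f ⊠ g) 0 ℙ.≈ ℙ.1#
    ⊠₁ f g e e′ = ℙ.trans (⊠-zero f g) (ℙ.trans (ℙ.*-cong e e′) (ℙ.*-identityˡ ℙ.1#))
    Δ-0 : Δ 0 ℙ.≈ ℙ.1#
    Δ-0 = ℙ.trans (solve 3 (λ x t a → :1 :- t :* x :- x :- :2 :* (t :* x :* a) := :1 :+ x :* (:- t :- :1 :- :2 :* (t :* a))) 𝕊.refl X T A 0) (constant-term 𝕊.1# (neg T ⊟ 𝕊.1# ⊟ 2# ⊠ (T ⊠ A)))
    V-0 : V 0 ℙ.≈ ℙ.1#
    V-0 = ℙ.trans (solve 2 (λ x t → :1 :- t :* x := :1 :+ x :* (:- t)) 𝕊.refl X T 0) (constant-term 𝕊.1# (neg T))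
    U-0 : U 0 ℙ.≈ ℙ.1#
    U-0 = ℙ.trans (solve 2 (λ x t → :1 :- x := :1 :+ x :* (:- :1)) 𝕊.refl X T 0) (constant-term 𝕊.1# (neg 𝕊.1#))
    V+X-0 : (V ⊞ X) 0 ℙ.≈ ℙ.1#
    V+X-0 = ℙ.trans (solve 2 (λ x t → :1 :- t :* x :+ x := :1 :+ x :* (:1 :- t)) 𝕊.refl X T 0) (constant-term 𝕊.1# (𝕊.1# ⊟ T))
    U+TX-0 : (U ⊞ TX) 0 ℙ.≈ ℙ.1#
    U+TX-0 = ℙ.trans (solve 2 (λ x t → :1 :- x :+ t :* x := :1 :+ x :* (t :- :1)) 𝕊.refl X T 0) (constant-term 𝕊.1# (T ⊟ 𝕊.1#))

  -- `wheel-identity` yields the equation multiplied by `D`, and every factor of `D` has constant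
  -- term 1.
  lhs-symmetric : lhsₜ ≋ lhs₁
  lhs-symmetric n k = ≡.trans (solve 2 (λ a b → a := (a :- b) :+ b) 𝕊.refl lhsₜ lhs₁ n k)
    (≡.trans (≡.cong (ℚ._+ lhs₁ n k) (unit-cancel D (lhsₜ ⊟ lhs₁) D-0
      (wheel-identity {X} {T} {A} {θA} {Sₜ.binomial rhs} {S₁.binomial P̄} {Sₜ.binomial 𝕊.1#} {S₁.binomial 𝕊.1#} curve θ-curve cleared-rhs cleared-P̄ V-inverse U-inverse) n k))
    (ℚ.+-identityˡ (lhs₁ n k)))

  binomialₜ-1 : ∀ b → Sₜ.binomial 𝕊.1# b ℙ.≈ Poly.raise b ℙ.1#
  binomialₜ-1 zero = ℙ.refl
  binomialₜ-1 (suc b) = ℙ.trans (ℙ.+-cong (ℙ.*-congˡ {Poly.X} (binomialₜ-1 b)) (Sₜ.binomial-0 b)) (ℙ.trans (ℙ.+-identityʳ _) go)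
    where
    go : Poly.X ℙ.* Poly.raise b ℙ.1# ℙ.≈ Poly.raise (suc b) ℙ.1#
    go zero = Poly.X⊠-zero (Poly.raise b ℙ.1#)
    go (suc k) = Poly.X⊠-suc (Poly.raise b ℙ.1#) k

  binomial₁-1 : ∀ b → S₁.binomial 𝕊.1# b ℙ.≈ ℙ.1#
  binomial₁-1 zero = ℙ.refl
  binomial₁-1 (suc b) = ℙ.trans (ℙ.+-cong (ℙ.trans (ℙ.*-identityˡ (S₁.binomial 𝕊.1# b)) (binomial₁-1 b)) (S₁.binomial-0 b)) (ℙ.+-identityʳ ℙ.1#)

  wheel-symmetric : ∀ b → Fₜ.wheelF 0 (suc b) ℙ.+ Sₜ.binomial rhs (suc b) ℙ.+ Poly.raise b ℙ.1#
    ℙ.≈ F₁.wheelF 0 (suc b) ℙ.+ S₁.binomial P̄ (suc b) ℙ.+ Poly.X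
  wheel-symmetric b = ℙ.trans (ℙ.+-cong (ℙ.+-congʳ {Sₜ.binomial rhs (suc b)} (wheelₜ≋ (suc b)))
      (ℙ.sym (ℙ.trans (X⊠-suc (Sₜ.binomial 𝕊.1#) b) (binomialₜ-1 b))))
    (ℙ.trans (lhs-symmetric (suc b))
    (ℙ.+-cong (ℙ.+-congʳ {S₁.binomial P̄ (suc b)} (ℙ.sym (wheel₁≋ (suc b))))
      (ℙ.trans (𝕊.*-assoc T X (S₁.binomial 𝕊.1#) (suc b)) (ℙ.trans (⊠-constantˡ Poly.X (X ⊠ S₁.binomial 𝕊.1#) (suc b))
        (ℙ.trans (ℙ.*-congˡ {Poly.X} (ℙ.trans (X⊠-suc (S₁.binomial 𝕊.1#) b) (binomial₁-1 b))) (ℙ.*-identityʳ Poly.X))))))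

-- The properties of the closed form used from here on.

module WheelPolynomials where

  open ClosedForm
  open Support
  open Reversal
  open Substitutions
  open Symmetry
  open import Data.Nat.Base using (_≤_)

  opaque

    -- Opaque, so that checking the combinatorial part never unfolds the recursions behind `rhs`.
    wheelPoly wheelPoly̅ : Series
    wheelPoly = rhs
    wheelPoly̅ = P̄

    wheelPoly≡rhs : ∀ n k → wheelPoly n k ≡ rhs n k
    wheelPoly≡rhs n k = ≡.refl

    wheelPoly-degree : ∀ n k → n ≤ 2 ℕ.* k → wheelPoly n k ≡ 0ℚ
    wheelPoly-degree = rhs-degree

    -- The full rim, the only word without spokes and without missing edges, receives its value
    -- separately; nothing may be added to it here.
    wheelPoly-0 : wheelPoly 0 ℙ.≈ ℙ.0#
    wheelPoly-0 k = rhs-degree 0 k z≤n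

    -- A rim with one missing edge is not a flat; as its value is zero it may stay in the sums. The
    -- degree bound misses only the constant term, which is evaluated.
    wheelPoly-1 : wheelPoly 1 ℙ.≈ ℙ.0#
    wheelPoly-1 zero = ≡.refl
    wheelPoly-1 (suc k) = rhs-degree 1 (suc k) (s≤s z≤n)

    reverse-wheelPoly : ∀ b → Poly.reverse b (wheelPoly b) ℙ.≈ wheelPoly̅ b
    reverse-wheelPoly b k = ≡.refl

    wheelPoly-symmetric : ∀ b → Fₜ.wheelF 0 (suc b) ℙ.+ Sₜ.binomial wheelPoly (suc b) ℙ.+ Poly.raise b ℙ.1#
      ℙ.≈ F₁.wheelF 0 (suc b) ℙ.+ S₁.binomial wheelPoly̅ (suc b) ℙ.+ Poly.X
    wheelPoly-symmetric = wheel-symmetric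

-- Flats of wheels as words over the rim.

module LetterWords where

  open import Data.Bool.Base using (T)
  open import Data.List.Base using (replicate; foldr)
  open import Data.List.Properties using (++-assoc; ++-identityʳ; map-++)
  open import Data.Product.Base using (_×_)

  -- The letter (s , e) at a rim vertex i of a wheel says whether the spoke at i and
  -- the rim edge from i to i + 1 belong to the flat.
  Letter : Set
  Letter = Bool × Bool

  -- A present rim edge out of a joined vertex forces the next vertex to be joined as well. The
  -- empty word qualifies because a joined vertex follows it.
  data StartsAtHub : List Letter → Set where
    []  : StartsAtHub []
    hub : ∀ {e g} → StartsAtHub ((true , e) ∷ g)

  -- Chain g bs: read from the hub and back to it, g is a flat whose runs of vertices
  -- off the hub have the numbers of blocks bs.
  data Chain : List Letter → List ℕ → Set where
    nil : Chain [] (0 ∷ [])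
    hub : ∀ {e g bs} → (e ≡ true → StartsAtHub g) → Chain g bs → Chain ((true , e) ∷ g) (0 ∷ bs)
    brk : ∀ {g b bs} → Chain g (b ∷ bs) → Chain ((false , false) ∷ g) (suc b ∷ bs)
    ext : ∀ {x g b bs} → Chain ((false , x) ∷ g) (b ∷ bs) → Chain ((false , true) ∷ (false , x) ∷ g) (b ∷ bs)

  -- `ext` asks for a further letter off the hub, so a `Run` cannot end in a present edge. `OffHub`
  -- has no such condition, as befits a rim cut open anywhere.
  data Run : List Letter → ℕ → Set where
    nil : Run [] 0
    brk : ∀ {g b} → Run g b → Run ((false , false) ∷ g) (suc b)
    ext : ∀ {x g b} → Run ((false , x) ∷ g) b → Run ((false , true) ∷ (false , x) ∷ g) b

  data OffHub : List Letter → ℕ → Set where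
    nil : OffHub [] 0
    brk : ∀ {g b} → OffHub g b → OffHub ((false , false) ∷ g) (suc b)
    ext : ∀ {g b} → OffHub g b → OffHub ((false , true) ∷ g) b

  -- The number of blocks of the current run once the new letter is read; a present edge keeps the
  -- vertex in the block of its predecessor.
  blocks : Letter → ℕ → Letter → ℕ
  blocks l a (true , _) = 0
  blocks (true , _) a (false , _) = 1
  blocks (false , e) a (false , _) = if e then a else suc a

  -- Flatness at one rim edge. Between two joined vertices the edge closes a triangle and must be
  -- present; between a joined vertex and another one it must be absent; off the hub it is free.
  compatible : Letter → Bool → Bool
  compatible (true , e) true = e
  compatible (true , e) false = not e
  compatible (false , e) true = not e
  compatible (false , e) false = true

  -- `s` tells whether the vertex that follows the word is joined to the hub.
  Linked : Bool → Letter → List Letter → Set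
  Linked s l [] = T (compatible l s)
  Linked s l (l′ ∷ w) = T (compatible l (proj₁ l′)) × Linked s l′ w

  Linked-++ : ∀ {s l} x {l′ y} → Linked s l (x ++ l′ ∷ y) → Linked (proj₁ l′) l x × Linked s l′ y
  Linked-++ [] (c , k) = c , k
  Linked-++ (m ∷ x) (c , k) = let (k₁ , k₂) = Linked-++ x k in (c , k₁) , k₂

  ++-Linked : ∀ {s l} x {l′ y} → Linked (proj₁ l′) l x → Linked s l′ y → Linked s l (x ++ l′ ∷ y)
  ++-Linked [] c k = c , k
  ++-Linked (m ∷ x) (c , k₁) k₂ = c , ++-Linked x k₁ k₂

  private
    ChainFrom : Letter → List Letter → Set
    ChainFrom (true , e) g = (e ≡ true → StartsAtHub g) × ∃₂ λ b bs → Chain g (b ∷ bs)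
    ChainFrom (false , e) g = ∃₂ λ b bs → Chain ((false , e) ∷ g) (b ∷ bs)

    parse : ∀ l g → Linked true l g → ChainFrom l g
    parse (true , true) [] k = (λ _ → []) , _ , _ , nil
    parse (false , false) [] k = _ , _ , brk nil
    parse (true , true) ((true , e) ∷ g) (c , k) = let (s , _ , _ , ch) = parse (true , e) g k in (λ _ → hub) , _ , _ , hub s ch
    parse (true , false) ((false , e) ∷ g) (c , k) = (λ ()) , parse (false , e) g k
    parse (false , false) ((true , e) ∷ g) (c , k) = let (s , _ , _ , ch) = parse (true , e) g k in _ , _ , brk (hub s ch)
    parse (false , false) ((false , e) ∷ g) (c , k) = let (_ , _ , ch) = parse (false , e) g k in _ , _ , brk ch
    parse (false , true) ((false , e) ∷ g) (c , k) = let (_ , _ , ch) = parse (false , e) g k in _ , _ , ext ch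

  chain-from-hub : ∀ {e} g → Linked true (true , e) g → (e ≡ true → StartsAtHub g) × ∃₂ λ b bs → Chain g (b ∷ bs)
  chain-from-hub g = parse (true , _) g

  -- Weighted sums over words.

  module Words (R : CommutativeRing 0ℓ 0ℓ) (c : CommutativeRing.Carrier R) (μ : ℕ → CommutativeRing.Carrier R) where

    open CommutativeRing R
    open PowerSeries R using (module BinomialTransform)
    open BinomialTransform c using (binomial; substitute; binomial-cong)
    open Fan R c μ using (hubF; runF; wheelF; run) renaming (hub to hubs)
    open import Relation.Binary.Reasoning.Setoid setoid
    open IntegerCoefficientSolver R

    Weight : Set
    Weight = Letter → Carrier

    Σᴸ : (Letter → Carrier) → Carrier
    Σᴸ f = f (true , true) + f (true , false) + (f (false , true) + f (false , false))

    Σᴸ-cong : ∀ {f g} → (∀ l → f l ≈ g l) → Σᴸ f ≈ Σᴸ g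
    Σᴸ-cong e = +-cong (+-cong (e _) (e _)) (+-cong (e _) (e _))

    -- The sum is over all words. `lin` and `cyc` vanish on words with an incompatible pair of
    -- neighbours, so no flatness condition obstructs summing one letter at a time.
    wordSum : List Weight → (List Letter → Carrier) → Carrier
    wordSum [] f = f []
    wordSum (κ ∷ κs) f = Σᴸ (λ l → κ l * wordSum κs (λ w → f (l ∷ w)))

    wordSum-cong : ∀ κs {f g} → (∀ w → f w ≈ g w) → wordSum κs f ≈ wordSum κs g
    wordSum-cong [] e = e []
    wordSum-cong (κ ∷ κs) e = Σᴸ-cong (λ l → *-congˡ {κ l} (wordSum-cong κs (λ w → e (l ∷ w))))

    wordSum-+ : ∀ κs f g → wordSum κs (λ w → f w + g w) ≈ wordSum κs f + wordSum κs g
    wordSum-+ [] f g = refl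
    wordSum-+ (κ ∷ κs) f g = trans (Σᴸ-cong (λ l → *-congˡ {κ l} (wordSum-+ κs (λ w → f (l ∷ w)) (λ w → g (l ∷ w)))))
      (solve 12 (λ a b c d x y z w x′ y′ z′ w′ → a :* (x :+ x′) :+ b :* (y :+ y′) :+ (c :* (z :+ z′) :+ d :* (w :+ w′))
          := (a :* x :+ b :* y :+ (c :* z :+ d :* w)) :+ (a :* x′ :+ b :* y′ :+ (c :* z′ :+ d :* w′))) refl
        (κ (true , true)) (κ (true , false)) (κ (false , true)) (κ (false , false)) _ _ _ _ _ _ _ _)

    wordSum-* : ∀ κs k f → wordSum κs (λ w → k * f w) ≈ k * wordSum κs f
    wordSum-* [] k f = refl
    wordSum-* (κ ∷ κs) k f = trans (Σᴸ-cong (λ l → *-congˡ {κ l} (wordSum-* κs k (λ w → f (l ∷ w)))))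
      (solve 9 (λ k a b c d x y z w → a :* (k :* x) :+ b :* (k :* y) :+ (c :* (k :* z) :+ d :* (k :* w))
          := k :* (a :* x :+ b :* y :+ (c :* z :+ d :* w))) refl k
        (κ (true , true)) (κ (true , false)) (κ (false , true)) (κ (false , false)) _ _ _ _)

    wordSum-0 : ∀ κs → wordSum κs (λ _ → 0#) ≈ 0#
    wordSum-0 κs = trans (wordSum-cong κs (λ _ → sym (zeroˡ 0#))) (trans (wordSum-* κs 0# (λ _ → 0#)) (zeroˡ _))

    wordSum-≈0 : ∀ κs {f} → (∀ w → f w ≈ 0#) → wordSum κs f ≈ 0#
    wordSum-≈0 κs e = trans (wordSum-cong κs e) (wordSum-0 κs)

    wordSum-++ : ∀ κs κs′ f → wordSum (κs ++ κs′) f ≈ wordSum κs (λ u → wordSum κs′ (λ v → f (u ++ v)))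
    wordSum-++ [] κs′ f = refl
    wordSum-++ (κ ∷ κs) κs′ f = Σᴸ-cong (λ l → *-congˡ {κ l} (wordSum-++ κs κs′ (λ w → f (l ∷ w))))

    wordSum-swap : ∀ κs κs′ (f : List Letter → List Letter → Carrier) → wordSum κs (λ u → wordSum κs′ (λ v → f u v)) ≈ wordSum κs′ (λ v → wordSum κs (λ u → f u v))
    wordSum-swap [] κs′ f = refl
    wordSum-swap (κ ∷ κs) κs′ f = begin
      Σᴸ (λ l → κ l * wordSum κs (λ u → wordSum κs′ (λ v → f (l ∷ u) v)))
        ≈⟨ Σᴸ-cong (λ l → trans (*-congˡ {κ l} (wordSum-swap κs κs′ (λ u → f (l ∷ u)))) (sym (wordSum-* κs′ (κ l) _))) ⟩
      Σᴸ (λ l → wordSum κs′ (λ v → κ l * wordSum κs (λ u → f (l ∷ u) v)))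
        ≈⟨ +-cong (sym (wordSum-+ κs′ _ _)) (sym (wordSum-+ κs′ _ _)) ⟩
      _ ≈⟨ sym (wordSum-+ κs′ _ _) ⟩
      wordSum κs′ (λ v → Σᴸ (λ l → κ l * wordSum κs (λ u → f (l ∷ u) v))) ∎

    -- Linear value of a word between two hub vertices, given the preceding letter and the
    -- number of blocks of the current run; it is zero unless consecutive letters are compatible.
    end : Letter → ℕ → Carrier
    end (true , e) a = if e then 1# else 0#
    end (false , e) a = if e then 0# else μ a

    step : Letter → ℕ → Letter → Carrier
    step l a (true , _) = end l a
    step (true , e) a (false , _) = if e then 0# else 1#
    step (false , e) a (false , _) = 1#

    lin : Letter → ℕ → List Letter → Carrier
    lin l a [] = end l a
    lin l a (l′ ∷ w) = step l a l′ * lin l′ (blocks l a l′) w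

    -- The cyclic value: restart the reading at the first letter at the hub; the argument u
    -- collects the letters before it.
    cyc : List Letter → List Letter → Carrier
    cyc u [] = 0#
    cyc u ((true , e) ∷ w) = lin (true , e) 0 (w ++ u)
    cyc u ((false , e) ∷ w) = cyc (u ++ (false , e) ∷ []) w

    -- A joined vertex closes the current run and resets the block count, so what precedes it has no
    -- influence on what follows.
    lin-++ : ∀ l a x {e} y → lin l a (x ++ (true , e) ∷ y) ≈ lin l a x * lin (true , e) 0 y
    lin-++ l a [] y = refl
    lin-++ l a (l′ ∷ x) y = trans (*-congˡ (lin-++ l′ (blocks l a l′) x y)) (sym (*-assoc _ _ _))

    cyc-moveʳ : ∀ {e} u w → cyc ((false , e) ∷ u) w ≈ cyc u (w ++ (false , e) ∷ [])
    cyc-moveʳ u [] = refl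
    cyc-moveʳ {e} u ((true , e′) ∷ w) = reflexive (≡.cong (lin (true , e′) 0) (≡.sym (++-assoc w ((false , e) ∷ []) u)))
    cyc-moveʳ u ((false , e′) ∷ w) = cyc-moveʳ (u ++ (false , e′) ∷ []) w

    -- If `w` has a joined vertex, both readings split the cycle at two joined vertices into the
    -- same two stretches, only in different order; by `lin-++` the values are products.
    lin-cyc : ∀ {e} u w → lin (true , e) 0 (u ++ w) ≈ cyc u (w ++ (true , e) ∷ [])
    lin-cyc {e} u [] = reflexive (≡.cong (lin (true , e) 0) (++-identityʳ u))
    lin-cyc {e} u ((true , e′) ∷ w) = begin
      lin (true , e) 0 (u ++ (true , e′) ∷ w)           ≈⟨ lin-++ (true , e) 0 u w ⟩
      lin (true , e) 0 u * lin (true , e′) 0 w          ≈⟨ *-comm _ _ ⟩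
      lin (true , e′) 0 w * lin (true , e) 0 u          ≈⟨ lin-++ (true , e′) 0 w u ⟨
      lin (true , e′) 0 (w ++ (true , e) ∷ u)           ≡⟨ ≡.cong (lin (true , e′) 0) (++-assoc w ((true , e) ∷ []) u) ⟨
      lin (true , e′) 0 ((w ++ (true , e) ∷ []) ++ u)   ∎
    lin-cyc {e} u ((false , e′) ∷ w) = trans (reflexive (≡.cong (lin (true , e) 0) (≡.sym (++-assoc u ((false , e′) ∷ []) w))))
      (lin-cyc (u ++ (false , e′) ∷ []) w)

    cyc-rotate₁ : ∀ l w → cyc [] (l ∷ w) ≈ cyc [] (w ++ l ∷ [])
    cyc-rotate₁ (true , e) w = trans (reflexive (≡.cong (lin (true , e) 0) (++-identityʳ w))) (lin-cyc [] w)
    cyc-rotate₁ (false , e) w = cyc-moveʳ [] w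

    cyc-rotate : ∀ u v → cyc [] (u ++ v) ≈ cyc [] (v ++ u)
    cyc-rotate [] v = reflexive (≡.cong (cyc []) (≡.sym (++-identityʳ v)))
    cyc-rotate (l ∷ u) v = begin
      cyc [] (l ∷ u ++ v)              ≈⟨ cyc-rotate₁ l (u ++ v) ⟩
      cyc [] ((u ++ v) ++ l ∷ [])      ≡⟨ ≡.cong (cyc []) (++-assoc u v (l ∷ [])) ⟩
      cyc [] (u ++ (v ++ l ∷ []))      ≈⟨ cyc-rotate u (v ++ l ∷ []) ⟩
      cyc [] ((v ++ l ∷ []) ++ u)      ≡⟨ ≡.cong (cyc []) (++-assoc v (l ∷ []) u) ⟩
      cyc [] (v ++ l ∷ u)              ∎

    wordSum-cyc-rotate : ∀ κs κs′ → wordSum (κs ++ κs′) (cyc []) ≈ wordSum (κs′ ++ κs) (cyc [])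
    wordSum-cyc-rotate κs κs′ = begin
      wordSum (κs ++ κs′) (cyc [])                                ≈⟨ wordSum-++ κs κs′ (cyc []) ⟩
      wordSum κs (λ u → wordSum κs′ (λ v → cyc [] (u ++ v)))      ≈⟨ wordSum-swap κs κs′ (λ u v → cyc [] (u ++ v)) ⟩
      wordSum κs′ (λ v → wordSum κs (λ u → cyc [] (u ++ v)))      ≈⟨ wordSum-cong κs′ (λ v → wordSum-cong κs (λ u → cyc-rotate u v)) ⟩
      wordSum κs′ (λ v → wordSum κs (λ u → cyc [] (v ++ u)))      ≈⟨ wordSum-++ κs′ κs (cyc []) ⟨
      wordSum (κs′ ++ κs) (cyc [])                                ∎

    -- c to the increase of the rank when the letter g of a flat grows to l (and 0 if it shrinks)
    above : Letter → Weight
    above (true , true) (true , e) = if e then 1# else 0#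
    above (true , false) (true , e) = 1#
    above (true , _) (false , _) = 0#
    above (false , true) (_ , e) = if e then 1# else 0#
    above (false , false) (false , false) = 1#
    above (false , false) _ = c

    -- For a free vertex already known not to be joined, as are those met before the first joined
    -- one.
    offHub : Weight
    offHub (true , _) = 0#
    offHub (false , e) = if e then c else 1#

    Lsum : Letter → ℕ → List Weight → Carrier
    Lsum l a κs = wordSum κs (lin l a)

    -- The edge out of the preceding vertex is still open. After a joined vertex both choices give
    -- the same rank; in `runSum` adding the edge raises it and costs `c`.
    hubSum : List Weight → Carrier
    hubSum κs = Lsum (true , true) 0 κs + Lsum (true , false) 0 κs

    runSum : ℕ → List Weight → Carrier
    runSum a κs = c * Lsum (false , true) a κs + Lsum (false , false) a κs

    Lsum-∷ : ∀ l a κ κs → Lsum l a (κ ∷ κs) ≈ Σᴸ (λ l′ → κ l′ * (step l a l′ * Lsum l′ (blocks l a l′) κs))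
    Lsum-∷ l a κ κs = Σᴸ-cong (λ l′ → *-congˡ {κ l′} (wordSum-* κs (step l a l′) (lin l′ (blocks l a l′))))

    hubSum-break : ∀ κs → hubSum (above (false , false) ∷ κs) ≈ c * hubSum κs + runSum 1 κs
    hubSum-break κs = trans (+-cong (Lsum-∷ (true , true) 0 (above (false , false)) κs) (Lsum-∷ (true , false) 0 (above (false , false)) κs))
      (solve 5 (λ c p q r s → (c :* (:1 :* p) :+ c :* (:1 :* q) :+ (c :* (:0 :* r) :+ :1 :* (:0 :* s)))
         :+ (c :* (:0 :* p) :+ c :* (:0 :* q) :+ (c :* (:1 :* r) :+ :1 :* (:1 :* s))) := c :* (p :+ q) :+ (c :* r :+ s)) refl c _ _ _ _)

    runSum-break : ∀ a κs → runSum a (above (false , false) ∷ κs) ≈ runSum (suc a) κs + c * runSum a κs + c * (μ a * hubSum κs)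
    runSum-break a κs = trans (+-cong (*-congˡ (Lsum-∷ (false , true) a (above (false , false)) κs)) (Lsum-∷ (false , false) a (above (false , false)) κs))
      (solve 8 (λ c m p q r s r′ s′ → c :* (c :* (:0 :* p) :+ c :* (:0 :* q) :+ (c :* (:1 :* r) :+ :1 :* (:1 :* s)))
         :+ (c :* (m :* p) :+ c :* (m :* q) :+ (c :* (:1 :* r′) :+ :1 :* (:1 :* s′)))
         := (c :* r′ :+ s′) :+ c :* (c :* r :+ s) :+ c :* (m :* (p :+ q))) refl c (μ a) _ _ _ _ _ _)

    hubSum-offHub : ∀ κs → hubSum (offHub ∷ κs) ≈ runSum 1 κs
    hubSum-offHub κs = trans (+-cong (Lsum-∷ (true , true) 0 offHub κs) (Lsum-∷ (true , false) 0 offHub κs))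
      (solve 5 (λ c p q r s → (:0 :* (:1 :* p) :+ :0 :* (:1 :* q) :+ (c :* (:0 :* r) :+ :1 :* (:0 :* s)))
         :+ (:0 :* (:0 :* p) :+ :0 :* (:0 :* q) :+ (c :* (:1 :* r) :+ :1 :* (:1 :* s))) := c :* r :+ s) refl c _ _ _ _)

    runSum-offHub : ∀ a κs → runSum a (offHub ∷ κs) ≈ c * runSum a κs + runSum (suc a) κs
    runSum-offHub a κs = trans (+-cong (*-congˡ (Lsum-∷ (false , true) a offHub κs)) (Lsum-∷ (false , false) a offHub κs))
      (solve 8 (λ c m p q r s r′ s′ → c :* (:0 :* (:0 :* p) :+ :0 :* (:0 :* q) :+ (c :* (:1 :* r) :+ :1 :* (:1 :* s)))
         :+ (:0 :* (m :* p) :+ :0 :* (m :* q) :+ (c :* (:1 :* r′) :+ :1 :* (:1 :* s′)))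
         := c :* (c :* r :+ s) :+ (c :* r′ :+ s′)) refl c (μ a) _ _ _ _ _ _)

    -- A rim edge of the smaller flat may be contracted.
    Lsum-contract : ∀ l a x κs → Lsum l a (above (false , true) ∷ above (false , x) ∷ κs) ≈ Lsum l a (above (false , x) ∷ κs)
    Lsum-contract l@(s , e) a x κs = trans (trans (Lsum-∷ l a (above (false , true)) (above (false , x) ∷ κs))
        (+-cong (+-cong (*-congˡ (*-congˡ (Lsum-∷ (true , true) 0 (above (false , x)) κs))) (zeroˡ _)) (+-cong (*-congˡ (*-congˡ (Lsum-∷ (false , true) (blocks l a (false , true)) (above (false , x)) κs))) (zeroˡ _))))
      (trans (go s e x) (sym (Lsum-∷ l a (above (false , x)) κs)))
      where
      go : ∀ s e x → let κ = above (false , x) in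
        1# * (step (s , e) a (true , true) * Σᴸ (λ l′ → κ l′ * (step (true , true) 0 l′ * Lsum l′ (blocks (true , true) 0 l′) κs))) + 0#
        + (1# * (step (s , e) a (false , true) * Σᴸ (λ l′ → κ l′ * (step (false , true) (blocks (s , e) a (false , true)) l′ * Lsum l′ (blocks (false , true) (blocks (s , e) a (false , true)) l′) κs))) + 0#)
        ≈ Σᴸ (λ l′ → κ l′ * (step (s , e) a l′ * Lsum l′ (blocks (s , e) a l′) κs))
      go true e x = solve 12 (λ k₁ k₂ k₃ k₄ p q r s r′ s′ t t′ →
           :1 :* (t :* (k₁ :* (:1 :* p) :+ k₂ :* (:1 :* q) :+ (k₃ :* (:0 :* r) :+ k₄ :* (:0 :* s)))) :+ :0
           :+ (:1 :* (t′ :* (k₁ :* (:0 :* p) :+ k₂ :* (:0 :* q) :+ (k₃ :* (:1 :* r′) :+ k₄ :* (:1 :* s′)))) :+ :0)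
           := k₁ :* (t :* p) :+ k₂ :* (t :* q) :+ (k₃ :* (t′ :* r′) :+ k₄ :* (t′ :* s′))) refl
           (above (false , x) (true , true)) (above (false , x) (true , false)) (above (false , x) (false , true)) (above (false , x) (false , false)) _ _ _ _ _ _ (if e then 1# else 0#) (if e then 0# else 1#)
      go false e x = solve 11 (λ k₁ k₂ k₃ k₄ p q r s r′ s′ t →
           :1 :* (t :* (k₁ :* (:1 :* p) :+ k₂ :* (:1 :* q) :+ (k₃ :* (:0 :* r) :+ k₄ :* (:0 :* s)))) :+ :0
           :+ (:1 :* (:1 :* (k₁ :* (:0 :* p) :+ k₂ :* (:0 :* q) :+ (k₃ :* (:1 :* r′) :+ k₄ :* (:1 :* s′)))) :+ :0)
           := k₁ :* (t :* p) :+ k₂ :* (t :* q) :+ (k₃ :* (:1 :* r′) :+ k₄ :* (:1 :* s′))) refl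
           (above (false , x) (true , true)) (above (false , x) (true , false)) (above (false , x) (false , true)) (above (false , x) (false , false)) _ _ _ _ _ _ (if e then 0# else μ a)

    hubSum-contract : ∀ x κs → hubSum (above (false , true) ∷ above (false , x) ∷ κs) ≈ hubSum (above (false , x) ∷ κs)
    hubSum-contract x κs = +-cong (Lsum-contract (true , true) 0 x κs) (Lsum-contract (true , false) 0 x κs)

    runSum-contract : ∀ a x κs → runSum a (above (false , true) ∷ above (false , x) ∷ κs) ≈ runSum a (above (false , x) ∷ κs)
    runSum-contract a x κs = +-cong (*-congˡ (Lsum-contract (false , true) a x κs)) (Lsum-contract (false , false) a x κs)

    fromHub : Bool → List Weight → Carrier
    fromHub e κs = if e then Lsum (true , true) 0 κs else hubSum κs

    -- If the edge lies in the smaller flat, the second term of `hubSum` is zero: the next vertex is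
    -- joined too, and an absent edge between joined vertices is incompatible.
    fromHub≈hubSum : ∀ e g → (e ≡ true → StartsAtHub g) → fromHub e (map above g) ≈ hubSum (map above g)
    fromHub≈hubSum false g s = refl
    fromHub≈hubSum true g s with s ≡.refl
    ... | [] = sym (+-identityʳ _)
    ... | hub {true} {g′} = sym (trans (+-congˡ (trans (Lsum-∷ (true , false) 0 (above (true , true)) (map above g′))
        (solve 4 (λ p q r s → :1 :* (:0 :* p) :+ :0 :* (:0 :* q) :+ (:0 :* (:1 :* r) :+ :0 :* (:1 :* s)) := :0) refl _ _ _ _))) (+-identityʳ _))
    ... | hub {false} {g′} = sym (trans (+-congˡ (trans (Lsum-∷ (true , false) 0 (above (true , false)) (map above g′))
        (solve 4 (λ p q r s → :1 :* (:0 :* p) :+ :1 :* (:0 :* q) :+ (:0 :* (:1 :* r) :+ :0 :* (:1 :* s)) := :0) refl _ _ _ _))) (+-identityʳ _))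

    hubSum-hub : ∀ e κs → hubSum (above (true , e) ∷ κs) ≈ fromHub e κs
    hubSum-hub true κs = trans (+-cong (Lsum-∷ (true , true) 0 (above (true , true)) κs) (Lsum-∷ (true , false) 0 (above (true , true)) κs))
      (solve 4 (λ p q r s → (:1 :* (:1 :* p) :+ :0 :* (:1 :* q) :+ (:0 :* (:0 :* r) :+ :0 :* (:0 :* s)))
         :+ (:1 :* (:0 :* p) :+ :0 :* (:0 :* q) :+ (:0 :* (:1 :* r) :+ :0 :* (:1 :* s))) := p) refl _ _ _ _)
    hubSum-hub false κs = trans (+-cong (Lsum-∷ (true , true) 0 (above (true , false)) κs) (Lsum-∷ (true , false) 0 (above (true , false)) κs))
      (solve 4 (λ p q r s → (:1 :* (:1 :* p) :+ :1 :* (:1 :* q) :+ (:0 :* (:0 :* r) :+ :0 :* (:0 :* s)))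
         :+ (:1 :* (:0 :* p) :+ :1 :* (:0 :* q) :+ (:0 :* (:1 :* r) :+ :0 :* (:1 :* s))) := p :+ q) refl _ _ _ _)

    runSum-hub : ∀ a e κs → runSum a (above (true , e) ∷ κs) ≈ μ a * fromHub e κs
    runSum-hub a true κs = trans (+-cong (*-congˡ (Lsum-∷ (false , true) a (above (true , true)) κs)) (Lsum-∷ (false , false) a (above (true , true)) κs))
      (solve 8 (λ c m p q r s r′ s′ → c :* (:1 :* (:0 :* p) :+ :0 :* (:0 :* q) :+ (:0 :* (:1 :* r) :+ :0 :* (:1 :* s)))
         :+ (:1 :* (m :* p) :+ :0 :* (m :* q) :+ (:0 :* (:1 :* r′) :+ :0 :* (:1 :* s′))) := m :* p) refl c (μ a) _ _ _ _ _ _)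
    runSum-hub a false κs = trans (+-cong (*-congˡ (Lsum-∷ (false , true) a (above (true , false)) κs)) (Lsum-∷ (false , false) a (above (true , false)) κs))
      (solve 8 (λ c m p q r s r′ s′ → c :* (:1 :* (:0 :* p) :+ :1 :* (:0 :* q) :+ (:0 :* (:1 :* r) :+ :0 :* (:1 :* s)))
         :+ (:1 :* (m :* p) :+ :1 :* (m :* q) :+ (:0 :* (:1 :* r′) :+ :0 :* (:1 :* s′))) := m :* (p :+ q)) refl c (μ a) _ _ _ _ _ _)

    Πhub : List ℕ → Carrier
    Πhub = foldr (λ b z → hubs b * z) 1#

    module _ (μ₀ : μ 0 ≈ 1#) where

      -- Contracting a flat with spokes leaves a direct sum of fans, one for each run with its
      -- blocks as rim vertices, so the sum over larger flats factors. Reading block by block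
      -- reproduces the recursions of `hubF` and `runF`.
      hubSum-chain : ∀ {g b bs} → Chain g (b ∷ bs) → hubSum (map above g) ≈ hubs b * Πhub bs
      runSum-chain : ∀ {g b bs} → Chain g (b ∷ bs) → ∀ a → runSum a (map above g) ≈ run a b * Πhub bs
      hubSum-chain nil = trans (+-identityʳ _) (trans (sym μ₀) (sym (*-identityʳ _)))
      hubSum-chain (hub {e} {g} s ch) = trans (hubSum-hub e (map above g)) (trans (fromHub≈hubSum e g s)
        (trans (hubSum-chain′ ch) (trans (sym (*-identityˡ _)) (*-congʳ (sym μ₀)))))
        where
        hubSum-chain′ : ∀ {g bs} → Chain g bs → hubSum (map above g) ≈ Πhub bs
        hubSum-chain′ {bs = []} ()
        hubSum-chain′ {bs = b ∷ bs} ch = hubSum-chain ch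
      hubSum-chain (brk {g} {b} {bs} ch) = trans (hubSum-break (map above g)) (trans (+-cong (*-congˡ (hubSum-chain ch)) (runSum-chain ch 1))
        (solve 4 (λ c h r p → c :* (h :* p) :+ r :* p := (c :* h :+ r) :* p) refl c _ _ _))
      hubSum-chain (ext {x} {g} ch) = trans (hubSum-contract x (map above g)) (hubSum-chain ch)
      runSum-chain nil a = trans (+-congʳ (zeroʳ c)) (trans (+-identityˡ _) (trans (reflexive (≡.cong μ (≡.sym (ℕ.+-identityʳ a)))) (sym (*-identityʳ _))))
      runSum-chain (hub {e} {g} {b ∷ bs} s ch) a = trans (runSum-hub a e (map above g)) (trans (*-congˡ (trans (fromHub≈hubSum e g s) (hubSum-chain ch)))
        (*-congʳ (reflexive (≡.cong μ (≡.sym (ℕ.+-identityʳ a))))))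
      runSum-chain (brk {g} {b} {bs} ch) a = trans (runSum-break a (map above g)) (trans (+-cong (+-cong (runSum-chain ch (suc a)) (*-congˡ (runSum-chain ch a))) (*-congˡ (*-congˡ (hubSum-chain ch))))
        (solve 6 (λ c m r r′ h p → r :* p :+ c :* (r′ :* p) :+ c :* (m :* (h :* p)) := (r :+ c :* r′ :+ c :* (m :* h)) :* p) refl c (μ a) _ _ _ _))
      runSum-chain (ext {x} {g} ch) a = trans (runSum-contract a x (map above g)) (runSum-chain ch a)

      hubSum-offHubs : ∀ i → hubSum (replicate i offHub) ≈ substitute μ i
      runSum-offHubs : ∀ i a → runSum a (replicate i offHub) ≈ binomial (λ j → μ (a ℕ.+ j)) i
      hubSum-offHubs zero = trans (+-identityʳ _) (sym μ₀)
      hubSum-offHubs (suc i) = trans (hubSum-offHub (replicate i offHub)) (runSum-offHubs i 1)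
      runSum-offHubs zero a = trans (+-congʳ (zeroʳ c)) (trans (+-identityˡ _) (reflexive (≡.cong μ (≡.sym (ℕ.+-identityʳ a)))))
      runSum-offHubs (suc i) a = trans (runSum-offHub a (replicate i offHub)) (+-cong (*-congˡ (runSum-offHubs i a))
        (trans (runSum-offHubs i (suc a)) (binomial-cong (λ j → reflexive (≡.cong μ (≡.sym (ℕ.+-suc a j)))) i)))

      -- The letters appended at the end are the vertices passed before the first joined one,
      -- carried to the back of the linear reading.
      hubSum-run : ∀ {g b} → Run g b → ∀ i → hubSum (map above g ++ replicate i offHub) ≈ hubF i b
      runSum-run : ∀ {g b} → Run g b → ∀ i a → runSum a (map above g ++ replicate i offHub) ≈ runF i b a
      hubSum-run nil i = hubSum-offHubs i
      hubSum-run (brk {g} r) i = trans (hubSum-break (map above g ++ replicate i offHub)) (+-cong (*-congˡ (hubSum-run r i)) (runSum-run r i 1))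
      hubSum-run (ext {x} {g} r) i = trans (hubSum-contract x (map above g ++ replicate i offHub)) (hubSum-run r i)
      runSum-run nil i a = runSum-offHubs i a
      runSum-run (brk {g} r) i a = trans (runSum-break a (map above g ++ replicate i offHub))
        (+-cong (+-cong (runSum-run r i (suc a)) (*-congˡ (runSum-run r i a))) (*-congˡ (*-congˡ (hubSum-run r i))))
      runSum-run (ext {x} {g} r) i a = trans (runSum-contract a x (map above g ++ replicate i offHub)) (runSum-run r i a)

      -- A flat with a spoke: cut the rim open there.
      wordSum-cyc-hub : ∀ u e v {b bs} → (e ≡ true → StartsAtHub (v ++ u)) → Chain (v ++ u) (b ∷ bs) →
        wordSum (map above (u ++ (true , e) ∷ v)) (cyc []) ≈ hubs b * Πhub bs
      wordSum-cyc-hub u e v {b} {bs} s ch = begin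
        wordSum (map above (u ++ (true , e) ∷ v)) (cyc [])              ≡⟨ ≡.cong (λ κs → wordSum κs (cyc [])) (map-++ above u ((true , e) ∷ v)) ⟩
        wordSum (map above u ++ map above ((true , e) ∷ v)) (cyc [])    ≈⟨ wordSum-cyc-rotate (map above u) (map above ((true , e) ∷ v)) ⟩
        wordSum (map above ((true , e) ∷ v) ++ map above u) (cyc [])    ≡⟨ ≡.cong (λ κs → wordSum (above (true , e) ∷ κs) (cyc [])) (map-++ above v u) ⟨
        wordSum (above (true , e) ∷ map above (v ++ u)) (cyc [])        ≈⟨ first e ⟩
        fromHub e (map above (v ++ u))                                  ≈⟨ fromHub≈hubSum e (v ++ u) s ⟩
        hubSum (map above (v ++ u))                                     ≈⟨ hubSum-chain ch ⟩
        hubs b * Πhub bs                                                ∎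
        where
        κs = map above (v ++ u)
        open-up : ∀ e′ → wordSum κs (λ w → cyc [] ((true , e′) ∷ w)) ≈ Lsum (true , e′) 0 κs
        open-up e′ = wordSum-cong κs (λ w → reflexive (≡.cong (lin (true , e′) 0) (++-identityʳ w)))
        first : ∀ e → wordSum (above (true , e) ∷ κs) (cyc []) ≈ fromHub e κs
        first true = trans (solve 4 (λ p q r s → :1 :* p :+ :0 :* q :+ (:0 :* r :+ :0 :* s) := p) refl _ _ _ _) (open-up true)
        first false = trans (solve 4 (λ p q r s → :1 :* p :+ :1 :* q :+ (:0 :* r :+ :0 :* s) := p :+ q) refl _ _ _ _) (+-cong (open-up true) (open-up false))

    -- The word is followed by a joined vertex, and a present edge to it from a vertex off the hub
    -- is incompatible.
    end-01 : ∀ l a x → lin l a (x ++ (false , true) ∷ []) ≈ 0#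
    end-01 l a [] = zeroʳ _
    end-01 l a (l′ ∷ x) = trans (*-congˡ (end-01 l′ (blocks l a l′) x)) (zeroʳ _)

    lin-contract : ∀ l a x y z → lin l a (x ++ (false , true) ∷ (false , y) ∷ z) ≈ lin l a (x ++ (false , y) ∷ z)
    lin-contract (true , e) a [] y z = *-congˡ (*-identityˡ _)
    lin-contract (false , e) a [] y z = *-congˡ (*-identityˡ _)
    lin-contract l a (l′ ∷ x) y z = *-congˡ (lin-contract l′ (blocks l a l′) x y z)

    cyc-contract : ∀ u y v w → cyc (u ++ (false , true) ∷ (false , y) ∷ v) w ≈ cyc (u ++ (false , y) ∷ v) w
    cyc-contract u y v [] = refl
    cyc-contract u y v ((true , e) ∷ w) = begin
      lin (true , e) 0 (w ++ (u ++ (false , true) ∷ (false , y) ∷ v))   ≡⟨ ≡.cong (lin (true , e) 0) (++-assoc w u _) ⟨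
      lin (true , e) 0 ((w ++ u) ++ (false , true) ∷ (false , y) ∷ v)   ≈⟨ lin-contract (true , e) 0 (w ++ u) y v ⟩
      lin (true , e) 0 ((w ++ u) ++ (false , y) ∷ v)                    ≡⟨ ≡.cong (lin (true , e) 0) (++-assoc w u _) ⟩
      lin (true , e) 0 (w ++ (u ++ (false , y) ∷ v))                    ∎
    cyc-contract u y v ((false , e) ∷ w) = begin
      cyc ((u ++ (false , true) ∷ (false , y) ∷ v) ++ (false , e) ∷ []) w  ≡⟨ ≡.cong (λ x → cyc x w) (++-assoc u _ ((false , e) ∷ [])) ⟩
      cyc (u ++ (false , true) ∷ (false , y) ∷ v ++ (false , e) ∷ []) w    ≈⟨ cyc-contract u y (v ++ (false , e) ∷ []) w ⟩
      cyc (u ++ (false , y) ∷ v ++ (false , e) ∷ []) w                     ≡⟨ ≡.cong (λ x → cyc x w) (++-assoc u _ ((false , e) ∷ [])) ⟨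
      cyc ((u ++ (false , y) ∷ v) ++ (false , e) ∷ []) w                   ∎

    -- An edge of the smaller flat lies in all larger ones; its ends are on the same side of the
    -- hub, and one of them may be deleted.
    wordSum-cyc-contract : ∀ u x κs → wordSum (above (false , true) ∷ above (false , x) ∷ κs) (cyc u) ≈ wordSum (above (false , x) ∷ κs) (cyc u)
    wordSum-cyc-contract u x κs = begin
      wordSum (above (false , true) ∷ κ ∷ κs) (cyc u)
        -- Only two letters lie above `(false , true)`, and each tolerates only successors on its
        -- own side; `onHub` and `offHub′` are the indicators of the sides.
        ≈⟨ +-cong (+-cong (*-congˡ (Σᴸ-cong first)) (zeroˡ _)) (+-cong (*-congˡ (Σᴸ-cong second)) (zeroˡ _)) ⟩
      1# * Σᴸ (λ l → κ l * (onHub l * S l)) + 0# + (1# * Σᴸ (λ l → κ l * (offHub′ l * S l)) + 0#)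
        ≈⟨ solve 8 (λ k₁ k₂ k₃ k₄ p q r s → :1 :* (k₁ :* (:1 :* p) :+ k₂ :* (:1 :* q) :+ (k₃ :* (:0 :* r) :+ k₄ :* (:0 :* s))) :+ :0
               :+ (:1 :* (k₁ :* (:0 :* p) :+ k₂ :* (:0 :* q) :+ (k₃ :* (:1 :* r) :+ k₄ :* (:1 :* s))) :+ :0)
               := k₁ :* p :+ k₂ :* q :+ (k₃ :* r :+ k₄ :* s)) refl
             (κ (true , true)) (κ (true , false)) (κ (false , true)) (κ (false , false)) (S (true , true)) (S (true , false)) (S (false , true)) (S (false , false)) ⟩
      wordSum (κ ∷ κs) (cyc u) ∎
      where
      κ : Weight
      κ = above (false , x)
      S onHub offHub′ : Letter → Carrier
      S l = wordSum κs (λ w → cyc u (l ∷ w))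
      onHub (s , _) = if s then 1# else 0#
      offHub′ (s , _) = if s then 0# else 1#
      first : ∀ l → κ l * wordSum κs (λ w → cyc u ((true , true) ∷ l ∷ w)) ≈ κ l * (onHub l * S l)
      first (true , e) = *-congˡ (wordSum-* κs 1# _)
      first (false , e) = *-congˡ (trans (wordSum-* κs 0# _) (trans (zeroˡ _) (sym (zeroˡ _))))
      second : ∀ l → κ l * wordSum κs (λ w → cyc u ((false , true) ∷ l ∷ w)) ≈ κ l * (offHub′ l * S l)
      second (true , e) = *-congˡ (trans (wordSum-≈0 κs (λ w → trans (reflexive (≡.cong (lin (true , e) 0) (≡.sym (++-assoc w u _)))) (end-01 (true , e) 0 (w ++ u)))) (sym (zeroˡ _)))
      second (false , e) = *-congˡ (trans (wordSum-cong κs (λ w → trans (reflexive (≡.cong (λ x → cyc x w) (++-assoc u ((false , true) ∷ []) ((false , e) ∷ [])))) (cyc-contract u e [] w))) (sym (*-identityˡ _)))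

    offHubs-snoc : ∀ i → replicate i offHub ++ offHub ∷ [] ≡ replicate (suc i) offHub
    offHubs-snoc zero = ≡.refl
    offHubs-snoc (suc i) = ≡.cong (offHub ∷_) (offHubs-snoc i)

    -- The next free block is either joined, which starts a linear reading with the `i` earlier
    -- vertices at its end, or off the hub, which makes them i + 1. This is the recursion of
    -- `wheelF`.
    wordSum-cyc-run : μ 0 ≈ 1# → ∀ {g b} → Run g b → ∀ i → wordSum (replicate i offHub) (λ u → wordSum (map above g) (cyc u)) ≈ wheelF i b
    wordSum-cyc-run μ₀ nil i = wordSum-0 (replicate i offHub)
    wordSum-cyc-run μ₀ (ext {x} {g} r) i = trans (wordSum-cong (replicate i offHub) (λ u → wordSum-cyc-contract u x (map above g))) (wordSum-cyc-run μ₀ r i)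
    wordSum-cyc-run μ₀ (brk {g} {b} r) i = begin
      wordSum off (λ u → c * S₁ u + c * S₂ u + (c * S₃ u + 1# * S₄ u))
        -- Zero terms are inserted for joined letters, so that the second part becomes a sum over
        -- one more `offHub` letter.
        ≈⟨ wordSum-cong off (λ u → solve 5 (λ c p q r s → c :* p :+ c :* q :+ (c :* r :+ :1 :* s)
                := c :* (p :+ q) :+ (:0 :* p :+ :0 :* q :+ (c :* r :+ :1 :* s))) refl c (S₁ u) (S₂ u) (S₃ u) (S₄ u)) ⟩
      wordSum off (λ u → c * (S₁ u + S₂ u) + (0# * S₁ u + 0# * S₂ u + (c * S₃ u + 1# * S₄ u)))
        ≈⟨ wordSum-+ off _ _ ⟩
      wordSum off (λ u → c * (S₁ u + S₂ u)) + wordSum off (λ u → 0# * S₁ u + 0# * S₂ u + (c * S₃ u + 1# * S₄ u))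
        ≈⟨ +-cong (trans (wordSum-* off c _) (*-congˡ (trans (wordSum-+ off S₁ S₂) (+-cong (merge true) (merge false))))) (wordSum-cong off λ u → +-congʳ (+-cong (trans (zeroˡ _) (sym (zeroˡ _))) (trans (zeroˡ _) (sym (zeroˡ _))))) ⟩
      c * hubSum (map above g ++ off) + wordSum off (λ u → wordSum (offHub ∷ []) (λ l → wordSum (map above g) (cyc (u ++ l))))
        ≈⟨ +-cong (*-congˡ (hubSum-run μ₀ r i)) (sym (wordSum-++ off (offHub ∷ []) (λ u → wordSum (map above g) (cyc u)))) ⟩
      c * hubF i b + wordSum (off ++ offHub ∷ []) (λ u → wordSum (map above g) (cyc u))
        ≈⟨ +-congˡ (trans (reflexive (≡.cong (λ κs → wordSum κs (λ u → wordSum (map above g) (cyc u))) (offHubs-snoc i))) (wordSum-cyc-run μ₀ r (suc i))) ⟩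
      c * hubF i b + wheelF (suc i) b ∎
      where
      off = replicate i offHub
      S₁ S₂ S₃ S₄ : List Letter → Carrier
      S₁ u = wordSum (map above g) (λ w → cyc u ((true , true) ∷ w))
      S₂ u = wordSum (map above g) (λ w → cyc u ((true , false) ∷ w))
      S₃ u = wordSum (map above g) (λ w → cyc u ((false , true) ∷ w))
      S₄ u = wordSum (map above g) (λ w → cyc u ((false , false) ∷ w))
      merge : ∀ e → wordSum off (λ u → wordSum (map above g) (λ w → cyc u ((true , e) ∷ w))) ≈ Lsum (true , e) 0 (map above g ++ off)
      merge e = trans (wordSum-swap off (map above g) (λ u w → lin (true , e) 0 (w ++ u))) (sym (wordSum-++ (map above g) off (lin (true , e) 0)))

    -- The value on flats without spokes. Contraction there leaves a wheel, and `f` is read at the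
    -- number of its rim vertices.
    rim : (ℕ → Carrier) → ℕ → List Letter → Carrier
    rim f j [] = f j
    rim f j ((true , _) ∷ w) = 0#
    rim f j ((false , e) ∷ w) = rim f (if e then j else suc j) w

    -- Larger flats without spokes arise by filling in any of the missing edges at the price `c`
    -- each: a binomial sum.
    wordSum-rim : ∀ f {g b} → OffHub g b → ∀ j → wordSum (map above g) (rim f j) ≈ binomial (λ i → f (j ℕ.+ i)) b
    wordSum-rim f nil j = reflexive (≡.cong f (≡.sym (ℕ.+-identityʳ j)))
    wordSum-rim f (ext {g} o) j = trans (+-cong (+-cong (*-congˡ (wordSum-0 (map above g))) (zeroˡ _)) (+-cong (*-congˡ (wordSum-rim f o j)) (zeroˡ _)))
      (solve 1 (λ x → :1 :* :0 :+ :0 :+ (:1 :* x :+ :0) := x) refl _)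
    wordSum-rim f (brk {g} {b} o) j = trans (+-cong (+-cong (*-congˡ (wordSum-0 (map above g))) (*-congˡ (wordSum-0 (map above g)))) (+-cong (*-congˡ (wordSum-rim f o j))
        (*-congˡ (trans (wordSum-rim f o (suc j)) (binomial-cong (λ i → reflexive (≡.cong f (≡.sym (ℕ.+-suc j i)))) b)))))
      (solve 3 (λ c x y → c :* :0 :+ c :* :0 :+ (c :* x :+ :1 :* y) := c :* x :+ y) refl c _ _)

    wordSum-rim-hub : ∀ f u e v j → wordSum (map above (u ++ (true , e) ∷ v)) (rim f j) ≈ 0#
    wordSum-rim-hub f [] true v j = trans (+-cong (+-cong (*-congˡ (wordSum-0 (map above v))) (*-congˡ (wordSum-0 (map above v)))) (+-cong (zeroˡ _) (zeroˡ _)))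
      (solve 1 (λ c → :1 :* :0 :+ :0 :* :0 :+ (:0 :+ :0) := :0) refl c)
    wordSum-rim-hub f [] false v j = trans (+-cong (+-cong (*-congˡ (wordSum-0 (map above v))) (*-congˡ (wordSum-0 (map above v)))) (+-cong (zeroˡ _) (zeroˡ _)))
      (solve 1 (λ c → :1 :* :0 :+ :1 :* :0 :+ (:0 :+ :0) := :0) refl c)
    wordSum-rim-hub f (l ∷ u) e v j = trans (+-cong (+-cong (*-congˡ (wordSum-0 (map above (u ++ (true , e) ∷ v)))) (*-congˡ (wordSum-0 (map above (u ++ (true , e) ∷ v)))))
        (+-cong (*-congˡ (wordSum-rim-hub f u e v j)) (*-congˡ (wordSum-rim-hub f u e v (suc j)))))
      (solve 4 (λ p q r s → p :* :0 :+ q :* :0 :+ (r :* :0 :+ s :* :0) := :0) refl _ _ _ _)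

-- Degrees and reversal of the values of words.

module WordValues where

  open ClosedForm hiding (T)
  open Support
  open Reversal
  open Substitutions
  open Symmetry
  open LetterWords
  open import Data.Bool.Base using (T)
  open import Data.List.Properties using (++-identityʳ; ++-assoc; map-++)
  open import Data.Nat.Base using (_≤_; _<_)
  open import Data.Product.Base using (_×_)
  open import Data.Unit.Base using (tt)

  module Wₜ = Words polyRing Poly.X μ
  module W₁ = Words polyRing ℙ.1# μ̄

  -- degree less than m / 2, or constant if m = 0
  BelowHalf : ℕ → PolyQ → Set
  BelowHalf m f = ∀ k → 0 < k → m ≤ 2 ℕ.* k → f k ≡ 0ℚ

  belowHalf⇒degree : ∀ {m f} → BelowHalf m f → Poly.DegreeAtMost m f
  belowHalf⇒degree {m} h k m<k = h k (ℕ.≤-trans (s≤s z≤n) m<k) (ℕ.≤-trans (ℕ.<⇒≤ m<k) (ℕ.m≤m+n k (k ℕ.+ 0)))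

  belowHalf-⊠ : ∀ {m n f g} → BelowHalf m f → BelowHalf n g → BelowHalf (m ℕ.+ n) (f Poly.⊠ g)
  belowHalf-⊠ {m} {n} {f} {g} hf hg k k>0 le = ≡.trans (Poly.⊠-Σ< f g k) (Σ<-vanish (suc k) _ (λ { i (s≤s i≤k) → term i i≤k }))
    where
    term : ∀ i → i ≤ k → f i ℚ.* g (k ∸ i) ≡ 0ℚ
    term i i≤k with m ℕ.≤? 2 ℕ.* i | i ℕ.≟ 0
    ... | yes m≤2i | no i≢0 = ≡.trans (≡.cong (ℚ._* g (k ∸ i)) (hf i (ℕ.n≢0⇒n>0 i≢0) m≤2i)) (ℚ.*-zeroˡ (g (k ∸ i)))
    -- Here `m` is zero, and the whole bound falls on `g`.
    ... | yes m≤2i | yes ≡.refl = ≡.trans (≡.cong (f 0 ℚ.*_) (hg k k>0 (ℕ.≤-trans (ℕ.m≤n+m n m) le))) (ℚ.*-zeroʳ (f 0))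
    ... | no m≰2i | _ = ≡.trans (≡.cong (f i ℚ.*_) (hg (k ∸ i) (ℕ.m<n⇒0<n∸m (ℕ.*-cancelˡ-< 2 i k (ℕ.<-≤-trans (ℕ.≰⇒> m≰2i) (ℕ.≤-trans (ℕ.m≤m+n m n) le)))) n≤)) (ℚ.*-zeroʳ (f i))
      where
      n≤ : n ≤ 2 ℕ.* (k ∸ i)
      n≤ = ≡.subst (n ≤_) (≡.sym (ℕ.*-distribˡ-∸ 2 k i)) (ℕ.m+n≤o⇒m≤o∸n n (≡.subst (_≤ 2 ℕ.* k) (ℕ.+-comm (2 ℕ.* i) n) (ℕ.≤-trans (ℕ.+-monoˡ-≤ n (ℕ.<⇒≤ (ℕ.≰⇒> m≰2i))) le)))

  belowHalf-0 : ∀ {m} → BelowHalf m ℙ.0#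
  belowHalf-0 k _ _ = ≡.refl

  belowHalf-1 : ∀ {m} → BelowHalf m ℙ.1#
  belowHalf-1 (suc k) _ _ = ≡.refl

  belowHalf-μ : ∀ a → BelowHalf a (μ a)
  belowHalf-μ zero k@(suc _) k>0 _ = ≡.trans (ℚ.+-identityˡ _) (X⊠-zero motzkin k)
  belowHalf-μ (suc a) k k>0 le = ≡.trans (ℚ.+-identityˡ _) (≡.trans (X⊠-suc motzkin a k) (supported-motzkin a k le))

  -- The number of blocks in the run that is closed, hence the rank of its fan and the degree at
  -- which its polynomial has to be reversed.
  endSize : Letter → ℕ → ℕ
  endSize (true , _) a = 0
  endSize (false , _) a = a

  stepSize : Letter → ℕ → Letter → ℕ
  stepSize l a (true , _) = endSize l a
  stepSize l a (false , _) = 0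

  size : Letter → ℕ → List Letter → ℕ
  size l a [] = endSize l a
  size l a (l′ ∷ w) = stepSize l a l′ ℕ.+ size l′ (blocks l a l′) w

  end-belowHalf : ∀ l a → BelowHalf (endSize l a) (Wₜ.end l a)
  end-belowHalf (true , true) a = belowHalf-1
  end-belowHalf (true , false) a = belowHalf-0
  end-belowHalf (false , true) a = belowHalf-0
  end-belowHalf (false , false) a = belowHalf-μ a

  step-belowHalf : ∀ l a l′ → BelowHalf (stepSize l a l′) (Wₜ.step l a l′)
  step-belowHalf l a (true , _) = end-belowHalf l a
  step-belowHalf (true , true) a (false , _) = belowHalf-0
  step-belowHalf (true , false) a (false , _) = belowHalf-1
  step-belowHalf (false , e) a (false , _) = belowHalf-1

  lin-belowHalf : ∀ l a w → BelowHalf (size l a w) (Wₜ.lin l a w)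
  lin-belowHalf l a [] = end-belowHalf l a
  lin-belowHalf l a (l′ ∷ w) = belowHalf-⊠ {stepSize l a l′} {size l′ (blocks l a l′) w} {Wₜ.step l a l′} {Wₜ.lin l′ (blocks l a l′) w} (step-belowHalf l a l′) (lin-belowHalf l′ (blocks l a l′) w)

  reverse-0 : ∀ r → Poly.reverse r ℙ.0# ℙ.≈ ℙ.0#
  reverse-0 r k with k ≤ᵇ r
  ... | true = ≡.refl
  ... | false = ≡.refl

  reverse-0-1 : Poly.reverse 0 ℙ.1# ℙ.≈ ℙ.1#
  reverse-0-1 zero = ≡.refl
  reverse-0-1 (suc k) = ≡.refl

  end-reverse : ∀ l a → Poly.reverse (endSize l a) (Wₜ.end l a) ℙ.≈ W₁.end l a
  end-reverse (true , true) a = reverse-0-1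
  end-reverse (true , false) a = reverse-0 0
  end-reverse (false , true) a = reverse-0 a
  end-reverse (false , false) a = ℙ.refl

  step-reverse : ∀ l a l′ → Poly.reverse (stepSize l a l′) (Wₜ.step l a l′) ℙ.≈ W₁.step l a l′
  step-reverse l a (true , _) = end-reverse l a
  step-reverse (true , true) a (false , _) = reverse-0 0
  step-reverse (true , false) a (false , _) = reverse-0-1
  step-reverse (false , e) a (false , _) = reverse-0-1

  -- The value is a product over the closed runs; reversal at the total size distributes because
  -- every factor obeys its own bound.
  lin-reverse : ∀ l a w → Poly.reverse (size l a w) (Wₜ.lin l a w) ℙ.≈ W₁.lin l a w
  lin-reverse l a [] = end-reverse l a
  lin-reverse l a (l′ ∷ w) = ℙ.trans (Poly.reverse-⊠ (stepSize l a l′) (size l′ (blocks l a l′) w) (Wₜ.step l a l′) (Wₜ.lin l′ (blocks l a l′) w)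
      (belowHalf⇒degree (step-belowHalf l a l′)) (belowHalf⇒degree (lin-belowHalf l′ (blocks l a l′) w)))
    (ℙ.*-cong (step-reverse l a l′) (lin-reverse l′ (blocks l a l′) w))

  isBreak : Letter → ℕ
  isBreak (false , false) = 1
  isBreak _ = 0

  breaks : List Letter → ℕ
  breaks [] = 0
  breaks (l ∷ w) = isBreak l ℕ.+ breaks w

  breaks-++ : ∀ u v → breaks (u ++ v) ≡ breaks u ℕ.+ breaks v
  breaks-++ [] v = ≡.refl
  breaks-++ (l ∷ u) v = ≡.trans (≡.cong (isBreak l ℕ.+_) (breaks-++ u v)) (≡.sym (ℕ.+-assoc (isBreak l) (breaks u) (breaks v)))

  private
    -- `blocks` counts a block at its first vertex, `breaks` at its last. Inside a block the two
    -- therefore differ by one.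
    pending : Letter → ℕ → ℕ
    pending (true , _) a = 0
    pending (false , false) a = a
    pending (false , true) a = a ∸ 1

    size-linked : ∀ l a w → (proj₁ l ≡ false → 0 < a) → Linked true l w → size l a w ≡ pending l a ℕ.+ breaks w
    size-linked (true , true) a [] _ k = ≡.refl
    size-linked (false , false) a [] _ k = ≡.sym (ℕ.+-identityʳ a)
    size-linked (true , true) a ((true , e) ∷ w) _ (c , k) = size-linked (true , e) 0 w (λ ()) k
    size-linked (false , false) a ((true , e) ∷ w) _ (c , k) = ≡.cong (a ℕ.+_) (size-linked (true , e) 0 w (λ ()) k)
    size-linked (true , false) a ((false , false) ∷ w) _ (c , k) = size-linked (false , false) 1 w (λ _ → s≤s z≤n) k
    size-linked (true , false) a ((false , true) ∷ w) _ (c , k) = size-linked (false , true) 1 w (λ _ → s≤s z≤n) k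
    size-linked (false , false) a ((false , false) ∷ w) _ (c , k) = ≡.trans (size-linked (false , false) (suc a) w (λ _ → s≤s z≤n) k) (≡.sym (ℕ.+-suc a (breaks w)))
    size-linked (false , false) a ((false , true) ∷ w) _ (c , k) = size-linked (false , true) (suc a) w (λ _ → s≤s z≤n) k
    size-linked (false , true) (suc a) ((false , false) ∷ w) pos (c , k) = ≡.trans (size-linked (false , false) (suc a) w pos k) (≡.sym (ℕ.+-suc a (breaks w)))
    size-linked (false , true) (suc a) ((false , true) ∷ w) pos (c , k) = size-linked (false , true) (suc a) w pos k
    size-linked (false , true) zero (_ ∷ w) pos (c , k) with () ← pos ≡.refl

    linked-or-zero : ∀ l a w → Linked true l w ⊎ (Wₜ.lin l a w ℙ.≈ ℙ.0#)
    linked-or-zero (true , true) a [] = inj₁ tt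
    linked-or-zero (true , false) a [] = inj₂ ℙ.refl
    linked-or-zero (false , true) a [] = inj₂ ℙ.refl
    linked-or-zero (false , false) a [] = inj₁ tt
    linked-or-zero l a (l′ ∷ w) with first l l′
      where
      first : ∀ l l′ → T (compatible l (proj₁ l′)) ⊎ (∀ a → Wₜ.step l a l′ ℙ.≈ ℙ.0#)
      first (true , true) (true , _) = inj₁ tt
      first (true , true) (false , _) = inj₂ (λ _ → ℙ.refl)
      first (true , false) (true , _) = inj₂ (λ _ → ℙ.refl)
      first (true , false) (false , _) = inj₁ tt
      first (false , true) (true , _) = inj₂ (λ _ → ℙ.refl)
      first (false , false) (true , _) = inj₁ tt
      first (false , _) (false , _) = inj₁ tt
    ... | inj₂ z = inj₂ (ℙ.trans (ℙ.*-congʳ {Wₜ.lin l′ (blocks l a l′) w} (z a)) (ℙ.zeroˡ (Wₜ.lin l′ (blocks l a l′) w)))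
    ... | inj₁ c with linked-or-zero l′ (blocks l a l′) w
    ...   | inj₁ k = inj₁ (c , k)
    ...   | inj₂ z = inj₂ (ℙ.trans (ℙ.*-congˡ {Wₜ.step l a l′} z) (ℙ.zeroʳ (Wₜ.step l a l′)))

  data HubSplit : List Letter → Set where
    off : ∀ {w b} → OffHub w b → HubSplit w
    at  : ∀ u e v {b} → OffHub u b → HubSplit (u ++ (true , e) ∷ v)

  hubSplit : ∀ w → HubSplit w
  hubSplit [] = off nil
  hubSplit ((true , e) ∷ w) = at [] e w nil
  hubSplit ((false , e) ∷ w) with hubSplit w
  hubSplit ((false , false) ∷ w) | off o = off (brk o)
  hubSplit ((false , true) ∷ w) | off o = off (ext o)
  hubSplit ((false , false) ∷ .(u ++ (true , e) ∷ v)) | at u e v o = at ((false , false) ∷ u) e v (brk o)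
  hubSplit ((false , true) ∷ .(u ++ (true , e) ∷ v)) | at u e v o = at ((false , true) ∷ u) e v (ext o)

  offHub-breaks : ∀ {w b} → OffHub w b → breaks w ≡ b
  offHub-breaks nil = ≡.refl
  offHub-breaks (brk o) = ≡.cong suc (offHub-breaks o)
  offHub-breaks (ext o) = offHub-breaks o

  offHub-++ : ∀ {u b v c} → OffHub u b → OffHub v c → OffHub (u ++ v) (b ℕ.+ c)
  offHub-++ nil o = o
  offHub-++ (brk p) o = brk (offHub-++ p o)
  offHub-++ (ext p) o = ext (offHub-++ p o)

  module CycAt {c : PolyQ} {ν : Series} where
    open Words polyRing c ν

    cyc-off : ∀ {w b} → OffHub w b → ∀ u → cyc u w ℙ.≈ ℙ.0#
    cyc-off nil u = ℙ.refl
    cyc-off (brk o) u = cyc-off o _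
    cyc-off (ext o) u = cyc-off o _

    cyc-at : ∀ {u b} → OffHub u b → ∀ x e v → cyc x (u ++ (true , e) ∷ v) ≡ lin (true , e) 0 (v ++ (x ++ u))
    cyc-at nil x e v = ≡.cong (λ y → lin (true , e) 0 (v ++ y)) (≡.sym (++-identityʳ x))
    cyc-at {.((false , false) ∷ _)} (brk {g} o) x e v = ≡.trans (cyc-at o (x ++ (false , false) ∷ []) e v) (≡.cong (λ y → lin (true , e) 0 (v ++ y)) (++-assoc x ((false , false) ∷ []) g))
    cyc-at {.((false , true) ∷ _)} (ext {g} o) x e v = ≡.trans (cyc-at o (x ++ (false , true) ∷ []) e v) (≡.cong (λ y → lin (true , e) 0 (v ++ y)) (++-assoc x ((false , true) ∷ []) g))

    rim-off : ∀ f {w b} → OffHub w b → ∀ j → rim f j w ≡ f (j ℕ.+ b)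
    rim-off f nil j = ≡.cong f (≡.sym (ℕ.+-identityʳ j))
    rim-off f (brk {b = b} o) j = ≡.trans (rim-off f o (suc j)) (≡.cong f (≡.sym (ℕ.+-suc j b)))
    rim-off f (ext o) j = rim-off f o j

    rim-at : ∀ f {u b} → OffHub u b → ∀ e v j → rim f j (u ++ (true , e) ∷ v) ≡ ℙ.0#
    rim-at f nil e v j = ≡.refl
    rim-at f (brk o) e v j = rim-at f o e v (suc j)
    rim-at f (ext o) e v j = rim-at f o e v j

  breaks-at : ∀ u e v → breaks (v ++ u) ≡ breaks (u ++ (true , e) ∷ v)
  breaks-at u e v = ≡.trans (breaks-++ v u) (≡.trans (ℕ.+-comm (breaks v) (breaks u)) (≡.sym (breaks-++ u ((true , e) ∷ v))))

  module _ {u b} (o : OffHub u b) (e : Bool) (v : List Letter) where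

    private
      w : List Letter
      w = u ++ (true , e) ∷ v

    cyc-linked-or-zero : Linked true (true , e) (v ++ u) ⊎ (Wₜ.cyc [] w ℙ.≈ ℙ.0#)
    cyc-linked-or-zero with linked-or-zero (true , e) 0 (v ++ u)
    ... | inj₁ k = inj₁ k
    ... | inj₂ z = inj₂ (ℙ.trans (ℙ.reflexive (CycAt.cyc-at o [] e v)) z)

    private
      size≡ : Linked true (true , e) (v ++ u) → size (true , e) 0 (v ++ u) ≡ breaks w
      size≡ k = ≡.trans (size-linked (true , e) 0 (v ++ u) (λ ()) k) (breaks-at u e v)

    cyc-belowHalf : Linked true (true , e) (v ++ u) → BelowHalf (breaks w) (Wₜ.cyc [] w)
    cyc-belowHalf k i i>0 le = ≡.trans (≡.cong (λ f → f i) (CycAt.cyc-at o [] e v)) (lin-belowHalf (true , e) 0 (v ++ u) i i>0 (≡.subst (_≤ 2 ℕ.* i) (≡.sym (size≡ k)) le))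

    cyc-reverse : Linked true (true , e) (v ++ u) → Poly.reverse (breaks w) (Wₜ.cyc [] w) ℙ.≈ W₁.cyc [] w
    cyc-reverse k = ℙ.trans (ℙ.reflexive (≡.cong₂ Poly.reverse (≡.sym (size≡ k)) (CycAt.cyc-at o [] e v)))
      (ℙ.trans (lin-reverse (true , e) 0 (v ++ u)) (ℙ.reflexive (≡.sym (CycAt.cyc-at o [] e v))))

    cyc₁-zero : Wₜ.cyc [] w ℙ.≈ ℙ.0# → W₁.cyc [] w ℙ.≈ ℙ.0#
    cyc₁-zero z = ℙ.trans (ℙ.reflexive (CycAt.cyc-at o [] e v)) (ℙ.trans (ℙ.sym (lin-reverse (true , e) 0 (v ++ u)))
      (ℙ.trans (Poly.reverse-cong (size (true , e) 0 (v ++ u)) (ℙ.trans (ℙ.reflexive (≡.sym (CycAt.cyc-at o [] e v))) z)) (reverse-0 (size (true , e) 0 (v ++ u)))))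

  ends-at-break : ∀ {w b} → OffHub w b → Run (w ++ (false , false) ∷ []) (suc b)
  ends-at-break nil = brk nil
  ends-at-break (brk o) = brk (ends-at-break o)
  ends-at-break (ext nil) = ext (brk nil)
  ends-at-break (ext (brk o)) = ext (ends-at-break (brk o))
  ends-at-break (ext (ext o)) = ext (ends-at-break (ext o))

  offHub-split : ∀ {w b} → OffHub w (suc b) → ∃₂ λ u v → w ≡ u ++ (false , false) ∷ v × ∃ λ c → OffHub (v ++ u) c × c ≡ b
  offHub-split (brk {g} {b} o) = [] , g , ≡.refl , b , ≡.subst (λ x → OffHub x b) (≡.sym (++-identityʳ g)) o , ≡.refl
  offHub-split (ext {g} o) with offHub-split o
  ... | u , v , ≡.refl , c , o′ , e = (false , true) ∷ u , v , ≡.refl , insert o o′ e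
    where
    insert : ∀ {b c} → OffHub (u ++ (false , false) ∷ v) (suc b) → OffHub (v ++ u) c → c ≡ b → ∃ λ c → OffHub (v ++ (false , true) ∷ u) c × c ≡ b
    insert {b} _ o′ ≡.refl = let (x , y , ox , oy , p) = unglue v o′ in x ℕ.+ y , offHub-++ ox (ext oy) , p
      where
      unglue : ∀ v {u b} → OffHub (v ++ u) b → ∃₂ λ x y → OffHub v x × OffHub u y × x ℕ.+ y ≡ b
      unglue [] o = 0 , _ , nil , o , ≡.refl
      unglue (_ ∷ v) (brk o) = let (x , y , p , q , e) = unglue v o in suc x , y , brk p , q , ≡.cong suc e
      unglue (_ ∷ v) (ext o) = let (x , y , p , q , e) = unglue v o in x , y , ext p , q , e

  module _ (c : PolyQ) (ν : Series) (ν₀ : ν 0 ℙ.≈ ℙ.1#) where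
    open Words polyRing c ν
    private module F = Fan polyRing c ν

    -- `wordSum-cyc-run` needs a word that ends with a missing edge; the cyclic sum does not change
    -- when such an edge is rotated to the end.
    wordSum-cyc-off : ∀ {g b} → OffHub g (suc b) → wordSum (map above g) (cyc []) ℙ.≈ F.wheelF 0 (suc b)
    wordSum-cyc-off {g} {b} o with offHub-split o
    ... | u , v , ≡.refl , _ , o′ , ≡.refl =
      ℙ.trans (ℙ.reflexive (≡.cong (λ κs → wordSum κs (cyc [])) (map-++ above u ((false , false) ∷ v))))
      -- The first rotation brings the missing edge to the front, the second takes it to the back.
      (ℙ.trans (wordSum-cyc-rotate (map above u) (above (false , false) ∷ map above v))
      (ℙ.trans (wordSum-cyc-rotate (above (false , false) ∷ []) (map above v ++ map above u))
      (ℙ.trans (ℙ.reflexive (≡.cong (λ κs → wordSum κs (cyc [])) (≡.trans (≡.cong (_++ above (false , false) ∷ []) (≡.sym (map-++ above v u))) (≡.sym (map-++ above (v ++ u) ((false , false) ∷ []))))))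
      (wordSum-cyc-run ν₀ (ends-at-break o′) 0))))

    -- Contraction of edges leaves a single letter. Of the two words above it only the one with the
    -- spoke has a cyclic value, and this is 1.
    wordSum-cyc-full : ∀ {l g} → OffHub (l ∷ g) 0 → wordSum (map above (l ∷ g)) (cyc []) ℙ.≈ ℙ.1#
    wordSum-cyc-full (ext nil) = λ k → ≡.trans (≡.cong₂ ℚ._+_ (≡.cong₂ ℚ._+_ (ℙ.*-identityˡ ℙ.1# k) (ℙ.zeroˡ (lin (true , false) 0 []) k)) (≡.cong₂ ℚ._+_ (ℙ.zeroʳ ℙ.1# k) (ℙ.zeroʳ ℙ.0# k)))
      (≡.trans (ℚ.+-identityʳ _) (ℚ.+-identityʳ _))
    wordSum-cyc-full {g = l ∷ g} (ext (ext o)) = ℙ.trans (wordSum-cyc-contract [] true (map above g)) (wordSum-cyc-full (ext o))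

-- Sums over subsets and the renumbering of ground sets.

module SubsetSums where

  open ClosedForm using (ℚ-ring)
  open import Data.Bool.ListAction using (all)
  open import Data.Fin.Subset using (Subset; ⊤; ⊥; ⁅_⁆; _∪_; _⊆_; ∣_∣; ∁; ⋃; _∈_; _∉_)
  open import Data.Fin.Subset.Properties
  open import Data.Integer.Base as ℤ using (ℤ; 0ℤ; 1ℤ)
  import Data.Integer.Properties as ℤ
  open import Data.List.Base using (filter; allFin; tabulate; foldr)
  open import Data.List.Properties using (map-tabulate; map-∘)
  open import Data.List.Membership.Propositional using () renaming (_∈_ to _∈ᴸ_)
  open import Data.List.Membership.Propositional.Properties using (∈-filter⁺; ∈-filter⁻; ∈-tabulate⁺; ∈-lookup)
  import Data.List.Relation.Unary.Any as Any
  open import Data.List.Relation.Unary.Any.Properties using (lookup-index)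
  open import Data.List.Relation.Unary.All as All using ([]; _∷_)
  open import Data.List.Relation.Unary.AllPairs using ([]; _∷_)
  open import Data.List.Relation.Unary.Unique.Propositional using (Unique)
  open import Data.List.Relation.Unary.Unique.Propositional.Properties using (allFin⁺; filter⁺)
  open import Data.Nat.Base using (_≡ᵇ_)
  open import Data.Nat.DivMod using ([m+n]%n≡m%n)
  open import Data.Product.Base using (_×_)
  open import Data.Rational using (toℚᵘ)
  import Data.Rational.Unnormalised as ℚᵘ
  import Data.Rational.Unnormalised.Properties as ℚᵘ
  open import Data.Vec.Base as Vec using ([]; _∷_; lookup)
  open import Data.Vec.Properties using ([]=⇒lookup; lookup⇒[]=)

  ι : ℤ → ℚ
  ι z = z ℚ./ 1

  toℚᵘ-ι : ∀ z → toℚᵘ (ι z) ℚᵘ.≃ ℚᵘ.mkℚᵘ z 0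
  toℚᵘ-ι z = ℚ.toℚᵘ-fromℚᵘ (ℚᵘ.mkℚᵘ z 0)

  ι-+ : ∀ a b → ι (a ℤ.+ b) ≡ ι a ℚ.+ ι b
  ι-+ a b = ℚ.toℚᵘ-injective (ℚᵘ.≃-trans (toℚᵘ-ι (a ℤ.+ b)) (ℚᵘ.≃-trans (ℚᵘ.*≡* (≡.cong (ℤ._* 1ℤ) (≡.sym (≡.cong₂ ℤ._+_ (ℤ.*-identityʳ a) (ℤ.*-identityʳ b)))))
    (ℚᵘ.≃-sym (ℚᵘ.≃-trans (ℚ.toℚᵘ-homo-+ (ι a) (ι b)) (ℚᵘ.+-cong (toℚᵘ-ι a) (toℚᵘ-ι b))))))

  ι-* : ∀ a b → ι (a ℤ.* b) ≡ ι a ℚ.* ι b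
  ι-* a b = ℚ.toℚᵘ-injective (ℚᵘ.≃-trans (toℚᵘ-ι (a ℤ.* b)) (ℚᵘ.≃-sym (ℚᵘ.≃-trans (ℚ.toℚᵘ-homo-* (ι a) (ι b)) (ℚᵘ.*-cong (toℚᵘ-ι a) (toℚᵘ-ι b)))))

  -- Conditions are indicators, so that every sum runs over all subsets and sums can be exchanged.
  [_]_ : Bool → ℚ → ℚ
  [ b ] x = if b then x else 0ℚ

  infixr 8 [_]_

  Σₛ : ∀ {m} → (Subset m → ℚ) → ℚ
  Σₛ {zero} f = f []
  Σₛ {suc m} f = Σₛ (λ X → f (true ∷ X)) ℚ.+ Σₛ (λ X → f (false ∷ X))

  Σₛ-cong : ∀ {m} {f g : Subset m → ℚ} → (∀ X → f X ≡ g X) → Σₛ f ≡ Σₛ g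
  Σₛ-cong {zero} e = e []
  Σₛ-cong {suc m} e = ≡.cong₂ ℚ._+_ (Σₛ-cong (λ X → e (true ∷ X))) (Σₛ-cong (λ X → e (false ∷ X)))

  Σₛ-+ : ∀ {m} (f g : Subset m → ℚ) → Σₛ (λ X → f X ℚ.+ g X) ≡ Σₛ f ℚ.+ Σₛ g
  Σₛ-+ {zero} f g = ≡.refl
  Σₛ-+ {suc m} f g = ≡.trans (≡.cong₂ ℚ._+_ (Σₛ-+ (λ X → f (true ∷ X)) (λ X → g (true ∷ X))) (Σₛ-+ (λ X → f (false ∷ X)) (λ X → g (false ∷ X))))
    (solve 4 (λ a b c d → (a :+ b) :+ (c :+ d) := (a :+ c) :+ (b :+ d)) ≡.refl (Σₛ (λ X → f (true ∷ X))) (Σₛ (λ X → g (true ∷ X))) (Σₛ (λ X → f (false ∷ X))) (Σₛ (λ X → g (false ∷ X))))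
    where open IntegerCoefficientSolver ℚ-ring

  Σₛ-* : ∀ {m} k (f : Subset m → ℚ) → Σₛ (λ X → k ℚ.* f X) ≡ k ℚ.* Σₛ f
  Σₛ-* {zero} k f = ≡.refl
  Σₛ-* {suc m} k f = ≡.trans (≡.cong₂ ℚ._+_ (Σₛ-* k (λ X → f (true ∷ X))) (Σₛ-* k (λ X → f (false ∷ X)))) (≡.sym (ℚ.*-distribˡ-+ k _ _))

  Σₛ-0 : ∀ {m} → Σₛ {m} (λ _ → 0ℚ) ≡ 0ℚ
  Σₛ-0 {zero} = ≡.refl
  Σₛ-0 {suc m} = ≡.cong₂ ℚ._+_ (Σₛ-0 {m}) (Σₛ-0 {m})

  Σₛ-swap : ∀ {m n} (f : Subset m → Subset n → ℚ) → Σₛ (λ X → Σₛ (f X)) ≡ Σₛ (λ Y → Σₛ (λ X → f X Y))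
  Σₛ-swap {zero} f = ≡.refl
  Σₛ-swap {suc m} f = ≡.trans (≡.cong₂ ℚ._+_ (Σₛ-swap (λ X → f (true ∷ X))) (Σₛ-swap (λ X → f (false ∷ X)))) (≡.sym (Σₛ-+ (λ Y → Σₛ (λ X → f (true ∷ X) Y)) (λ Y → Σₛ (λ X → f (false ∷ X) Y))))

  sumList : {A : Set} → (A → ℚ) → List A → ℚ
  sumList = sumWith ℚ._+_ 0ℚ

  sumList-++ : {A : Set} (f : A → ℚ) (xs ys : List A) → sumList f (xs ++ ys) ≡ sumList f xs ℚ.+ sumList f ys
  sumList-++ f [] ys = ≡.sym (ℚ.+-identityˡ _)
  sumList-++ f (x ∷ xs) ys = ≡.trans (≡.cong (f x ℚ.+_) (sumList-++ f xs ys)) (≡.sym (ℚ.+-assoc (f x) (sumList f xs) (sumList f ys)))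

  sumList-map : {A B : Set} (f : B → ℚ) (g : A → B) (xs : List A) → sumList f (map g xs) ≡ sumList (f ∘ g) xs
  sumList-map f g [] = ≡.refl
  sumList-map f g (x ∷ xs) = ≡.cong (f (g x) ℚ.+_) (sumList-map f g xs)

  sumList-allSubsets : ∀ m (f : Subset m → ℚ) → sumList f (allSubsets m) ≡ Σₛ f
  sumList-allSubsets zero f = ℚ.+-identityʳ _
  sumList-allSubsets (suc m) f = ≡.trans (sumList-++ f (map (true ∷_) (allSubsets m)) _)
    (≡.cong₂ ℚ._+_ (≡.trans (sumList-map f (true ∷_) (allSubsets m)) (sumList-allSubsets m _)) (≡.trans (sumList-map f (false ∷_) (allSubsets m)) (sumList-allSubsets m _)))

  sumList-filter : {A : Set} (f : A → ℚ) (b : A → Bool) (xs : List A) → sumList f (filter (λ x → b x 𝔹.≟ true) xs) ≡ sumList (λ x → [ b x ] f x) xs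
  sumList-filter f b [] = ≡.refl
  sumList-filter f b (x ∷ xs) with b x
  ... | true = ≡.cong (f x ℚ.+_) (sumList-filter f b xs)
  ... | false = ≡.trans (sumList-filter f b xs) (≡.sym (ℚ.+-identityˡ _))

  ι-sum : {A : Set} (f : A → ℤ) (xs : List A) → ι (sumWith ℤ._+_ 0ℤ f xs) ≡ sumList (ι ∘ f) xs
  ι-sum f [] = ≡.refl
  ι-sum f (x ∷ xs) = ≡.trans (ι-+ (f x) _) (≡.cong (ι (f x) ℚ.+_) (ι-sum f xs))

  sumᶻ-at : {A : Set} (f : A → PolyZ) (xs : List A) (k : ℕ) → sumᶻ f xs k ≡ sumWith ℤ._+_ 0ℤ (λ a → f a k) xs
  sumᶻ-at f [] k = ≡.refl
  sumᶻ-at f (x ∷ xs) k = ≡.cong (λ z → f x k ℤ.+ z) (sumᶻ-at f xs k)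

  members-∷ : ∀ {m} b (X : Subset m) → members (b ∷ X) ≡ (if b then zero ∷ map suc (members X) else map suc (members X))
  members-∷ {m} b X = ≡.trans (head b) (≡.cong (λ xs → if b then zero ∷ xs else xs) tail)
    where
    P? : ∀ {m} (X : Subset m) i → Dec (lookup X i ≡ true)
    P? X i = lookup X i 𝔹.≟ true
    head : ∀ b → members (b ∷ X) ≡ (if b then zero ∷ filter (P? (b ∷ X)) (tabulate suc) else filter (P? (b ∷ X)) (tabulate suc))
    head true = ≡.refl
    head false = ≡.refl
    filter-suc : ∀ xs → filter (P? (b ∷ X)) (map suc xs) ≡ map suc (filter (P? X) xs)
    filter-suc [] = ≡.refl
    filter-suc (x ∷ xs) with lookup X x
    ... | true = ≡.cong (suc x ∷_) (filter-suc xs)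
    ... | false = filter-suc xs
    tail : filter (P? (b ∷ X)) (tabulate suc) ≡ map suc (members X)
    tail = ≡.trans (≡.cong (filter (P? (b ∷ X))) (≡.sym (map-tabulate id suc))) (filter-suc (allFin m))

  image-∷ : ∀ {m} x (xs : List (Fin m)) b Y → image (x ∷ xs) (b ∷ Y) ≡ (if b then ⁅ x ⁆ ∪ image xs Y else image xs Y)
  image-∷ x xs true Y = ≡.trans (≡.cong (⋃ ∘ map (λ i → ⁅ List.lookup (x ∷ xs) i ⁆)) (members-∷ true Y)) (≡.cong (λ ys → ⁅ x ⁆ ∪ ⋃ ys) (≡.sym (map-∘ (members Y))))
  image-∷ x xs false Y = ≡.trans (≡.cong (⋃ ∘ map (λ i → ⁅ List.lookup (x ∷ xs) i ⁆)) (members-∷ false Y)) (≡.cong ⋃ (≡.sym (map-∘ (members Y))))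

  -- Mediates between subsets of the renumbered ground sets of `localization` and `contraction` and
  -- subsets of the original one, by recursion on the list of retained elements.
  imageSum : ∀ {m} → List (Fin m) → (Subset m → ℚ) → ℚ
  imageSum [] g = g ⊥
  imageSum (x ∷ xs) g = imageSum xs (λ Z → g (⁅ x ⁆ ∪ Z)) ℚ.+ imageSum xs g

  Σₛ-image : ∀ {m} (xs : List (Fin m)) (g : Subset m → ℚ) → Σₛ (λ Y → g (image xs Y)) ≡ imageSum xs g
  Σₛ-image [] g = ≡.refl
  Σₛ-image (x ∷ xs) g = ≡.cong₂ ℚ._+_
    (≡.trans (Σₛ-cong (λ Y → ≡.cong g (image-∷ x xs true Y))) (Σₛ-image xs (λ Z → g (⁅ x ⁆ ∪ Z))))
    (≡.trans (Σₛ-cong (λ Y → ≡.cong g (image-∷ x xs false Y))) (Σₛ-image xs g))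

  imageSum-cong : ∀ {m} (xs : List (Fin m)) {f g : Subset m → ℚ} → (∀ Z → f Z ≡ g Z) → imageSum xs f ≡ imageSum xs g
  imageSum-cong [] e = e ⊥
  imageSum-cong (x ∷ xs) e = ≡.cong₂ ℚ._+_ (imageSum-cong xs (λ Z → e (⁅ x ⁆ ∪ Z))) (imageSum-cong xs e)

  imageSum-suc : ∀ {m} (xs : List (Fin m)) (g : Subset (suc m) → ℚ) → imageSum (map suc xs) g ≡ imageSum xs (λ Z → g (false ∷ Z))
  imageSum-true : ∀ {m} (xs : List (Fin m)) (g : Subset (suc m) → ℚ) → imageSum (map suc xs) (λ Z → g (⁅ zero ⁆ ∪ Z)) ≡ imageSum xs (λ Z → g (true ∷ Z))
  imageSum-suc [] g = ≡.refl
  imageSum-suc (x ∷ xs) g = ≡.cong₂ ℚ._+_ (imageSum-suc xs (λ Z → g (⁅ suc x ⁆ ∪ Z))) (imageSum-suc xs g)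
  imageSum-true xs g = ≡.trans (imageSum-suc xs (λ Z → g (⁅ zero ⁆ ∪ Z))) (imageSum-cong xs (λ Z → ≡.cong (λ W → g (true ∷ W)) (∪-identityˡ Z)))

  _⊆ᵇ_ : ∀ {m} → Subset m → Subset m → Bool
  [] ⊆ᵇ [] = true
  (b ∷ X) ⊆ᵇ (c ∷ Y) = (not b ∨ c) ∧ (X ⊆ᵇ Y)

  infix 4 _⊆ᵇ_

  imageSum-members : ∀ {m} (F : Subset m) (g : Subset m → ℚ) → imageSum (members F) g ≡ Σₛ (λ X → [ X ⊆ᵇ F ] g X)
  imageSum-members [] g = ≡.refl
  imageSum-members (true ∷ F) g = ≡.trans (≡.cong (λ xs → imageSum xs g) (members-∷ true F))
    (≡.cong₂ ℚ._+_ (≡.trans (imageSum-true (members F) g) (imageSum-members F (λ Z → g (true ∷ Z)))) (≡.trans (imageSum-suc (members F) g) (imageSum-members F (λ Z → g (false ∷ Z)))))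
  imageSum-members {suc m} (false ∷ F) g = ≡.trans (≡.cong (λ xs → imageSum xs g) (members-∷ false F))
    (≡.trans (imageSum-suc (members F) g) (≡.trans (imageSum-members F (λ Z → g (false ∷ Z))) (≡.sym (≡.trans (≡.cong (ℚ._+ Σₛ (λ X → [ X ⊆ᵇ F ] g (false ∷ X))) (Σₛ-0 {m})) (ℚ.+-identityˡ _)))))

  -- A superset of `F` is the union of `F` with a unique subset of its complement.
  Σₛ-∁-∪ : ∀ {m} (F : Subset m) (g : Subset m → ℚ) → Σₛ (λ Z → [ Z ⊆ᵇ ∁ F ] g (Z ∪ F)) ≡ Σₛ (λ X → [ F ⊆ᵇ X ] g X)
  Σₛ-∁-∪ [] g = ≡.refl
  Σₛ-∁-∪ {suc m} (true ∷ F) g = ≡.trans (≡.cong₂ ℚ._+_ (Σₛ-0 {m}) (Σₛ-∁-∪ F (λ Z → g (true ∷ Z)))) (≡.trans (ℚ.+-identityˡ (Σₛ (λ X → [ F ⊆ᵇ X ] g (true ∷ X)))) (≡.sym (≡.trans (≡.cong (Σₛ (λ X → [ F ⊆ᵇ X ] g (true ∷ X)) ℚ.+_) (Σₛ-0 {m})) (ℚ.+-identityʳ (Σₛ (λ X → [ F ⊆ᵇ X ] g (true ∷ X)))))))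
  Σₛ-∁-∪ (false ∷ F) g = ≡.cong₂ ℚ._+_ (Σₛ-∁-∪ F (λ Z → g (true ∷ Z))) (Σₛ-∁-∪ F (λ Z → g (false ∷ Z)))

  ⊆ᵇ-sound : ∀ {m} (X Y : Subset m) → (X ⊆ᵇ Y) ≡ true → X ⊆ Y
  ⊆ᵇ-sound (true ∷ X) (true ∷ Y) e Vec.here = Vec.here
  ⊆ᵇ-sound (true ∷ X) (true ∷ Y) e (Vec.there x∈) = Vec.there (⊆ᵇ-sound X Y e x∈)
  ⊆ᵇ-sound (false ∷ X) (c ∷ Y) e (Vec.there x∈) = Vec.there (⊆ᵇ-sound X Y e x∈)

  ⊆ᵇ-complete : ∀ {m} (X Y : Subset m) → X ⊆ Y → (X ⊆ᵇ Y) ≡ true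
  ⊆ᵇ-complete [] [] s = ≡.refl
  ⊆ᵇ-complete (true ∷ X) (c ∷ Y) s with s Vec.here
  ... | Vec.here = ⊆ᵇ-complete X Y (drop-∷-⊆ s)
  ⊆ᵇ-complete (false ∷ X) (c ∷ Y) s = ⊆ᵇ-complete X Y (drop-∷-⊆ s)

  bool-≡ : ∀ {a b : Bool} → (a ≡ true → b ≡ true) → (b ≡ true → a ≡ true) → a ≡ b
  bool-≡ {true} {b} f g = ≡.sym (f ≡.refl)
  bool-≡ {false} {true} f g = g ≡.refl
  bool-≡ {false} {false} f g = ≡.refl

  ∈-members⁻ : ∀ {m} (X : Subset m) {i} → i ∈ᴸ members X → i ∈ X
  ∈-members⁻ X i∈ = lookup⇒[]= _ X (proj₂ (∈-filter⁻ (λ i → lookup X i 𝔹.≟ true) {xs = allFin _} i∈))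

  ∈-members⁺ : ∀ {m} (X : Subset m) {i} → i ∈ X → i ∈ᴸ members X
  ∈-members⁺ X {i} i∈ = ∈-filter⁺ (λ i → lookup X i 𝔹.≟ true) (∈-tabulate⁺ i) ([]=⇒lookup i∈)

  members-unique : ∀ {m} (X : Subset m) → Unique (members X)
  members-unique {m} X = filter⁺ (λ i → lookup X i 𝔹.≟ true) (allFin⁺ m)

  lookup-injective : {A : Set} {xs : List A} → Unique xs → ∀ i j → List.lookup xs i ≡ List.lookup xs j → i ≡ j
  lookup-injective (p ∷ u) zero zero e = ≡.refl
  lookup-injective {xs = x ∷ xs} (p ∷ u) zero (suc j) e with () ← All.lookup p (∈-lookup j) e
  lookup-injective {xs = x ∷ xs} (p ∷ u) (suc i) zero e with () ← All.lookup p (∈-lookup i) (≡.sym e)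
  lookup-injective (p ∷ u) (suc i) (suc j) e = ≡.cong suc (lookup-injective u i j e)

  ∈-image⁺ : ∀ {m} (xs : List (Fin m)) Y {j} → j ∈ Y → List.lookup xs j ∈ image xs Y
  ∈-image⁺ (x ∷ xs) (true ∷ Y) Vec.here = ≡.subst (x ∈_) (≡.sym (image-∷ x xs true Y)) (x∈p∪q⁺ (inj₁ (x∈⁅x⁆ x)))
  ∈-image⁺ (x ∷ xs) (true ∷ Y) (Vec.there j∈) = ≡.subst (_ ∈_) (≡.sym (image-∷ x xs true Y)) (x∈p∪q⁺ (inj₂ (∈-image⁺ xs Y j∈)))
  ∈-image⁺ (x ∷ xs) (false ∷ Y) (Vec.there j∈) = ≡.subst (_ ∈_) (≡.sym (image-∷ x xs false Y)) (∈-image⁺ xs Y j∈)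

  ∈-image⁻ : ∀ {m} (xs : List (Fin m)) Y {i} → i ∈ image xs Y → ∃ λ j → j ∈ Y × List.lookup xs j ≡ i
  ∈-image⁻ [] [] i∈ with () ← ∉⊥ i∈
  ∈-image⁻ (x ∷ xs) (true ∷ Y) i∈ with x∈p∪q⁻ ⁅ x ⁆ (image xs Y) (≡.subst (_ ∈_) (image-∷ x xs true Y) i∈)
  ... | inj₁ i∈x = zero , Vec.here , ≡.sym (x∈⁅y⁆⇒x≡y x i∈x)
  ... | inj₂ i∈Y = let (j , j∈ , e) = ∈-image⁻ xs Y i∈Y in suc j , Vec.there j∈ , e
  ∈-image⁻ (x ∷ xs) (false ∷ Y) i∈ = let (j , j∈ , e) = ∈-image⁻ xs Y (≡.subst (_ ∈_) (image-∷ x xs false Y) i∈) in suc j , Vec.there j∈ , e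

  ∣⁅x⁆∪p∣≡1+∣p∣ : ∀ {m} x (p : Subset m) → x ∉ p → ∣ ⁅ x ⁆ ∪ p ∣ ≡ suc ∣ p ∣
  ∣⁅x⁆∪p∣≡1+∣p∣ zero (true ∷ p) x∉ with () ← x∉ Vec.here
  ∣⁅x⁆∪p∣≡1+∣p∣ zero (false ∷ p) x∉ = ≡.cong suc (≡.cong ∣_∣ (∪-identityˡ p))
  ∣⁅x⁆∪p∣≡1+∣p∣ (suc x) (true ∷ p) x∉ = ≡.cong suc (∣⁅x⁆∪p∣≡1+∣p∣ x p (x∉ ∘ Vec.there))
  ∣⁅x⁆∪p∣≡1+∣p∣ (suc x) (false ∷ p) x∉ = ∣⁅x⁆∪p∣≡1+∣p∣ x p (x∉ ∘ Vec.there)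

  ∣image∣ : ∀ {m} (xs : List (Fin m)) → Unique xs → ∀ Y → ∣ image xs Y ∣ ≡ ∣ Y ∣
  ∣image∣ {m} [] u [] = ∣⊥∣≡0 m
  ∣image∣ (x ∷ xs) (p ∷ u) (true ∷ Y) = ≡.trans (≡.cong ∣_∣ (image-∷ x xs true Y)) (≡.trans (∣⁅x⁆∪p∣≡1+∣p∣ x (image xs Y)
    (λ x∈ → let (j , _ , e) = ∈-image⁻ xs Y x∈ in All.lookup p (∈-lookup j) (≡.sym e))) (≡.cong suc (∣image∣ xs u Y)))
  ∣image∣ (x ∷ xs) (p ∷ u) (false ∷ Y) = ≡.trans (≡.cong ∣_∣ (image-∷ x xs false Y)) (∣image∣ xs u Y)

  image-⊤ : ∀ {m} (F : Subset m) → image (members F) ⊤ ≡ F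
  image-⊤ F = ⊆-antisym
    (λ i∈ → let (j , _ , e) = ∈-image⁻ (members F) ⊤ i∈ in ∈-members⁻ F (≡.subst (_∈ᴸ members F) e (∈-lookup j)))
    (λ {i} i∈ → let i∈′ = ∈-members⁺ F i∈ in ≡.subst (_∈ image (members F) ⊤) (≡.sym (lookup-index i∈′)) (∈-image⁺ (members F) ⊤ (∈⊤ {x = Any.index i∈′})))

  all-allFin⁻ : ∀ {m} (p : Fin m → Bool) → all p (allFin m) ≡ true → ∀ i → p i ≡ true
  all-allFin⁻ {suc m} p e zero with p zero
  ... | true = ≡.refl
  all-allFin⁻ {suc m} p e (suc i) with p zero
  ... | true = all-allFin⁻ (p ∘ suc) (≡.trans (≡.cong (foldr _∧_ true) (≡.trans (map-tabulate id (p ∘ suc)) (≡.sym (map-tabulate suc p)))) e) i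

  all-allFin⁺ : ∀ {m} (p : Fin m → Bool) → (∀ i → p i ≡ true) → all p (allFin m) ≡ true
  all-allFin⁺ {zero} p f = ≡.refl
  all-allFin⁺ {suc m} p f = ≡.cong₂ _∧_ (f zero) (≡.trans (≡.cong (foldr _∧_ true) (≡.trans (map-tabulate suc p) (≡.sym (map-tabulate id (p ∘ suc))))) (all-allFin⁺ (p ∘ suc) (f ∘ suc)))

  sign-suc : ∀ n → sign (suc n) ≡ ℤ.- sign n
  sign-suc zero = ≡.refl
  sign-suc (suc zero) = ≡.refl
  sign-suc (suc (suc n)) = ≡.trans (≡.cong (λ x → if x ≡ᵇ 0 then 1ℤ else ℤ.- 1ℤ) (two (suc n)))
    (≡.trans (sign-suc n) (≡.cong (λ x → ℤ.- (if x ≡ᵇ 0 then 1ℤ else ℤ.- 1ℤ)) (≡.sym (two n))))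
    where
    two : ∀ n → suc (suc n) ℕ.% 2 ≡ n ℕ.% 2
    two n = ≡.trans (≡.cong (ℕ._% 2) (ℕ.+-comm 2 n)) ([m+n]%n≡m%n n 2)

  sgn : ℕ → ℚ
  sgn n = ι (sign n)

  sgn-suc : ∀ n → sgn (suc n) ≡ ℚ.- sgn n
  sgn-suc n = ≡.trans (≡.cong ι (≡.trans (sign-suc n) (≡.sym (ℤ.-1*i≡-i (sign n))))) (≡.trans (ι-* (ℤ.- 1ℤ) (sign n)) (≡.trans (≡.sym (ℚ.neg-distribˡ-* 1ℚ (sgn n))) (≡.cong ℚ.-_ (ℚ.*-identityˡ (sgn n)))))

  isEmpty : ∀ {m} → Subset m → Bool
  isEmpty [] = true
  isEmpty (b ∷ X) = not b ∧ isEmpty X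

  -- Toggling one fixed element of `F` reverses the sign, so all terms cancel unless `F` is empty.
  -- This does the work of Möbius inversion.
  Σₛ-sgn : ∀ {m} (F : Subset m) → Σₛ (λ X → [ X ⊆ᵇ F ] sgn ∣ X ∣) ≡ [ isEmpty F ] 1ℚ
  Σₛ-sgn [] = ≡.refl
  Σₛ-sgn (true ∷ F) = ≡.trans (≡.cong (ℚ._+ S) (≡.trans (Σₛ-cong neg) (Σₛ-* (ℚ.- 1ℚ) (λ X → [ X ⊆ᵇ F ] sgn ∣ X ∣))))
    (≡.trans (≡.cong (ℚ._+ S) (≡.trans (≡.sym (ℚ.neg-distribˡ-* 1ℚ S)) (≡.cong ℚ.-_ (ℚ.*-identityˡ S)))) (ℚ.+-inverseˡ S))
    where
    S : ℚ
    S = Σₛ (λ X → [ X ⊆ᵇ F ] sgn ∣ X ∣)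
    neg : ∀ X → [ X ⊆ᵇ F ] sgn (suc ∣ X ∣) ≡ (ℚ.- 1ℚ) ℚ.* [ X ⊆ᵇ F ] sgn ∣ X ∣
    neg X with X ⊆ᵇ F
    ... | true = ≡.trans (sgn-suc ∣ X ∣) (≡.trans (≡.cong ℚ.-_ (≡.sym (ℚ.*-identityˡ (sgn ∣ X ∣)))) (ℚ.neg-distribˡ-* 1ℚ (sgn ∣ X ∣)))
    ... | false = ≡.refl
  Σₛ-sgn {suc m} (false ∷ F) = ≡.trans (≡.cong (ℚ._+ Σₛ (λ X → [ X ⊆ᵇ F ] sgn ∣ X ∣)) (Σₛ-0 {m})) (≡.trans (ℚ.+-identityˡ _) (Σₛ-sgn F))

  Σₛ-isEmpty : ∀ {m} (g : Subset m → ℚ) → Σₛ (λ F → [ isEmpty F ] g F) ≡ g ⊥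
  Σₛ-isEmpty {zero} g = ≡.refl
  Σₛ-isEmpty {suc m} g = ≡.trans (≡.cong (ℚ._+ Σₛ (λ F → [ isEmpty F ] g (false ∷ F))) (Σₛ-0 {m})) (≡.trans (ℚ.+-identityˡ _) (Σₛ-isEmpty (λ F → g (false ∷ F))))

-- Flats and contractions of matroids given by rank functions.

module Matroids where

  open SubsetSums
  open import Data.Bool.Base using (T)
  open import Data.Fin.Subset using (Subset; ⊤; ⊥; ⁅_⁆; _∪_; _∩_; _⊆_; ∁; _∈_; _∉_)
  open import Data.Fin.Subset.Properties
  open import Data.List.Membership.Propositional.Properties using (∈-lookup)
  import Data.List.Relation.Unary.Any as Any
  open import Data.List.Relation.Unary.Any.Properties using (lookup-index)
  open import Data.Nat.Base using (_≡ᵇ_; _≤_)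
  open import Data.Sum.Base using ([_,_]′)
  open import Data.Vec.Base using (lookup)
  open import Data.Vec.Properties using ([]=⇒lookup; lookup⇒[]=)

  Flat : ∀ {m} → RankFn m → Subset m → Set
  Flat {m} r F = ∀ (e : Fin m) → e ∉ F → r (F ∪ ⁅ e ⁆) ≢ r F

  isFlat⇒Flat : ∀ {m} (r : RankFn m) F → isFlat r F ≡ true → Flat r F
  isFlat⇒Flat r F h e e∉ eq with lookup F e in l | all-allFin⁻ _ h e
  ... | true | _ = e∉ (lookup⇒[]= e F l)
  ... | false | q with r (F ∪ ⁅ e ⁆) ≡ᵇ r F in t
  ...   | false = ≡.subst T t (ℕ.≡⇒≡ᵇ _ _ eq)

  Flat⇒isFlat : ∀ {m} (r : RankFn m) F → Flat r F → isFlat r F ≡ true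
  Flat⇒isFlat r F h = all-allFin⁺ _ (λ e → go e)
    where
    go : ∀ e → (lookup F e ∨ not (r (F ∪ ⁅ e ⁆) ≡ᵇ r F)) ≡ true
    go e with lookup F e in l
    ... | true = ≡.refl
    ... | false with r (F ∪ ⁅ e ⁆) ≡ᵇ r F in t
    ...   | false = ≡.refl
    ...   | true = ⊥-elim (h e (λ e∈ → 𝔹.not-¬ ([]=⇒lookup e∈) l) (ℕ.≡ᵇ⇒≡ _ _ (≡.subst T (≡.sym t) _)))

  ∪-lub : ∀ {m} {X Y Z : Subset m} → X ⊆ Z → Y ⊆ Z → X ∪ Y ⊆ Z
  ∪-lub {X = X} {Y} f g i∈ = [ f , g ]′ (x∈p∪q⁻ X Y i∈)

  ∪-mono : ∀ {m} {X X′ Y Y′ : Subset m} → X ⊆ X′ → Y ⊆ Y′ → X ∪ Y ⊆ X′ ∪ Y′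
  ∪-mono {X′ = X′} {Y′ = Y′} f g = ∪-lub (λ i → p⊆p∪q Y′ (f i)) (λ i → q⊆p∪q X′ Y′ (g i))

  ⁅⁆-⊆ : ∀ {m} {e : Fin m} {X} → e ∈ X → ⁅ e ⁆ ⊆ X
  ⁅⁆-⊆ {e = e} {X} e∈ i∈ = ≡.subst (_∈ X) (≡.sym (x∈⁅y⁆⇒x≡y e i∈)) e∈

  module Matroid {m} {r : RankFn m} (M : IsMatroid r) where
    open IsMatroid M

    rank-⊥ : r ⊥ ≡ 0
    rank-⊥ = ℕ.n≤0⇒n≡0 (≡.subst (r ⊥ ≤_) (∣⊥∣≡0 m) (bounded ⊥))

    rank-∪ : ∀ X Y → r (X ∪ Y) ≤ r X ℕ.+ r Y
    rank-∪ X Y = ℕ.≤-trans (ℕ.m≤m+n _ _) (submodular X Y)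

    rank-∪-⁅⁆ : ∀ X e → r (X ∪ ⁅ e ⁆) ≤ suc (r X)
    rank-∪-⁅⁆ X e = ℕ.≤-trans (rank-∪ X ⁅ e ⁆) (≡.subst (r X ℕ.+ r ⁅ e ⁆ ≤_) (ℕ.+-comm (r X) 1) (ℕ.+-monoʳ-≤ (r X) (≡.subst (r ⁅ e ⁆ ≤_) (∣⁅x⁆∣≡1 e) (bounded ⁅ e ⁆))))

    rank-≤-∪ : ∀ X Y → r X ≤ r (X ∪ Y)
    rank-≤-∪ X Y = monotone X (X ∪ Y) (p⊆p∪q Y)

    flat-step : ∀ {F} → Flat r F → ∀ {e} → e ∉ F → r (F ∪ ⁅ e ⁆) ≡ suc (r F)
    flat-step {F} fl {e} e∉ = ℕ.≤-antisym (rank-∪-⁅⁆ F e) (ℕ.≤∧≢⇒< (rank-≤-∪ F ⁅ e ⁆) (fl e e∉ ∘ ≡.sym))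

    -- Submodularity for `F` and `X ∪ ⁅ e ⁆`, whose intersection contains `X`: adding `e` to `F`
    -- raises the rank by no more than adding it to `X`.
    spanned⇒∈flat : ∀ {X F e} → X ⊆ F → Flat r F → r (X ∪ ⁅ e ⁆) ≡ r X → e ∈ F
    spanned⇒∈flat {X} {F} {e} X⊆F fl eq with e ∈? F
    ... | yes e∈ = e∈
    ... | no e∉ = ⊥-elim (fl e e∉ (ℕ.≤-antisym (ℕ.+-cancelʳ-≤ (r X) _ _ (ℕ.≤-trans (ℕ.+-mono-≤
             (monotone (F ∪ ⁅ e ⁆) (F ∪ (X ∪ ⁅ e ⁆)) (∪-mono {Y = ⁅ e ⁆} id (q⊆p∪q X ⁅ e ⁆)))
             (monotone X (F ∩ (X ∪ ⁅ e ⁆)) (λ i∈ → x∈p∩q⁺ (X⊆F i∈ , p⊆p∪q ⁅ e ⁆ i∈))))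
           (≡.subst (r (F ∪ (X ∪ ⁅ e ⁆)) ℕ.+ r (F ∩ (X ∪ ⁅ e ⁆)) ≤_) (≡.cong (r F ℕ.+_) eq) (submodular F (X ∪ ⁅ e ⁆))))) (rank-≤-∪ F ⁅ e ⁆)))

    flat-⊥ : Loopless r → Flat r ⊥
    flat-⊥ ll e _ eq with () ← ≡.trans (≡.sym (ll e)) (≡.trans (≡.cong r (≡.sym (∪-identityˡ ⁅ e ⁆))) (≡.trans eq rank-⊥))

  module Contraction {m} {r : RankFn m} (M : IsMatroid r) (F : Subset m) where
    open IsMatroid M
    open Matroid M

    xs : List (Fin m)
    xs = members (∁ F)

    -- An order isomorphism from the subsets of the contracted ground set to the supersets of `F`.
    -- It preserves flats and shifts ranks by `r F`, so contractions can be studied inside the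
    -- original matroid.
    ε : Subset (length xs) → Subset m
    ε Y = image xs Y ∪ F

    r′ : RankFn (length xs)
    r′ = contraction r F

    lookup-∉F : ∀ j → List.lookup xs j ∉ F
    lookup-∉F j = x∈∁p⇒x∉p (∈-members⁻ (∁ F) (∈-lookup {xs = xs} j))

    index-of : ∀ {e} → e ∉ F → ∃ λ j → List.lookup xs j ≡ e
    index-of e∉ = let e∈ = ∈-members⁺ (∁ F) (x∉p⇒x∈∁p e∉) in Any.index e∈ , ≡.sym (lookup-index e∈)

    ε-∈⁺ : ∀ {Y j} → j ∈ Y → List.lookup xs j ∈ ε Y
    ε-∈⁺ {Y} j∈ = p⊆p∪q F (∈-image⁺ xs Y j∈)

    F⊆ε : ∀ Y → F ⊆ ε Y
    F⊆ε Y = q⊆p∪q (image xs Y) F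

    ε-∈⁻ : ∀ {Y j} → List.lookup xs j ∈ ε Y → j ∈ Y
    ε-∈⁻ {Y} {j} e∈ with x∈p∪q⁻ (image xs Y) F e∈
    ... | inj₂ e∈F = ⊥-elim (lookup-∉F j e∈F)
    ... | inj₁ e∈Y = let (j′ , j′∈ , eq) = ∈-image⁻ xs Y e∈Y in ≡.subst (_∈ Y) (lookup-injective (members-unique (∁ F)) j′ j eq) j′∈

    ε-elim : ∀ {Y Z} → F ⊆ Z → (∀ j → j ∈ Y → List.lookup xs j ∈ Z) → ε Y ⊆ Z
    ε-elim {Y} {Z} F⊆Z h = ∪-lub (λ i∈ → let (j , j∈ , eq) = ∈-image⁻ xs Y i∈ in ≡.subst (_∈ Z) eq (h j j∈)) F⊆Z

    ⊆-ε : ∀ {Y Z} → (∀ j → List.lookup xs j ∈ Z → j ∈ Y) → Z ⊆ ε Y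
    ⊆-ε {Y} {Z} h {i} i∈ with i ∈? F
    ... | yes i∈F = F⊆ε Y i∈F
    ... | no i∉F = let (j , eq) = index-of i∉F in ≡.subst (_∈ ε Y) eq (ε-∈⁺ (h j (≡.subst (_∈ Z) (≡.sym eq) i∈)))

    ε-mono : ∀ {Y Z} → Y ⊆ Z → ε Y ⊆ ε Z
    ε-mono {Y} {Z} s = ε-elim (F⊆ε Z) (λ j j∈ → ε-∈⁺ (s j∈))

    ε-reflect : ∀ {Y Z} → ε Y ⊆ ε Z → Y ⊆ Z
    ε-reflect s {j} j∈ = ε-∈⁻ (s (ε-∈⁺ j∈))

    ε-∪ : ∀ Y Z → ε (Y ∪ Z) ≡ ε Y ∪ ε Z
    ε-∪ Y Z = ⊆-antisym
      (ε-elim (λ i → p⊆p∪q (ε Z) (F⊆ε Y i)) (λ j j∈ → [ (λ j∈Y → p⊆p∪q (ε Z) (ε-∈⁺ j∈Y)) , (λ j∈Z → q⊆p∪q (ε Y) (ε Z) (ε-∈⁺ j∈Z)) ]′ (x∈p∪q⁻ Y Z j∈)))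
      (∪-lub (ε-mono {Y} {Y ∪ Z} (p⊆p∪q Z)) (ε-mono {Z} {Y ∪ Z} (q⊆p∪q Y Z)))

    ε-∩ : ∀ Y Z → ε (Y ∩ Z) ≡ ε Y ∩ ε Z
    ε-∩ Y Z = ⊆-antisym (λ i∈ → x∈p∩q⁺ (ε-mono {Y ∩ Z} {Y} (p∩q⊆p Y Z) i∈ , ε-mono {Y ∩ Z} {Z} (p∩q⊆q Y Z) i∈))
      (⊆-ε {Y ∩ Z} (λ j j∈ → let (a , b) = x∈p∩q⁻ (ε Y) (ε Z) j∈ in x∈p∩q⁺ {p = Y} {Z} (ε-∈⁻ a , ε-∈⁻ b)))

    ε-⊤ : ε ⊤ ≡ ⊤
    ε-⊤ = ⊆-antisym (λ _ → ∈⊤) (⊆-ε (λ j _ → ∈⊤))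

    ε-⊥ : ε ⊥ ≡ F
    ε-⊥ = ⊆-antisym (ε-elim id (λ j j∈ → ⊥-elim (∉⊥ j∈))) (F⊆ε ⊥)

    ε-∪-⁅⁆ : ∀ Y j → ε (Y ∪ ⁅ j ⁆) ≡ ε Y ∪ ⁅ List.lookup xs j ⁆
    ε-∪-⁅⁆ Y j = ⊆-antisym
      (ε-elim (λ i → p⊆p∪q _ (F⊆ε Y i)) (λ j′ j′∈ → [ (λ a → p⊆p∪q _ (ε-∈⁺ a)) , (λ b → q⊆p∪q (ε Y) _ (≡.subst (λ z → List.lookup xs z ∈ ⁅ List.lookup xs j ⁆) (≡.sym (x∈⁅y⁆⇒x≡y j b)) (x∈⁅x⁆ _))) ]′ (x∈p∪q⁻ Y ⁅ j ⁆ j′∈)))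
      (∪-lub (ε-mono {Y} {Y ∪ ⁅ j ⁆} (p⊆p∪q ⁅ j ⁆)) (⁅⁆-⊆ (ε-∈⁺ (q⊆p∪q Y ⁅ j ⁆ (x∈⁅x⁆ j)))))

    rF≤ : ∀ Y → r F ≤ r (ε Y)
    rF≤ Y = monotone F (ε Y) (F⊆ε Y)

    r′+ : ∀ Y → r′ Y ℕ.+ r F ≡ r (ε Y)
    r′+ Y = ℕ.m∸n+n≡m (rF≤ Y)

    isMatroid′ : IsMatroid r′
    isMatroid′ = record
      { bounded = λ Y → ℕ.≤-trans (ℕ.m≤n+o⇒m∸n≤o _ (r F) (≡.subst (r (ε Y) ≤_) (ℕ.+-comm _ (r F)) (ℕ.≤-trans (rank-∪ (image xs Y) F) (ℕ.+-monoˡ-≤ (r F) (bounded (image xs Y))))))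
                    (ℕ.≤-reflexive (∣image∣ xs (members-unique (∁ F)) Y))
      ; monotone = λ Y Z s → ℕ.∸-monoˡ-≤ (r F) (monotone (ε Y) (ε Z) (ε-mono s))
      -- Adding `r F` twice to both sides removes the truncated subtractions.
      ; submodular = λ Y Z → ℕ.+-cancelʳ-≤ (r F ℕ.+ r F) _ _ (≡.subst₂ _≤_
          (≡.sym (≡.trans (shuffle (r′ (Y ∪ Z)) (r′ (Y ∩ Z)) (r F)) (≡.cong₂ ℕ._+_ (≡.trans (r′+ (Y ∪ Z)) (≡.cong r (ε-∪ Y Z))) (≡.trans (r′+ (Y ∩ Z)) (≡.cong r (ε-∩ Y Z))))))
          (≡.sym (≡.trans (shuffle (r′ Y) (r′ Z) (r F)) (≡.cong₂ ℕ._+_ (r′+ Y) (r′+ Z))))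
          (submodular (ε Y) (ε Z))) }
      where
      shuffle : ∀ a b f → a ℕ.+ b ℕ.+ (f ℕ.+ f) ≡ (a ℕ.+ f) ℕ.+ (b ℕ.+ f)
      shuffle a b f = solve 3 (λ a b f → a :+ b :+ (f :+ f) := (a :+ f) :+ (b :+ f)) ≡.refl a b f
        where open import Data.Nat.Solver using (module +-*-Solver)
              open +-*-Solver

    loopless′ : Flat r F → Loopless r′
    loopless′ fl j = ≡.trans (≡.cong (λ Z → r Z ∸ r F) ε-⁅⁆) (≡.trans (≡.cong (_∸ r F) (flat-step fl (lookup-∉F j))) (ℕ.m+n∸n≡m 1 (r F)))
      where
      ε-⁅⁆ : ε ⁅ j ⁆ ≡ F ∪ ⁅ List.lookup xs j ⁆
      ε-⁅⁆ = ≡.trans (≡.cong ε (≡.sym (∪-identityˡ ⁅ j ⁆))) (≡.trans (ε-∪-⁅⁆ ⊥ j) (≡.cong (_∪ ⁅ List.lookup xs j ⁆) ε-⊥))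

    flat′⇒flat : ∀ {Y} → Flat r′ Y → Flat r (ε Y)
    flat′⇒flat {Y} fl e e∉ eq = let (j , l) = index-of (λ e∈F → e∉ (F⊆ε Y e∈F)) in
      fl j (λ j∈ → e∉ (≡.subst (_∈ ε Y) l (ε-∈⁺ j∈))) (≡.cong (_∸ r F) (≡.trans (≡.cong r (≡.trans (ε-∪-⁅⁆ Y j) (≡.cong (λ z → ε Y ∪ ⁅ z ⁆) l))) eq))

    flat⇒flat′ : ∀ {Y} → Flat r (ε Y) → Flat r′ Y
    flat⇒flat′ {Y} fl j j∉ eq = fl (List.lookup xs j) (λ e∈ → j∉ (ε-∈⁻ e∈))
      (≡.trans (≡.cong r (≡.sym (ε-∪-⁅⁆ Y j))) (≡.trans (≡.sym (r′+ (Y ∪ ⁅ j ⁆))) (≡.trans (≡.cong (ℕ._+ r F) eq) (r′+ Y))))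

    isFlat-ε : ∀ Y → isFlat r′ Y ≡ isFlat r (ε Y)
    isFlat-ε Y = bool-≡ (λ h → Flat⇒isFlat r (ε Y) (flat′⇒flat (isFlat⇒Flat r′ Y h))) (λ h → Flat⇒isFlat r′ Y (flat⇒flat′ (isFlat⇒Flat r (ε Y) h)))

    ⊆ᵇ-ε : ∀ Y Z → (Y ⊆ᵇ Z) ≡ (ε Y ⊆ᵇ ε Z)
    ⊆ᵇ-ε Y Z = bool-≡ (λ h → ⊆ᵇ-complete (ε Y) (ε Z) (ε-mono (⊆ᵇ-sound Y Z h))) (λ h → ⊆ᵇ-complete Y Z (ε-reflect (⊆ᵇ-sound (ε Y) (ε Z) h)))

    Σₛ-ε : ∀ g → Σₛ (λ Y → g (ε Y)) ≡ Σₛ (λ X → [ F ⊆ᵇ X ] g X)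
    Σₛ-ε g = ≡.trans (Σₛ-image xs (λ Z → g (Z ∪ F))) (≡.trans (imageSum-members (∁ F) (λ Z → g (Z ∪ F))) (Σₛ-∁-∪ F g))

-- Palindromic sums determine the Kazhdan-Lusztig polynomials.

module PalindromicUniqueness where

  open ClosedForm using (module Poly; module ℙ)
  open SubsetSums
  open Matroids
  open import Data.Bool.Base using (T)
  open import Data.Fin.Subset using (Subset; ⊤; ⊥; ⁅_⁆; _∪_; ∣_∣; _∈_)
  open import Data.Fin.Subset.Properties
  open import Data.Integer.Base as ℤ using (0ℤ)
  open import Data.Nat.Base using (_≡ᵇ_; _≤_; _<_)
  open import Data.Product.Base using (_×_)
  open import Data.Vec.Base as Vec using ([]; _∷_)
  open import Relation.Nullary using (contradiction)

  -- The Z-polynomial of the contraction at `X` and its reversal, the latter carried out summand by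
  -- summand. `X` may be any subset, as the expansion of characteristic polynomials over subsets
  -- requires.
  Palindromic : ∀ {m} → RankFn m → (Subset m → PolyQ) → Subset m → Set
  Palindromic r p X = ∀ k → Σₛ (λ F → [ isFlat r F ∧ (X ⊆ᵇ F) ] Poly.raise (r F ∸ r X) (p F) k)
                          ≡ Σₛ (λ F → [ isFlat r F ∧ (X ⊆ᵇ F) ] Poly.reverse (rk r ∸ r F) (p F) k)

  -- p F plays the role of the Kazhdan–Lusztig polynomial of the contraction at F; the palindromic
  -- sums are the Z-polynomials of the contractions.
  record Candidate {m} (r : RankFn m) (p : Subset m → PolyQ) : Set where
    field
      top         : p ⊤ ℙ.≈ ℙ.1#
      degree      : ∀ F → Flat r F → r F < rk r → ∀ k → rk r ∸ r F ≤ 2 ℕ.* k → p F k ≡ 0ℚ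
      palindromic : ∀ X → Flat r X → Palindromic r p X

  []-cong : ∀ b {x y} → (b ≡ true → x ≡ y) → [ b ] x ≡ [ b ] y
  []-cong true e = e ≡.refl
  []-cong false e = ≡.refl

  []-∧ : ∀ a b x → [ a ∧ b ] x ≡ [ a ] [ b ] x
  []-∧ true b x = ≡.refl
  []-∧ false b x = ≡.refl

  []-*ʳ : ∀ b x y → [ b ] (x ℚ.* y) ≡ ([ b ] x) ℚ.* y
  []-*ʳ true x y = ≡.refl
  []-*ʳ false x y = ≡.sym (ℚ.*-zeroˡ y)

  []-*ˡ : ∀ b x y → [ b ] (x ℚ.* y) ≡ x ℚ.* [ b ] y
  []-*ˡ true x y = ≡.refl
  []-*ˡ false x y = ≡.sym (ℚ.*-zeroʳ x)

  []-Σₛ : ∀ {m} b (f : Subset m → ℚ) → [ b ] Σₛ f ≡ Σₛ (λ X → [ b ] f X)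
  []-Σₛ true f = ≡.refl
  []-Σₛ {m} false f = ≡.sym (Σₛ-0 {m})

  ∧-split : ∀ {a b} → (a ∧ b) ≡ true → a ≡ true × b ≡ true
  ∧-split {true} e = ≡.refl , e

  raise-at : ∀ d k → [ k ≡ᵇ d ] 1ℚ ≡ Poly.raise d ℙ.1# k
  raise-at zero zero = ≡.refl
  raise-at zero (suc k) = ≡.refl
  raise-at (suc d) zero = ≡.refl
  raise-at (suc d) (suc k) = raise-at d k

  ⊠-Σₛ : ∀ {m} (c : Subset m → ℚ) (d : Subset m → ℕ) (q : PolyQ) k →
    ((λ i → Σₛ (λ X → c X ℚ.* Poly.raise (d X) ℙ.1# i)) Poly.⊠ q) k ≡ Σₛ (λ X → c X ℚ.* Poly.raise (d X) q k)
  ⊠-Σₛ {zero} c d q k = ≡.trans (Poly.⊠-scaleˡ (c []) (Poly.raise (d []) ℙ.1#) q k)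
    (≡.cong (c [] ℚ.*_) (≡.trans (Poly.raise-⊠ (d []) ℙ.1# q k) (Poly.raise-cong (d []) (ℙ.*-identityˡ q) k)))
  ⊠-Σₛ {suc m} c d q k = ≡.trans (Poly.⊠-distribʳ q (λ i → Σₛ (λ X → c (true ∷ X) ℚ.* Poly.raise (d (true ∷ X)) ℙ.1# i)) (λ i → Σₛ (λ X → c (false ∷ X) ℚ.* Poly.raise (d (false ∷ X)) ℙ.1# i)) k)
    (≡.cong₂ ℚ._+_ (⊠-Σₛ (λ X → c (true ∷ X)) (λ X → d (true ∷ X)) q k) (⊠-Σₛ (λ X → c (false ∷ X)) (λ X → d (false ∷ X)) q k))

  isEmpty-complete : ∀ {m} (F : Subset m) → isEmpty F ≡ true → F ≡ ⊥
  isEmpty-complete [] e = ≡.refl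
  isEmpty-complete (false ∷ F) e = ≡.cong (false ∷_) (isEmpty-complete F e)

  isEmpty-false : ∀ {m} (F : Subset m) → isEmpty F ≡ false → ∃ λ e → e ∈ F
  isEmpty-false (true ∷ F) e = zero , Vec.here
  isEmpty-false (false ∷ F) e = let (i , i∈) = isEmpty-false F e in suc i , Vec.there i∈

  module _ {m} {r : RankFn m} (M : IsMatroid r) (p : Subset m → PolyQ) where
    open IsMatroid M
    open Matroid M

    -- Enlarging X inside its closure changes neither side.
    palindromic-all : (∀ X → Flat r X → Palindromic r p X) → ∀ X → Palindromic r p X
    palindromic-all pal X = go (m ∸ ∣ X ∣) X ℕ.≤-refl
      where
      go : ∀ n X → m ∸ ∣ X ∣ ≤ n → Palindromic r p X
      go n X le with isFlat r X in fl
      go n X le | true = pal X (isFlat⇒Flat r X fl)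
      go n X le | false with Fin.any? (λ e → Relation.Nullary.Decidable._×-dec_ (Relation.Nullary.Decidable.¬? (e ∈? X)) (r (X ∪ ⁅ e ⁆) ℕ.≟ r X))
        where import Relation.Nullary.Decidable
      go n X le | false | no none = contradiction (Flat⇒isFlat r X (λ e e∉ eq → none (e , e∉ , eq))) (λ t → case t)
        where
        case : isFlat r X ≡ true → Data.Empty.⊥
        case t with () ← ≡.trans (≡.sym t) fl
      go zero X le | false | yes (e , e∉ , eq) = contradiction (∣p∣≡n⇒p≡⊤ (ℕ.≤-antisym (∣p∣≤n X) (ℕ.m∸n≡0⇒m≤n (ℕ.n≤0⇒n≡0 le)))) (λ X≡⊤ → e∉ (≡.subst (e ∈_) (≡.sym X≡⊤) ∈⊤))
      go (suc n) X le | false | yes (e , e∉ , eq) = λ k → ≡.trans (Σₛ-cong (λ F → step F (λ r → Poly.raise (r F ∸ r X) (p F) k) (λ r → Poly.raise (r F ∸ r X′) (p F) k) (≡.cong (λ a → Poly.raise (r F ∸ a) (p F) k) (≡.sym eq))))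
          (≡.trans (go n X′ le′ k) (≡.sym (Σₛ-cong (λ F → step F (λ r → Poly.reverse (rk r ∸ r F) (p F) k) (λ r → Poly.reverse (rk r ∸ r F) (p F) k) ≡.refl))))
        where
        X′ : Subset m
        X′ = X ∪ ⁅ e ⁆
        smaller : ∣ X ∣ < ∣ X′ ∣
        smaller = p⊂q⇒∣p∣<∣q∣ (p⊆p∪q ⁅ e ⁆ , e , q⊆p∪q X ⁅ e ⁆ (x∈⁅x⁆ e) , e∉)
        le′ : m ∸ ∣ X′ ∣ ≤ n
        le′ = ℕ.≤-pred (ℕ.≤-trans (ℕ.∸-monoʳ-< smaller (∣p∣≤n X′)) le)
        step : ∀ F (f g : RankFn m → ℚ) → f r ≡ g r → [ isFlat r F ∧ (X ⊆ᵇ F) ] f r ≡ [ isFlat r F ∧ (X′ ⊆ᵇ F) ] g r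
        step F f g fg with isFlat r F in flF
        ... | false = ≡.refl
        ... | true = ≡.cong₂ (λ b x → [ b ] x) (bool-≡
            (λ h → ⊆ᵇ-complete X′ F (∪-lub (⊆ᵇ-sound X F h) (⁅⁆-⊆ (spanned⇒∈flat (⊆ᵇ-sound X F h) (isFlat⇒Flat r F flF) eq))))
            (λ h → ⊆ᵇ-complete X F (λ i∈ → ⊆ᵇ-sound X′ F h (p⊆p∪q ⁅ e ⁆ i∈)))) fg

    characteristic : Subset m → PolyQ
    characteristic F k = ι (charPoly (localization r F) k)

    -- Brings a summand of the recurrence into the form in which the sums over flats and over
    -- subsets can be exchanged.
    characteristic-⊠ : ∀ F q k → (characteristic F Poly.⊠ q) k ≡ Σₛ (λ X → [ X ⊆ᵇ F ] (sgn ∣ X ∣ ℚ.* Poly.raise (r F ∸ r X) q k))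
    characteristic-⊠ F q k = ≡.trans (Poly.⊠-cong {g = q} (λ i → expand i) (λ _ → ≡.refl) k)
      (≡.trans (⊠-Σₛ (λ X → [ X ⊆ᵇ F ] sgn ∣ X ∣) (λ X → r F ∸ r X) q k) (Σₛ-cong (λ X → ≡.sym ([]-*ʳ (X ⊆ᵇ F) (sgn ∣ X ∣) (Poly.raise (r F ∸ r X) q k)))))
      where
      term : ℕ → Subset m → ℚ
      term i X = sgn ∣ X ∣ ℚ.* Poly.raise (r F ∸ r X) ℙ.1# i
      mono : ∀ c d i → ι (monoᶻ c d i) ≡ ι c ℚ.* Poly.raise d ℙ.1# i
      mono c d i = ≡.trans (if-ι (i ≡ᵇ d)) (≡.cong (ι c ℚ.*_) (raise-at d i))
        where
        if-ι : ∀ b → ι (if b then c else 0ℤ) ≡ ι c ℚ.* [ b ] 1ℚ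
        if-ι true = ≡.sym (ℚ.*-identityʳ (ι c))
        if-ι false = ≡.sym (ℚ.*-zeroʳ (ι c))
      expand : ∀ i → characteristic F i ≡ Σₛ (λ X → ([ X ⊆ᵇ F ] sgn ∣ X ∣) ℚ.* Poly.raise (r F ∸ r X) ℙ.1# i)
      expand i = ≡.trans (≡.cong ι (sumᶻ-at (λ Y → monoᶻ (sign ∣ Y ∣) (rk (localization r F) ∸ localization r F Y)) (allSubsets _) i))
        (≡.trans (ι-sum (λ Y → monoᶻ (sign ∣ Y ∣) (rk (localization r F) ∸ localization r F Y) i) (allSubsets _))
        (≡.trans (sumList-allSubsets _ (λ Y → ι (monoᶻ (sign ∣ Y ∣) (rk (localization r F) ∸ localization r F Y) i)))
        (≡.trans (Σₛ-cong (λ Y → ≡.trans (mono (sign ∣ Y ∣) _ i) (≡.cong₂ (λ a b → sgn a ℚ.* Poly.raise (r b ∸ r (image (members F) Y)) ℙ.1# i)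
             (≡.sym (∣image∣ (members F) (members-unique F) Y)) (image-⊤ F))))
        (≡.trans (Σₛ-image (members F) (term i))
        (≡.trans (imageSum-members F (term i))
        (Σₛ-cong (λ X → []-*ʳ (X ⊆ᵇ F) (sgn ∣ X ∣) (Poly.raise (r F ∸ r X) ℙ.1# i))))))))

    -- Σ_F χ_F p_F = rev p_∅: expand χ_F over X ⊆ F, exchange the sums and use Σ_{X ⊆ F} (-1)^|X| = [F = ∅].
    inversion : (∀ X → Flat r X → Palindromic r p X) → Flat r ⊥ → ∀ k →
      Σₛ (λ F → [ isFlat r F ] (characteristic F Poly.⊠ p F) k) ≡ Poly.reverse (rk r ∸ r ⊥) (p ⊥) k
    inversion pal fl⊥ k = begin
      Σₛ (λ F → [ isFlat r F ] (characteristic F Poly.⊠ p F) k)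
        ≡⟨ Σₛ-cong (λ F → ≡.trans (≡.cong ([ isFlat r F ]_) (characteristic-⊠ F (p F) k)) ([]-Σₛ (isFlat r F) (λ X → [ X ⊆ᵇ F ] (sgn ∣ X ∣ ℚ.* Poly.raise (r F ∸ r X) (p F) k)))) ⟩
      Σₛ (λ F → Σₛ (λ X → [ isFlat r F ] [ X ⊆ᵇ F ] (sgn ∣ X ∣ ℚ.* Poly.raise (r F ∸ r X) (p F) k)))
        ≡⟨ Σₛ-cong (λ F → Σₛ-cong (λ X → ≡.trans (≡.sym ([]-∧ (isFlat r F) (X ⊆ᵇ F) _)) ([]-*ˡ (isFlat r F ∧ (X ⊆ᵇ F)) (sgn ∣ X ∣) _))) ⟩
      Σₛ (λ F → Σₛ (λ X → sgn ∣ X ∣ ℚ.* [ isFlat r F ∧ (X ⊆ᵇ F) ] Poly.raise (r F ∸ r X) (p F) k))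
        ≡⟨ Σₛ-swap (λ F X → sgn ∣ X ∣ ℚ.* [ isFlat r F ∧ (X ⊆ᵇ F) ] Poly.raise (r F ∸ r X) (p F) k) ⟩
      Σₛ (λ X → Σₛ (λ F → sgn ∣ X ∣ ℚ.* [ isFlat r F ∧ (X ⊆ᵇ F) ] Poly.raise (r F ∸ r X) (p F) k))
        ≡⟨ Σₛ-cong (λ X → ≡.trans (Σₛ-* (sgn ∣ X ∣) (λ F → [ isFlat r F ∧ (X ⊆ᵇ F) ] Poly.raise (r F ∸ r X) (p F) k))
             (≡.trans (≡.cong (sgn ∣ X ∣ ℚ.*_) (palindromic-all pal X k)) (≡.sym (Σₛ-* (sgn ∣ X ∣) (λ F → [ isFlat r F ∧ (X ⊆ᵇ F) ] rev F))))) ⟩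
      Σₛ (λ X → Σₛ (λ F → sgn ∣ X ∣ ℚ.* [ isFlat r F ∧ (X ⊆ᵇ F) ] rev F))
        ≡⟨ Σₛ-swap (λ X F → sgn ∣ X ∣ ℚ.* [ isFlat r F ∧ (X ⊆ᵇ F) ] rev F) ⟩
      Σₛ (λ F → Σₛ (λ X → sgn ∣ X ∣ ℚ.* [ isFlat r F ∧ (X ⊆ᵇ F) ] rev F))
        ≡⟨ Σₛ-cong (λ F → ≡.trans (Σₛ-cong (λ X → regroup (isFlat r F) (X ⊆ᵇ F) (sgn ∣ X ∣) (rev F)))
             (≡.trans (Σₛ-* ([ isFlat r F ] rev F) (λ X → [ X ⊆ᵇ F ] sgn ∣ X ∣)) (≡.cong (([ isFlat r F ] rev F) ℚ.*_) (Σₛ-sgn F)))) ⟩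
      Σₛ (λ F → ([ isFlat r F ] rev F) ℚ.* [ isEmpty F ] 1ℚ)
        ≡⟨ Σₛ-cong (λ F → ≡.trans (≡.sym ([]-*ˡ (isEmpty F) ([ isFlat r F ] rev F) 1ℚ)) (≡.cong ([ isEmpty F ]_) (ℚ.*-identityʳ _))) ⟩
      Σₛ (λ F → [ isEmpty F ] [ isFlat r F ] rev F)
        ≡⟨ Σₛ-isEmpty (λ F → [ isFlat r F ] rev F) ⟩
      [ isFlat r ⊥ ] rev ⊥
        ≡⟨ ≡.cong (λ b → [ b ] rev ⊥) (Flat⇒isFlat r ⊥ fl⊥) ⟩
      rev ⊥ ∎
      where
      open ≡.≡-Reasoning
      rev : Subset m → ℚ
      rev F = Poly.reverse (rk r ∸ r F) (p F) k
      regroup : ∀ a b s x → s ℚ.* [ a ∧ b ] x ≡ ([ a ] x) ℚ.* [ b ] s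
      regroup true true s x = ℚ.*-comm s x
      regroup true false s x = ≡.trans (ℚ.*-zeroʳ s) (≡.sym (ℚ.*-zeroʳ x))
      regroup false b s x = ≡.trans (ℚ.*-zeroʳ s) (≡.sym (ℚ.*-zeroˡ ([ b ] s)))

  module Contracted {m} {r : RankFn m} (M : IsMatroid r) {p : Subset m → PolyQ} (C : Candidate r p) {F : Subset m} (fl : Flat r F) where
    open Contraction M F
    open Candidate C
    open IsMatroid M

    rank-diff : ∀ Y Z → r′ Y ∸ r′ Z ≡ r (ε Y) ∸ r (ε Z)
    rank-diff Y Z = ≡.trans (≡.sym (ℕ.[m+n]∸[m+o]≡n∸o (r F) (r′ Y) (r′ Z))) (≡.cong₂ _∸_ (≡.trans (ℕ.+-comm (r F) _) (r′+ Y)) (≡.trans (ℕ.+-comm (r F) _) (r′+ Z)))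

    rk-diff : ∀ Y → rk r′ ∸ r′ Y ≡ rk r ∸ r (ε Y)
    rk-diff Y = ≡.trans (rank-diff ⊤ Y) (≡.cong (λ Z → r Z ∸ r (ε Y)) ε-⊤)

    rk′ : rk r′ ≡ rk r ∸ r F
    rk′ = ≡.cong (λ Z → r Z ∸ r F) ε-⊤

    -- The conditions involve only flats above `F` and differences of ranks, and `ε` respects both.
    candidate′ : Candidate r′ (λ Y → p (ε Y))
    candidate′ = record
      { top = λ k → ≡.trans (≡.cong (λ Z → p Z k) ε-⊤) (top k)
      ; degree = λ Y flY lt k le → degree (ε Y) (flat′⇒flat flY)
          (≡.subst₂ _<_ (r′+ Y) (≡.trans (r′+ ⊤) (≡.cong r ε-⊤)) (ℕ.+-monoˡ-< (r F) lt)) k (≡.subst (_≤ 2 ℕ.* k) (rk-diff Y) le)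
      ; palindromic = λ X flX k → ≡.trans (transfer X (λ Z → Poly.raise (r Z ∸ r (ε X)) (p Z) k) (λ Y → Poly.raise (r′ Y ∸ r′ X) (p (ε Y)) k) (λ Y → ≡.cong (λ d → Poly.raise d (p (ε Y)) k) (rank-diff Y X)))
          (≡.trans (palindromic (ε X) (flat′⇒flat flX) k)
          (≡.sym (transfer X (λ Z → Poly.reverse (rk r ∸ r Z) (p Z) k) (λ Y → Poly.reverse (rk r′ ∸ r′ Y) (p (ε Y)) k) (λ Y → ≡.cong (λ d → Poly.reverse d (p (ε Y)) k) (rk-diff Y))))) }
      where
      transfer : ∀ X (g : Subset m → ℚ) (g′ : Subset (length xs) → ℚ) → (∀ Y → g′ Y ≡ g (ε Y)) →
        Σₛ (λ Y → [ isFlat r′ Y ∧ (X ⊆ᵇ Y) ] g′ Y) ≡ Σₛ (λ Z → [ isFlat r Z ∧ (ε X ⊆ᵇ Z) ] g Z)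
      transfer X g g′ e = ≡.trans (Σₛ-cong (λ Y → ≡.cong₂ (λ b x → [ b ] x) (≡.cong₂ _∧_ (isFlat-ε Y) (⊆ᵇ-ε X Y)) (e Y)))
        (≡.trans (Σₛ-ε (λ Z → [ isFlat r Z ∧ (ε X ⊆ᵇ Z) ] g Z)) (Σₛ-cong drop))
        where
        drop : ∀ Z → [ F ⊆ᵇ Z ] [ isFlat r Z ∧ (ε X ⊆ᵇ Z) ] g Z ≡ [ isFlat r Z ∧ (ε X ⊆ᵇ Z) ] g Z
        drop Z with isFlat r Z ∧ (ε X ⊆ᵇ Z) in b
        ... | false = if-same (F ⊆ᵇ Z)
          where
          if-same : ∀ b → [ b ] 0ℚ ≡ 0ℚ
          if-same true = ≡.refl
          if-same false = ≡.refl
        ... | true = ≡.cong (λ b → [ b ] g Z) (⊆ᵇ-complete F Z (λ i∈ → ⊆ᵇ-sound (ε X) Z (proj₂ (∧-split b)) (F⊆ε X i∈)))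

  module Uniqueness (P : KLAssignment) (kl : IsKL P) where
    open IsKL kl renaming (degree to kl-degree)

    Pℚ : ∀ {m} → RankFn m → PolyQ
    Pℚ r k = ι (P r k)

    recurrenceℚ : ∀ {m} (r : RankFn m) (M : IsMatroid r) → Loopless r → ∀ p k →
      Poly.reverse (rk r) (Pℚ r) k ≡ Σₛ (λ F → [ isFlat r F ] (characteristic M p F Poly.⊠ Pℚ (contraction r F)) k)
    recurrenceℚ r M ll p k = ≡.trans (rev-ι (k ≤ᵇ rk r)) (≡.trans (≡.cong ι (recurrence r M ll k))
      (≡.trans (≡.cong ι (sumᶻ-at (λ F → charPoly (localization r F) *ᶻ P (contraction r F)) (flats r) k))
      (≡.trans (ι-sum (λ F → (charPoly (localization r F) *ᶻ P (contraction r F)) k) (flats r))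
      (≡.trans (sumList-filter (λ F → ι ((charPoly (localization r F) *ᶻ P (contraction r F)) k)) (isFlat r) (allSubsets _))
      (≡.trans (sumList-allSubsets _ (λ F → [ isFlat r F ] ι ((charPoly (localization r F) *ᶻ P (contraction r F)) k))) (Σₛ-cong (λ F → ≡.cong ([ isFlat r F ]_) (prod F))))))))
      where
      rev-ι : ∀ b → (if b then ι (P r (rk r ∸ k)) else 0ℚ) ≡ ι (if b then P r (rk r ∸ k) else 0ℤ)
      rev-ι true = ≡.refl
      rev-ι false = ≡.refl
      prod : ∀ F → ι ((charPoly (localization r F) *ᶻ P (contraction r F)) k) ≡ (characteristic M p F Poly.⊠ Pℚ (contraction r F)) k
      prod F = ≡.trans (ι-sum (λ i → charPoly (localization r F) i ℤ.* P (contraction r F) (k ∸ i)) (upTo (suc k)))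
        (sum-cong (upTo (suc k)) (λ i → ι-* (charPoly (localization r F) i) (P (contraction r F) (k ∸ i))))
        where
        sum-cong : ∀ xs {f g : ℕ → ℚ} → (∀ i → f i ≡ g i) → sumList f xs ≡ sumList g xs
        sum-cong [] e = ≡.refl
        sum-cong (x ∷ xs) e = ≡.cong₂ ℚ._+_ (e x) (sum-cong xs e)

    private
      Holds : ℕ → Set
      Holds d = ∀ {m} (r : RankFn m) → IsMatroid r → Loopless r → rk r ≡ d → ∀ p → Candidate r p → ∀ k → Pℚ r k ≡ p ⊥ k

      -- A loopless matroid of rank 0 has no elements; then `⊥` is `⊤`, where the proposal is 1.
      rank-zero : Holds 0
      rank-zero {zero} r M ll e p C k = ≡.trans (≡.cong ι (rank0 r M ll e k)) (≡.trans (one k) (≡.sym (Candidate.top C k)))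
        where
        one : ∀ k → ι (oneᶻ k) ≡ ℙ.1# k
        one zero = ≡.refl
        one (suc k) = ≡.refl
      rank-zero {suc m} r M ll e p C k with () ← ℕ.≤-trans (ℕ.≤-reflexive (≡.sym (ll zero))) (ℕ.≤-trans (IsMatroid.monotone M ⁅ zero ⁆ ⊤ (λ _ → ∈⊤)) (ℕ.≤-reflexive e))

      -- From half the rank on, both polynomials vanish. A lower coefficient reappears in the
      -- reversed polynomial, where the recurrence expresses it by proper contractions, known by
      -- induction.
      rank-positive : ∀ d → (∀ d′ → d′ ≤ d → Holds d′) → Holds (suc d)
      rank-positive d IH {m} r M ll e p C j with rk r ℕ.≤? 2 ℕ.* j
      ... | yes le = ≡.trans (≡.cong ι (kl-degree r M ll (≡.subst (0 <_) (≡.sym e) (s≤s z≤n)) j le))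
              (≡.sym (Candidate.degree C ⊥ (Matroid.flat-⊥ M ll) (≡.subst₂ _<_ (≡.sym (Matroid.rank-⊥ M)) (≡.sym e) (s≤s z≤n)) j (ℕ.≤-trans (ℕ.m∸n≤m (rk r) (r ⊥)) le)))
      ... | no nle = begin
        Pℚ r j                                                              ≡⟨ rev-at (Pℚ r) ⟨
        Poly.reverse (rk r) (Pℚ r) k                                        ≡⟨ recurrenceℚ r M ll p k ⟩
        Σₛ (λ F → [ isFlat r F ] (characteristic M p F Poly.⊠ Pℚ (contraction r F)) k)  ≡⟨ Σₛ-cong (λ F → []-cong (isFlat r F) (λ h → replace F (isFlat⇒Flat r F h))) ⟩
        Σₛ (λ F → [ isFlat r F ] (characteristic M p F Poly.⊠ p F) k)         ≡⟨ inversion M p (Candidate.palindromic C) flat⊥ k ⟩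
        Poly.reverse (rk r ∸ r ⊥) (p ⊥) k                                   ≡⟨ ≡.cong (λ z → Poly.reverse (rk r ∸ z) (p ⊥) k) (Matroid.rank-⊥ M) ⟩
        Poly.reverse (rk r) (p ⊥) k                                         ≡⟨ rev-at (p ⊥) ⟩
        p ⊥ j                                                               ∎
        where
        open ≡.≡-Reasoning
        open Matroid M
        k : ℕ
        k = rk r ∸ j
        2j<rk : 2 ℕ.* j < rk r
        2j<rk = ℕ.≰⇒> nle
        j≤rk : j ≤ rk r
        j≤rk = ℕ.≤-trans (ℕ.m≤m+n j (j ℕ.+ 0)) (ℕ.<⇒≤ 2j<rk)
        flat⊥ : Flat r ⊥
        flat⊥ = flat-⊥ ll
        rk≤2k : rk r ≤ 2 ℕ.* k
        rk≤2k = ℕ.+-cancelʳ-≤ (2 ℕ.* j) _ _ (ℕ.≤-trans (ℕ.+-monoʳ-≤ (rk r) (ℕ.<⇒≤ 2j<rk)) (ℕ.≤-reflexive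
          (≡.trans (≡.trans (≡.cong (rk r ℕ.+_) (≡.sym (ℕ.+-identityʳ (rk r)))) (≡.cong (2 ℕ.*_) (≡.sym (ℕ.m∸n+n≡m j≤rk)))) (ℕ.*-distribˡ-+ 2 k j))))
        rev-at : ∀ q → Poly.reverse (rk r) q k ≡ q j
        rev-at q with k ≤ᵇ rk r in b
        ... | true = ≡.cong q (ℕ.m∸[m∸n]≡n j≤rk)
        ... | false with () ← ≡.subst T b (ℕ.≤⇒≤ᵇ (ℕ.m∸n≤m (rk r) j))
        replace : ∀ F → Flat r F → (characteristic M p F Poly.⊠ Pℚ (contraction r F)) k ≡ (characteristic M p F Poly.⊠ p F) k
        replace F fl with isEmpty F in em
        ... | false = Poly.⊠-cong {f = characteristic M p F} (λ _ → ≡.refl) (λ i → ≡.trans (IH (rk r ∸ r F) smaller r′ isMatroid′ (loopless′ fl) rk′ (λ Y → p (ε Y)) candidate′ i) (≡.cong (λ Z → p Z i) ε-⊥)) k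
          where
          open Contraction M F
          open Contracted M C fl
          smaller : rk r ∸ r F ≤ d
          smaller = ℕ.≤-pred (ℕ.≤-trans (ℕ.∸-monoʳ-< {rk r} {r F} {0} rF>0 (IsMatroid.monotone M F ⊤ (λ _ → ∈⊤))) (ℕ.≤-reflexive e))
            where
            rF>0 : 0 < r F
            rF>0 = let (x , x∈) = isEmpty-false F em in ℕ.≤-trans (ℕ.≤-reflexive (≡.sym (ll x))) (IsMatroid.monotone M ⁅ x ⁆ F (⁅⁆-⊆ x∈))
        -- The contraction at `⊥` has the same rank, so the induction hypothesis says nothing about
        -- it. But `k` is at least half the rank, and there both polynomials are zero by their
        -- degree bounds.
        ... | true with ≡.refl ← isEmpty-complete F em = ≡.trans (characteristic-⊠ M p ⊥ (Pℚ (contraction r ⊥)) k)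
                (≡.trans (Σₛ-cong vanish₁) (≡.sym (≡.trans (characteristic-⊠ M p ⊥ (p ⊥) k) (Σₛ-cong vanish₂))))
          where
          open Contraction M ⊥
          rk′≡ : rk r′ ≡ rk r
          rk′≡ = ≡.trans (≡.cong₂ (λ Z z → r Z ∸ z) ε-⊤ rank-⊥) ≡.refl
          r⊥∸ : ∀ X → r ⊥ ∸ r X ≡ 0
          r⊥∸ X = ≡.trans (≡.cong (_∸ r X) rank-⊥) (ℕ.0∸n≡0 (r X))
          vanish : ∀ q → q k ≡ 0ℚ → ∀ X → [ X ⊆ᵇ ⊥ ] (sgn ∣ X ∣ ℚ.* Poly.raise (r ⊥ ∸ r X) q k) ≡ [ X ⊆ᵇ ⊥ ] (sgn ∣ X ∣ ℚ.* 0ℚ)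
          vanish q qk X = ≡.cong (λ z → [ X ⊆ᵇ ⊥ ] (sgn ∣ X ∣ ℚ.* z)) (≡.trans (≡.cong (λ d → Poly.raise d q k) (r⊥∸ X)) qk)
          vanish₁ = vanish (Pℚ (contraction r ⊥)) (≡.cong ι (kl-degree r′ isMatroid′ (loopless′ fl) (≡.subst (0 <_) (≡.sym (≡.trans rk′≡ e)) (s≤s z≤n)) k (≡.subst (_≤ 2 ℕ.* k) (≡.sym rk′≡) rk≤2k)))
          vanish₂ = vanish (p ⊥) (Candidate.degree C ⊥ fl (≡.subst₂ _<_ (≡.sym rank-⊥) (≡.sym e) (s≤s z≤n)) k (ℕ.≤-trans (ℕ.m∸n≤m (rk r) (r ⊥)) rk≤2k))

      all-ranks : ∀ d d′ → d′ ≤ d → Holds d′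
      all-ranks d zero le = rank-zero
      all-ranks (suc d) (suc d′) (s≤s le) = rank-positive d′ (λ d″ le″ → all-ranks d d″ (ℕ.≤-trans le″ le))

    unique : ∀ {m} (r : RankFn m) → IsMatroid r → Loopless r → ∀ p → Candidate r p → ∀ k → Pℚ r k ≡ p ⊥ k
    unique r M ll p C = all-ranks (rk r) (rk r) ℕ.≤-refl r M ll ≡.refl p C

-- Connectivity, components and graphic matroids.

module Graphs where

  open SubsetSums
  open Matroids
  open import Data.Bool.Base using (T)
  open import Data.Bool.ListAction using (all; any)
  open import Data.Empty using () renaming (⊥ to Void)
  open import Data.Fin.Subset using (Subset; ⊥; ⁅_⁆; _∪_; _∩_; _⊆_; ∣_∣; _∈_; _∉_)
  open import Data.Fin.Subset.Properties
  open import Data.List.Base using (filter; allFin)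
  open import Data.List.Properties using (length-map; length-tabulate; length-filter)
  open import Data.List.Membership.Propositional using () renaming (_∈_ to _∈ᴸ_)
  open import Data.List.Membership.Propositional.Properties using (∈-filter⁺; ∈-filter⁻; ∈-tabulate⁺; ∈-lookup; ∈-map⁺; ∈-map⁻)
  open import Data.List.Relation.Unary.Any as Any using (here; there)
  open import Data.List.Relation.Unary.Any.Properties using (lookup-index)
  open import Data.List.Relation.Unary.All using (All; []; _∷_)
  open import Data.List.Relation.Unary.AllPairs using ([]; _∷_)
  open import Data.List.Relation.Unary.Unique.Propositional using (Unique)
  open import Data.List.Relation.Unary.Unique.Propositional.Properties using (allFin⁺; filter⁺)
  open import Data.Nat.Base using (_≤_; _<_)
  open import Data.Product.Base using (_×_)
  open import Data.Sum.Base using ([_,_]′)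
  open import Data.Vec.Base using ([]; _∷_; tabulate)
  open import Data.Vec.Properties using ([]=⇒lookup; lookup⇒[]=; lookup∘tabulate)
  open import Relation.Binary.Definitions using (tri<; tri≈; tri>)
  open import Relation.Nullary using (contradiction)
  open import Relation.Nullary.Decidable using (¬?; _×-dec_; map′)

  any-sound : {A : Set} (p : A → Bool) (xs : List A) → any p xs ≡ true → ∃ λ x → x ∈ᴸ xs × p x ≡ true
  any-sound p (x ∷ xs) h with p x in e
  ... | true = x , here ≡.refl , e
  ... | false = let (y , y∈ , q) = any-sound p xs h in y , there y∈ , q

  any-complete : {A : Set} (p : A → Bool) {xs : List A} {x : A} → x ∈ᴸ xs → p x ≡ true → any p xs ≡ true
  any-complete p {x ∷ xs} (here ≡.refl) e rewrite e = ≡.refl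
  any-complete p {y ∷ xs} (there x∈) e with p y
  ... | true = ≡.refl
  ... | false = any-complete p x∈ e

  ∨-split : ∀ {a b} → (a ∨ b) ≡ true → a ≡ true ⊎ b ≡ true
  ∨-split {true} e = inj₁ ≡.refl
  ∨-split {false} e = inj₂ e

  ∧-intro : ∀ {a b} → a ≡ true → b ≡ true → (a ∧ b) ≡ true
  ∧-intro ≡.refl ≡.refl = ≡.refl

  ∧-elim : ∀ {a b} → (a ∧ b) ≡ true → a ≡ true × b ≡ true
  ∧-elim {true} e = ≡.refl , e

  ∨-introʳ : ∀ a {b} → b ≡ true → (a ∨ b) ≡ true
  ∨-introʳ true e = ≡.refl
  ∨-introʳ false e = e

  true≢false : ∀ {b} → b ≡ true → b ≡ false → Void
  true≢false ≡.refl ()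

  module _ {v : ℕ} where

    ==-sound : (a b : Fin v) → (a == b) ≡ true → a ≡ b
    ==-sound a b e with a Fin.≟ b
    ... | yes p = p

    ==-refl : (a : Fin v) → (a == a) ≡ true
    ==-refl a with a Fin.≟ a
    ... | yes p = ≡.refl
    ... | no ¬p = ⊥-elim (¬p ≡.refl)

    -- Walks without the length bound built into `reach`; edges are listed with an orientation but
    -- may be traversed both ways.
    data Connected (es : Graph v) (a : Fin v) : Fin v → Set where
      done  : Connected es a a
      along : ∀ {b c} → Connected es a b → (b , c) ∈ᴸ es → Connected es a c
      back  : ∀ {b c} → Connected es a b → (c , b) ∈ᴸ es → Connected es a c

    module _ {es : Graph v} where

      conn-trans : ∀ {a b c} → Connected es a b → Connected es b c → Connected es a c
      conn-trans p done = p
      conn-trans p (along q e) = along (conn-trans p q) e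
      conn-trans p (back q e) = back (conn-trans p q) e

      conn-sym : ∀ {a b} → Connected es a b → Connected es b a
      conn-sym done = done
      conn-sym (along q e) = conn-trans (back done e) (conn-sym q)
      conn-sym (back q e) = conn-trans (along done e) (conn-sym q)

      conn-invariant : {A : Set} (ℓ : Fin v → A) → (∀ {x y} → (x , y) ∈ᴸ es → ℓ x ≡ ℓ y) → ∀ {a b} → Connected es a b → ℓ a ≡ ℓ b
      conn-invariant ℓ h done = ≡.refl
      conn-invariant ℓ h (along q e) = ≡.trans (conn-invariant ℓ h q) (h e)
      conn-invariant ℓ h (back q e) = ≡.trans (conn-invariant ℓ h q) (≡.sym (h e))

    conn-mono : ∀ {es es′ : Graph v} → (∀ {x y} → (x , y) ∈ᴸ es → Connected es′ x y) → ∀ {a b} → Connected es a b → Connected es′ a b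
    conn-mono h done = done
    conn-mono h (along q e) = conn-trans (conn-mono h q) (h e)
    conn-mono h (back q e) = conn-trans (conn-mono h q) (conn-sym (h e))

    -- The balls around a vertex grow strictly until they are stable, so v steps suffice.
    module Reach (es : Graph v) where

      sound : ∀ k {a b} → reach es k a b ≡ true → Connected es a b
      sound zero {a} {b} h = ≡.subst (Connected es a) (==-sound a b h) done
      sound (suc k) {a} {b} h with ∨-split {reach es k a b} h
      ... | inj₁ p = sound k p
      ... | inj₂ q with any-sound _ es q
      ...   | (x , y) , e∈ , t with ∨-split {reach es k a x ∧ (y == b)} t
      ...     | inj₁ t′ = let (p , yb) = ∧-elim t′ in ≡.subst (Connected es a) (==-sound y b yb) (along (sound k p) e∈)
      ...     | inj₂ t′ = let (p , xb) = ∧-elim t′ in ≡.subst (Connected es a) (==-sound x b xb) (back (sound k p) e∈)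

      step-along : ∀ k {a b c} → reach es k a b ≡ true → (b , c) ∈ᴸ es → reach es (suc k) a c ≡ true
      step-along k {a} {b} {c} p e∈ = ∨-introʳ (reach es k a c) (any-complete _ e∈ (≡.cong (_∨ (reach es k a c ∧ (b == c))) (∧-intro p (==-refl c))))

      step-back : ∀ k {a b c} → reach es k a b ≡ true → (c , b) ∈ᴸ es → reach es (suc k) a c ≡ true
      step-back k {a} {b} {c} p e∈ = ∨-introʳ (reach es k a c) (any-complete _ e∈ (∨-introʳ (reach es k a c ∧ (b == c)) (∧-intro p (==-refl c))))

      grow : ∀ k {a b} → reach es k a b ≡ true → reach es (suc k) a b ≡ true
      grow k p rewrite p = ≡.refl

      grow-≤ : ∀ {k k′} → k ≤ k′ → ∀ {a b} → reach es k a b ≡ true → reach es k′ a b ≡ true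
      grow-≤ {k} {k′} le p with ℕ.m≤n⇒m<n∨m≡n le
      ... | inj₂ ≡.refl = p
      grow-≤ {k} {suc k′} le p | inj₁ (s≤s lt) = grow k′ (grow-≤ lt p)

      module _ (a : Fin v) where

        Stable : ℕ → Set
        Stable k = ∀ b → reach es (suc k) a b ≡ true → reach es k a b ≡ true

        ball : ℕ → Subset v
        ball k = tabulate (reach es k a)

        ∈-ball⁺ : ∀ k {b} → reach es k a b ≡ true → b ∈ ball k
        ∈-ball⁺ k {b} h = lookup⇒[]= b (ball k) (≡.trans (lookup∘tabulate (reach es k a) b) h)

        ∈-ball⁻ : ∀ k {b} → b ∈ ball k → reach es k a b ≡ true
        ∈-ball⁻ k {b} h = ≡.trans (≡.sym (lookup∘tabulate (reach es k a) b)) ([]=⇒lookup h)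

        stable-or-big : ∀ k → (∃ λ j → j ≤ k × Stable j) ⊎ suc k ≤ ∣ ball k ∣
        stable-or-big zero = inj₂ (≡.subst (_≤ ∣ ball 0 ∣) (∣⁅x⁆∣≡1 a) (p⊆q⇒∣p∣≤∣q∣ (⁅⁆-⊆ (∈-ball⁺ 0 (==-refl a)))))
        stable-or-big (suc k) with stable-or-big k
        ... | inj₁ (j , j≤k , s) = inj₁ (j , ℕ.m≤n⇒m≤1+n j≤k , s)
        ... | inj₂ big with Fin.any? (λ b → (reach es (suc k) a b 𝔹.≟ true) ×-dec (reach es k a b 𝔹.≟ false))
        ...   | yes (b , p , q) = inj₂ (ℕ.≤-trans (s≤s big) (p⊂q⇒∣p∣<∣q∣ ((λ h → ∈-ball⁺ (suc k) (grow k (∈-ball⁻ k h))) , b , ∈-ball⁺ (suc k) p , λ h → true≢false (∈-ball⁻ k h) q)))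
        ...   | no none = inj₁ (k , ℕ.n≤1+n k , λ b p → 𝔹.¬-not (λ q → none (b , p , q)))

        stable-complete : ∀ k → Stable k → ∀ {b} → Connected es a b → reach es k a b ≡ true
        stable-complete k s done = grow-≤ {0} {k} z≤n {a} {a} (==-refl a)
        stable-complete k s (along q e) = s _ (step-along k (stable-complete k s q) e)
        stable-complete k s (back q e) = s _ (step-back k (stable-complete k s q) e)

        complete : ∀ {b} → Connected es a b → reach es v a b ≡ true
        complete c with stable-or-big v
        ... | inj₁ (j , j≤v , s) = grow-≤ j≤v (stable-complete j s c)
        ... | inj₂ big = contradiction (ℕ.≤-trans big (∣p∣≤n (ball v))) (ℕ.<⇒≱ (ℕ.n<1+n v))

      connected? : ∀ a b → Dec (Connected es a b)
      connected? a b = map′ (sound v) (complete a) (reach es v a b 𝔹.≟ true)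

    -- A system of representatives of the components. `components` counts the least vertices; since
    -- all such systems have equal length, a more convenient one can be counted instead.
    record Transversal (es : Graph v) (ts : List (Fin v)) : Set where
      field
        unique   : Unique ts
        covers   : ∀ i → ∃ λ t → t ∈ᴸ ts × Connected es i t
        separate : ∀ {s t} → s ∈ᴸ ts → t ∈ᴸ ts → Connected es s t → s ≡ t

    -- Sending each vertex of the first system to the one covering it in the second is injective,
    -- because the first system separates components.
    transversal-≤ : ∀ {es ts ts′} → Transversal es ts → Transversal es ts′ → length ts ≤ length ts′
    transversal-≤ {es} {ts} {ts′} A B = Fin.injective⇒≤ {f = f} inj
      where
      module A = Transversal A
      module B = Transversal B
      f : Fin (length ts) → Fin (length ts′)
      f i = Any.index (proj₁ (proj₂ (B.covers (List.lookup ts i))))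
      f-conn : ∀ i → Connected es (List.lookup ts i) (List.lookup ts′ (f i))
      f-conn i = let (t , t∈ , c) = B.covers (List.lookup ts i) in ≡.subst (Connected es (List.lookup ts i)) (lookup-index t∈) c
      inj : ∀ {i j} → f i ≡ f j → i ≡ j
      inj {i} {j} e = lookup-injective A.unique i j (A.separate (∈-lookup i) (∈-lookup j)
        (conn-trans (f-conn i) (≡.subst (λ z → Connected es (List.lookup ts′ z) (List.lookup ts j)) (≡.sym e) (conn-sym (f-conn j)))))

    minimal : Graph v → Fin v → Bool
    minimal es i = all (λ j → not (suc (toℕ j) ≤ᵇ toℕ i) ∨ not (reach es v j i)) (allFin v)

    minimals : Graph v → List (Fin v)
    minimals es = filter (λ i → minimal es i 𝔹.≟ true) (allFin v)

    minimal-sound : ∀ es i → minimal es i ≡ true → ∀ j → toℕ j < toℕ i → ¬ Connected es j i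
    minimal-sound es i h j lt c with suc (toℕ j) ≤ᵇ toℕ i in p | reach es v j i in q | all-allFin⁻ _ h j
    ... | true | false | t = true≢false (Reach.complete es j c) q
    ... | false | _ | t = ≡.subst T p (ℕ.≤⇒≤ᵇ lt)

    minimal-complete : ∀ es i → (∀ j → toℕ j < toℕ i → ¬ Connected es j i) → minimal es i ≡ true
    minimal-complete es i h = all-allFin⁺ _ go
      where
      go : ∀ j → (not (suc (toℕ j) ≤ᵇ toℕ i) ∨ not (reach es v j i)) ≡ true
      go j with suc (toℕ j) ≤ᵇ toℕ i in p | reach es v j i in q
      ... | false | _ = ≡.refl
      ... | true | false = ≡.refl
      ... | true | true = ⊥-elim (h j (ℕ.≤ᵇ⇒≤ _ _ (≡.subst T (≡.sym p) _)) (Reach.sound es v q))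

    minimals-transversal : ∀ es → Transversal es (minimals es)
    minimals-transversal es = record
      { unique = filter⁺ (λ i → minimal es i 𝔹.≟ true) (allFin⁺ v)
      ; covers = λ i → find (toℕ i) i ℕ.≤-refl
      ; separate = λ {s} {t} s∈ t∈ c → sep s t (proj₂ (∈-filter⁻ (λ i → minimal es i 𝔹.≟ true) {xs = allFin v} s∈)) (proj₂ (∈-filter⁻ (λ i → minimal es i 𝔹.≟ true) {xs = allFin v} t∈)) c }
      where
      sep : ∀ s t → minimal es s ≡ true → minimal es t ≡ true → Connected es s t → s ≡ t
      sep s t ms mt c with ℕ.<-cmp (toℕ s) (toℕ t)
      ... | tri< lt _ _ = ⊥-elim (minimal-sound es t mt s lt c)
      ... | tri≈ _ e _ = Fin.toℕ-injective e
      ... | tri> _ _ gt = ⊥-elim (minimal-sound es s ms t gt (conn-sym c))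
      find : ∀ n i → toℕ i ≤ n → ∃ λ t → t ∈ᴸ minimals es × Connected es i t
      find n i le with Fin.any? (λ j → (toℕ j ℕ.<? toℕ i) ×-dec Reach.connected? es j i)
      ... | no none = i , ∈-filter⁺ (λ i → minimal es i 𝔹.≟ true) (∈-tabulate⁺ i) (minimal-complete es i (λ j lt c → none (j , lt , c))) , done
      find zero i le | yes (j , lt , c) with () ← ℕ.≤-trans lt le
      find (suc n) i le | yes (j , lt , c) = let (t , t∈ , d) = find n j (ℕ.≤-pred (ℕ.≤-trans lt le)) in t , t∈ , conn-trans (conn-sym c) d

    components-transversal : ∀ {es ts} → Transversal es ts → components es ≡ length ts
    components-transversal {es} A = ℕ.≤-antisym (transversal-≤ (minimals-transversal es) A) (transversal-≤ A (minimals-transversal es))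

    components≤v : ∀ es → components es ≤ v
    components≤v es = ℕ.≤-trans (length-filter (λ i → minimal es i 𝔹.≟ true) (allFin v)) (ℕ.≤-reflexive (length-tabulate id))

    record AddsEdge (es es′ : Graph v) (a b : Fin v) : Set where
      field
        old  : ∀ {x y} → (x , y) ∈ᴸ es → (x , y) ∈ᴸ es′
        new  : (a , b) ∈ᴸ es′
        only : ∀ {x y} → (x , y) ∈ᴸ es′ → (x , y) ∈ᴸ es ⊎ (x ≡ a × y ≡ b)

    module _ {es es′ : Graph v} {a b : Fin v} (add : AddsEdge es es′ a b) where
      open AddsEdge add

      conn-old : ∀ {x y} → Connected es x y → Connected es′ x y
      conn-old = conn-mono (λ e → along done (old e))

      components-spanned : Connected es a b → components es′ ≡ components es
      components-spanned ab = components-transversal (record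
        { unique = unique
        ; covers = λ i → let (t , t∈ , c) = covers i in t , t∈ , conn-old c
        ; separate = λ s∈ t∈ c → separate s∈ t∈ (conn-mono (λ e → [ along done , (λ { (≡.refl , ≡.refl) → ab }) ]′ (only e)) c) })
        where open Transversal (minimals-transversal es)

      -- One crossing of the new edge suffices: crossing back returns to a component already
      -- visited.
      conn-new : ∀ {x y} → Connected es′ x y → Connected es x y ⊎ (Connected es x a × Connected es b y) ⊎ (Connected es x b × Connected es a y)
      conn-new done = inj₁ done
      conn-new (along q e) with conn-new q | only e
      ... | inj₁ c | inj₁ e′ = inj₁ (along c e′)
      ... | inj₁ c | inj₂ (≡.refl , ≡.refl) = inj₂ (inj₁ (c , done))
      ... | inj₂ (inj₁ (p , q′)) | inj₁ e′ = inj₂ (inj₁ (p , along q′ e′))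
      ... | inj₂ (inj₁ (p , q′)) | inj₂ (≡.refl , ≡.refl) = inj₂ (inj₁ (p , done))
      ... | inj₂ (inj₂ (p , q′)) | inj₁ e′ = inj₂ (inj₂ (p , along q′ e′))
      ... | inj₂ (inj₂ (p , q′)) | inj₂ (≡.refl , ≡.refl) = inj₁ p
      conn-new (back q e) with conn-new q | only e
      ... | inj₁ c | inj₁ e′ = inj₁ (back c e′)
      ... | inj₁ c | inj₂ (≡.refl , ≡.refl) = inj₂ (inj₂ (c , done))
      ... | inj₂ (inj₁ (p , q′)) | inj₁ e′ = inj₂ (inj₁ (p , back q′ e′))
      ... | inj₂ (inj₁ (p , q′)) | inj₂ (≡.refl , ≡.refl) = inj₁ p
      ... | inj₂ (inj₂ (p , q′)) | inj₁ e′ = inj₂ (inj₂ (p , back q′ e′))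
      ... | inj₂ (inj₂ (p , q′)) | inj₂ (≡.refl , ≡.refl) = inj₂ (inj₂ (p , done))

      components-joined : ¬ Connected es a b → components es ≡ suc (components es′)
      components-joined ¬ab = ≡.trans (length-remove (minimals es) unique β∈) (≡.cong suc (≡.sym (components-transversal new-transversal)))
        where
        open Transversal (minimals-transversal es)
        α β : Fin v
        α = proj₁ (covers a)
        β = proj₁ (covers b)
        α∈ = proj₁ (proj₂ (covers a))
        β∈ = proj₁ (proj₂ (covers b))
        aα = proj₂ (proj₂ (covers a))
        bβ = proj₂ (proj₂ (covers b))
        α≢β : α ≢ β
        α≢β e = ¬ab (conn-trans aα (≡.subst (λ z → Connected es z b) (≡.sym e) (conn-sym bβ)))
        P? : ∀ i → Dec (¬ i ≡ β)
        P? i = ¬? (i Fin.≟ β)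
        length-remove : ∀ ts → Unique ts → ∀ {x} → x ∈ᴸ ts → length ts ≡ suc (length (filter (λ i → ¬? (i Fin.≟ x)) ts))
        length-remove (t ∷ ts) (p ∷ u) {x} x∈ with t Fin.≟ x
        length-remove (t ∷ ts) (p ∷ u) {x} x∈ | yes ≡.refl = ≡.cong suc (≡.sym (keep ts p))
          where
          keep : ∀ ts → All (t ≢_) ts → length (filter (λ i → ¬? (i Fin.≟ t)) ts) ≡ length ts
          keep [] [] = ≡.refl
          keep (s ∷ ts) (q ∷ p) with s Fin.≟ t
          ... | yes e = ⊥-elim (q (≡.sym e))
          ... | no _ = ≡.cong suc (keep ts p)
        length-remove (t ∷ ts) (p ∷ u) {x} (here e) | no t≢x = ⊥-elim (t≢x (≡.sym e))
        length-remove (t ∷ ts) (p ∷ u) {x} (there x∈) | no t≢x = ≡.cong suc (length-remove ts u x∈)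
        new-transversal : Transversal es′ (filter P? (minimals es))
        new-transversal = record
          { unique = filter⁺ P? unique
          ; covers = cov′
          ; separate = λ s∈ t∈ c → let (s∈′ , s≢) = ∈-filter⁻ P? {xs = minimals es} s∈ ; (t∈′ , t≢) = ∈-filter⁻ P? {xs = minimals es} t∈ in sep s∈′ s≢ t∈′ t≢ (conn-new c) }
          where
          cov′ : ∀ i → ∃ λ t → t ∈ᴸ filter P? (minimals es) × Connected es′ i t
          cov′ i with covers i
          ... | t , t∈ , c with t Fin.≟ β
          ...   | no t≢ = t , ∈-filter⁺ P? t∈ t≢ , conn-old c
          ...   | yes ≡.refl = α , ∈-filter⁺ P? α∈ α≢β , conn-trans (conn-old (conn-trans c (conn-sym bβ))) (conn-trans (back done new) (conn-old aα))
          sep : ∀ {s t} → s ∈ᴸ minimals es → s ≢ β → t ∈ᴸ minimals es → t ≢ β → Connected es s t ⊎ (Connected es s a × Connected es b t) ⊎ (Connected es s b × Connected es a t) → s ≡ t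
          sep s∈ s≢ t∈ t≢ (inj₁ c) = separate s∈ t∈ c
          sep s∈ s≢ t∈ t≢ (inj₂ (inj₁ (_ , bt))) = ⊥-elim (t≢ (separate t∈ β∈ (conn-trans (conn-sym bt) bβ)))
          sep s∈ s≢ t∈ t≢ (inj₂ (inj₂ (sb , _))) = ⊥-elim (s≢ (separate s∈ β∈ (conn-trans sb bβ)))

  -- Matroid axioms from a monotone relation that decides whether an element raises the rank; any
  -- two sets are compared by adding elements one at a time.
  module FromSpan {m} (r : RankFn m) (Spanned : Subset m → Fin m → Set) (spanned? : ∀ X e → Dec (Spanned X e))
    (rank-spanned : ∀ {X e} → Spanned X e → r (X ∪ ⁅ e ⁆) ≡ r X)
    (rank-unspanned : ∀ {X e} → ¬ Spanned X e → r (X ∪ ⁅ e ⁆) ≡ suc (r X))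
    (spanned-mono : ∀ {X Y e} → X ⊆ Y → Spanned X e → Spanned Y e)
    (rank-empty : r ⊥ ≡ 0) where

    adjoin : Subset m → List (Fin m) → Subset m
    adjoin X [] = X
    adjoin X (e ∷ l) = adjoin X l ∪ ⁅ e ⁆

    adjoin-mono : ∀ {X Y} l → X ⊆ Y → adjoin X l ⊆ adjoin Y l
    adjoin-mono [] s = s
    adjoin-mono {X} {Y} (e ∷ l) s = ∪-mono {Y = ⁅ e ⁆} (adjoin-mono l s) id

    adjoin-∪ : ∀ X l {i} → i ∈ adjoin X l → i ∈ X ⊎ i ∈ᴸ l
    adjoin-∪ X [] i∈ = inj₁ i∈
    adjoin-∪ X (e ∷ l) i∈ with x∈p∪q⁻ (adjoin X l) ⁅ e ⁆ i∈
    ... | inj₁ p = [ inj₁ , inj₂ ∘ there ]′ (adjoin-∪ X l p)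
    ... | inj₂ q = inj₂ (here (x∈⁅y⁆⇒x≡y e q))

    ⊆-adjoin : ∀ X l → X ⊆ adjoin X l
    ⊆-adjoin X [] i∈ = i∈
    ⊆-adjoin X (e ∷ l) i∈ = p⊆p∪q ⁅ e ⁆ (⊆-adjoin X l i∈)

    ∈-adjoin : ∀ X l {i} → i ∈ᴸ l → i ∈ adjoin X l
    ∈-adjoin X (e ∷ l) (here ≡.refl) = q⊆p∪q (adjoin X l) ⁅ e ⁆ (x∈⁅x⁆ e)
    ∈-adjoin X (e ∷ l) (there i∈) = p⊆p∪q ⁅ e ⁆ (∈-adjoin X l i∈)

    adjoin-members : ∀ X Y → adjoin X (members Y) ≡ X ∪ Y
    adjoin-members X Y = ⊆-antisym (λ i∈ → x∈p∪q⁺ ([ inj₁ , inj₂ ∘ ∈-members⁻ Y ]′ (adjoin-∪ X (members Y) i∈)))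
      (∪-lub (⊆-adjoin X (members Y)) (λ i∈ → ∈-adjoin X (members Y) (∈-members⁺ Y i∈)))

    rank-adjoin-≥ : ∀ X l → r X ≤ r (adjoin X l)
    rank-adjoin-≥ X [] = ℕ.≤-refl
    rank-adjoin-≥ X (e ∷ l) with spanned? (adjoin X l) e
    ... | yes s = ℕ.≤-trans (rank-adjoin-≥ X l) (ℕ.≤-reflexive (≡.sym (rank-spanned s)))
    ... | no ¬s = ℕ.≤-trans (rank-adjoin-≥ X l) (ℕ.≤-trans (ℕ.n≤1+n _) (ℕ.≤-reflexive (≡.sym (rank-unspanned ¬s))))

    rank-adjoin-≤ : ∀ X l → r (adjoin X l) ≤ length l ℕ.+ r X
    rank-adjoin-≤ X [] = ℕ.≤-refl
    rank-adjoin-≤ X (e ∷ l) with spanned? (adjoin X l) e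
    ... | yes s = ℕ.≤-trans (ℕ.≤-reflexive (rank-spanned s)) (ℕ.m≤n⇒m≤1+n (rank-adjoin-≤ X l))
    ... | no ¬s = ℕ.≤-trans (ℕ.≤-reflexive (rank-unspanned ¬s)) (s≤s (rank-adjoin-≤ X l))

    -- What a set spans is spanned by every larger set, so an element raises the rank over `Y` only
    -- if it does so over `X`. This is submodularity.
    diminishing : ∀ {X Y} → X ⊆ Y → ∀ l → r (adjoin Y l) ℕ.+ r X ≤ r (adjoin X l) ℕ.+ r Y
    diminishing {X} {Y} s [] = ℕ.≤-reflexive (ℕ.+-comm (r Y) (r X))
    diminishing {X} {Y} s (e ∷ l) with spanned? (adjoin X l) e | spanned? (adjoin Y l) e
    ... | yes sX | yes sY = ≡.subst₂ _≤_ (≡.cong (ℕ._+ r X) (≡.sym (rank-spanned sY))) (≡.cong (ℕ._+ r Y) (≡.sym (rank-spanned sX))) (diminishing s l)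
    ... | yes sX | no ¬sY = ⊥-elim (¬sY (spanned-mono (adjoin-mono l s) sX))
    ... | no ¬sX | yes sY = ≡.subst₂ _≤_ (≡.cong (ℕ._+ r X) (≡.sym (rank-spanned sY))) (≡.cong (ℕ._+ r Y) (≡.sym (rank-unspanned ¬sX))) (ℕ.m≤n⇒m≤1+n (diminishing s l))
    ... | no ¬sX | no ¬sY = ≡.subst₂ _≤_ (≡.cong (ℕ._+ r X) (≡.sym (rank-unspanned ¬sY))) (≡.cong (ℕ._+ r Y) (≡.sym (rank-unspanned ¬sX))) (s≤s (diminishing s l))

    length-members : ∀ {m} (X : Subset m) → length (members X) ≡ ∣ X ∣
    length-members [] = ≡.refl
    length-members (true ∷ X) = ≡.trans (≡.cong length (members-∷ true X)) (≡.cong suc (≡.trans (length-map suc (members X)) (length-members X)))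
    length-members (false ∷ X) = ≡.trans (≡.cong length (members-∷ false X)) (≡.trans (length-map suc (members X)) (length-members X))

    isMatroid : IsMatroid r
    isMatroid = record
      { bounded = λ X → ≡.subst₂ _≤_ (≡.cong r (≡.trans (adjoin-members ⊥ X) (∪-identityˡ X))) (≡.trans (≡.cong₂ ℕ._+_ (length-members X) rank-empty) (ℕ.+-identityʳ ∣ X ∣)) (rank-adjoin-≤ ⊥ (members X))
      ; monotone = λ X Y s → ≡.subst (r X ≤_) (≡.cong r (≡.trans (adjoin-members X Y) (⊆-antisym (∪-lub s id) (q⊆p∪q X Y)))) (rank-adjoin-≥ X (members Y))
      ; submodular = λ X Y → ≡.subst₂ _≤_ (≡.cong (λ Z → r Z ℕ.+ r (X ∩ Y)) (adjoin-members X Y))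
          (≡.trans (≡.cong (λ Z → r Z ℕ.+ r X) (≡.trans (adjoin-members (X ∩ Y) Y) (⊆-antisym (∪-lub (p∩q⊆q X Y) id) (q⊆p∪q (X ∩ Y) Y)))) (ℕ.+-comm (r Y) (r X)))
          (diminishing {X ∩ Y} {X} (p∩q⊆p X Y) (members Y)) }

  module GraphicMatroid {v : ℕ} (G : Graph v) where

    edges : Subset (length G) → Graph v
    edges X = map (List.lookup G) (members X)

    src tgt : Fin (length G) → Fin v
    src e = proj₁ (List.lookup G e)
    tgt e = proj₂ (List.lookup G e)

    edges⁺ : ∀ X {e} → e ∈ X → (src e , tgt e) ∈ᴸ edges X
    edges⁺ X e∈ = ∈-map⁺ (List.lookup G) (∈-members⁺ X e∈)

    edges⁻ : ∀ X {x y} → (x , y) ∈ᴸ edges X → ∃ λ e → e ∈ X × x ≡ src e × y ≡ tgt e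
    edges⁻ X p = let (e , e∈ , q) = ∈-map⁻ (List.lookup G) p in e , ∈-members⁻ X e∈ , ≡.cong proj₁ q , ≡.cong proj₂ q

    Spanned : Subset (length G) → Fin (length G) → Set
    Spanned X e = Connected (edges X) (src e) (tgt e)

    r : RankFn (length G)
    r = graphicRank G

    adds : ∀ X e → AddsEdge (edges X) (edges (X ∪ ⁅ e ⁆)) (src e) (tgt e)
    adds X e = record
      { old = λ p → let (e′ , e′∈ , q , q′) = edges⁻ X p in ≡.subst₂ (λ a b → (a , b) ∈ᴸ edges (X ∪ ⁅ e ⁆)) (≡.sym q) (≡.sym q′) (edges⁺ (X ∪ ⁅ e ⁆) (p⊆p∪q ⁅ e ⁆ e′∈))
      ; new = edges⁺ (X ∪ ⁅ e ⁆) (q⊆p∪q X ⁅ e ⁆ (x∈⁅x⁆ e))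
      ; only = λ p → let (e′ , e′∈ , q , q′) = edges⁻ (X ∪ ⁅ e ⁆) p in
          [ (λ e′∈X → inj₁ (≡.subst₂ (λ a b → (a , b) ∈ᴸ edges X) (≡.sym q) (≡.sym q′) (edges⁺ X e′∈X)))
          , (λ e′∈e → let eq = x∈⁅y⁆⇒x≡y e e′∈e in inj₂ (≡.trans q (≡.cong src eq) , ≡.trans q′ (≡.cong tgt eq))) ]′ (x∈p∪q⁻ X ⁅ e ⁆ e′∈) }

    rank-spanned : ∀ {X e} → Spanned X e → r (X ∪ ⁅ e ⁆) ≡ r X
    rank-spanned {X} {e} s = ≡.cong (v ∸_) (components-spanned (adds X e) s)

    rank-unspanned : ∀ {X e} → ¬ Spanned X e → r (X ∪ ⁅ e ⁆) ≡ suc (r X)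
    -- `components≤v` prevents the subtraction from being truncated.
    rank-unspanned {X} {e} ¬s = ≡.trans (≡.sym (suc-∸ (≡.subst (_≤ v) joined (components≤v (edges X))))) (≡.cong (λ z → suc (v ∸ z)) (≡.sym joined))
      where
      joined = components-joined (adds X e) ¬s
      suc-∸ : ∀ {m n} → suc n ≤ m → suc (m ∸ suc n) ≡ m ∸ n
      suc-∸ {suc m} {zero} (s≤s z≤n) = ≡.refl
      suc-∸ {suc m} {suc n} (s≤s le) = suc-∸ le

    edges-mono : ∀ {X Y} → X ⊆ Y → ∀ {a b} → Connected (edges X) a b → Connected (edges Y) a b
    edges-mono {X} {Y} s = conn-mono (λ p → let (e , e∈ , q , q′) = edges⁻ X p in ≡.subst₂ (λ a b → Connected (edges Y) a b) (≡.sym q) (≡.sym q′) (along done (edges⁺ Y (s e∈))))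

    rank-empty : r ⊥ ≡ 0
    rank-empty = ≡.trans (≡.cong (v ∸_) (≡.trans (components-transversal (record
        { unique = allFin⁺ v ; covers = λ i → i , ∈-tabulate⁺ i , done ; separate = λ _ _ c → conn-invariant id (λ p → ⊥-elim (∉⊥ (proj₁ (proj₂ (edges⁻ ⊥ p))))) c })) (length-tabulate {n = v} id))) (ℕ.n∸n≡0 v)

    isMatroid : IsMatroid r
    isMatroid = FromSpan.isMatroid r Spanned (λ X e → Reach.connected? (edges X) (src e) (tgt e)) (λ {X} {e} → rank-spanned {X} {e}) (λ {X} {e} → rank-unspanned {X} {e}) (λ {X} {Y} s → edges-mono {X} {Y} s) rank-empty

    loopless : (∀ e → src e ≢ tgt e) → Loopless r
    loopless h e = ≡.trans (≡.cong r (≡.sym (∪-identityˡ ⁅ e ⁆))) (≡.trans (rank-unspanned {⊥} {e} (λ c → h e (conn-invariant id (λ p → ⊥-elim (∉⊥ (proj₁ (proj₂ (edges⁻ ⊥ p))))) c))) (≡.cong suc rank-empty))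

    flat⇒ : ∀ {F} → Flat r F → ∀ {e} → Spanned F e → e ∈ F
    flat⇒ {F} fl {e} s with e ∈? F
    ... | yes e∈ = e∈
    ... | no e∉ = ⊥-elim (fl e e∉ (rank-spanned {F} {e} s))

    ⇒flat : ∀ {F} → (∀ e → e ∉ F → ¬ Spanned F e) → Flat r F
    ⇒flat {F} h e e∉ eq = ℕ.1+n≢n (≡.trans (≡.sym (rank-unspanned {F} {e} (h e e∉))) eq)

    rank-transversal : ∀ {X ts} → Transversal (edges X) ts → r X ≡ v ∸ length ts
    rank-transversal t = ≡.cong (v ∸_) (components-transversal t)

-- The cycle of rim vertices and the coding of edge sets by words.

module WheelWords where

  open ClosedForm using (ℚ-ring)
  open SubsetSums
  open Matroids
  open Graphs
  open LetterWords using (Letter)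
  open import Data.Fin.Base using (fromℕ; inject₁; _↑ˡ_; _↑ʳ_; splitAt)
  open import Data.Fin.Subset using (Subset)
  open import Data.List.Properties using (length-map; length-applyUpTo; length-++)
  open import Data.Maybe.Base using (Maybe; just; nothing)
  open import Data.Maybe.Properties using (just-injective)
  open import Data.Nat.Base using (_≤_; _<_)
  open import Data.Product.Base using (_×_)
  open import Data.Vec.Base as Vec using (Vec; []; _∷_; lookup; tabulate)
  open import Data.Vec.Properties as Vec using (lookup∘tabulate; tabulate∘lookup; tabulate-cong; lookup-map; lookup-++ˡ; lookup-++ʳ)

  -- Edges are located by natural numbers first, since the length of the edge list equals n + n only
  -- by a proof.
  nth : {A : Set} → List A → ℕ → Maybe A
  nth [] _ = nothing
  nth (x ∷ xs) zero = just x
  nth (x ∷ xs) (suc k) = nth xs k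

  nth-lookup : {A : Set} (xs : List A) (i : Fin (length xs)) → nth xs (toℕ i) ≡ just (List.lookup xs i)
  nth-lookup (x ∷ xs) zero = ≡.refl
  nth-lookup (x ∷ xs) (suc i) = nth-lookup xs i

  nth-++ˡ : {A : Set} (xs ys : List A) {k : ℕ} → k < length xs → nth (xs ++ ys) k ≡ nth xs k
  nth-++ˡ (x ∷ xs) ys {zero} _ = ≡.refl
  nth-++ˡ (x ∷ xs) ys {suc k} (s≤s lt) = nth-++ˡ xs ys lt

  nth-++ʳ : {A : Set} (xs ys : List A) (k : ℕ) → nth (xs ++ ys) (length xs ℕ.+ k) ≡ nth ys k
  nth-++ʳ [] ys k = ≡.refl
  nth-++ʳ (x ∷ xs) ys k = nth-++ʳ xs ys k

  nth-map-applyUpTo : {A : Set} (f : ℕ → A) (g : ℕ → ℕ) (a : ℕ) {k : ℕ} → k < a → nth (map f (applyUpTo g a)) k ≡ just (f (g k))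
  nth-map-applyUpTo f g (suc a) {zero} _ = ≡.refl
  nth-map-applyUpTo f g (suc a) {suc k} (s≤s lt) = nth-map-applyUpTo f (g ∘ suc) a lt

  toℕ-vtx : ∀ n {k} → k ≤ n → toℕ (vtx n k) ≡ k
  toℕ-vtx n {zero} _ = ≡.refl
  toℕ-vtx (suc n) {suc k} (s≤s le) = ≡.cong suc (toℕ-vtx n le)

  vtx-rim : ∀ n (i : Fin n) → vtx n (suc (toℕ i)) ≡ suc i
  vtx-rim n i = Fin.toℕ-injective (toℕ-vtx n (Fin.toℕ<n i))

  module _ {m : ℕ} where

    next : Fin (suc m) → Fin (suc m)
    next i with m ℕ.≟ toℕ i
    ... | yes _ = zero
    ... | no m≢i = suc (Fin.lower₁ i m≢i)

    next-last : ∀ {i} → toℕ i ≡ m → next i ≡ zero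
    next-last {i} e with m ℕ.≟ toℕ i
    ... | yes _ = ≡.refl
    ... | no ne = ⊥-elim (ne (≡.sym e))

    toℕ-next : ∀ {i} → toℕ i ≢ m → toℕ (next i) ≡ suc (toℕ i)
    toℕ-next {i} ne with m ℕ.≟ toℕ i
    ... | yes e = ⊥-elim (ne (≡.sym e))
    ... | no m≢i = ≡.cong suc (Fin.toℕ-lower₁ i m≢i)

    private
      toℕ≤m : (i : Fin (suc m)) → toℕ i ≤ m
      toℕ≤m i = ℕ.≤-pred (Fin.toℕ<n i)

    next-inject₁ : (p : Fin m) → next (inject₁ p) ≡ suc p
    next-inject₁ p = Fin.toℕ-injective (≡.trans (toℕ-next (λ e → ℕ.<⇒≢ (Fin.toℕ<n p) (≡.trans (≡.sym (Fin.toℕ-inject₁ p)) e))) (≡.cong suc (Fin.toℕ-inject₁ p)))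

    module _ (Q : Fin (suc m) → Set) where

      ascend : (∀ i → toℕ i ≢ m → Q i → Q (next i)) → ∀ {j} → Q j → ∀ i → toℕ j ≤ toℕ i → Q i
      ascend h {j} qj i le with ℕ.m≤n⇒m<n∨m≡n le
      ... | inj₂ e = ≡.subst Q (Fin.toℕ-injective e) qj
      ascend h {j} qj (suc p) le | inj₁ (s≤s lt) = ≡.subst Q (next-inject₁ p) (h (inject₁ p) (λ e → ℕ.<⇒≢ (Fin.toℕ<n p) (≡.trans (≡.sym (Fin.toℕ-inject₁ p)) e))
          (go (toℕ p) p ≡.refl lt))
        where
        go : ∀ k (p : Fin m) → toℕ p ≡ k → toℕ j ≤ toℕ p → Q (inject₁ p)
        go k p e le with ℕ.m≤n⇒m<n∨m≡n le
        ... | inj₂ e′ = ≡.subst Q (Fin.toℕ-injective (≡.trans e′ (≡.sym (Fin.toℕ-inject₁ p)))) qj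
        go zero p e le | inj₁ lt with () ← ≡.subst (toℕ j <_) e lt
        go (suc k) (suc p) e le | inj₁ (s≤s lt) = ≡.subst Q (next-inject₁ (inject₁ p)) (h (inject₁ (inject₁ p)) (λ eq → ℕ.<⇒≢ (ℕ.<-trans (ℕ.≤-reflexive (≡.cong suc (≡.trans (Fin.toℕ-inject₁ (inject₁ p)) (Fin.toℕ-inject₁ p)))) (Fin.toℕ<n (suc p))) eq)
            (go k (inject₁ p) (≡.trans (Fin.toℕ-inject₁ p) (ℕ.suc-injective e)) (≡.subst (toℕ j ≤_) (≡.sym (Fin.toℕ-inject₁ p)) lt)))

      descend : (∀ i → toℕ i ≢ m → Q (next i) → Q i) → ∀ {j} → Q j → ∀ i → toℕ i ≤ toℕ j → Q i
      descend h {j} qj i le = go (toℕ j ∸ toℕ i) i (ℕ.m∸n+n≡m le)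
        where
        go : ∀ d i → d ℕ.+ toℕ i ≡ toℕ j → Q i
        go zero i e = ≡.subst Q (Fin.toℕ-injective (≡.sym e)) qj
        go (suc d) i e = h i ne (go d (next i) (≡.trans (≡.cong (d ℕ.+_) (toℕ-next ne)) (≡.trans (ℕ.+-suc d (toℕ i)) e)))
          where
          ne : toℕ i ≢ m
          ne e′ = ℕ.<⇒≱ (s≤s (≡.subst (_≤ d ℕ.+ toℕ i) e′ (ℕ.m≤n+m (toℕ i) d))) (≡.subst (_≤ m) (≡.sym e) (toℕ≤m j))

      private
        top : Fin (suc m)
        top = fromℕ m
        next-top : next top ≡ zero
        next-top = next-last (Fin.toℕ-fromℕ m)

      -- Induction around the cycle: up from `j` to the last vertex, across to zero, and up again.
      forward : ∀ {j} → Q j → (∀ i → Q i → Q (next i)) → ∀ i → Q i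
      forward {j} qj h i = ascend (λ i _ → h i) {zero} (≡.subst Q next-top (h top (ascend (λ i _ → h i) qj top (≡.subst (toℕ j ≤_) (≡.sym (Fin.toℕ-fromℕ m)) (toℕ≤m j))))) i z≤n

      backward : ∀ {j} → Q j → (∀ i → Q (next i) → Q i) → ∀ i → Q i
      backward {j} qj h i = descend (λ i _ → h i) {top} (h top (≡.subst Q (≡.sym next-top) (descend (λ i _ → h i) qj zero z≤n))) i (≡.subst (toℕ i ≤_) (≡.sym (Fin.toℕ-fromℕ m)) (toℕ≤m i))

  Σʷ : ∀ {n} → (Vec Letter n → ℚ) → ℚ
  Σʷ {zero} f = f []
  Σʷ {suc n} f = Σʷ (λ w → f ((true , true) ∷ w)) ℚ.+ Σʷ (λ w → f ((true , false) ∷ w)) ℚ.+ (Σʷ (λ w → f ((false , true) ∷ w)) ℚ.+ Σʷ (λ w → f ((false , false) ∷ w)))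

  Σʷ-cong : ∀ {n} {f g : Vec Letter n → ℚ} → (∀ w → f w ≡ g w) → Σʷ f ≡ Σʷ g
  Σʷ-cong {zero} e = e []
  Σʷ-cong {suc n} e = ≡.cong₂ ℚ._+_ (≡.cong₂ ℚ._+_ (Σʷ-cong (λ w → e ((true , true) ∷ w))) (Σʷ-cong (λ w → e ((true , false) ∷ w)))) (≡.cong₂ ℚ._+_ (Σʷ-cong (λ w → e ((false , true) ∷ w))) (Σʷ-cong (λ w → e ((false , false) ∷ w))))

  Σʷ-+ : ∀ {n} (f g : Vec Letter n → ℚ) → Σʷ (λ w → f w ℚ.+ g w) ≡ Σʷ f ℚ.+ Σʷ g
  Σʷ-+ {zero} f g = ≡.refl
  Σʷ-+ {suc n} f g = ≡.trans (≡.cong₂ ℚ._+_ (≡.cong₂ ℚ._+_ (Σʷ-+ (λ w → f ((true , true) ∷ w)) (λ w → g ((true , true) ∷ w))) (Σʷ-+ (λ w → f ((true , false) ∷ w)) (λ w → g ((true , false) ∷ w)))) (≡.cong₂ ℚ._+_ (Σʷ-+ (λ w → f ((false , true) ∷ w)) (λ w → g ((false , true) ∷ w))) (Σʷ-+ (λ w → f ((false , false) ∷ w)) (λ w → g ((false , false) ∷ w)))))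
    (solve 8 (λ a b c d a′ b′ c′ d′ → (a :+ a′) :+ (b :+ b′) :+ ((c :+ c′) :+ (d :+ d′)) := (a :+ b :+ (c :+ d)) :+ (a′ :+ b′ :+ (c′ :+ d′))) ≡.refl
      (Σʷ (λ w → f ((true , true) ∷ w))) (Σʷ (λ w → f ((true , false) ∷ w))) (Σʷ (λ w → f ((false , true) ∷ w))) (Σʷ (λ w → f ((false , false) ∷ w)))
      (Σʷ (λ w → g ((true , true) ∷ w))) (Σʷ (λ w → g ((true , false) ∷ w))) (Σʷ (λ w → g ((false , true) ∷ w))) (Σʷ (λ w → g ((false , false) ∷ w))))
    where open IntegerCoefficientSolver ℚ-ring

  Σₛ-++ : ∀ a {b} (f : Subset (a ℕ.+ b) → ℚ) → Σₛ f ≡ Σₛ {a} (λ X → Σₛ {b} (λ Y → f (X Vec.++ Y)))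
  Σₛ-++ zero f = ≡.refl
  Σₛ-++ (suc a) f = ≡.cong₂ ℚ._+_ (Σₛ-++ a (λ X → f (true ∷ X))) (Σₛ-++ a (λ X → f (false ∷ X)))

  Σₛ-zip : ∀ n (f : Subset n → Subset n → ℚ) → Σₛ (λ X → Σₛ (f X)) ≡ Σʷ (λ w → f (Vec.map proj₂ w) (Vec.map proj₁ w))
  Σₛ-zip zero f = ≡.refl
  Σₛ-zip (suc n) f = ≡.trans (≡.cong₂ ℚ._+_ (half true) (half false))
    (solve 4 (λ a b c d → (a :+ c) :+ (b :+ d) := a :+ b :+ (c :+ d)) ≡.refl (S (true , true)) (S (true , false)) (S (false , true)) (S (false , false)))
    where
    open IntegerCoefficientSolver ℚ-ring
    S : Letter → ℚ
    S l = Σʷ (λ w → f (Vec.map proj₂ (l ∷ w)) (Vec.map proj₁ (l ∷ w)))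
    half : ∀ e → Σₛ (λ X → Σₛ (f (e ∷ X))) ≡ S (true , e) ℚ.+ S (false , e)
    half e = ≡.trans (Σₛ-+ {n} (λ X → Σₛ (λ Y → f (e ∷ X) (true ∷ Y))) (λ X → Σₛ (λ Y → f (e ∷ X) (false ∷ Y))))
      (≡.cong₂ ℚ._+_ (Σₛ-zip n (λ X Y → f (e ∷ X) (true ∷ Y))) (Σₛ-zip n (λ X Y → f (e ∷ X) (false ∷ Y))))

  Σₛ-subst : ∀ {a b} (eq : a ≡ b) (f : Subset b → ℚ) → Σₛ f ≡ Σₛ (λ X → f (≡.subst Subset eq X))
  Σₛ-subst ≡.refl f = ≡.refl

  lookup-subst : ∀ {a b} (eq : a ≡ b) (X : Subset a) i → lookup (≡.subst Subset eq X) (≡.subst Fin eq i) ≡ lookup X i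
  lookup-subst ≡.refl X i = ≡.refl

  toℕ-subst : ∀ {a b} (eq : a ≡ b) (i : Fin a) → toℕ (≡.subst Fin eq i) ≡ toℕ i
  toℕ-subst ≡.refl i = ≡.refl

  subst-surjective : ∀ {a b} (eq : a ≡ b) (j : Fin b) → ∃ λ i → ≡.subst Fin eq i ≡ j
  subst-surjective ≡.refl j = j , ≡.refl

  -- The rim edges are listed first, then the spokes.
  module Encoding (n : ℕ) {L : ℕ} (len : n ℕ.+ n ≡ L) where

    rimIdx spokeIdx : Fin n → Fin L
    rimIdx i = ≡.subst Fin len (i ↑ˡ n)
    spokeIdx i = ≡.subst Fin len (n ↑ʳ i)

    classify : ∀ j → (∃ λ i → j ≡ rimIdx i) ⊎ (∃ λ i → j ≡ spokeIdx i)
    classify j with subst-surjective len j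
    ... | k , ≡.refl with splitAt n k in e
    ...   | inj₁ i = inj₁ (i , ≡.cong (≡.subst Fin len) (≡.sym (Fin.splitAt⁻¹-↑ˡ e)))
    ...   | inj₂ i = inj₂ (i , ≡.cong (≡.subst Fin len) (≡.sym (Fin.splitAt⁻¹-↑ʳ e)))

    encode : Vec Letter n → Subset L
    encode w = ≡.subst Subset len (Vec.map proj₂ w Vec.++ Vec.map proj₁ w)

    decode : Subset L → Vec Letter n
    decode X = tabulate (λ i → lookup X (spokeIdx i) , lookup X (rimIdx i))

    lookup-decode : ∀ X i → lookup (decode X) i ≡ (lookup X (spokeIdx i) , lookup X (rimIdx i))
    lookup-decode X i = lookup∘tabulate (λ i → lookup X (spokeIdx i) , lookup X (rimIdx i)) i

    decode-encode : ∀ w → decode (encode w) ≡ w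
    decode-encode w = ≡.trans (tabulate-cong (λ i → ≡.cong₂ _,_
        (≡.trans (lookup-subst len bits (n ↑ʳ i)) (≡.trans (lookup-++ʳ (Vec.map proj₂ w) (Vec.map proj₁ w) i) (lookup-map i proj₁ w)))
        (≡.trans (lookup-subst len bits (i ↑ˡ n)) (≡.trans (lookup-++ˡ (Vec.map proj₂ w) (Vec.map proj₁ w) i) (lookup-map i proj₂ w))))) (tabulate∘lookup w)
      where bits = Vec.map proj₂ w Vec.++ Vec.map proj₁ w

    Σₛ-words : (f : Subset L → ℚ) → Σₛ f ≡ Σʷ (λ w → f (encode w))
    Σₛ-words f = ≡.trans (Σₛ-subst len f) (≡.trans (Σₛ-++ n (λ X → f (≡.subst Subset len X))) (Σₛ-zip n (λ X Y → f (≡.subst Subset len (X Vec.++ Y)))))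

  module WheelGraph (n₀ : ℕ) where

    -- With at least three rim vertices `wheel n` reduces to its general clause.
    m n : ℕ
    m = suc (suc n₀)
    n = suc m

    G : Graph (suc n)
    G = wheel n

    private
      rimEdge spokeEdge : ℕ → Fin (suc n) × Fin (suc n)
      rimEdge i = vtx n (suc i) , vtx n (suc (suc i))
      spokeEdge i = vtx n 0 , vtx n (suc i)
      rims spokes : Graph (suc n)
      rims = map rimEdge (upTo m)
      spokes = map spokeEdge (upTo n)
      length-rims : length rims ≡ m
      length-rims = ≡.trans (length-map rimEdge (upTo m)) (length-applyUpTo id m)
      length-spokes : length spokes ≡ n
      length-spokes = ≡.trans (length-map spokeEdge (upTo n)) (length-applyUpTo id n)

    len : n ℕ.+ n ≡ length G
    len = ≡.sym (≡.trans (length-++ rims) (≡.trans (≡.cong₂ (λ a b → a ℕ.+ suc b) length-rims length-spokes) (ℕ.+-suc m n)))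

    open Encoding n len public

    lookup-rim : ∀ i → List.lookup G (rimIdx i) ≡ (suc i , suc (next i))
    lookup-rim i = just-injective (≡.trans (≡.sym (nth-lookup G (rimIdx i))) (≡.trans (≡.cong (nth G) (≡.trans (toℕ-subst len (i ↑ˡ n)) (Fin.toℕ-↑ˡ i n))) go))
      where
      go : nth G (toℕ i) ≡ just (suc i , suc (next i))
      go with toℕ i ℕ.≟ m
      ... | no ne = ≡.trans (nth-++ˡ rims _ (≡.subst (toℕ i <_) (≡.sym length-rims) i<m)) (≡.trans (nth-map-applyUpTo rimEdge id m i<m)
          (≡.cong just (≡.cong₂ _,_ (vtx-rim n i) (≡.trans (≡.cong (λ k → vtx n (suc k)) (≡.sym (toℕ-next ne))) (vtx-rim n (next i))))))
        where
        i<m : toℕ i < m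
        i<m = ℕ.≤∧≢⇒< (ℕ.≤-pred (Fin.toℕ<n i)) ne
      -- Index `m` is the closing edge of the rim, listed between the other rim edges and the
      -- spokes.
      ... | yes e = ≡.trans (≡.cong (nth G) (≡.trans e (≡.trans (≡.sym length-rims) (≡.sym (ℕ.+-identityʳ (length rims)))))) (≡.trans (nth-++ʳ rims _ 0)
          (≡.cong just (≡.cong₂ _,_ (≡.trans (≡.cong (λ k → vtx n (suc k)) (≡.sym e)) (vtx-rim n i)) (≡.cong suc (≡.sym (next-last e))))))

    lookup-spoke : ∀ i → List.lookup G (spokeIdx i) ≡ (zero , suc i)
    lookup-spoke i = just-injective (≡.trans (≡.sym (nth-lookup G (spokeIdx i))) (≡.trans (≡.cong (nth G) (≡.trans (toℕ-subst len (n ↑ʳ i)) (Fin.toℕ-↑ʳ n i)))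
      (≡.trans (≡.cong (nth G) (≡.trans (≡.sym (ℕ.+-suc m (toℕ i))) (≡.cong (ℕ._+ suc (toℕ i)) (≡.sym length-rims)))) (≡.trans (nth-++ʳ rims _ (suc (toℕ i)))
      (≡.trans (nth-map-applyUpTo spokeEdge id n (Fin.toℕ<n i)) (≡.cong (λ z → just (zero , z)) (vtx-rim n i)))))))

-- Flatness and rank of an edge set in terms of its word.

module FlatsOfWheels where

  open SubsetSums
  open Matroids
  open Graphs
  open LetterWords
  open WordValues using (isBreak; breaks)
  open WheelWords
  open import Data.Bool.Base using (T)
  open import Data.Fin.Base using (fromℕ; inject₁)
  open import Data.Fin.Subset using (Subset; _∈_; _∉_)
  open import Data.List.Base using (filter; allFin)
  open import Data.List.Properties using (length-map; map-tabulate; ++-identityʳ; ∷-injective)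
  open import Data.List.Membership.Propositional using () renaming (_∈_ to _∈ᴸ_)
  open import Data.List.Membership.Propositional.Properties using (∈-filter⁺; ∈-filter⁻; ∈-tabulate⁺; ∈-map⁺; ∈-map⁻)
  open import Data.List.Relation.Unary.Any using (here; there)
  open import Data.List.Relation.Unary.All as All using ([]; _∷_)
  import Data.List.Relation.Unary.All.Properties as All
  open import Data.List.Relation.Unary.AllPairs using ([]; _∷_)
  open import Data.List.Relation.Unary.Unique.Propositional.Properties using (allFin⁺; filter⁺; map⁺)
  open import Data.Nat.Base using (_≤_; _<_)
  open import Data.Product.Base using (_×_)
  open import Data.Product.Properties using (≡-dec)
  open import Data.Unit.Base using (tt)
  open import Data.Vec.Base using (Vec; []; _∷_; lookup; toList)
  open import Data.Vec.Properties using ([]=⇒lookup; lookup⇒[]=)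
  open import Relation.Binary.Definitions using (tri<; tri≈; tri>)
  open import Relation.Nullary.Decidable using (_×-dec_; ¬?)

  _≟ᴸ_ : (l l′ : Letter) → Dec (l ≡ l′)
  _≟ᴸ_ = ≡-dec 𝔹._≟_ 𝔹._≟_

  -- In a block off the hub the last vertex, and no other, has the letter `(false , false)`; these
  -- vertices will represent the blocks.
  breakPositions : ∀ {n} → Vec Letter n → List (Fin n)
  breakPositions {n} w = filter (λ i → lookup w i ≟ᴸ (false , false)) (allFin n)

  length-breakPositions : ∀ {n} (w : Vec Letter n) → length (breakPositions w) ≡ breaks (toList w)
  length-breakPositions [] = ≡.refl
  length-breakPositions {suc n} (l ∷ w) = ≡.trans (head l) (≡.cong (isBreak l ℕ.+_) (≡.trans (≡.cong length tail) (≡.trans (length-map suc (breakPositions w)) (length-breakPositions w))))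
    where
    P? : ∀ i → Dec (lookup (l ∷ w) i ≡ (false , false))
    P? i = lookup (l ∷ w) i ≟ᴸ (false , false)
    head : ∀ l → length (breakPositions (l ∷ w)) ≡ isBreak l ℕ.+ length (filter (λ i → lookup (l ∷ w) i ≟ᴸ (false , false)) (List.tabulate suc))
    head (true , true) = ≡.refl
    head (true , false) = ≡.refl
    head (false , true) = ≡.refl
    head (false , false) = ≡.refl
    filter-suc : ∀ xs → filter P? (map suc xs) ≡ map suc (filter (λ i → lookup w i ≟ᴸ (false , false)) xs)
    filter-suc [] = ≡.refl
    filter-suc (x ∷ xs) with does (lookup w x ≟ᴸ (false , false))
    ... | true = ≡.cong (suc x ∷_) (filter-suc xs)
    ... | false = filter-suc xs
    tail : filter P? (List.tabulate suc) ≡ map suc (breakPositions w)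
    tail = ≡.trans (≡.cong (filter P?) (≡.sym (map-tabulate id suc))) (filter-suc (allFin n))

  ∈-breakPositions⁺ : ∀ {n} (w : Vec Letter n) {i} → lookup w i ≡ (false , false) → i ∈ᴸ breakPositions w
  ∈-breakPositions⁺ w {i} e = ∈-filter⁺ (λ i → lookup w i ≟ᴸ (false , false)) (∈-tabulate⁺ i) e

  ∈-breakPositions⁻ : ∀ {n} (w : Vec Letter n) {i} → i ∈ᴸ breakPositions w → lookup w i ≡ (false , false)
  ∈-breakPositions⁻ {n} w i∈ = proj₂ (∈-filter⁻ (λ i → lookup w i ≟ᴸ (false , false)) {xs = allFin n} i∈)

  CycCompatible : ∀ {m} → Vec Letter (suc m) → Set
  CycCompatible w = ∀ i → T (compatible (lookup w i) (proj₁ (lookup w (next i))))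

  private
    linked⁺ : ∀ {m} l (w : Vec Letter m) s → (∀ p → T (compatible (lookup (l ∷ w) (inject₁ p)) (proj₁ (lookup w p)))) →
      T (compatible (lookup (l ∷ w) (fromℕ m)) s) → Linked s l (toList w)
    linked⁺ l [] s h c = c
    linked⁺ l (l′ ∷ w) s h c = h zero , linked⁺ l′ w s (λ p → h (suc p)) c

    linked⁻ : ∀ {m} l (w : Vec Letter m) s → Linked s l (toList w) →
      (∀ p → T (compatible (lookup (l ∷ w) (inject₁ p)) (proj₁ (lookup w p)))) × T (compatible (lookup (l ∷ w) (fromℕ m)) s)
    linked⁻ l [] s c = (λ ()) , c
    linked⁻ l (l′ ∷ w) s (c , k) = let (h , d) = linked⁻ l′ w s k in (λ { zero → c ; (suc p) → h p }) , d

  compatible⇒linked : ∀ {m} l (w : Vec Letter m) → CycCompatible (l ∷ w) → Linked (proj₁ l) l (toList w)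
  compatible⇒linked {m} l w h = linked⁺ l w (proj₁ l) (λ p → ≡.subst (λ z → T (compatible (lookup (l ∷ w) (inject₁ p)) (proj₁ (lookup (l ∷ w) z)))) (next-inject₁ p) (h (inject₁ p)))
    (≡.subst (λ z → T (compatible (lookup (l ∷ w) (fromℕ m)) (proj₁ (lookup (l ∷ w) z)))) (next-last (Fin.toℕ-fromℕ m)) (h (fromℕ m)))

  linked⇒compatible : ∀ {m} l (w : Vec Letter m) → Linked (proj₁ l) l (toList w) → CycCompatible (l ∷ w)
  linked⇒compatible {m} l w k i with linked⁻ l w (proj₁ l) k | toℕ i ℕ.≟ m
  ... | h , d | yes e = ≡.subst₂ (λ a b → T (compatible (lookup (l ∷ w) a) (proj₁ (lookup (l ∷ w) b)))) (Fin.toℕ-injective (≡.trans (Fin.toℕ-fromℕ m) (≡.sym e))) (≡.sym (next-last e)) d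
  ... | h , d | no ne = ≡.subst₂ (λ a b → T (compatible (lookup (l ∷ w) a) (proj₁ (lookup (l ∷ w) b)))) (Fin.inject₁-lower₁ i (ne ∘ ≡.sym))
      (≡.trans (≡.sym (next-inject₁ (Fin.lower₁ i (ne ∘ ≡.sym)))) (≡.cong next (Fin.inject₁-lower₁ i (ne ∘ ≡.sym)))) (h (Fin.lower₁ i (ne ∘ ≡.sym)))

  -- The condition concerns cyclic neighbours, so the cycle can be opened at any joined vertex.
  compatible⇒linked-at : ∀ {m} (w : Vec Letter (suc m)) u e v → toList w ≡ u ++ (true , e) ∷ v → CycCompatible w → Linked true (true , e) (v ++ u)
  compatible⇒linked-at (l ∷ w) [] e v ≡.refl h = ≡.subst (Linked true (true , e)) (≡.sym (++-identityʳ v)) (compatible⇒linked l w h)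
  compatible⇒linked-at (l ∷ w) (l′ ∷ u) e v eq h with ≡.refl , eq′ ← ∷-injective eq = let (k₁ , k₂) = Linked-++ u (≡.subst (Linked (proj₁ l) l) eq′ (compatible⇒linked l w h)) in ++-Linked v k₂ k₁

  linked-at⇒compatible : ∀ {m} (w : Vec Letter (suc m)) u e v → toList w ≡ u ++ (true , e) ∷ v → Linked true (true , e) (v ++ u) → CycCompatible w
  linked-at⇒compatible (l ∷ w) [] e v ≡.refl k = linked⇒compatible l w (≡.subst (Linked true (true , e)) (++-identityʳ v) k)
  linked-at⇒compatible (l ∷ w) (l′ ∷ u) e v eq k with ≡.refl , eq′ ← ∷-injective eq = let (k₂ , k₁) = Linked-++ v k in linked⇒compatible l w (≡.subst (Linked (proj₁ l) l) (≡.sym eq′) (++-Linked u k₁ k₂))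

  module WheelFlats (m : ℕ) (G : Graph (suc (suc m))) (len : suc m ℕ.+ suc m ≡ length G)
    (lookup-rim : ∀ i → List.lookup G (Encoding.rimIdx (suc m) len i) ≡ (suc i , suc (next i)))
    (lookup-spoke : ∀ i → List.lookup G (Encoding.spokeIdx (suc m) len i) ≡ (zero , suc i)) where

    n : ℕ
    n = suc m

    open Encoding n len
    open GraphicMatroid G

    module _ (X : Subset (length G)) where

      letter : Fin n → Letter
      letter = lookup (decode X)

      private
        spoke-bit : ∀ i → proj₁ (letter i) ≡ lookup X (spokeIdx i)
        spoke-bit i = ≡.cong proj₁ (lookup-decode X i)
        rim-bit : ∀ i → proj₂ (letter i) ≡ lookup X (rimIdx i)
        rim-bit i = ≡.cong proj₂ (lookup-decode X i)

      spoke-∈⁻ : ∀ {i} → spokeIdx i ∈ X → proj₁ (letter i) ≡ true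
      spoke-∈⁻ {i} h = ≡.trans (spoke-bit i) ([]=⇒lookup h)

      rim-∈⁻ : ∀ {i} → rimIdx i ∈ X → proj₂ (letter i) ≡ true
      rim-∈⁻ {i} h = ≡.trans (rim-bit i) ([]=⇒lookup h)

      spoke-∈⁺ : ∀ {i} → proj₁ (letter i) ≡ true → spokeIdx i ∈ X
      spoke-∈⁺ {i} h = lookup⇒[]= _ X (≡.trans (≡.sym (spoke-bit i)) h)

      rim-∈⁺ : ∀ {i} → proj₂ (letter i) ≡ true → rimIdx i ∈ X
      rim-∈⁺ {i} h = lookup⇒[]= _ X (≡.trans (≡.sym (rim-bit i)) h)

      conn-spoke : ∀ {i} → proj₁ (letter i) ≡ true → Connected (edges X) zero (suc i)
      conn-spoke {i} h = along done (≡.subst (_∈ᴸ edges X) (lookup-spoke i) (edges⁺ X (spoke-∈⁺ h)))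

      conn-rim : ∀ {i} → proj₂ (letter i) ≡ true → Connected (edges X) (suc i) (suc (next i))
      conn-rim {i} h = along done (≡.subst (_∈ᴸ edges X) (lookup-rim i) (edges⁺ X (rim-∈⁺ h)))

      -- Two vertices are shown to be disconnected by a two-colouring that is constant along all
      -- edges of `X`.
      cut : (ℓ : Fin (suc n) → Bool) → (∀ i → proj₁ (letter i) ≡ true → ℓ zero ≡ ℓ (suc i)) → (∀ i → proj₂ (letter i) ≡ true → ℓ (suc i) ≡ ℓ (suc (next i))) →
        ∀ {a b} → Connected (edges X) a b → ℓ a ≡ ℓ b
      cut ℓ hs hr = conn-invariant ℓ edge
        where
        edge : ∀ {x y} → (x , y) ∈ᴸ edges X → ℓ x ≡ ℓ y
        edge p with edges⁻ X p
        ... | j , j∈ , ex , ey with classify j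
        ...   | inj₁ (i , ≡.refl) = ≡.subst₂ (λ a b → ℓ a ≡ ℓ b) (≡.sym (≡.trans ex (≡.cong proj₁ (lookup-rim i)))) (≡.sym (≡.trans ey (≡.cong proj₂ (lookup-rim i)))) (hr i (rim-∈⁻ j∈))
        ...   | inj₂ (i , ≡.refl) = ≡.subst₂ (λ a b → ℓ a ≡ ℓ b) (≡.sym (≡.trans ex (≡.cong proj₁ (lookup-spoke i)))) (≡.sym (≡.trans ey (≡.cong proj₂ (lookup-spoke i)))) (hs i (spoke-∈⁻ j∈))

      spanned-spoke : ∀ i → Connected (edges X) zero (suc i) → Spanned X (spokeIdx i)
      spanned-spoke i c = ≡.subst₂ (Connected (edges X)) (≡.sym (≡.cong proj₁ (lookup-spoke i))) (≡.sym (≡.cong proj₂ (lookup-spoke i))) c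

      spanned-rim : ∀ i → Connected (edges X) (suc i) (suc (next i)) → Spanned X (rimIdx i)
      spanned-rim i c = ≡.subst₂ (Connected (edges X)) (≡.sym (≡.cong proj₁ (lookup-rim i))) (≡.sym (≡.cong proj₂ (lookup-rim i))) c

      flat⇒compatible : Flat r X → CycCompatible (decode X)
      flat⇒compatible fl i with letter i in li | letter (next i) in ln
      ... | true , true | true , _ = tt
      ... | true , false | true , _ = ⊥-elim (true≢false (rim-∈⁻ (flat⇒ fl (spanned-rim i (conn-trans (conn-sym (conn-spoke (≡.cong proj₁ li))) (conn-spoke (≡.cong proj₁ ln)))))) (≡.cong proj₂ li))
      ... | true , true | false , _ = ⊥-elim (true≢false (spoke-∈⁻ (flat⇒ fl (spanned-spoke (next i) (conn-trans (conn-spoke (≡.cong proj₁ li)) (conn-rim (≡.cong proj₂ li)))))) (≡.cong proj₁ ln))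
      ... | true , false | false , _ = tt
      ... | false , true | true , _ = ⊥-elim (true≢false (spoke-∈⁻ (flat⇒ fl (spanned-spoke i (conn-trans (conn-spoke (≡.cong proj₁ ln)) (conn-sym (conn-rim (≡.cong proj₂ li))))))) (≡.cong proj₁ li))
      ... | false , false | true , _ = tt
      ... | false , _ | false , _ = tt

      -- If only one rim edge were missing, the others would connect its ends the long way round.
      flat⇒second-break : Flat r X → (∀ i → proj₁ (letter i) ≡ false) → ∀ k → letter k ≡ (false , false) → ∃ λ j → j ≢ k × letter j ≡ (false , false)
      flat⇒second-break fl noS k lk with Fin.any? (λ j → ¬? (j Fin.≟ k) ×-dec (letter j ≟ᴸ (false , false)))
      ... | yes p = p
      ... | no none = ⊥-elim (true≢false (rim-∈⁻ (flat⇒ fl (spanned-rim k (conn-sym (around k))))) (≡.cong proj₂ lk))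
        where
        other : ∀ i → i ≢ k → proj₂ (letter i) ≡ true
        other i i≢k with letter i in li
        ... | s , true = ≡.refl
        ... | true , false with () ← ≡.trans (≡.sym (noS i)) (≡.cong proj₁ li)
        ... | false , false = ⊥-elim (none (i , i≢k , li))
        around : ∀ i → Connected (edges X) (suc (next k)) (suc i)
        around = forward (λ i → Connected (edges X) (suc (next k)) (suc i)) {next k} done (λ i c → case i (i Fin.≟ k) c)
          where
          case : ∀ i → Dec (i ≡ k) → Connected (edges X) (suc (next k)) (suc i) → Connected (edges X) (suc (next k)) (suc (next i))
          case i (yes ≡.refl) c = done
          case i (no i≢k) c = conn-trans c (conn-rim (other i i≢k))

      module _ (comp : CycCompatible (decode X)) where

        private
          rim-same : ∀ i → proj₂ (letter i) ≡ true → proj₁ (letter i) ≡ proj₁ (letter (next i))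
          rim-same i h with letter i | letter (next i) | comp i
          rim-same i ≡.refl | true , true | true , _ | _ = ≡.refl
          rim-same i ≡.refl | false , true | false , _ | _ = ≡.refl

        -- By compatibility the hub and the vertices joined to it by spokes are a whole component.
        hubSide : Fin (suc n) → Bool
        hubSide zero = true
        hubSide (suc i) = proj₁ (letter i)

        hub-cut : ∀ {a b} → Connected (edges X) a b → hubSide a ≡ hubSide b
        hub-cut = cut hubSide (λ i h → ≡.sym h) rim-same

        off-hub : ∀ {i} → proj₁ (letter i) ≡ false → ¬ Connected (edges X) zero (suc i)
        off-hub h c = true≢false (≡.sym (hub-cut c)) h

        side : ∀ {i j} → proj₁ (letter i) ≢ proj₁ (letter j) → ¬ Connected (edges X) (suc i) (suc j)
        side ne c = ne (hub-cut c)

        module _ {i j : Fin n} (li : letter i ≡ (false , false)) (lj : letter j ≡ (false , false)) (i<j : toℕ i < toℕ j) where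

          -- The stretch off the hub between the missing edges at `i` and `j`. No edge of `X` leaves
          -- it: both ends are missing edges, and compatibility cuts off the joined vertices.
          InArc : Fin n → Set
          InArc x = proj₁ (letter x) ≡ false × toℕ i < toℕ x × toℕ x ≤ toℕ j

          inArc? : ∀ x → Dec (InArc x)
          inArc? x = (proj₁ (letter x) 𝔹.≟ false) ×-dec ((toℕ i ℕ.<? toℕ x) ×-dec (toℕ x ℕ.≤? toℕ j))

          private
            arc : Fin (suc n) → Bool
            arc zero = false
            arc (suc x) = does (inArc? x)
            does-true : ∀ {A : Set} (d : Dec A) → A → does d ≡ true
            does-true (yes _) _ = ≡.refl
            does-true (no ¬a) a = ⊥-elim (¬a a)
            does-false : ∀ {A : Set} (d : Dec A) → ¬ A → does d ≡ false
            does-false (yes a) ¬a = ⊥-elim (¬a a)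
            does-false (no _) _ = ≡.refl
            does-⇔ : ∀ {A B : Set} (d : Dec A) (d′ : Dec B) → (A → B) → (B → A) → does d ≡ does d′
            does-⇔ (yes a) d′ f g = ≡.sym (does-true d′ (f a))
            does-⇔ (no ¬a) d′ f g = ≡.sym (does-false d′ (¬a ∘ g))
            not-break : ∀ {x} → proj₂ (letter x) ≡ true → x ≢ i × x ≢ j
            not-break h = (λ { ≡.refl → true≢false h (≡.cong proj₂ li) }) , (λ { ≡.refl → true≢false h (≡.cong proj₂ lj) })
            spoke-ok : ∀ x → proj₁ (letter x) ≡ true → arc zero ≡ arc (suc x)
            spoke-ok x h = ≡.sym (does-false (inArc? x) (λ { (f , _) → true≢false h f }))
            rim-ok : ∀ x → proj₂ (letter x) ≡ true → arc (suc x) ≡ arc (suc (next x))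
            rim-ok x h = does-⇔ (inArc? x) (inArc? (next x)) to from
              where
              x≢i = proj₁ (not-break h)
              x≢j = proj₂ (not-break h)
              to : InArc x → InArc (next x)
              to (f , a , b) = ≡.trans (≡.sym (rim-same x h)) f , ≡.subst (toℕ i <_) (≡.sym e) (ℕ.m≤n⇒m≤1+n a) , ≡.subst (_≤ toℕ j) (≡.sym e) x<j
                where
                x<j : toℕ x < toℕ j
                x<j = ℕ.≤∧≢⇒< b (x≢j ∘ Fin.toℕ-injective)
                e : toℕ (next x) ≡ suc (toℕ x)
                e = toℕ-next (λ eq → ℕ.<⇒≱ (Fin.toℕ<n j) (≡.subst (λ z → suc z ≤ toℕ j) eq x<j))
              from : InArc (next x) → InArc x
              from (f , a , b) with toℕ x ℕ.≟ m
              ... | yes last with () ← ≡.subst (λ z → toℕ i < toℕ z) (next-last last) a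
              ... | no ne = ≡.trans (rim-same x h) f , ℕ.≤∧≢⇒< (ℕ.≤-pred (≡.subst (suc (toℕ i) ≤_) (toℕ-next ne) a)) (λ e → x≢i (Fin.toℕ-injective (≡.sym e))) , ℕ.<⇒≤ (≡.subst (_≤ toℕ j) (toℕ-next ne) b)

          arc-separates : ∀ {x y} → InArc x → ¬ InArc y → ¬ Connected (edges X) (suc x) (suc y)
          arc-separates {x} {y} ax ¬ay c = true≢false (does-true (inArc? x) ax) (≡.trans (cut arc spoke-ok rim-ok c) (does-false (inArc? y) ¬ay))

          breaks-separate : ¬ Connected (edges X) (suc i) (suc j)
          breaks-separate c = arc-separates {j} {i} (≡.cong proj₁ lj , i<j , ℕ.≤-refl) (λ { (_ , lt , _) → ℕ.<-irrefl ≡.refl lt }) (conn-sym c)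

        distinct-breaks-separate : ∀ {i j} → letter i ≡ (false , false) → letter j ≡ (false , false) → Connected (edges X) (suc i) (suc j) → i ≡ j
        distinct-breaks-separate {i} {j} li lj c with ℕ.<-cmp (toℕ i) (toℕ j)
        ... | tri< lt _ _ = ⊥-elim (breaks-separate li lj lt c)
        ... | tri≈ _ e _ = Fin.toℕ-injective e
        ... | tri> _ _ gt = ⊥-elim (breaks-separate lj li gt (conn-sym c))

        private
          -- If `k` precedes `j`, the arc between them contains the successor of `k` but not `k`; if
          -- it follows `j`, the arc contains `k` but not its successor.
          rim-separate : ∀ k j → letter k ≡ (false , false) → letter j ≡ (false , false) → j ≢ k → ¬ Connected (edges X) (suc k) (suc (next k))
          rim-separate k j lk lj j≢k c with 𝔹._≟_ (proj₁ (letter (next k))) false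
          ... | no ne = side (λ e → ne (≡.trans (≡.sym e) (≡.cong proj₁ lk))) c
          ... | yes off with ℕ.<-cmp (toℕ k) (toℕ j)
          ...   | tri≈ _ e _ = j≢k (≡.sym (Fin.toℕ-injective e))
          ...   | tri< lt _ _ = arc-separates lk lj lt {next k} {k} (off , ≡.subst (toℕ k <_) (≡.sym e) ℕ.≤-refl , ≡.subst (_≤ toℕ j) (≡.sym e) lt) (λ { (_ , lt′ , _) → ℕ.<-irrefl ≡.refl lt′ }) (conn-sym c)
            where
            e : toℕ (next k) ≡ suc (toℕ k)
            e = toℕ-next (λ eq → ℕ.<⇒≱ (Fin.toℕ<n j) (≡.subst (λ z → suc z ≤ toℕ j) eq lt))
          ...   | tri> _ _ gt = arc-separates lj lk gt {k} {next k} (≡.cong proj₁ lk , gt , ℕ.≤-refl) out c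
            where
            out : ¬ InArc lj lk gt (next k)
            out (_ , a , b) with toℕ k ℕ.≟ m
            ... | yes last with () ← ≡.subst (λ z → toℕ j < toℕ z) (next-last last) a
            ... | no ne = ℕ.<-irrefl ≡.refl (≡.subst (_≤ toℕ k) (toℕ-next ne) b)

        -- Without a second missing rim edge the run starting after k never meets a spoke.
        compatible⇒flat : ((∀ i → proj₁ (letter i) ≡ false) → ∀ k → letter k ≡ (false , false) → ∃ λ j → j ≢ k × letter j ≡ (false , false)) → Flat r X
        compatible⇒flat second = ⇒flat go
          where
          go : ∀ e → e ∉ X → ¬ Spanned X e
          go e e∉ c with classify e
          go e e∉ c | inj₂ (i , ≡.refl) = off-hub (𝔹.¬-not (λ h → e∉ (spoke-∈⁺ h))) (≡.subst₂ (Connected (edges X)) (≡.cong proj₁ (lookup-spoke i)) (≡.cong proj₂ (lookup-spoke i)) c)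
          go e e∉ c | inj₁ (k , ≡.refl) = rim k (𝔹.¬-not (λ h → e∉ (rim-∈⁺ h))) (≡.subst₂ (Connected (edges X)) (≡.cong proj₁ (lookup-rim k)) (≡.cong proj₂ (lookup-rim k)) c)
            where
            rim : ∀ k → proj₂ (letter k) ≡ false → ¬ Connected (edges X) (suc k) (suc (next k))
            rim k ek with letter k in lk | letter (next k) in ln | comp k
            ... | true , false | false , _ | _ = side (λ e → true≢false (≡.trans (≡.sym (≡.trans e (≡.cong proj₁ ln))) (≡.cong proj₁ lk)) ≡.refl)
            ... | false , false | true , _ | _ = side (λ e → true≢false (≡.trans e (≡.cong proj₁ ln)) (≡.cong proj₁ lk))
            ... | false , false | false , _ | _ with Fin.any? (λ j → ¬? (j Fin.≟ k) ×-dec (letter j ≟ᴸ (false , false)))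
            ...   | yes (j , j≢k , lj) = rim-separate k j lk lj j≢k
            ...   | no none = ⊥-elim (none (second noS k lk))
              where
              noS : ∀ i → proj₁ (letter i) ≡ false
              noS = forward (λ i → proj₁ (letter i) ≡ false) {next k} (≡.cong proj₁ ln) (λ i h → case i h (i Fin.≟ k))
                where
                case : ∀ i → proj₁ (letter i) ≡ false → Dec (i ≡ k) → proj₁ (letter (next i)) ≡ false
                case i h (yes ≡.refl) = ≡.cong proj₁ ln
                case i h (no i≢k) with letter i in li
                ... | false , true = ≡.trans (≡.sym (rim-same i (≡.cong proj₂ li))) (≡.cong proj₁ li)
                ... | false , false = ⊥-elim (none (i , i≢k , li))

        private
          ts : List (Fin (suc n))
          ts = zero ∷ map suc (breakPositions (decode X))

          suc-∈ : ∀ {i} → suc i ∈ᴸ ts → letter i ≡ (false , false)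
          suc-∈ (there p) with ∈-map⁻ suc p
          ... | j , j∈ , ≡.refl = ∈-breakPositions⁻ (decode X) j∈

        -- Components are that of the hub and one for each block, represented by its last vertex.
        -- The hypothesis excludes the full rim, which has no last vertex.
        rank-compatible : (∃ λ j → letter j ≢ (false , true)) → r X ≡ n ∸ breaks (toList (decode X))
        rank-compatible (j , lj) = ≡.trans (rank-transversal {X} {ts} transversal) (≡.cong (n ∸_) (≡.trans (length-map suc (breakPositions (decode X))) (length-breakPositions (decode X))))
          where
          Q : Fin n → Set
          Q i = ∃ λ t → t ∈ᴸ ts × Connected (edges X) (suc i) t
          stop : ∀ i → letter i ≢ (false , true) → Q i
          stop i ne with letter i in li
          ... | true , _ = zero , here ≡.refl , conn-sym (conn-spoke (≡.cong proj₁ li))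
          ... | false , false = suc i , there (∈-map⁺ suc (∈-breakPositions⁺ (decode X) li)) , done
          ... | false , true = ⊥-elim (ne ≡.refl)
          move : ∀ i → Q (next i) → Q i
          move i (t , t∈ , c) with letter i ≟ᴸ (false , true)
          ... | no ne = stop i ne
          ... | yes e = t , t∈ , conn-trans (conn-rim (≡.cong proj₂ e)) c
          sep : ∀ {s t} → s ∈ᴸ ts → t ∈ᴸ ts → Connected (edges X) s t → s ≡ t
          sep {zero} {zero} _ _ _ = ≡.refl
          sep {zero} {suc i} _ t∈ c = ⊥-elim (off-hub (≡.cong proj₁ (suc-∈ t∈)) c)
          sep {suc i} {zero} s∈ _ c = ⊥-elim (off-hub (≡.cong proj₁ (suc-∈ s∈)) (conn-sym c))
          sep {suc i} {suc j} s∈ t∈ c = ≡.cong suc (distinct-breaks-separate (suc-∈ s∈) (suc-∈ t∈) c)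
          transversal : Transversal (edges X) ts
          transversal = record
            { unique = All.map⁺ (All.tabulate (λ _ ())) ∷ map⁺ Fin.suc-injective (filter⁺ (λ i → lookup (decode X) i ≟ᴸ (false , false)) (allFin⁺ n))
            -- Following present edges forwards leads to a representative, so the induction runs
            -- backwards from a vertex where such a walk stops.
            ; covers = λ { zero → zero , here ≡.refl , done ; (suc i) → backward Q {j} (stop j lj) move i }
            ; separate = sep }

        -- Although no rim edge is missing, the rim is a component of its own beside the hub; this
        -- costs one rank.
        rank-full : (∀ j → letter j ≡ (false , true)) → r X ≡ m
        rank-full full = rank-transversal {X} {zero ∷ suc zero ∷ []} record
          { unique = ((λ ()) ∷ []) ∷ [] ∷ []
          ; covers = λ { zero → zero , here ≡.refl , done ; (suc i) → suc zero , there (here ≡.refl) , conn-sym (forward (λ i → Connected (edges X) (suc zero) (suc i)) {zero} done (λ i c → conn-trans c (conn-rim (≡.cong proj₂ (full i)))) i) }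
          ; separate = λ { (here ≡.refl) (here ≡.refl) _ → ≡.refl
                         ; (here ≡.refl) (there (here ≡.refl)) c → ⊥-elim (off-hub (≡.cong proj₁ (full zero)) c)
                         ; (there (here ≡.refl)) (here ≡.refl) c → ⊥-elim (off-hub (≡.cong proj₁ (full zero)) (conn-sym c))
                         ; (there (here ≡.refl)) (there (here ≡.refl)) _ → ≡.refl } }

-- Sums over larger words and the proposed values.

module WordSums where

  open ClosedForm hiding (T)
  open Support
  open Reversal
  open Substitutions
  open Symmetry
  open WheelPolynomials
  open SubsetSums
  open Matroids
  open PalindromicUniqueness
  open Graphs
  open LetterWords
  open WordValues
  open WheelWords
  open FlatsOfWheels
  open import Data.Empty using () renaming (⊥ to Void)
  open import Data.List.Properties using (∷-injectiveʳ)
  open import Data.List.Relation.Unary.Any using (here; there)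
  open import Data.List.Relation.Unary.All using ([]; _∷_)
  open import Data.List.Relation.Unary.AllPairs using ([]; _∷_)
  open import Data.List.Relation.Unary.Unique.Propositional using (Unique)
  open import Data.List.Relation.Unary.Unique.Propositional.Properties using (allFin⁺; filter⁺)
  open import Data.List.Membership.Propositional using () renaming (_∈_ to _∈ᴸ_)
  open import Data.Nat.Base using (_≤_; _<_)
  open import Data.Product.Base using (_×_)
  open import Data.Vec.Base using (Vec; []; _∷_; lookup; toList)

  _≤ᴸ_ : Letter → Letter → Bool
  (s , e) ≤ᴸ (s′ , e′) = (not s ∨ s′) ∧ (not e ∨ e′)

  _≤ᵛ_ : ∀ {n} → Vec Letter n → Vec Letter n → Bool
  [] ≤ᵛ [] = true
  (l ∷ g) ≤ᵛ (l′ ∷ w) = (l ≤ᴸ l′) ∧ (g ≤ᵛ w)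

  ≤ᵛ-sound : ∀ {n} (g w : Vec Letter n) → (g ≤ᵛ w) ≡ true → ∀ i → (lookup g i ≤ᴸ lookup w i) ≡ true
  ≤ᵛ-sound (l ∷ g) (l′ ∷ w) h zero = proj₁ (∧-split h)
  ≤ᵛ-sound (l ∷ g) (l′ ∷ w) h (suc i) = ≤ᵛ-sound g w (proj₂ (∧-split {l ≤ᴸ l′} h)) i

  ≤ᵛ-complete : ∀ {n} (g w : Vec Letter n) → (∀ i → (lookup g i ≤ᴸ lookup w i) ≡ true) → (g ≤ᵛ w) ≡ true
  ≤ᵛ-complete [] [] h = ≡.refl
  ≤ᵛ-complete (l ∷ g) (l′ ∷ w) h = ∧-intro (h zero) (≤ᵛ-complete g w (h ∘ suc))

  isBreak-anti : ∀ l l′ → (l ≤ᴸ l′) ≡ true → isBreak l′ ≤ isBreak l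
  isBreak-anti (true , e) (true , e′) h = z≤n
  isBreak-anti (false , true) (true , e′) h = z≤n
  isBreak-anti (false , true) (false , true) h = z≤n
  isBreak-anti (false , false) (true , e′) h = z≤n
  isBreak-anti (false , false) (false , true) h = z≤n
  isBreak-anti (false , false) (false , false) h = s≤s z≤n

  breaks-anti : ∀ {n} (g w : Vec Letter n) → (g ≤ᵛ w) ≡ true → breaks (toList w) ≤ breaks (toList g)
  breaks-anti [] [] h = z≤n
  breaks-anti (l ∷ g) (l′ ∷ w) h = let (a , b) = ∧-split {l ≤ᴸ l′} h in ℕ.+-mono-≤ (isBreak-anti l l′ a) (breaks-anti g w b)

  breaks≤length : ∀ {n} (w : Vec Letter n) → breaks (toList w) ≤ n
  breaks≤length [] = z≤n
  breaks≤length ((true , _) ∷ w) = ℕ.m≤n⇒m≤1+n (breaks≤length w)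
  breaks≤length ((false , true) ∷ w) = ℕ.m≤n⇒m≤1+n (breaks≤length w)
  breaks≤length ((false , false) ∷ w) = s≤s (breaks≤length w)

  Σʷ-0 : ∀ {n} → Σʷ {n} (λ _ → 0ℚ) ≡ 0ℚ
  Σʷ-0 {zero} = ≡.refl
  Σʷ-0 {suc n} = ≡.cong (λ x → x ℚ.+ x ℚ.+ (x ℚ.+ x)) (Σʷ-0 {n})

  -- The rank difference is a difference of numbers of breaks and thus additive over the letters, so
  -- the power of t splits into the weights `above`.
  Σʷ-raise : ∀ {n} (g : Vec Letter n) (f : List Letter → PolyQ) k →
    Σʷ (λ w → [ g ≤ᵛ w ] Poly.raise (breaks (toList g) ∸ breaks (toList w)) (f (toList w)) k) ≡ Wₜ.wordSum (map Wₜ.above (toList g)) f k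
  Σʷ-raise [] f k = ≡.refl
  Σʷ-raise {suc n} (l ∷ g) f k = ≡.cong₂ ℚ._+_ (≡.cong₂ ℚ._+_ (part l (true , true)) (part l (true , false))) (≡.cong₂ ℚ._+_ (part l (false , true)) (part l (false , false)))
    where
    S : Letter → PolyQ
    S l′ = Wₜ.wordSum (map Wₜ.above (toList g)) (λ w → f (l′ ∷ w))
    Part : Letter → Letter → Set
    Part l l′ = Σʷ (λ w → [ (l ≤ᴸ l′) ∧ (g ≤ᵛ w) ] Poly.raise ((isBreak l ℕ.+ breaks (toList g)) ∸ (isBreak l′ ℕ.+ breaks (toList w))) (f (l′ ∷ toList w)) k) ≡ (Wₜ.above l l′ ℙ.* S l′) k
    none : ∀ l′ → Σʷ {n} (λ w → 0ℚ) ≡ (ℙ.0# ℙ.* S l′) k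
    none l′ = ≡.trans (Σʷ-0 {n}) (≡.sym (ℙ.zeroˡ (S l′) k))
    same : ∀ l′ → Σʷ (λ w → [ g ≤ᵛ w ] Poly.raise (breaks (toList g) ∸ breaks (toList w)) (f (l′ ∷ toList w)) k) ≡ (ℙ.1# ℙ.* S l′) k
    same l′ = ≡.trans (Σʷ-raise g (λ w → f (l′ ∷ w)) k) (≡.sym (ℙ.*-identityˡ (S l′) k))
    more : ∀ l′ → Σʷ (λ w → [ g ≤ᵛ w ] Poly.raise (suc (breaks (toList g)) ∸ breaks (toList w)) (f (l′ ∷ toList w)) k) ≡ (Poly.X ℙ.* S l′) k
    more l′ = ≡.trans (Σʷ-cong (λ w → []-cong (g ≤ᵛ w) (λ h → ≡.cong (λ d → Poly.raise d (f (l′ ∷ toList w)) k) (ℕ.+-∸-assoc 1 (breaks-anti g w h))))) (go k)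
      where
      go : ∀ k → Σʷ (λ w → [ g ≤ᵛ w ] Poly.raise (suc (breaks (toList g) ∸ breaks (toList w))) (f (l′ ∷ toList w)) k) ≡ (Poly.X ℙ.* S l′) k
      go zero = ≡.trans (≡.trans (Σʷ-cong (λ w → if-same (g ≤ᵛ w))) (Σʷ-0 {n})) (≡.sym (Poly.X⊠-zero (S l′)))
        where
        if-same : ∀ b → [ b ] 0ℚ ≡ 0ℚ
        if-same true = ≡.refl
        if-same false = ≡.refl
      go (suc k) = ≡.trans (Σʷ-raise g (λ w → f (l′ ∷ w)) k) (≡.sym (Poly.X⊠-suc (S l′) k))
    part : ∀ l l′ → Part l l′
    part (true , true) l′@(true , true) = same l′
    part (true , true) l′@(true , false) = none l′
    part (true , true) l′@(false , true) = none l′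
    part (true , true) l′@(false , false) = none l′
    part (true , false) l′@(true , true) = same l′
    part (true , false) l′@(true , false) = same l′
    part (true , false) l′@(false , true) = none l′
    part (true , false) l′@(false , false) = none l′
    part (false , true) l′@(true , true) = same l′
    part (false , true) l′@(true , false) = none l′
    part (false , true) l′@(false , true) = same l′
    part (false , true) l′@(false , false) = none l′
    part (false , false) l′@(true , true) = more l′
    part (false , false) l′@(true , false) = more l′
    part (false , false) l′@(false , true) = more l′
    part (false , false) l′@(false , false) = same l′

  Σʷ-plain : ∀ {n} (g : Vec Letter n) (f : List Letter → PolyQ) k → Σʷ (λ w → [ g ≤ᵛ w ] f (toList w) k) ≡ W₁.wordSum (map W₁.above (toList g)) f k
  Σʷ-plain [] f k = ≡.refl
  Σʷ-plain {suc n} (l ∷ g) f k = ≡.cong₂ ℚ._+_ (≡.cong₂ ℚ._+_ (part l (true , true)) (part l (true , false))) (≡.cong₂ ℚ._+_ (part l (false , true)) (part l (false , false)))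
    where
    S : Letter → PolyQ
    S l′ = W₁.wordSum (map W₁.above (toList g)) (λ w → f (l′ ∷ w))
    none : ∀ l′ → Σʷ {n} (λ w → 0ℚ) ≡ (ℙ.0# ℙ.* S l′) k
    none l′ = ≡.trans (Σʷ-0 {n}) (≡.sym (ℙ.zeroˡ (S l′) k))
    same : ∀ l′ → Σʷ (λ w → [ g ≤ᵛ w ] f (l′ ∷ toList w) k) ≡ (ℙ.1# ℙ.* S l′) k
    same l′ = ≡.trans (Σʷ-plain g (λ w → f (l′ ∷ w)) k) (≡.sym (ℙ.*-identityˡ (S l′) k))
    part : ∀ l l′ → Σʷ (λ w → [ (l ≤ᴸ l′) ∧ (g ≤ᵛ w) ] f (l′ ∷ toList w) k) ≡ (W₁.above l l′ ℙ.* S l′) k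
    part (true , true) l′@(true , true) = same l′
    part (true , true) l′@(true , false) = none l′
    part (true , true) l′@(false , true) = none l′
    part (true , true) l′@(false , false) = none l′
    part (true , false) l′@(true , true) = same l′
    part (true , false) l′@(true , false) = same l′
    part (true , false) l′@(false , true) = none l′
    part (true , false) l′@(false , false) = none l′
    part (false , true) l′@(true , true) = same l′
    part (false , true) l′@(true , false) = none l′
    part (false , true) l′@(false , true) = same l′
    part (false , true) l′@(false , false) = none l′
    part (false , false) l′@(true , true) = same l′
    part (false , false) l′@(true , false) = same l′
    part (false , false) l′@(false , true) = same l′
    part (false , false) l′@(false , false) = same l′

  -- Singles out the full rim, for which missing edges do not give the rank.
  isFull : List Letter → Bool
  isFull [] = true
  isFull ((s , e) ∷ w) = not s ∧ e ∧ isFull w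

  Σʷ-isFull-off : ∀ {n} (g : Vec Letter n) {b} → OffHub (toList g) b → ∀ x → Σʷ (λ w → [ g ≤ᵛ w ] [ isFull (toList w) ] x) ≡ x
  Σʷ-isFull-off [] nil x = ≡.refl
  Σʷ-isFull-off {suc n} ((false , e) ∷ g) o x = ≡.trans (≡.cong₂ ℚ._+_ (≡.cong₂ ℚ._+_ (zeros (λ w → (not e ∨ true) ∧ (g ≤ᵛ w))) (zeros (λ w → (not e ∨ false) ∧ (g ≤ᵛ w)))) (≡.cong₂ ℚ._+_ (≡.trans (Σʷ-cong (λ w → ≡.cong (λ b → [ b ∧ (g ≤ᵛ w) ] [ isFull (toList w) ] x) (not-∨-true e))) (rest o)) (zeros (λ w → (not e ∨ false) ∧ (g ≤ᵛ w)))))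
    (solve 1 (λ x → :0 :+ :0 :+ (x :+ :0) := x) ≡.refl x)
    where
    open IntegerCoefficientSolver ℚ-ring
    not-∨-true : ∀ e → (not e ∨ true) ≡ true
    not-∨-true true = ≡.refl
    not-∨-true false = ≡.refl
    zeros : (b : Vec Letter n → Bool) → Σʷ (λ w → [ b w ] 0ℚ) ≡ 0ℚ
    zeros b = ≡.trans (Σʷ-cong (λ w → if-same (b w))) (Σʷ-0 {n})
      where
      if-same : ∀ b → [ b ] 0ℚ ≡ 0ℚ
      if-same true = ≡.refl
      if-same false = ≡.refl
    rest : ∀ {e b} → OffHub ((false , e) ∷ toList g) b → Σʷ (λ w → [ g ≤ᵛ w ] [ isFull (toList w) ] x) ≡ x
    rest (brk o) = Σʷ-isFull-off g o x
    rest (ext o) = Σʷ-isFull-off g o x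

  Σʷ-isFull-hub : ∀ {n} (g : Vec Letter n) i → proj₁ (lookup g i) ≡ true → ∀ x → Σʷ (λ w → [ g ≤ᵛ w ] [ isFull (toList w) ] x) ≡ 0ℚ
  Σʷ-isFull-hub {n} g i gi x = ≡.trans (Σʷ-cong zero-term) (Σʷ-0 {n})
    where
    full-off : ∀ {n} (w : Vec Letter n) → isFull (toList w) ≡ true → ∀ i → proj₁ (lookup w i) ≡ false
    full-off ((false , true) ∷ w) h zero = ≡.refl
    full-off ((false , true) ∷ w) h (suc i) = full-off w h i
    zero-term : ∀ w → [ g ≤ᵛ w ] [ isFull (toList w) ] x ≡ 0ℚ
    zero-term w with g ≤ᵛ w in le | isFull (toList w) in fl
    ... | false | _ = ≡.refl
    ... | true | false = ≡.refl
    ... | true | true = ⊥-elim (true≢false (up (lookup g i) (lookup w i) gi (≤ᵛ-sound g w le i)) (full-off w fl i))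
      where
      up : ∀ l l′ → proj₁ l ≡ true → (l ≤ᴸ l′) ≡ true → proj₁ l′ ≡ true
      up (true , e) (true , e′) _ _ = ≡.refl

  toList-∈ : ∀ {n} (w : Vec Letter n) u l v → toList w ≡ u ++ l ∷ v → ∃ λ i → lookup w i ≡ l
  toList-∈ (x ∷ w) [] l v ≡.refl = zero , ≡.refl
  toList-∈ (x ∷ w) (_ ∷ u) l v eq = let (i , e) = toList-∈ w u l v (∷-injectiveʳ eq) in suc i , e

  offHub-lookup : ∀ {n} (w : Vec Letter n) {b} → OffHub (toList w) b → ∀ i → proj₁ (lookup w i) ≡ false
  offHub-lookup ((false , false) ∷ w) (brk o) zero = ≡.refl
  offHub-lookup ((false , false) ∷ w) (brk o) (suc i) = offHub-lookup w o i
  offHub-lookup ((false , true) ∷ w) (ext o) zero = ≡.refl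
  offHub-lookup ((false , true) ∷ w) (ext o) (suc i) = offHub-lookup w o i

  offHub-full : ∀ {n} (w : Vec Letter n) → OffHub (toList w) 0 → ∀ i → lookup w i ≡ (false , true)
  offHub-full ((false , true) ∷ w) (ext o) zero = ≡.refl
  offHub-full ((false , true) ∷ w) (ext o) (suc i) = offHub-full w o i

  isFull-0 : ∀ {w} → OffHub w 0 → isFull w ≡ true
  isFull-0 nil = ≡.refl
  isFull-0 (ext o) = isFull-0 o

  isFull-suc : ∀ {w b} → OffHub w (suc b) → isFull w ≡ false
  isFull-suc (brk o) = ≡.refl
  isFull-suc (ext o) = isFull-suc o

  isFull-at : ∀ u e v → isFull (u ++ (true , e) ∷ v) ≡ false
  isFull-at [] e v = ≡.refl
  isFull-at ((true , _) ∷ u) e v = ≡.refl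
  isFull-at ((false , false) ∷ u) e v = ≡.refl
  isFull-at ((false , true) ∷ u) e v = isFull-at u e v

  module _ {n} (w : Vec Letter n) where

    private
      bs : List (Fin n)
      bs = breakPositions w

      unique-bs : Unique bs
      unique-bs = filter⁺ (λ i → lookup w i ≟ᴸ (false , false)) (allFin⁺ n)

    break-exists : 0 < breaks (toList w) → ∃ λ k → lookup w k ≡ (false , false)
    break-exists lt with breakPositions w in e | ≡.subst (0 <_) (≡.sym (length-breakPositions w)) lt
    ... | k ∷ _ | _ = k , ∈-breakPositions⁻ w (≡.subst (k ∈ᴸ_) (≡.sym e) (here ≡.refl))

    second-break : 1 < breaks (toList w) → ∀ k → ∃ λ j → j ≢ k × lookup w j ≡ (false , false)
    second-break lt k with breakPositions w in e | unique-bs | ≡.subst (1 <_) (≡.sym (length-breakPositions w)) lt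
    ... | i ∷ j ∷ _ | (i≢j ∷ _) ∷ _ | _ with i Fin.≟ k
    ...   | no i≢k = i , i≢k , ∈-breakPositions⁻ w (≡.subst (i ∈ᴸ_) (≡.sym e) (here ≡.refl))
    ...   | yes ≡.refl = j , (λ j≡i → i≢j (≡.sym j≡i)) , ∈-breakPositions⁻ w (≡.subst (j ∈ᴸ_) (≡.sym e) (there (here ≡.refl)))
    second-break lt k | _ ∷ [] | _ | s≤s ()

    two-breaks : ∀ {j k} → j ≢ k → lookup w j ≡ (false , false) → lookup w k ≡ (false , false) → breaks (toList w) ≢ 1
    two-breaks {j} {k} j≢k lj lk one = single bs (≡.trans (length-breakPositions w) one) (∈-breakPositions⁺ w lj) (∈-breakPositions⁺ w lk)
      where
      single : ∀ xs → length xs ≡ 1 → j ∈ᴸ xs → k ∈ᴸ xs → Void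
      single (x ∷ []) _ (here ≡.refl) (here ≡.refl) = j≢k ≡.refl

  -- At most one summand of `value` is nonzero: `cyc` needs a spoke, `rim` needs none and at least
  -- two missing edges, and the last term belongs to the full rim, whose contraction consists of
  -- parallel spokes.
  base base₁ value : List Letter → PolyQ
  base w = Wₜ.cyc [] w ℙ.+ Wₜ.rim wheelPoly 0 w
  base₁ w = W₁.cyc [] w ℙ.+ W₁.rim wheelPoly̅ 0 w
  value w = base w ℙ.+ (λ k → [ isFull w ] ℙ.1# k)

  ∸-∸ : ∀ {n a b} → a ≤ b → b ≤ n → (n ∸ a) ∸ (n ∸ b) ≡ b ∸ a
  ∸-∸ {n} {a} {b} a≤b b≤n = ≡.trans (≡.cong (_∸ (n ∸ b)) (≡.trans (≡.cong (_∸ a) (≡.sym (ℕ.m∸n+n≡m b≤n))) (ℕ.+-∸-assoc (n ∸ b) a≤b))) (ℕ.m+n∸m≡n (n ∸ b) (b ∸ a))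

-- The proposed polynomials satisfy the palindromic identities.

module Candidates where

  open ClosedForm hiding (T)
  open Support
  open Reversal
  open Substitutions
  open Symmetry
  open WheelPolynomials
  open SubsetSums
  open Matroids
  open PalindromicUniqueness
  open Graphs
  open LetterWords
  open WordValues
  open WheelWords
  open FlatsOfWheels
  open WordSums
  open import Data.Bool.Base using (T)
  open import Data.Fin.Subset using (Subset; ⊤; ⊥; _⊆_)
  open import Data.List.Relation.Unary.All using ([]; _∷_)
  open import Data.List.Relation.Unary.AllPairs using ([]; _∷_)
  open import Data.Nat.Base using (_≤_; _<_)
  open import Data.Product.Base using (_×_)
  open import Data.Vec.Base using (Vec; []; _∷_; lookup; toList)
  open import Data.Vec.Properties using (lookup-replicate)

  module WheelCandidate (m : ℕ) (G : Graph (suc (suc m))) (len : suc m ℕ.+ suc m ≡ length G)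
    (lookup-rim : ∀ i → List.lookup G (Encoding.rimIdx (suc m) len i) ≡ (suc i , suc (next i)))
    (lookup-spoke : ∀ i → List.lookup G (Encoding.spokeIdx (suc m) len i) ≡ (zero , suc i)) where

    open WheelFlats m G len lookup-rim lookup-spoke
    open Encoding n len
    open GraphicMatroid G

    word : Subset (length G) → List Letter
    word X = toList (decode X)

    p : Subset (length G) → PolyQ
    p X = value (word X)

    -- `vanishing` leaves open whether `X` is a flat: a value of zero is enough, as the term then
    -- drops out of every sum.
    data Status (X : Subset (length G)) : Set where
      vanishing : base (word X) ℙ.≈ ℙ.0# → base₁ (word X) ℙ.≈ ℙ.0# → isFull (word X) ≡ false → Status X
      proper    : Flat r X → r X ≡ n ∸ breaks (word X) → isFull (word X) ≡ false →
                  Poly.reverse (breaks (word X)) (base (word X)) ℙ.≈ base₁ (word X) → BelowHalf (breaks (word X)) (base (word X)) → Status X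
      full      : Flat r X → r X ≡ m → OffHub (word X) 0 → base (word X) ℙ.≈ ℙ.0# → base₁ (word X) ℙ.≈ ℙ.0# → isFull (word X) ≡ true → Status X

    private
      base-off : ∀ {w b} → OffHub w b → base w ℙ.≈ wheelPoly b
      base-off o = ℙ.trans (ℙ.+-cong (CycAt.cyc-off o []) (ℙ.reflexive (CycAt.rim-off wheelPoly o 0))) (ℙ.+-identityˡ _)

      base₁-off : ∀ {w b} → OffHub w b → base₁ w ℙ.≈ wheelPoly̅ b
      base₁-off o = ℙ.trans (ℙ.+-cong (CycAt.cyc-off o []) (ℙ.reflexive (CycAt.rim-off wheelPoly̅ o 0))) (ℙ.+-identityˡ _)

      base-at : ∀ {u b} → OffHub u b → ∀ e v → base (u ++ (true , e) ∷ v) ℙ.≈ Wₜ.cyc [] (u ++ (true , e) ∷ v)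
      base-at {u} o e v = ℙ.trans (ℙ.+-congˡ {Wₜ.cyc [] (u ++ (true , e) ∷ v)} (ℙ.reflexive (CycAt.rim-at wheelPoly o e v 0))) (ℙ.+-identityʳ _)

      base₁-at : ∀ {u b} → OffHub u b → ∀ e v → base₁ (u ++ (true , e) ∷ v) ℙ.≈ W₁.cyc [] (u ++ (true , e) ∷ v)
      base₁-at {u} o e v = ℙ.trans (ℙ.+-congˡ {W₁.cyc [] (u ++ (true , e) ∷ v)} (ℙ.reflexive (CycAt.rim-at wheelPoly̅ o e v 0))) (ℙ.+-identityʳ _)

      wheelPoly̅-0 : wheelPoly̅ 0 ℙ.≈ ℙ.0#
      wheelPoly̅-0 = ℙ.trans (ℙ.sym (reverse-wheelPoly 0)) (ℙ.trans (Poly.reverse-cong 0 wheelPoly-0) (reverse-0 0))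

      wheelPoly̅-1 : wheelPoly̅ 1 ℙ.≈ ℙ.0#
      wheelPoly̅-1 = ℙ.trans (ℙ.sym (reverse-wheelPoly 1)) (ℙ.trans (Poly.reverse-cong 1 wheelPoly-1) (reverse-0 1))

      off-compatible : ∀ X → (∀ i → proj₁ (letter X i) ≡ false) → CycCompatible (decode X)
      off-compatible X noS i = ≡.subst₂ (λ l s → T (compatible l s)) (≡.cong (_, proj₂ (letter X i)) (≡.sym (noS i))) (≡.sym (noS (next i))) _

    status-at : ∀ X u e v {b} → OffHub u b → word X ≡ u ++ (true , e) ∷ v → Status X
    status-at X u e v o eq with cyc-linked-or-zero o e v
    ... | inj₂ z = vanishing (on base (ℙ.trans (base-at o e v) z)) (on base₁ (ℙ.trans (base₁-at o e v) (cyc₁-zero o e v z))) (≡.trans (≡.cong isFull eq) (isFull-at u e v))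
      where
      on : ∀ (f : List Letter → PolyQ) {q} → f (u ++ (true , e) ∷ v) ℙ.≈ q → f (word X) ℙ.≈ q
      on f h = ℙ.trans (ℙ.reflexive (≡.cong f eq)) h
    ... | inj₁ k = proper (compatible⇒flat X comp (λ noS _ _ → ⊥-elim (true≢false (≡.cong proj₁ li) (noS i))))
        (rank-compatible X comp (i , λ h → true≢false (≡.cong proj₁ li) (≡.cong proj₁ h)))
        (≡.trans (≡.cong isFull eq) (isFull-at u e v))
        (≡.subst (λ w → Poly.reverse (breaks w) (base w) ℙ.≈ base₁ w) (≡.sym eq)
          (ℙ.trans (Poly.reverse-cong (breaks (u ++ (true , e) ∷ v)) (base-at o e v)) (ℙ.trans (cyc-reverse o e v k) (ℙ.sym (base₁-at o e v)))))
        (≡.subst (λ w → BelowHalf (breaks w) (base w)) (≡.sym eq) (λ j j>0 le → ≡.trans (base-at o e v j) (cyc-belowHalf o e v k j j>0 le)))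
      where
      comp : CycCompatible (decode X)
      comp = linked-at⇒compatible (decode X) u e v eq k
      i = proj₁ (toList-∈ (decode X) u (true , e) v eq)
      li : letter X i ≡ (true , e)
      li = proj₂ (toList-∈ (decode X) u (true , e) v eq)

    -- Without missing edges this is the full rim; with one the value is zero; with two or more the
    -- contraction is, up to parallel edges, a wheel with that many rim vertices, the triangle
    -- included.
    status-off : ∀ X {b} → OffHub (word X) b → Status X
    status-off X {zero} o = full (compatible⇒flat X comp (λ _ k lk → ⊥-elim (true≢false (≡.cong proj₂ (offHub-full (decode X) o k)) (≡.cong proj₂ lk))))
        (rank-full X comp (offHub-full (decode X) o)) o (ℙ.trans (base-off o) wheelPoly-0) (ℙ.trans (base₁-off o) wheelPoly̅-0) (isFull-0 o)
      where comp = off-compatible X (offHub-lookup (decode X) o)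
    status-off X {suc zero} o = vanishing (ℙ.trans (base-off o) wheelPoly-1) (ℙ.trans (base₁-off o) wheelPoly̅-1) (isFull-suc o)
    status-off X {suc (suc b)} o = proper (compatible⇒flat X comp (λ _ k _ → second-break (decode X) two k))
        (rank-compatible X comp (k₀ , λ h → true≢false (≡.cong proj₂ h) (≡.cong proj₂ lk₀)))
        (isFull-suc o)
        (ℙ.trans (Poly.reverse-cong (breaks (word X)) (base-off o)) (ℙ.trans (ℙ.reflexive (≡.cong (λ c → Poly.reverse c (wheelPoly (suc (suc b)))) br)) (ℙ.trans (reverse-wheelPoly (suc (suc b))) (ℙ.sym (base₁-off o)))))
        (λ j _ le → ≡.trans (base-off o j) (wheelPoly-degree (suc (suc b)) j (≡.subst (_≤ 2 ℕ.* j) br le)))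
      where
      comp = off-compatible X (offHub-lookup (decode X) o)
      br : breaks (word X) ≡ suc (suc b)
      br = offHub-breaks o
      two : 1 < breaks (word X)
      two = ≡.subst (1 <_) (≡.sym br) (s≤s (s≤s z≤n))
      k₀ = proj₁ (break-exists (decode X) (ℕ.<⇒≤ two))
      lk₀ = proj₂ (break-exists (decode X) (ℕ.<⇒≤ two))

    private
      status′ : ∀ X {w} → HubSplit w → word X ≡ w → Status X
      status′ X (off o) eq = status-off X (≡.subst (λ w → OffHub w _) (≡.sym eq) o)
      status′ X (at u e v o) eq = status-at X u e v o eq

    status : ∀ X → Status X
    status X = status′ X (hubSplit (word X)) ≡.refl

    word-⊤ : ∀ i → letter ⊤ i ≡ (true , true)
    word-⊤ i = ≡.trans (lookup-decode ⊤ i) (≡.cong₂ _,_ (lookup-replicate (spokeIdx i) true) (lookup-replicate (rimIdx i) true))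

    private
      all-hub : ∀ {n} (w : Vec Letter n) → (∀ i → lookup w i ≡ (true , true)) → ∀ a → Wₜ.lin (true , true) a (toList w) ℙ.≈ ℙ.1#
      all-hub [] h a = ℙ.refl
      all-hub (l ∷ w) h a with h zero
      ... | ≡.refl = ℙ.trans (ℙ.*-identityˡ (Wₜ.lin (true , true) 0 (toList w))) (all-hub w (h ∘ suc) 0)

      no-breaks : ∀ {n} (w : Vec Letter n) → (∀ i → lookup w i ≡ (true , true)) → breaks (toList w) ≡ 0
      no-breaks [] h = ≡.refl
      no-breaks (l ∷ w) h with h zero
      ... | ≡.refl = no-breaks w (h ∘ suc)

      value-top : ∀ (w : Vec Letter n) → (∀ i → lookup w i ≡ (true , true)) → value (toList w) ℙ.≈ ℙ.1#
      value-top (l ∷ w) h with h zero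
      ... | ≡.refl = λ k → ≡.trans (ℚ.+-identityʳ _) (≡.trans (ℚ.+-identityʳ _) (≡.trans (≡.cong (λ v → Wₜ.lin (true , true) 0 v k) (++-identityʳ (toList w))) (all-hub w (h ∘ suc) 0 k)))
        where open import Data.List.Properties using (++-identityʳ)

      top-compatible : CycCompatible (decode ⊤)
      top-compatible i = ≡.subst₂ (λ l l′ → T (compatible l (proj₁ l′))) (≡.sym (word-⊤ i)) (≡.sym (word-⊤ (next i))) _

    rank-⊤ : rk r ≡ n
    rank-⊤ = ≡.trans (rank-compatible ⊤ top-compatible (zero , λ h → true≢false (≡.trans (≡.sym (≡.cong proj₁ h)) (≡.cong proj₁ (word-⊤ zero))) ≡.refl)) (≡.cong (n ∸_) (no-breaks (decode ⊤) word-⊤))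

    private
     degree′ : ∀ X → Status X → r X < rk r → ∀ k → rk r ∸ r X ≤ 2 ℕ.* k → p X k ≡ 0ℚ
     degree′ X (vanishing z _ nf) lt k le = ≡.trans (≡.cong₂ ℚ._+_ (z k) (≡.cong (λ b → [ b ] ℙ.1# k) nf)) (ℚ.+-identityʳ 0ℚ)
     degree′ X (proper _ rk≡ nf _ half) lt k le = ≡.trans (≡.cong₂ ℚ._+_ (half k (k>0 k (ℕ.≤-trans br>0 br≤)) br≤) (≡.cong (λ b → [ b ] ℙ.1# k) nf)) (ℚ.+-identityʳ 0ℚ)
       where
       br = breaks (word X)
       cork : rk r ∸ r X ≡ br
       cork = ≡.trans (≡.cong₂ _∸_ rank-⊤ rk≡) (ℕ.m∸[m∸n]≡n (breaks≤length (decode X)))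
       br≤ : br ≤ 2 ℕ.* k
       br≤ = ≡.subst (_≤ 2 ℕ.* k) cork le
       br>0 : 0 < br
       br>0 = ≡.subst (0 <_) cork (ℕ.m<n⇒0<n∸m lt)
       k>0 : ∀ k → 0 < 2 ℕ.* k → 0 < k
       k>0 (suc k) _ = s≤s z≤n
     degree′ X (full _ rk≡ _ z _ fl′) lt k le = ≡.trans (≡.cong₂ ℚ._+_ (z k) (≡.cong (λ b → [ b ] ℙ.1# k) fl′)) (≡.trans (ℚ.+-identityˡ _) (one k (≡.subst (_≤ 2 ℕ.* k) (≡.trans (≡.cong₂ _∸_ rank-⊤ rk≡) (ℕ.m+n∸n≡m 1 m)) le)))
       where
       one : ∀ k → 1 ≤ 2 ℕ.* k → ℙ.1# k ≡ 0ℚ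
       one (suc k) _ = ≡.refl

    degree : ∀ X → Flat r X → r X < rk r → ∀ k → rk r ∸ r X ≤ 2 ℕ.* k → p X k ≡ 0ℚ
    degree X _ = degree′ X (status X)

    ⊆ᵇ-encode : ∀ X w → (X ⊆ᵇ encode w) ≡ (decode X ≤ᵛ w)
    ⊆ᵇ-encode X w = bool-≡ to from
      where
      le-intro : ∀ (l l′ : Letter) → (proj₁ l ≡ true → proj₁ l′ ≡ true) → (proj₂ l ≡ true → proj₂ l′ ≡ true) → (l ≤ᴸ l′) ≡ true
      le-intro (s , e) (s′ , e′) f g = ∧-intro (imp s f) (imp e g)
        where
        imp : ∀ a {b} → (a ≡ true → b ≡ true) → (not a ∨ b) ≡ true
        imp true f = f ≡.refl
        imp false f = ≡.refl
      le-elim : ∀ (l l′ : Letter) → (l ≤ᴸ l′) ≡ true → (proj₁ l ≡ true → proj₁ l′ ≡ true) × (proj₂ l ≡ true → proj₂ l′ ≡ true)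
      le-elim (s , e) (s′ , e′) h = let (a , b) = ∧-split {not s ∨ s′} h in (λ { ≡.refl → a }) , (λ { ≡.refl → b })
      same : ∀ i → letter (encode w) i ≡ lookup w i
      same i = ≡.cong (λ v → lookup v i) (decode-encode w)
      to : (X ⊆ᵇ encode w) ≡ true → (decode X ≤ᵛ w) ≡ true
      to h = ≤ᵛ-complete (decode X) w (λ i → ≡.subst (λ l → (letter X i ≤ᴸ l) ≡ true) (same i) (le-intro (letter X i) (letter (encode w) i)
        (λ s → spoke-∈⁻ (encode w) {i} (⊆ᵇ-sound X (encode w) h (spoke-∈⁺ X {i} s))) (λ e → rim-∈⁻ (encode w) {i} (⊆ᵇ-sound X (encode w) h (rim-∈⁺ X {i} e)))))
      from : (decode X ≤ᵛ w) ≡ true → (X ⊆ᵇ encode w) ≡ true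
      from h = ⊆ᵇ-complete X (encode w) sub
        where
        le : ∀ i → (letter X i ≤ᴸ letter (encode w) i) ≡ true
        le i = ≡.subst (λ l → (letter X i ≤ᴸ l) ≡ true) (≡.sym (same i)) (≤ᵛ-sound (decode X) w h i)
        sub : X ⊆ encode w
        sub {j} j∈ with classify j
        ... | inj₁ (i , ≡.refl) = rim-∈⁺ (encode w) (proj₂ (le-elim (letter X i) (letter (encode w) i) (le i)) (rim-∈⁻ X j∈))
        ... | inj₂ (i , ≡.refl) = spoke-∈⁺ (encode w) (proj₁ (le-elim (letter X i) (letter (encode w) i) (le i)) (spoke-∈⁻ X j∈))

    -- Subsets that are not flats have value 0, so the flatness test can be dropped.
    module Terms (X : Subset (length G)) where

      private
        g : Vec Letter n
        g = decode X

      sum-terms : ∀ (h : Subset (length G) → ℚ) (t : Vec Letter n → ℚ) →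
        (∀ w → (g ≤ᵛ w) ≡ true → [ isFlat r (encode w) ] h (encode w) ≡ t w) →
        Σₛ (λ F → [ isFlat r F ∧ (X ⊆ᵇ F) ] h F) ≡ Σʷ (λ w → [ g ≤ᵛ w ] t w)
      sum-terms h t e = ≡.trans (Σₛ-words (λ F → [ isFlat r F ∧ (X ⊆ᵇ F) ] h F)) (Σʷ-cong (λ w →
        ≡.trans (≡.cong (λ b → [ isFlat r (encode w) ∧ b ] h (encode w)) (⊆ᵇ-encode X w)) (≡.trans (swap (isFlat r (encode w)) (g ≤ᵛ w) (h (encode w))) ([]-cong (g ≤ᵛ w) (e w)))))
        where
        swap : ∀ a b x → [ a ∧ b ] x ≡ [ b ] [ a ] x
        swap true b x = ≡.refl
        swap false true x = ≡.refl
        swap false false x = ≡.refl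

    private
      word-encode : ∀ w → word (encode w) ≡ toList w
      word-encode w = ≡.cong toList (decode-encode w)

      raise-≈0 : ∀ d {q} → q ℙ.≈ ℙ.0# → ∀ k → Poly.raise d q k ≡ 0ℚ
      raise-≈0 zero z k = z k
      raise-≈0 (suc d) z zero = ≡.refl
      raise-≈0 (suc d) z (suc k) = raise-≈0 d z k

      if-0 : ∀ b → [ b ] 0ℚ ≡ 0ℚ
      if-0 true = ≡.refl
      if-0 false = ≡.refl

      value-proper : ∀ w → isFull w ≡ false → value w ℙ.≈ base w
      value-proper w nf k = ≡.trans (≡.cong (λ b → base w k ℚ.+ [ b ] ℙ.1# k) nf) (ℚ.+-identityʳ _)

      value-full : ∀ w → isFull w ≡ true → base w ℙ.≈ ℙ.0# → value w ℙ.≈ ℙ.1#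
      value-full w fl z k = ≡.trans (≡.cong₂ (λ x b → x ℚ.+ [ b ] ℙ.1# k) (z k) fl) (ℚ.+-identityˡ _)

      reverse-1-1 : Poly.reverse 1 ℙ.1# ℙ.≈ Poly.X
      reverse-1-1 zero = ≡.refl
      reverse-1-1 (suc zero) = ≡.refl
      reverse-1-1 (suc (suc k)) = ≡.refl

    private
     term₁′ : ∀ F → Status F → ∀ k → [ isFlat r F ] Poly.reverse (rk r ∸ r F) (p F) k ≡ base₁ (word F) k ℚ.+ [ isFull (word F) ] Poly.X k
     term₁′ F (vanishing z z₁ nf) k = ≡.trans (≡.cong ([ isFlat r F ]_) (≡.trans (Poly.reverse-cong (rk r ∸ r F) (ℙ.trans (value-proper (word F) nf) z) k) (reverse-0 (rk r ∸ r F) k)))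
          (≡.trans (if-0 (isFlat r F)) (≡.sym (≡.cong₂ (λ x b → x ℚ.+ [ b ] Poly.X k) (z₁ k) nf)))
     term₁′ F (proper fl rk≡ nf rev _) k = ≡.trans (≡.cong (λ b → [ b ] Poly.reverse (rk r ∸ r F) (p F) k) (Flat⇒isFlat r F fl))
          (≡.trans (≡.cong (λ d → Poly.reverse d (p F) k) (≡.trans (≡.cong₂ _∸_ rank-⊤ rk≡) (ℕ.m∸[m∸n]≡n (breaks≤length (decode F)))))
          (≡.trans (Poly.reverse-cong (breaks (word F)) (value-proper (word F) nf) k) (≡.trans (rev k) (≡.sym (≡.trans (≡.cong (λ b → base₁ (word F) k ℚ.+ [ b ] Poly.X k) nf) (ℚ.+-identityʳ _))))))
     term₁′ F (full fl rk≡ _ z z₁ f) k = ≡.trans (≡.cong (λ b → [ b ] Poly.reverse (rk r ∸ r F) (p F) k) (Flat⇒isFlat r F fl))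
          (≡.trans (≡.cong (λ d → Poly.reverse d (p F) k) (≡.trans (≡.cong₂ _∸_ rank-⊤ rk≡) (ℕ.m+n∸n≡m 1 m)))
          (≡.trans (Poly.reverse-cong 1 (value-full (word F) f z) k) (≡.trans (reverse-1-1 k) (≡.sym (≡.trans (≡.cong₂ (λ x b → x ℚ.+ [ b ] Poly.X k) (z₁ k) f) (ℚ.+-identityˡ _))))))

    term₁ : ∀ F k → [ isFlat r F ] Poly.reverse (rk r ∸ r F) (p F) k ≡ base₁ (word F) k ℚ.+ [ isFull (word F) ] Poly.X k
    term₁ F = term₁′ F (status F)

    private
     termₜ′ : ∀ X F → Status F → ∀ k → r X ≡ n ∸ breaks (word X) → (decode X ≤ᵛ decode F) ≡ true →
      [ isFlat r F ] Poly.raise (r F ∸ r X) (p F) k ≡ Poly.raise (breaks (word X) ∸ breaks (word F)) (base (word F)) k ℚ.+ [ isFull (word F) ] Poly.raise (m ∸ r X) ℙ.1# k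
     termₜ′ X F (vanishing z z₁ nf) k rX le = ≡.trans (≡.cong ([ isFlat r F ]_) (raise-≈0 (r F ∸ r X) (ℙ.trans (value-proper (word F) nf) z) k))
          (≡.trans (if-0 (isFlat r F)) (≡.sym (≡.cong₂ (λ x b → x ℚ.+ [ b ] Poly.raise (m ∸ r X) ℙ.1# k) (raise-≈0 (breaks (word X) ∸ breaks (word F)) z k) nf)))
     termₜ′ X F (proper fl rk≡ nf _ _) k rX le = ≡.trans (≡.cong (λ b → [ b ] Poly.raise (r F ∸ r X) (p F) k) (Flat⇒isFlat r F fl))
          (≡.trans (≡.cong (λ d → Poly.raise d (p F) k) (≡.trans (≡.cong₂ _∸_ rk≡ rX) (∸-∸ (breaks-anti (decode X) (decode F) le) (breaks≤length (decode X)))))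
          (≡.trans (Poly.raise-cong (breaks (word X) ∸ breaks (word F)) (value-proper (word F) nf) k)
          (≡.sym (≡.trans (≡.cong (λ b → Poly.raise (breaks (word X) ∸ breaks (word F)) (base (word F)) k ℚ.+ [ b ] Poly.raise (m ∸ r X) ℙ.1# k) nf) (ℚ.+-identityʳ _)))))
     termₜ′ X F (full fl rk≡ _ z _ f) k rX le = ≡.trans (≡.cong (λ b → [ b ] Poly.raise (r F ∸ r X) (p F) k) (Flat⇒isFlat r F fl))
          (≡.trans (≡.cong (λ d → Poly.raise (d ∸ r X) (p F) k) rk≡)
          (≡.trans (Poly.raise-cong (m ∸ r X) (value-full (word F) f z) k)
          (≡.sym (≡.trans (≡.cong₂ (λ x b → x ℚ.+ [ b ] Poly.raise (m ∸ r X) ℙ.1# k) (raise-≈0 (breaks (word X) ∸ breaks (word F)) z k) f) (ℚ.+-identityˡ _)))))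

    -- The hypothesis on `r X` excludes the full rim as the smaller flat, so that missing edges give
    -- the rank difference. The larger flat may still be the full rim, which is the second summand.
    termₜ : ∀ X F k → r X ≡ n ∸ breaks (word X) → (decode X ≤ᵛ decode F) ≡ true →
      [ isFlat r F ] Poly.raise (r F ∸ r X) (p F) k ≡ Poly.raise (breaks (word X) ∸ breaks (word F)) (base (word F)) k ℚ.+ [ isFull (word F) ] Poly.raise (m ∸ r X) ℙ.1# k
    termₜ X F = termₜ′ X F (status F)

    private
      module _ (X : Subset (length G)) where

        g : Vec Letter n
        g = decode X

        Zₜ Z₁ : ℕ → ℚ
        Zₜ k = Σₛ (λ F → [ isFlat r F ∧ (X ⊆ᵇ F) ] Poly.raise (r F ∸ r X) (p F) k)
        Z₁ k = Σₛ (λ F → [ isFlat r F ∧ (X ⊆ᵇ F) ] Poly.reverse (rk r ∸ r F) (p F) k)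

        fullSum : ℚ → ℚ
        fullSum x = Σʷ (λ w → [ g ≤ᵛ w ] [ isFull (toList w) ] x)

        split : ∀ (a b : Vec Letter n → ℚ) → Σʷ (λ w → [ g ≤ᵛ w ] (a w ℚ.+ b w)) ≡ Σʷ (λ w → [ g ≤ᵛ w ] a w) ℚ.+ Σʷ (λ w → [ g ≤ᵛ w ] b w)
        split a b = ≡.trans (Σʷ-cong (λ w → []-+ (g ≤ᵛ w) (a w) (b w))) (Σʷ-+ (λ w → [ g ≤ᵛ w ] a w) (λ w → [ g ≤ᵛ w ] b w))
          where
          []-+ : ∀ c x y → [ c ] (x ℚ.+ y) ≡ [ c ] x ℚ.+ [ c ] y
          []-+ true x y = ≡.refl
          []-+ false x y = ≡.refl

        Zₜ-words : r X ≡ n ∸ breaks (word X) → ∀ k → Zₜ k ≡ Wₜ.wordSum (map Wₜ.above (word X)) base k ℚ.+ fullSum (Poly.raise (m ∸ r X) ℙ.1# k)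
        Zₜ-words rX k = ≡.trans (Terms.sum-terms X (λ F → Poly.raise (r F ∸ r X) (p F) k) t
            (λ w le → ≡.trans (termₜ X (encode w) k rX (≡.trans (≡.cong (g ≤ᵛ_) (decode-encode w)) le)) (≡.cong (λ v → Poly.raise (breaks (word X) ∸ breaks v) (base v) k ℚ.+ [ isFull v ] Poly.raise (m ∸ r X) ℙ.1# k) (word-encode w))))
          (≡.trans (split (λ w → Poly.raise (breaks (word X) ∸ breaks (toList w)) (base (toList w)) k) (λ w → [ isFull (toList w) ] Poly.raise (m ∸ r X) ℙ.1# k)) (≡.cong (ℚ._+ fullSum (Poly.raise (m ∸ r X) ℙ.1# k)) (Σʷ-raise g base k)))
          where
          t : Vec Letter n → ℚ
          t w = Poly.raise (breaks (word X) ∸ breaks (toList w)) (base (toList w)) k ℚ.+ [ isFull (toList w) ] Poly.raise (m ∸ r X) ℙ.1# k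

        Z₁-words : ∀ k → Z₁ k ≡ W₁.wordSum (map W₁.above (word X)) base₁ k ℚ.+ fullSum (Poly.X k)
        Z₁-words k = ≡.trans (Terms.sum-terms X (λ F → Poly.reverse (rk r ∸ r F) (p F) k) (λ w → base₁ (toList w) k ℚ.+ [ isFull (toList w) ] Poly.X k)
            (λ w le → ≡.trans (term₁ (encode w) k) (≡.cong (λ v → base₁ v k ℚ.+ [ isFull v ] Poly.X k) (word-encode w))))
          (≡.trans (split (λ w → base₁ (toList w) k) (λ w → [ isFull (toList w) ] Poly.X k)) (≡.cong (ℚ._+ fullSum (Poly.X k)) (Σʷ-plain g base₁ k)))

        wordSum-baseₜ : Wₜ.wordSum (map Wₜ.above (word X)) base ℙ.≈ Wₜ.wordSum (map Wₜ.above (word X)) (Wₜ.cyc []) ℙ.+ Wₜ.wordSum (map Wₜ.above (word X)) (Wₜ.rim wheelPoly 0)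
        wordSum-baseₜ = Wₜ.wordSum-+ (map Wₜ.above (word X)) (Wₜ.cyc []) (Wₜ.rim wheelPoly 0)

        wordSum-base₁ : W₁.wordSum (map W₁.above (word X)) base₁ ℙ.≈ W₁.wordSum (map W₁.above (word X)) (W₁.cyc []) ℙ.+ W₁.wordSum (map W₁.above (word X)) (W₁.rim wheelPoly̅ 0)
        wordSum-base₁ = W₁.wordSum-+ (map W₁.above (word X)) (W₁.cyc []) (W₁.rim wheelPoly̅ 0)

        -- Both sums are products over the runs of `X` and agree factor by factor, fans being
        -- palindromic. The full rim contains no spoke and does not occur.
        palindromic-at : Flat r X → ∀ u e v {b} → OffHub u b → word X ≡ u ++ (true , e) ∷ v → ∀ k → Zₜ k ≡ Z₁ k
        palindromic-at fl u e v o eq k = ≡.trans (≡.trans (Zₜ-words rX k) (≡.cong₂ ℚ._+_ (sumₜ k) (Σʷ-isFull-hub g i gi (Poly.raise (m ∸ r X) ℙ.1# k))))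
            (≡.sym (≡.trans (Z₁-words k) (≡.cong₂ ℚ._+_ (sum₁ k) (Σʷ-isFull-hub g i gi (Poly.X k)))))
          where
          comp = flat⇒compatible X fl
          i = proj₁ (toList-∈ g u (true , e) v eq)
          li : lookup g i ≡ (true , e)
          li = proj₂ (toList-∈ g u (true , e) v eq)
          gi : proj₁ (lookup g i) ≡ true
          gi = ≡.cong proj₁ li
          rX : r X ≡ n ∸ breaks (word X)
          rX = rank-compatible X comp (i , λ h → true≢false gi (≡.cong proj₁ h))
          parsed = chain-from-hub (v ++ u) (compatible⇒linked-at g u e v eq comp)
          starts = proj₁ parsed
          b₀ = proj₁ (proj₂ parsed)
          bs = proj₁ (proj₂ (proj₂ parsed))
          chain : Chain (v ++ u) (b₀ ∷ bs)
          chain = proj₂ (proj₂ (proj₂ parsed))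
          Πhub-symmetric : ∀ bs → Wₜ.Πhub bs ℙ.≈ W₁.Πhub bs
          Πhub-symmetric [] = ℙ.refl
          Πhub-symmetric (b ∷ bs) = ℙ.*-cong (hub-symmetric b) (Πhub-symmetric bs)
          value-hub : PolyQ
          value-hub = F₁.hub b₀ ℙ.* W₁.Πhub bs
          sumₜ : Wₜ.wordSum (map Wₜ.above (word X)) base ℙ.≈ value-hub
          sumₜ = ℙ.trans wordSum-baseₜ (ℙ.trans (ℙ.+-cong
              (ℙ.trans (ℙ.reflexive (≡.cong (λ w → Wₜ.wordSum (map Wₜ.above w) (Wₜ.cyc [])) eq)) (ℙ.trans (Wₜ.wordSum-cyc-hub μ-0 u e v starts chain) (ℙ.*-cong (hub-symmetric b₀) (Πhub-symmetric bs))))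
              (ℙ.trans (ℙ.reflexive (≡.cong (λ w → Wₜ.wordSum (map Wₜ.above w) (Wₜ.rim wheelPoly 0)) eq)) (Wₜ.wordSum-rim-hub wheelPoly u e v 0))) (ℙ.+-identityʳ value-hub))
          sum₁ : W₁.wordSum (map W₁.above (word X)) base₁ ℙ.≈ value-hub
          sum₁ = ℙ.trans wordSum-base₁ (ℙ.trans (ℙ.+-cong
              (ℙ.trans (ℙ.reflexive (≡.cong (λ w → W₁.wordSum (map W₁.above w) (W₁.cyc [])) eq)) (W₁.wordSum-cyc-hub μ̄-0 u e v starts chain))
              (ℙ.trans (ℙ.reflexive (≡.cong (λ w → W₁.wordSum (map W₁.above w) (W₁.rim wheelPoly̅ 0)) eq)) (W₁.wordSum-rim-hub wheelPoly̅ u e v 0))) (ℙ.+-identityʳ value-hub))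

        -- The contraction behaves like a wheel with b + 2 rim vertices, and `wheelPoly-symmetric`
        -- is its identity; there the full rim has rank b + 1.
        palindromic-off : Flat r X → ∀ {b} → OffHub (word X) (suc (suc b)) → ∀ k → Zₜ k ≡ Z₁ k
        palindromic-off fl {b} o k = ≡.trans (≡.trans (Zₜ-words rX k) (≡.cong₂ ℚ._+_ (sumₜ k) (≡.trans (Σʷ-isFull-off g o (Poly.raise (m ∸ r X) ℙ.1# k)) (≡.cong (λ d → Poly.raise d ℙ.1# k) m∸))))
            (≡.trans (wheelPoly-symmetric (suc b) k) (≡.sym (≡.trans (Z₁-words k) (≡.cong₂ ℚ._+_ (sum₁ k) (Σʷ-isFull-off g o (Poly.X k))))))
          where
          br : breaks (word X) ≡ suc (suc b)
          br = offHub-breaks o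
          b≤m : suc b ≤ m
          b≤m = ℕ.≤-pred (≡.subst (_≤ n) br (breaks≤length g))
          k₀ = break-exists g (≡.subst (0 <_) (≡.sym br) (s≤s z≤n))
          rX : r X ≡ n ∸ breaks (word X)
          rX = rank-compatible X (flat⇒compatible X fl) (proj₁ k₀ , λ h → true≢false (≡.cong proj₂ h) (≡.cong proj₂ (proj₂ k₀)))
          m∸ : m ∸ r X ≡ suc b
          m∸ = ≡.trans (≡.cong (m ∸_) (≡.trans rX (≡.cong (n ∸_) br))) (ℕ.m∸[m∸n]≡n b≤m)
          sumₜ : Wₜ.wordSum (map Wₜ.above (word X)) base ℙ.≈ Fₜ.wheelF 0 (suc (suc b)) ℙ.+ Sₜ.binomial wheelPoly (suc (suc b))
          sumₜ = ℙ.trans wordSum-baseₜ (ℙ.+-cong (wordSum-cyc-off Poly.X μ μ-0 o) (Wₜ.wordSum-rim wheelPoly o 0))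
          sum₁ : W₁.wordSum (map W₁.above (word X)) base₁ ℙ.≈ F₁.wheelF 0 (suc (suc b)) ℙ.+ S₁.binomial wheelPoly̅ (suc (suc b))
          sum₁ = ℙ.trans wordSum-base₁ (ℙ.+-cong (wordSum-cyc-off ℙ.1# μ̄ μ̄-0 o) (W₁.wordSum-rim wheelPoly̅ o 0))

        -- The full rim has rank `m` where missing edges predict `n`, so the exponent of t for every
        -- larger flat with a spoke is one more than `breaks` suggests.
        termₜ-full : OffHub (word X) 0 → r X ≡ m → ∀ F → Status F → ∀ k → (decode X ≤ᵛ decode F) ≡ true →
          [ isFlat r F ] Poly.raise (r F ∸ r X) (p F) k ≡ Poly.raise 1 (base (word F)) k ℚ.+ [ isFull (word F) ] ℙ.1# k
        termₜ-full o rX F (vanishing z z₁ nf) k le = ≡.trans (≡.cong ([ isFlat r F ]_) (raise-≈0 (r F ∸ r X) (ℙ.trans (value-proper (word F) nf) z) k))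
          (≡.trans (if-0 (isFlat r F)) (≡.sym (≡.cong₂ (λ x b → x ℚ.+ [ b ] ℙ.1# k) (raise-≈0 1 z k) nf)))
        termₜ-full o rX F (proper fl rk≡ nf _ _) k le = ≡.trans (≡.cong (λ b → [ b ] Poly.raise (r F ∸ r X) (p F) k) (Flat⇒isFlat r F fl))
          (≡.trans (≡.cong (λ d → Poly.raise d (p F) k) (≡.trans (≡.cong₂ _∸_ (≡.trans rk≡ (≡.cong (n ∸_) (ℕ.n≤0⇒n≡0 (≡.subst (breaks (word F) ≤_) (offHub-breaks o) (breaks-anti g (decode F) le))))) rX) (ℕ.m+n∸n≡m 1 m)))
          (≡.trans (Poly.raise-cong 1 (value-proper (word F) nf) k)
          (≡.sym (≡.trans (≡.cong (λ b → Poly.raise 1 (base (word F)) k ℚ.+ [ b ] ℙ.1# k) nf) (ℚ.+-identityʳ _)))))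
        termₜ-full o rX F (full fl rk≡ _ z _ f) k le = ≡.trans (≡.cong (λ b → [ b ] Poly.raise (r F ∸ r X) (p F) k) (Flat⇒isFlat r F fl))
          (≡.trans (≡.cong (λ d → Poly.raise d (p F) k) (≡.trans (≡.cong₂ _∸_ rk≡ rX) (ℕ.n∸n≡0 m)))
          (≡.trans (value-full (word F) f z k) (≡.sym (≡.trans (≡.cong₂ (λ x b → x ℚ.+ [ b ] ℙ.1# k) (raise-≈0 1 z k) f) (ℚ.+-identityˡ _)))))

        -- The full rim is contained in exactly two flats: itself and the whole wheel.
        palindromic-full : OffHub (word X) 0 → r X ≡ m → ∀ k → Zₜ k ≡ Z₁ k
        palindromic-full o rX k = ≡.trans (Terms.sum-terms X (λ F → Poly.raise (r F ∸ r X) (p F) k) (λ w → Poly.raise 1 (base (toList w)) k ℚ.+ [ isFull (toList w) ] ℙ.1# k)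
            (λ w le → ≡.trans (termₜ-full o rX (encode w) (status (encode w)) k (≡.trans (≡.cong (g ≤ᵛ_) (decode-encode w)) le)) (≡.cong (λ v → Poly.raise 1 (base v) k ℚ.+ [ isFull v ] ℙ.1# k) (word-encode w))))
          (≡.trans (split (λ w → Poly.raise 1 (base (toList w)) k) (λ w → [ isFull (toList w) ] ℙ.1# k))
          (≡.trans (≡.cong₂ ℚ._+_ (sumₜ k) (Σʷ-isFull-off g o (ℙ.1# k)))
          (≡.trans (ℚ.+-comm (Poly.X k) (ℙ.1# k)) (≡.sym (≡.trans (Z₁-words k) (≡.cong₂ ℚ._+_ (sum₁ k) (Σʷ-isFull-off g o (Poly.X k))))))))
          where
          cyc-one : ∀ c ν → ν 0 ℙ.≈ ℙ.1# → Words.wordSum polyRing c ν (map (Words.above polyRing c ν) (word X)) (Words.cyc polyRing c ν []) ℙ.≈ ℙ.1#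
          cyc-one c ν ν₀ = go (decode X) o
            where
            go : ∀ (w : Vec Letter n) → OffHub (toList w) 0 → Words.wordSum polyRing c ν (map (Words.above polyRing c ν) (toList w)) (Words.cyc polyRing c ν []) ℙ.≈ ℙ.1#
            go (l ∷ w) o = wordSum-cyc-full c ν ν₀ o
          sum₁ : W₁.wordSum (map W₁.above (word X)) base₁ ℙ.≈ ℙ.1#
          sum₁ = ℙ.trans wordSum-base₁ (ℙ.trans (ℙ.+-cong (cyc-one ℙ.1# μ̄ μ̄-0) (ℙ.trans (W₁.wordSum-rim wheelPoly̅ o 0) wheelPoly̅-0)) (ℙ.+-identityʳ ℙ.1#))
          total : Wₜ.wordSum (map Wₜ.above (word X)) base ℙ.≈ ℙ.1#
          total = ℙ.trans wordSum-baseₜ (ℙ.trans (ℙ.+-cong (cyc-one Poly.X μ μ-0) (ℙ.trans (Wₜ.wordSum-rim wheelPoly o 0) wheelPoly-0)) (ℙ.+-identityʳ ℙ.1#))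
          sumₜ : ∀ k → Σʷ (λ w → [ g ≤ᵛ w ] Poly.raise 1 (base (toList w)) k) ≡ Poly.X k
          sumₜ zero = ≡.trans (Σʷ-cong (λ w → if-0 (g ≤ᵛ w))) (Σʷ-0 {n})
          sumₜ (suc k) = ≡.trans (Σʷ-cong (λ w → []-cong (g ≤ᵛ w) (λ le → ≡.cong (λ d → Poly.raise d (base (toList w)) k) (≡.sym (≡.trans (≡.cong (_∸ breaks (toList w)) (offHub-breaks o)) (ℕ.0∸n≡0 (breaks (toList w))))))))
            (≡.trans (Σʷ-raise g base k) (total k))

        palindromic-kind : Flat r X → ∀ {w} → HubSplit w → word X ≡ w → ∀ k → Zₜ k ≡ Z₁ k
        palindromic-kind fl (at u e v o) eq = palindromic-at fl u e v o eq
        palindromic-kind fl (off {b = zero} o) ≡.refl = palindromic-full o (rank-full X (flat⇒compatible X fl) (offHub-full g o))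
        palindromic-kind fl (off {b = suc (suc b)} o) ≡.refl = palindromic-off fl o
        -- A flat without spokes that misses one rim edge misses a second one.
        palindromic-kind fl (off {b = suc zero} o) ≡.refl = ⊥-elim (two-breaks g (proj₁ (proj₂ other)) (proj₂ (proj₂ other)) (proj₂ first) (offHub-breaks o))
          where
          first = break-exists g (≡.subst (0 <_) (≡.sym (offHub-breaks o)) (s≤s z≤n))
          other = flat⇒second-break X fl (offHub-lookup g o) (proj₁ first) (proj₂ first)

    candidate : Candidate r p
    candidate = record
      { top = value-top (decode ⊤) word-⊤
      ; degree = degree
      ; palindromic = λ X fl → palindromic-kind X fl (hubSplit (word X)) ≡.refl }

    p-⊥ : ∀ k → p ⊥ k ≡ wheelPoly n k
    p-⊥ k = ≡.trans (≡.cong₂ (λ x b → x ℚ.+ [ b ] ℙ.1# k) (base-off off-⊥ k) (isFull-suc off-⊥)) (ℚ.+-identityʳ _)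
      where
      all-breaks : ∀ {n} (w : Vec Letter n) → (∀ i → lookup w i ≡ (false , false)) → OffHub (toList w) n
      all-breaks [] h = nil
      all-breaks (l ∷ w) h with h zero
      ... | ≡.refl = brk (all-breaks w (h ∘ suc))
      off-⊥ : OffHub (word ⊥) n
      off-⊥ = all-breaks (decode ⊥) (λ i → ≡.trans (lookup-decode ⊥ i) (≡.cong₂ _,_ (lookup-replicate (spokeIdx i) false) (lookup-replicate (rimIdx i) false)))

-- The triangle, looplessness and the final comparison.

open ClosedForm hiding (T)
open Support using (rhs-degree)
open WheelPolynomials
open SubsetSums
open Matroids
open PalindromicUniqueness
open Graphs
open WheelWords
open Candidates
open import Data.Vec.Base using ([]; _∷_)

-- The triangle has its own edge list, outside the general coding. In rank at most 2 the degree
-- bound leaves constants, and the identities are evaluated for each of the eight edge sets.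
triangle-candidate : Candidate (graphicRank (wheel 2)) (λ _ → ℙ.1#)
triangle-candidate = record
  { top = ℙ.refl
  ; degree = λ { F _ lt zero le → Relation.Nullary.contradiction (ℕ.<-≤-trans (ℕ.m<n⇒0<n∸m lt) le) (λ ()) ; F _ lt (suc k) le → ≡.refl }
  ; palindromic = λ X _ → pal X }
  where
  pal : ∀ X → Palindromic (graphicRank (wheel 2)) (λ _ → ℙ.1#) X
  -- From exponent 3 on, both sides compute to zero even for an unknown `k`.
  pal (true ∷ true ∷ true ∷ []) = λ { 0 → ≡.refl ; 1 → ≡.refl ; 2 → ≡.refl ; (suc (suc (suc k))) → ≡.refl }
  pal (true ∷ true ∷ false ∷ []) = λ { 0 → ≡.refl ; 1 → ≡.refl ; 2 → ≡.refl ; (suc (suc (suc k))) → ≡.refl }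
  pal (true ∷ false ∷ true ∷ []) = λ { 0 → ≡.refl ; 1 → ≡.refl ; 2 → ≡.refl ; (suc (suc (suc k))) → ≡.refl }
  pal (true ∷ false ∷ false ∷ []) = λ { 0 → ≡.refl ; 1 → ≡.refl ; 2 → ≡.refl ; (suc (suc (suc k))) → ≡.refl }
  pal (false ∷ true ∷ true ∷ []) = λ { 0 → ≡.refl ; 1 → ≡.refl ; 2 → ≡.refl ; (suc (suc (suc k))) → ≡.refl }
  pal (false ∷ true ∷ false ∷ []) = λ { 0 → ≡.refl ; 1 → ≡.refl ; 2 → ≡.refl ; (suc (suc (suc k))) → ≡.refl }
  pal (false ∷ false ∷ true ∷ []) = λ { 0 → ≡.refl ; 1 → ≡.refl ; 2 → ≡.refl ; (suc (suc (suc k))) → ≡.refl }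
  pal (false ∷ false ∷ false ∷ []) = λ { 0 → ≡.refl ; 1 → ≡.refl ; 2 → ≡.refl ; (suc (suc (suc k))) → ≡.refl }

triangle-loopless : Loopless (graphicRank (wheel 2))
triangle-loopless zero = ≡.refl
triangle-loopless (suc zero) = ≡.refl
triangle-loopless (suc (suc zero)) = ≡.refl

-- The degree bound disposes of all coefficients but the constant one, which is evaluated.
rhs-2 : ∀ k → rhs 2 k ≡ ℙ.1# k
rhs-2 zero = ≡.refl
rhs-2 (suc k) = rhs-degree 2 (suc k) (ℕ.*-monoʳ-≤ 2 (s≤s z≤n))

next-≢ : ∀ {m} (i : Fin (suc (suc m))) → next i ≢ i
next-≢ {m} i e with toℕ i ℕ.≟ suc m
... | yes last with () ← ≡.trans (≡.sym last) (≡.cong toℕ (≡.trans (≡.sym e) (next-last last)))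
... | no ne = ℕ.1+n≢n (≡.trans (≡.sym (toℕ-next ne)) (≡.cong toℕ e))

wheel-loopless : ∀ n₀ → Loopless (graphicRank (wheel (suc (suc (suc n₀)))))
wheel-loopless n₀ = loopless edge-ends
  where
  open WheelGraph n₀
  open GraphicMatroid G
  edge-ends : ∀ e → src e ≢ tgt e
  edge-ends e eq with classify e
  ... | inj₁ (i , ≡.refl) = next-≢ i (≡.sym (Fin.suc-injective (≡.trans (≡.sym (≡.cong proj₁ (lookup-rim i))) (≡.trans eq (≡.cong proj₂ (lookup-rim i))))))
  ... | inj₂ (i , ≡.refl) with () ← ≡.trans (≡.sym (≡.cong proj₁ (lookup-spoke i))) (≡.trans eq (≡.cong proj₂ (lookup-spoke i)))

theorem4p7 : (P : KLAssignment) → IsKL P →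
    (n k : ℕ) → lhs P n k ≡ rhs n k
-- The left-hand side has no terms below u^2, so the same must be shown of the closed form.
theorem4p7 P kl zero k = ≡.sym (rhs-degree 0 k z≤n)
theorem4p7 P kl (suc zero) k = ≡.sym (≡.trans (≡.sym (wheelPoly≡rhs 1 k)) (wheelPoly-1 k))
theorem4p7 P kl (suc (suc zero)) k = ≡.trans (Uniqueness.unique P kl (graphicRank (wheel 2)) (GraphicMatroid.isMatroid (wheel 2)) triangle-loopless (λ _ → ℙ.1#) triangle-candidate k) (≡.sym (rhs-2 k))
theorem4p7 P kl (suc (suc (suc n₀))) k = ≡.trans (Uniqueness.unique P kl (graphicRank G) (GraphicMatroid.isMatroid G) (wheel-loopless n₀) p candidate k)
  (≡.trans (p-⊥ k) (wheelPoly≡rhs n k))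
  where
  open WheelGraph n₀
  open WheelCandidate m G len lookup-rim lookup-spoke using (p; candidate; p-⊥)
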